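{- If $G$ is an $\mathcal{M}(2,2)$-connected graph not isomorphic to $K_5^-$ or $B_1$, then there is an admissible edge-reduction, an admissible $K_4^-$-reduction, or an admissible edge-deletion of $G$.
   Context: All graphs are finite and simple. A $(2,2)$-circuit is a graph $(V',E')$ with $|E'|=2|V'|-1$ all of whose proper subgraphs $(V'',E'')$ with $E''\neq\emptyset$ satisfy $|E''|\leq 2|V''|-2$. A graph is $\mathcal{M}(2,2)$-connected if it has no isolated vertices, at least 2 edges, and every pair of its edges lies in a common subgraph that is a $(2,2)$-circuit. $K_5^-$ is $K_5$ minus an edge; $B_1$ is the 6-vertex graph formed by two copies of $K_4$ sharing exactly one edge. A generalised vertex split chooses a vertex $v$ and a partition $N_1,N_2$ of its neighbours, deletes $v$, adds new vertices $v_1,v_2$ joined to $N_1$ and $N_2$ respectively, and adds edges $v_1v_2$ and $v_1x$ for some vertex $x\neq v$ not in $N_1$; a graph $G'$ is an edge-reduction of $G$ if $G$ is a generalised vertex split of $G'$. A $K_4^-$-reduction deletes two adjacent degree-3 vertices $u_1,u_2$ with $N(u_1)\cap N(u_2)=\{v_1,v_2\}$ and $v_1v_2$ not an edge, and adds the edge $v_1v_2$. An edge-deletion removes one edge. Such an operation is admissible if the resulting graph is $\mathcal{M}(2,2)$-connected. -}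

module Defs where

open import Data.Nat using (ℕ; zero; suc; _+_; _*_; _≤_; _<ᵇ_)
open import Data.Fin using (Fin; zero; suc; toℕ; _≟_)
open import Data.Bool using (Bool; true; false; if_then_else_; _∧_; _∨_; not)
open import Data.Product using (Σ; ∃; ∃-syntax; _×_; _,_)
open import Data.Sum using (_⊎_)
open import Relation.Binary.PropositionalEquality using (_≡_; _≢_)
open import Relation.Nullary using (¬_; does)
open import Function.Bundles using (_↔_; Inverse)
open import Function.Definitions using (Injective)

record Graph : Set where
  field
    n   : ℕ
    adj : Fin n → Fin n → Bool
open Graph public

SimpleGraph : Graph → Set
SimpleGraph G =
  (∀ i j → adj G i j ≡ adj G j i) × (∀ i → adj G i i ≡ false)

_==_ : ∀ {n} → Fin n → Fin n → Bool
a == b = does (a ≟ b)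

sumFin : ∀ {n} → (Fin n → ℕ) → ℕ
sumFin {zero}  f = 0
sumFin {suc n} f = f zero + sumFin (λ i → f (suc i))

countFin : ∀ {n} → (Fin n → Bool) → ℕ
countFin f = sumFin (λ i → if f i then 1 else 0)

ecount : ∀ {n} → (Fin n → Fin n → Bool) → ℕ
ecount E = sumFin (λ i → sumFin (λ j → if (toℕ i <ᵇ toℕ j) ∧ E i j then 1 else 0))

degree : (G : Graph) → Fin (n G) → ℕ
degree G v = countFin (adj G v)

IsSub : (G : Graph) → (Fin (n G) → Bool) → (Fin (n G) → Fin (n G) → Bool) → Set
IsSub G V E =
  (∀ i j → E i j ≡ true → adj G i j ≡ true) ×
  (∀ i j → E i j ≡ E j i) ×
  (∀ i j → E i j ≡ true → (V i ≡ true × V j ≡ true))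

SubOf : ∀ {m} → (Fin m → Bool) → (Fin m → Fin m → Bool)
      → (Fin m → Bool) → (Fin m → Fin m → Bool) → Set
SubOf V'' E'' V E =
  (∀ i → V'' i ≡ true → V i ≡ true) × (∀ i j → E'' i j ≡ true → E i j ≡ true)

ProperSubOf : ∀ {m} → (Fin m → Bool) → (Fin m → Fin m → Bool)
            → (Fin m → Bool) → (Fin m → Fin m → Bool) → Set
ProperSubOf V'' E'' V E =
  SubOf V'' E'' V E ×
  ((∃[ i ] (V i ≡ true × V'' i ≡ false)) ⊎
   (∃[ i ] ∃[ j ] (E i j ≡ true × E'' i j ≡ false)))

NonEmptyE : ∀ {m} → (Fin m → Fin m → Bool) → Set
NonEmptyE E = ∃[ i ] ∃[ j ] (E i j ≡ true)

-- (V', E') is a subgraph of G which is a (2,2)-circuit: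
-- |E'| = 2|V'| - 1 and every proper subgraph (V'',E'') with E'' ≠ ∅
-- has |E''| ≤ 2|V''| - 2  (written without truncated subtraction).
IsCircuit22 : (G : Graph) → (Fin (n G) → Bool) → (Fin (n G) → Fin (n G) → Bool) → Set
IsCircuit22 G V E =
  IsSub G V E ×
  (ecount E + 1 ≡ 2 * countFin V) ×
  (∀ V'' E'' → IsSub G V'' E'' → ProperSubOf V'' E'' V E → NonEmptyE E'' →
     ecount E'' + 2 ≤ 2 * countFin V'')

M22Connected : Graph → Set
M22Connected G =
  (∀ v → ∃[ w ] (adj G v w ≡ true)) ×
  (2 ≤ ecount (adj G)) ×
  (∀ a b c d → adj G a b ≡ true → adj G c d ≡ true →
     ∃[ V ] ∃[ E ] (IsCircuit22 G V E × E a b ≡ true × E c d ≡ true))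

_≅_ : Graph → Graph → Set
G ≅ H = Σ (Fin (n G) ↔ Fin (n H)) λ f →
  ∀ i j → adj H (Inverse.to f i) (Inverse.to f j) ≡ adj G i j

K5⁻ : Graph
K5⁻ = record { n = 5 ; adj = λ i j → not (i == j) ∧ not (isPair i j) }
  where
  isPair : Fin 5 → Fin 5 → Bool
  isPair zero (suc zero) = true
  isPair (suc zero) zero = true
  isPair _ _ = false

-- B1: two copies of K4, on {0,1,2,3} and {0,1,4,5}, sharing the edge {0,1}
B₁ : Graph
B₁ = record { n = 6 ; adj = λ i j → not (i == j) ∧ not (cross i j ∨ cross j i) }
  where
  inA : Fin 6 → Bool
  inA i = (toℕ i Data.Nat.≡ᵇ 2) ∨ (toℕ i Data.Nat.≡ᵇ 3)
  inB : Fin 6 → Bool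
  inB i = (toℕ i Data.Nat.≡ᵇ 4) ∨ (toℕ i Data.Nat.≡ᵇ 5)
  cross : Fin 6 → Fin 6 → Bool
  cross i j = inA i ∧ inB j

-- Generalised vertex split of G' at v, with side : N(v) → {N1 (true), N2 (false)},
-- extra vertex x.  New vertex set Fin (suc m): suc u is the old vertex u
-- (u ≠ v), suc v plays the role of v1, and zero is the new vertex v2.

splitAdj : (G' : Graph) → (v x : Fin (n G')) → (Fin (n G') → Bool)
         → Fin (suc (n G')) → Fin (suc (n G')) → Bool
splitAdj G' v x side zero zero = false
splitAdj G' v x side zero (suc u) = (u == v) ∨ (adj G' v u ∧ not (side u))
splitAdj G' v x side (suc u) zero = (u == v) ∨ (adj G' v u ∧ not (side u))
splitAdj G' v x side (suc u) (suc w) =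
  if u == v then (if w == v then false else ((adj G' v w ∧ side w) ∨ (w == x)))
  else (if w == v then ((adj G' v u ∧ side u) ∨ (u == x)) else adj G' u w)

vsplit : (G' : Graph) → (v x : Fin (n G')) → (Fin (n G') → Bool) → Graph
vsplit G' v x side = record { n = suc (n G') ; adj = splitAdj G' v x side }

IsEdgeReduction : Graph → Graph → Set
IsEdgeReduction G' G =
  SimpleGraph G' ×
  (∃[ v ] ∃[ x ] ∃[ side ]
     (x ≢ v × (adj G' v x ∧ side x) ≡ false × G ≅ vsplit G' v x side))

AdmissibleEdgeReduction : Graph → Set
AdmissibleEdgeReduction G = ∃[ G' ] (IsEdgeReduction G' G × M22Connected G')

-- K4⁻-reduction.  The result H is described up to isomorphism: an injection
-- f : V(H) → V(G) whose image is V(G) ∖ {u1,u2}, with H's edges being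
-- those of G - {u1,u2} together with v1v2.

IsK4Reduction : (G H : Graph) → Set
IsK4Reduction G H =
  ∃[ u₁ ] ∃[ u₂ ] ∃[ v₁ ] ∃[ v₂ ]
    ( adj G u₁ u₂ ≡ true × degree G u₁ ≡ 3 × degree G u₂ ≡ 3
    × v₁ ≢ v₂
    × (∀ w → (adj G u₁ w ∧ adj G u₂ w) ≡ true → (w ≡ v₁ ⊎ w ≡ v₂))
    × (adj G u₁ v₁ ∧ adj G u₂ v₁) ≡ true
    × (adj G u₁ v₂ ∧ adj G u₂ v₂) ≡ true
    × adj G v₁ v₂ ≡ false
    × Σ (Fin (n H) → Fin (n G)) λ f →
        Injective _≡_ _≡_ f
      × (∀ a → f a ≢ u₁ × f a ≢ u₂)
      × (∀ w → w ≢ u₁ → w ≢ u₂ → ∃[ a ] (f a ≡ w))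
      × (∀ a b → adj H a b ≡
           (adj G (f a) (f b) ∨ ((f a == v₁ ∧ f b == v₂) ∨ (f a == v₂ ∧ f b == v₁)))))

AdmissibleK4Reduction : Graph → Set
AdmissibleK4Reduction G = ∃[ H ] (IsK4Reduction G H × M22Connected H)

deleteEdge : (G : Graph) → Fin (n G) → Fin (n G) → Graph
deleteEdge G a b = record
  { n = n G
  ; adj = λ i j → adj G i j ∧ not ((i == a ∧ j == b) ∨ (i == b ∧ j == a)) }

AdmissibleEdgeDeletion : Graph → Set
AdmissibleEdgeDeletion G =
  ∃[ a ] ∃[ b ] (adj G a b ≡ true × M22Connected (deleteEdge G a b))

{-# OPTIONS --safe #-}

-- Starting from the vertex set of a circuit, enlarge U by circuits that share an edge with G[U] and leave U, as long as
-- some vertex remains. Unless an edge becomes superfluous on the way, this ends with a set U such that G/U is a single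
-- circuit: W₀ = V ∖ U is touched by exactly 2|W₀| + 1 edges, and every nonempty S ⊆ W₀ is touched by at least 2|S| + 1
-- edges and spans at most 2|S| − 2. If G is itself a circuit, U is a single vertex of degree at least four.
-- An edge-reduction that contracts v ∈ W₀ onto u and drops vy keeps this shape, and hence connectedness, unless there is
-- a cotight set (2|S| + 1 touching edges) containing y but not u, v, or a tight set (2|Y| − 2 inner edges) containing
-- u, v but not y. Both kinds of sets can be uncrossed. If some vertex of W₀ has degree at least four, choose a minimal
-- cotight W containing one. When nothing is reducible, every cubic vertex of W has an independent or a complete
-- neighbourhood; uncrossing excludes the former, and the copies of K₄ arising from the latter raise the average degree
-- in W to four, which is too much, unless G is K₅⁻ or B₁. If W₀ is cubic throughout, it induces a forest, and a leaf
-- of that forest admits a reduction or lies in a K₄ one of whose edges can be deleted.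

module Submission where

-- The numbers come from contracting `U` to a point: a (2,2)-circuit on |W₀| + 1 vertices has 2|W₀|
-- + 1 edges. An edge-reduction removes one vertex and two edges, a K₄⁻-reduction two vertices and
-- four edges in balance, so this total survives; only the bounds on subsets of W₀ can fail, and
-- obstacles are the sets where they do. The edges inside `U` stay, so the reduced graph is
-- connected as soon as its contraction is again a circuit that hangs on two vertices of `U`; with
-- one attachment the two sides would share no circuit. For a whole circuit, `U` is one vertex, and
-- its degree of at least four replaces the second attachment: both serve to exclude an outer vertex
-- with three neighbours in a tight set. The difficulty is that contraction must not create parallel
-- edges. A cubic vertex whose neighbourhood is complete cannot be contracted at all, and the final
-- count must show that W cannot be filled with such vertices. Arithmetic steps are linear
-- combinations of a few counts, checked by certificate; the relations between counts are truth
-- tables read edge by edge.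

open import Defs
open import Data.Bool using (Bool; true; false; if_then_else_; _∧_; _∨_; not; T)
import Data.Bool.Properties as 𝔹
open import Data.Empty using (⊥; ⊥-elim)
open import Data.Fin using (Fin; zero; suc; toℕ; _≟_; punchIn; punchOut)
open import Data.Fin.Patterns
open import Data.Fin.Properties using (any?; all?; punchIn-injective; punchInᵢ≢i; punchIn-punchOut; punchOut-punchIn; punchOut-cong)
open import Data.Fin.Subset.Properties using (anySubset?)
open import Data.Nat using (ℕ; zero; suc; _+_; _*_; _≤_; _<_; z≤n; s≤s; _≤ᵇ_; _≡ᵇ_; _<ᵇ_; _≤?_; _<?_)
open import Data.Nat.Induction using (<-wellFounded)
open import Data.Nat.Properties renaming (_≟_ to _≟ⁿ_)
open import Data.Nat.Tactic.RingSolver using (solve-∀)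
open import Data.Product using (∃; ∃-syntax; _×_; _,_; proj₁; proj₂)
open import Data.Sum using (_⊎_; inj₁; inj₂)
open import Data.Unit using (tt)
open import Data.Vec using (Vec; []; _∷_; lookup; zipWith; map; replicate; tabulate)
open import Data.Vec.Properties using (lookup∘tabulate)
open import Data.Vec.Relation.Unary.All using ([]; _∷_)
open import Data.Vec.Relation.Unary.AllPairs using ([]; _∷_)
open import Data.Vec.Relation.Unary.Unique.Propositional.Properties using (lookup-injective)
open import Function.Bundles using (_↔_; mk↔ₛ′)
open import Induction.WellFounded using (Acc; acc)
open import Relation.Binary.PropositionalEquality using (_≡_; _≢_; refl; sym; trans; cong; cong₂; subst; subst₂; ≢-sym)
open import Relation.Nullary using (¬_; Dec; yes; no)
open import Relation.Nullary.Decidable using (dec-true; dec-false; _×-dec_; _⊎-dec_; _→-dec_; ¬?; decidable-stable; map′)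

-- Linear arithmetic over ℕ by Farkas certificates

infixl 6 _⊕_ _⊹_
infixr 7 _⊗_
infix 5 _≼_ _≐_ _≑_
infixr 4 _⊠_ _⊢_
infixr 3 _⇛_

-- The constructors mirror the shapes in which numbers occur in the goals, so that `value` of an
-- expression is definitionally the term at hand.
data Exp (k : ℕ) : Set where
  var : Fin k → Exp k
  κ : ℕ → Exp k
  𝕤 : Exp k → Exp k
  _⊕_ : Exp k → Exp k → Exp k
  _⊹_ : Exp k → ℕ → Exp k
  _⊗_ : ℕ → Exp k → Exp k

value : ∀ {k} → Exp k → Vec ℕ k → ℕ
value (var x) ρ = lookup ρ x
value (κ c) ρ = c
value (𝕤 e) ρ = suc (value e ρ)
value (e ⊕ f) ρ = value e ρ + value f ρ
value (e ⊹ c) ρ = value e ρ + c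
value (m ⊗ e) ρ = m * value e ρ

Normal : ℕ → Set
Normal k = ℕ × Vec ℕ k

dot : ∀ {k} → Vec ℕ k → Vec ℕ k → ℕ
dot [] [] = 0
dot (a ∷ as) (x ∷ xs) = a * x + dot as xs

valueₙ : ∀ {k} → Normal k → Vec ℕ k → ℕ
valueₙ (c , v) ρ = c + dot v ρ

unit : ∀ {k} → Fin k → Vec ℕ k
unit zero = 1 ∷ replicate _ 0
unit (suc x) = 0 ∷ unit x

normal : ∀ {k} → Exp k → Normal k
normal (var x) = 0 , unit x
normal (κ c) = c , replicate _ 0
normal (𝕤 e) = let c , v = normal e in suc c , v
normal (e ⊕ f) = let c , v = normal e ; d , w = normal f in c + d , zipWith _+_ v w
normal (e ⊹ d) = let c , v = normal e in c + d , v
normal (m ⊗ e) = let c , v = normal e in m * c , map (m *_) v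

dot-0 : ∀ {k} (ρ : Vec ℕ k) → dot (replicate k 0) ρ ≡ 0
dot-0 [] = refl
dot-0 (x ∷ ρ) = dot-0 ρ

dot-unit : ∀ {k} (x : Fin k) ρ → dot (unit x) ρ ≡ lookup ρ x
dot-unit zero (x ∷ ρ) = trans (cong (x + 0 +_) (dot-0 ρ)) (trans (+-identityʳ _) (+-identityʳ x))
dot-unit (suc i) (x ∷ ρ) = dot-unit i ρ

dot-+ : ∀ {k} (v w ρ : Vec ℕ k) → dot (zipWith _+_ v w) ρ ≡ dot v ρ + dot w ρ
dot-+ [] [] [] = refl
dot-+ (a ∷ v) (b ∷ w) (x ∷ ρ) =
  trans (cong ((a + b) * x +_) (dot-+ v w ρ)) (rearrange a b x (dot v ρ) (dot w ρ))
  where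
  rearrange : ∀ a b x c d → (a + b) * x + (c + d) ≡ a * x + c + (b * x + d)
  rearrange = solve-∀

dot-* : ∀ {k} m (v ρ : Vec ℕ k) → dot (map (m *_) v) ρ ≡ m * dot v ρ
dot-* m [] [] = sym (*-zeroʳ m)
dot-* m (a ∷ v) (x ∷ ρ) =
  trans (cong (m * a * x +_) (dot-* m v ρ)) (rearrange m a x (dot v ρ))
  where
  rearrange : ∀ m a x c → m * a * x + m * c ≡ m * (a * x + c)
  rearrange = solve-∀

normal-sound : ∀ {k} (e : Exp k) ρ → value e ρ ≡ valueₙ (normal e) ρ
normal-sound (var x) ρ = sym (dot-unit x ρ)
normal-sound (κ c) ρ = sym (trans (cong (c +_) (dot-0 ρ)) (+-identityʳ c))
normal-sound (𝕤 e) ρ = cong suc (normal-sound e ρ)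
normal-sound (e ⊕ f) ρ = let c , v = normal e ; d , w = normal f in
  trans (cong₂ _+_ (normal-sound e ρ) (normal-sound f ρ))
    (trans (rearrange c (dot v ρ) d (dot w ρ)) (cong (c + d +_) (sym (dot-+ v w ρ))))
  where
  rearrange : ∀ a b c d → a + b + (c + d) ≡ a + c + (b + d)
  rearrange = solve-∀
normal-sound (e ⊹ d) ρ = let c , v = normal e in trans (cong (_+ d) (normal-sound e ρ)) (rearrange c (dot v ρ) d)
  where
  rearrange : ∀ a b c → a + b + c ≡ a + c + b
  rearrange = solve-∀
normal-sound (m ⊗ e) ρ = let c , v = normal e in
  trans (cong (m *_) (normal-sound e ρ))
    (trans (*-distribˡ-+ m c (dot v ρ)) (cong (m * c +_) (sym (dot-* m v ρ))))

_≤ᵛ_ : ∀ {k} → Vec ℕ k → Vec ℕ k → Bool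
[] ≤ᵛ [] = true
(a ∷ v) ≤ᵛ (b ∷ w) = (a ≤ᵇ b) ∧ (v ≤ᵛ w)

_≤ⁿ_ : ∀ {k} → Normal k → Normal k → Bool
(c , v) ≤ⁿ (d , w) = (c ≤ᵇ d) ∧ (v ≤ᵛ w)

T-∧ : ∀ {a b} → T (a ∧ b) → T a × T b
T-∧ {true} {true} _ = tt , tt

≤ᵛ-sound : ∀ {k} (v w ρ : Vec ℕ k) → T (v ≤ᵛ w) → dot v ρ ≤ dot w ρ
≤ᵛ-sound [] [] [] _ = z≤n
≤ᵛ-sound (a ∷ v) (b ∷ w) (x ∷ ρ) p = let q , r = T-∧ p in
  +-mono-≤ (*-monoˡ-≤ x (≤ᵇ⇒≤ a b q)) (≤ᵛ-sound v w ρ r)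

≤ⁿ-sound : ∀ {k} (e f : Exp k) ρ → T (normal e ≤ⁿ normal f) → value e ρ ≤ value f ρ
≤ⁿ-sound e f ρ p = subst₂ _≤_ (sym (normal-sound e ρ)) (sym (normal-sound f ρ))
  (+-mono-≤ (≤ᵇ⇒≤ _ _ (proj₁ (T-∧ p))) (≤ᵛ-sound (proj₂ (normal e)) (proj₂ (normal f)) ρ
      (proj₂ (T-∧ {proj₁ (normal e) ≤ᵇ proj₁ (normal f)} p))))

-- An equation l ≐ r contributes to a certificate as l ≤ r, and l ≑ r as r ≤ l.
data Rel (k : ℕ) : Set where
  _≼_ _≐_ _≑_ : Exp k → Exp k → Rel k
  _⊠_ : ℕ → Rel k → Rel k

-- The certificate is part of the statement: `m ⊠ h` weighs a hypothesis, with weight 1 when it is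
-- absent, and the number before `⊢` weighs the negated goal.
data Problem (k : ℕ) : Set where
  _⊢_ : ℕ → Rel k → Problem k
  ⊢⊥ : Problem k
  _⇛_ : Rel k → Problem k → Problem k

Meaningʳ : ∀ {k} → Rel k → Vec ℕ k → Set
Meaningʳ (l ≼ r) ρ = value l ρ ≤ value r ρ
Meaningʳ (l ≐ r) ρ = value l ρ ≡ value r ρ
Meaningʳ (l ≑ r) ρ = value l ρ ≡ value r ρ
Meaningʳ (m ⊠ h) ρ = Meaningʳ h ρ

Meaning : ∀ {k} → Problem k → Vec ℕ k → Set
Meaning (_ ⊢ g) ρ = Meaningʳ g ρ
Meaning ⊢⊥ ρ = ⊥
Meaning (h ⇛ P) ρ = Meaningʳ h ρ → Meaning P ρ

low high : ∀ {k} → Rel k → Exp k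
low (l ≼ r) = l
low (l ≐ r) = l
low (l ≑ r) = r
low (m ⊠ h) = m ⊗ low h
high (l ≼ r) = r
high (l ≐ r) = r
high (l ≑ r) = l
high (m ⊠ h) = m ⊗ high h

exact : ∀ {k} → Rel k → Bool
exact (l ≼ r) = false
exact (m ⊠ h) = exact h
exact _ = true

low≤high : ∀ {k} (h : Rel k) ρ → Meaningʳ h ρ → value (low h) ρ ≤ value (high h) ρ
low≤high (l ≼ r) ρ p = p
low≤high (l ≐ r) ρ p = ≤-reflexive p
low≤high (l ≑ r) ρ p = ≤-reflexive (sym p)
low≤high (m ⊠ h) ρ p = *-monoʳ-≤ m (low≤high h ρ p)

low≡high : ∀ {k} (h : Rel k) ρ → T (exact h) → Meaningʳ h ρ → value (low h) ρ ≡ value (high h) ρ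
low≡high (l ≐ r) ρ _ p = p
low≡high (l ≑ r) ρ _ p = sym p
low≡high (m ⊠ h) ρ e p = cong (m *_) (low≡high h ρ e p)

-- L and R are the weighted sums of the two sides of the hypotheses, and the flag says that all of
-- them are equations. For an inequality p ≼ q the negated goal q + 1 ≤ p is added with multiplier c;
-- the certificate is valid when the resulting left-hand side is larger in every coefficient.
certified : ∀ {k} → Exp k → Exp k → Bool → Problem k → Bool
certified L R e (c ⊢ p ≼ q) = normal (𝕤 (R ⊕ c ⊗ p)) ≤ⁿ normal (L ⊕ c ⊗ 𝕤 q)
certified L R e (c ⊢ p ≐ q) = e ∧ ((normal (L ⊕ q) ≤ⁿ normal (R ⊕ p)) ∧ (normal (R ⊕ p) ≤ⁿ normal (L ⊕ q)))
certified L R e (c ⊢ _) = false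
certified L R e ⊢⊥ = normal (𝕤 R) ≤ⁿ normal L
certified L R e (h ⇛ P) = certified (L ⊕ low h) (R ⊕ high h) (e ∧ exact h) P

certified-sound : ∀ {k} L R e (P : Problem k) ρ → value L ρ ≤ value R ρ → (T e → value L ρ ≡ value R ρ) → T
    (certified L R e P) → Meaning P ρ
certified-sound L R e (c ⊢ p ≼ q) ρ L≤R _ ok = ≮⇒≥ (λ q<p → <-irrefl refl
  (≤-trans (≤ⁿ-sound (𝕤 (R ⊕ c ⊗ p)) (L ⊕ c ⊗ 𝕤 q) ρ ok) (+-mono-≤ L≤R (*-monoʳ-≤ c q<p))))
certified-sound L R e (c ⊢ p ≐ q) ρ _ L≡R ok = let exact , ok = T-∧ {e} ok ; p₁ , p₂ = T-∧ {normal (L ⊕ q) ≤ⁿ normal (R ⊕ p)} ok in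
  +-cancelˡ-≡ (value R ρ) _ _ (trans (sym (≤-antisym (≤ⁿ-sound (L ⊕ q) (R ⊕ p) ρ p₁) (≤ⁿ-sound (R ⊕ p) (L ⊕ q) ρ p₂)))
      (cong (_+ value q ρ) (L≡R exact)))
certified-sound L R e ⊢⊥ ρ L≤R _ ok = <-irrefl refl (≤-trans (≤ⁿ-sound (𝕤 R) L ρ ok) L≤R)
certified-sound L R e (h ⇛ P) ρ L≤R L≡R ok p = certified-sound (L ⊕ low h) (R ⊕ high h) (e ∧ exact h) P ρ
    (+-mono-≤ L≤R (low≤high h ρ p))
  (λ t → let a , b = T-∧ {e} t in cong₂ _+_ (L≡R a) (low≡high h ρ b p)) ok

Curried : ℕ → Set → Set → Set
Curried zero A B = B
Curried (suc k) A B = A → Curried k A B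

_$ᶜ_ : ∀ {k : ℕ} {A B : Set} → Curried k A B → Vec A k → B
f $ᶜ [] = f
f $ᶜ (x ∷ xs) = f x $ᶜ xs

Allᶜ : ∀ k {A : Set} → (Vec A k → Set) → Set
Allᶜ zero P = P []
Allᶜ (suc k) {A} P = ∀ (x : A) → Allᶜ k (λ xs → P (x ∷ xs))

curryᶜ : ∀ k {A : Set} {P : Vec A k → Set} → (∀ xs → P xs) → Allᶜ k P
curryᶜ zero f = f []
curryᶜ (suc k) f x = curryᶜ k (λ xs → f (x ∷ xs))

abstract
  -- The problem is evaluated at the formal variables, so the certificate is a closed Boolean: the
  -- type checker validates it, and a caller supplies only the numbers and the hypotheses.
  lin : ∀ k (P : Curried k (Exp k) (Problem k)) {_ : T (certified (κ 0) (κ 0) true (P $ᶜ tabulate var))} →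
        Allᶜ k (Meaning (P $ᶜ tabulate var))
  lin k P {ok} = curryᶜ k (λ ρ → certified-sound (κ 0) (κ 0) true (P $ᶜ tabulate var) ρ z≤n (λ _ → refl) ok)

1≰0 : ¬ (1 ≤ 0)
1≰0 ()

-- Boolean reasoning by truth tables

𝟙 : Bool → ℕ
𝟙 b = if b then 1 else 0

infix 4 !_ ∼_ _⊃_ _⇔_ _≦_ _≃_
infix 3 ⊩_

data Fact : Set where
  !_ ∼_ : Bool → Fact
  _⊃_ _⇔_ : Bool → Bool → Fact
  _≦_ _≃_ : ℕ → ℕ → Fact

data Claim : Set where
  ⊩_ : Fact → Claim
  ⊩⊥ : Claim
  _⇛_ : Fact → Claim → Claim

Holdsᶠ : Fact → Set
Holdsᶠ (! a) = a ≡ true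
Holdsᶠ (∼ a) = a ≡ false
Holdsᶠ (a ⊃ b) = a ≡ true → b ≡ true
Holdsᶠ (a ⇔ b) = a ≡ b
Holdsᶠ (m ≦ n) = m ≤ n
Holdsᶠ (m ≃ n) = m ≡ n

Holds : Claim → Set
Holds (⊩ g) = Holdsᶠ g
Holds ⊩⊥ = ⊥
Holds (h ⇛ c) = Holdsᶠ h → Holds c

checkᶠ : Fact → Bool
checkᶠ (! a) = a
checkᶠ (∼ a) = not a
checkᶠ (a ⊃ b) = not a ∨ b
checkᶠ (a ⇔ b) = (a ∧ b) ∨ (not a ∧ not b)
checkᶠ (m ≦ n) = m ≤ᵇ n
checkᶠ (m ≃ n) = m ≡ᵇ n

check : Claim → Bool
check (⊩ g) = checkᶠ g
check ⊩⊥ = false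
check (h ⇛ c) = not (checkᶠ h) ∨ check c

checkᶠ-sound : ∀ f → T (checkᶠ f) → Holdsᶠ f
checkᶠ-sound (! true) _ = refl
checkᶠ-sound (∼ false) _ = refl
checkᶠ-sound (true ⊃ true) _ _ = refl
checkᶠ-sound (false ⊃ _) _ ()
checkᶠ-sound (true ⇔ true) _ = refl
checkᶠ-sound (false ⇔ false) _ = refl
checkᶠ-sound (m ≦ n) p = ≤ᵇ⇒≤ m n p
checkᶠ-sound (m ≃ n) p = ≡ᵇ⇒≡ m n p

checkᶠ-complete : ∀ f → Holdsᶠ f → T (checkᶠ f)
checkᶠ-complete (! _) refl = tt
checkᶠ-complete (∼ _) refl = tt
checkᶠ-complete (true ⊃ b) p = subst T (sym (p refl)) tt
checkᶠ-complete (false ⊃ b) p = tt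
checkᶠ-complete (true ⇔ _) refl = tt
checkᶠ-complete (false ⇔ _) refl = tt
checkᶠ-complete (m ≦ n) p = ≤⇒≤ᵇ p
checkᶠ-complete (m ≃ n) p = ≡⇒≡ᵇ m n p

check-sound : ∀ c → T (check c) → Holds c
check-sound (⊩ g) p = checkᶠ-sound g p
check-sound (h ⇛ c) p q = check-sound c (modus-ponens (checkᶠ h) (checkᶠ-complete h q) p)
  where
  modus-ponens : ∀ a {b} → T a → T (not a ∨ b) → T b
  modus-ponens true _ t = t

everywhere : ∀ k → Curried k Bool Claim → Bool
everywhere zero c = check c
everywhere (suc k) f = everywhere k (f true) ∧ everywhere k (f false)

everywhere-sound : ∀ k (f : Curried k Bool Claim) → T (everywhere k f) → ∀ xs → Holds (f $ᶜ xs)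
everywhere-sound zero c p [] = check-sound c p
everywhere-sound (suc k) f p (true ∷ xs) = everywhere-sound k (f true) (proj₁ (T-∧ p)) xs
everywhere-sound (suc k) f p (false ∷ xs) = everywhere-sound k (f false) (proj₂ (T-∧ {everywhere k (f true)} p)) xs

abstract
  -- Membership is Boolean, so a relation between indicators at one vertex or one pair of vertices
  -- is a finite table. Facts linking the entries enter as premises.
  tab : ∀ k (f : Curried k Bool Claim) {_ : T (everywhere k f)} → Allᶜ k (λ xs → Holds (f $ᶜ xs))
  tab k f {ok} = curryᶜ k (everywhere-sound k f ok)

T⇒≡ : ∀ {b} → T b → b ≡ true
T⇒≡ {true} _ = refl

∧ˡ : ∀ a b → a ∧ b ≡ true → a ≡ true
∧ˡ true _ _ = refl

∧ʳ : ∀ a b → a ∧ b ≡ true → b ≡ true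
∧ʳ true _ p = p

infixr 5 _&_
_&_ : ∀ {a b} → a ≡ true → b ≡ true → a ∧ b ≡ true
refl & refl = refl

not-intro : ∀ {a} → a ≡ false → not a ≡ true
not-intro refl = refl

not-elim : ∀ {a} → not a ≡ true → a ≡ false
not-elim {false} _ = refl

Decided : Bool → Set
Decided b = b ≡ true ⊎ b ≡ false

bool : ∀ b → Decided b
bool true = inj₁ refl
bool false = inj₂ refl

clash : ∀ {b} → b ≡ true → b ≡ false → ⊥
clash refl ()

-- Vertex sets and edge sets

VS ES : ℕ → Set
VS n = Fin n → Bool
ES n = Fin n → Fin n → Bool

opaque
  -- Opaque, so that cardinalities and edge counts behave as atoms in the arithmetic instead of
  -- unfolding into sums.
  ∣_∣ : ∀ {n} → VS n → ℕ
  ∣ X ∣ = countFin X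

  ec : ∀ {n} → ES n → ℕ
  ec E = ecount E

  ∣∣-def : ∀ {n} (X : VS n) → ∣ X ∣ ≡ countFin X
  ∣∣-def X = refl

  ec-def : ∀ {n} (E : ES n) → ec E ≡ ecount E
  ec-def E = refl

infixr 6 _∪_
infixr 7 _∩_
infixl 7 _∖_
_∪_ _∩_ _∖_ : ∀ {n} → VS n → VS n → VS n
(X ∪ Y) i = X i ∨ Y i
(X ∩ Y) i = X i ∧ Y i
(X ∖ Y) i = X i ∧ not (Y i)

∁ : ∀ {n} → VS n → VS n
∁ X i = not (X i)

⟨_⟩ : ∀ {n} → Fin n → VS n
⟨ t ⟩ i = i == t

full : ∀ {n} → VS n
full _ = true

infix 4 _⊆_ _⊆ₑ_
_⊆_ : ∀ {n} → VS n → VS n → Set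
X ⊆ Y = ∀ i → X i ≡ true → Y i ≡ true

_⊆ₑ_ : ∀ {n} → ES n → ES n → Set
E ⊆ₑ F = ∀ i j → E i j ≡ true → F i j ≡ true

NE : ∀ {n} → VS n → Set
NE X = ∃[ i ] X i ≡ true

Empty? : ∀ {n} → VS n → Set
Empty? X = NE X ⊎ (∀ i → X i ≡ false)

Edge? : ∀ {n} → ES n → Set
Edge? E = (∃[ a ] ∃[ b ] E a b ≡ true) ⊎ (∀ a b → E a b ≡ false)

record Simple {n} (E : ES n) : Set where
  constructor simple
  field
    symm : ∀ i j → E i j ≡ E j i
    irr : ∀ i → E i i ≡ false
open Simple public

inn inc : ∀ {n} → ES n → VS n → ES n
inn E X i j = E i j ∧ (X i ∧ X j)
inc E X i j = E i j ∧ (X i ∨ X j)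

btw : ∀ {n} → ES n → VS n → VS n → ES n
btw E X Y i j = E i j ∧ ((X i ∧ Y j) ∨ (Y i ∧ X j))

-- Sparsity bounds the induced edges from above; by complementation inside a circuit it bounds the
-- touching edges from below. Both views are needed throughout.
ins tch : ∀ {n} → ES n → VS n → ℕ
ins E X = ec (inn E X)
tch E X = ec (inc E X)

dg : ∀ {n} → ES n → Fin n → VS n → ℕ
dg E t X = ∣ E t ∩ X ∣

==-refl : ∀ {n} (i : Fin n) → (i == i) ≡ true
==-refl i = dec-true (i ≟ i) refl

==⇒≡ : ∀ {n} {i j : Fin n} → (i == j) ≡ true → i ≡ j
==⇒≡ {i = i} {j} p with i ≟ j
... | yes q = q

≢⇒== : ∀ {n} {i j : Fin n} → i ≢ j → (i == j) ≡ false
≢⇒== {i = i} {j} p = dec-false (i ≟ j) p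

≢⇒not : ∀ {n} {i j : Fin n} → i ≢ j → not (i == j) ≡ true
≢⇒not p = not-intro (≢⇒== p)

==-≢ : ∀ {n} {i j : Fin n} → (i == j) ≡ false → i ≢ j
==-≢ {i = i} p refl = clash (==-refl i) p

==-sym : ∀ {n} (i j : Fin n) → (i == j) ≡ (j == i)
==-sym i j with i ≟ j
... | yes refl = sym (==-refl i)
... | no p = sym (≢⇒== (≢-sym p))

∈≢∉ : ∀ {n} {X : VS n} {i j} → X i ≡ true → X j ≡ false → i ≢ j
∈≢∉ p q refl = clash p q

adj≢ : ∀ {n} {E : ES n} → Simple E → ∀ {i j} → E i j ≡ true → i ≢ j
adj≢ sE {i} p refl = clash p (irr sE i)

-- Summation

sum-cong : ∀ {n} {f g : Fin n → ℕ} → (∀ i → f i ≡ g i) → sumFin f ≡ sumFin g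
sum-cong {zero} h = refl
sum-cong {suc n} h = cong₂ _+_ (h zero) (sum-cong (λ i → h (suc i)))

sum-mono : ∀ {n} {f g : Fin n → ℕ} → (∀ i → f i ≤ g i) → sumFin f ≤ sumFin g
sum-mono {zero} h = z≤n
sum-mono {suc n} h = +-mono-≤ (h zero) (sum-mono (λ i → h (suc i)))

interchange : ∀ a b c d → a + b + (c + d) ≡ a + c + (b + d)
interchange = solve-∀

sum-+ : ∀ {n} (f g : Fin n → ℕ) → sumFin (λ i → f i + g i) ≡ sumFin f + sumFin g
sum-+ {zero} f g = refl
sum-+ {suc n} f g = trans (cong (f zero + g zero +_) (sum-+ (λ i → f (suc i)) (λ i → g (suc i))))
  (interchange (f zero) (g zero) _ _)

sum-0 : ∀ n → sumFin {n} (λ _ → 0) ≡ 0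
sum-0 zero = refl
sum-0 (suc n) = sum-0 n

opaque
  unfolding ∣_∣

  sum-const : ∀ {n} c (X : VS n) → sumFin (λ i → if X i then c else 0) ≡ c * ∣ X ∣
  sum-const {zero} c X = sym (*-zeroʳ c)
  sum-const {suc n} c X with X zero
  ... | true = trans (cong (c +_) (sum-const c (λ i → X (suc i)))) (sym (*-suc c _))
  ... | false = sum-const c (λ i → X (suc i))

esum : ∀ {n} → (Fin n → Fin n → ℕ) → ℕ
esum f = sumFin (λ i → sumFin (λ j → if toℕ i <ᵇ toℕ j then f i j else 0))

esum-mono : ∀ {n} {f g : Fin n → Fin n → ℕ} → (∀ i j → f i j ≤ g i j) → esum f ≤ esum g
esum-mono {f = f} {g} h = sum-mono (λ i → sum-mono (λ j → step i j (toℕ i <ᵇ toℕ j)))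
  where
  step : ∀ i j b → (if b then f i j else 0) ≤ (if b then g i j else 0)
  step i j true = h i j
  step i j false = z≤n

esum-+ : ∀ {n} (f g : Fin n → Fin n → ℕ) → esum (λ i j → f i j + g i j) ≡ esum f + esum g
esum-+ {n} f g = trans (sum-cong (λ i → trans (sum-cong (λ j → step i j (toℕ i <ᵇ toℕ j))) (sum-+ {n} _ _)))
    (sum-+ {n} _ _)
  where
  step : ∀ i j b → (if b then f i j + g i j else 0) ≡ (if b then f i j else 0) + (if b then g i j else 0)
  step i j true = refl
  step i j false = refl

opaque
  unfolding ec

  ec-esum : ∀ {n} (E : ES n) → ec E ≡ esum (λ i j → 𝟙 (E i j))
  ec-esum E = sum-cong (λ i → sum-cong (λ j → step (toℕ i <ᵇ toℕ j) (E i j)))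
    where
    step : ∀ a b → 𝟙 (a ∧ b) ≡ (if a then 𝟙 b else 0)
    step true b = refl
    step false b = refl

-- A square splits into two triangles and its diagonal. This is the double counting behind `star`
-- and `degree-sum`.
sum-pairs : ∀ {n} (g : Fin n → Fin n → ℕ) →
  sumFin (λ i → sumFin (g i)) ≡ esum (λ i j → g i j + g j i) + sumFin (λ i → g i i)
sum-pairs {zero} g = refl
sum-pairs {suc n} g = trans (cong (g zero zero + row +_) split)
  (trans (cong (λ x → g zero zero + row + (column + x)) (sum-pairs (λ i j → g (suc i) (suc j))))
  (trans (rearrange (g zero zero) row column pairs diagonal)
    (cong (λ x → x + pairs + (g zero zero + diagonal)) (sym (sum-+ (λ j → g zero (suc j)) (λ j → g (suc j) zero))))))
  where
  row column pairs diagonal : ℕ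
  row = sumFin (λ j → g zero (suc j))
  column = sumFin (λ i → g (suc i) zero)
  pairs = esum (λ i j → g (suc i) (suc j) + g (suc j) (suc i))
  diagonal = sumFin (λ i → g (suc i) (suc i))
  split : sumFin (λ i → g (suc i) zero + sumFin (λ j → g (suc i) (suc j))) ≡
          column + sumFin (λ i → sumFin (λ j → g (suc i) (suc j)))
  split = sum-+ {n} _ _
  rearrange : ∀ z r c p d → z + r + (c + (p + d)) ≡ r + c + p + (z + d)
  rearrange = solve-∀

opaque
  unfolding ∣_∣

  cnt≤ : ∀ {n} {X Y : VS n} → X ⊆ Y → ∣ X ∣ ≤ ∣ Y ∣
  cnt≤ {X = X} {Y} h = sum-mono (λ i → tab 2 (λ a b → a ⊃ b ⇛ ⊩ 𝟙 a ≦ 𝟙 b) (X i) (Y i) (h i))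

  cnt≗ : ∀ {n} {X Y : VS n} → (∀ i → X i ≡ Y i) → ∣ X ∣ ≡ ∣ Y ∣
  cnt≗ h = sum-cong (λ i → cong 𝟙 (h i))

  cnt12 : ∀ {n} (X Y Z : VS n) → (∀ i → 𝟙 (X i) ≡ 𝟙 (Y i) + 𝟙 (Z i)) → ∣ X ∣ ≡ ∣ Y ∣ + ∣ Z ∣
  cnt12 {n} X Y Z h = trans (sum-cong h) (sum-+ {n} _ _)

  cnt22 : ∀ {n} (X X′ Y Z : VS n) → (∀ i → 𝟙 (X i) + 𝟙 (X′ i) ≡ 𝟙 (Y i) + 𝟙 (Z i)) → ∣ X ∣ + ∣ X′ ∣ ≡ ∣ Y ∣ + ∣ Z ∣
  cnt22 {n} X X′ Y Z h = trans (sym (sum-+ {n} _ _)) (trans (sum-cong {n} h) (sum-+ {n} _ _))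

ec≤ : ∀ {n} (E F : ES n) → (∀ i j → 𝟙 (E i j) ≤ 𝟙 (F i j)) → ec E ≤ ec F
ec≤ E F h = subst₂ _≤_ (sym (ec-esum E)) (sym (ec-esum F)) (esum-mono h)

ec-⊆ : ∀ {n} {E F : ES n} → E ⊆ₑ F → ec E ≤ ec F
ec-⊆ {E = E} {F} h = ec≤ E F (λ i j → tab 2 (λ a b → a ⊃ b ⇛ ⊩ 𝟙 a ≦ 𝟙 b) (E i j) (F i j) (h i j))

ec-+ : ∀ {n} (E F : ES n) → esum (λ i j → 𝟙 (E i j) + 𝟙 (F i j)) ≡ ec E + ec F
ec-+ {n} E F = trans (esum-+ {n} _ _) (sym (cong₂ _+_ (ec-esum E) (ec-esum F)))

-- Edge counts are compared pair by pair. Two terms on each side fit submodularity; the forms with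
-- three terms pad with the empty edge set.
ec22 : ∀ {n} (E E′ F F′ : ES n) → (∀ i j → 𝟙 (E i j) + 𝟙 (E′ i j) ≤ 𝟙 (F i j) + 𝟙 (F′ i j)) →
       ec E + ec E′ ≤ ec F + ec F′
ec22 E E′ F F′ h = begin
  ec E + ec E′ ≡⟨ sym (ec-+ E E′) ⟩
  esum (λ i j → 𝟙 (E i j) + 𝟙 (E′ i j)) ≤⟨ esum-mono h ⟩
  esum (λ i j → 𝟙 (F i j) + 𝟙 (F′ i j)) ≡⟨ ec-+ F F′ ⟩
  ec F + ec F′ ∎
  where open ≤-Reasoning

none : ∀ {n} → ES n
none _ _ = false

ec-none : ∀ n → ec (none {n}) ≡ 0
ec-none n = trans (ec-esum {n} none)
  (trans (sum-cong {n} (λ i → trans (sum-cong {n} (λ j → step (toℕ i <ᵇ toℕ j))) (sum-0 n))) (sum-0 n))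
  where
  step : ∀ b → (if b then 0 else 0) ≡ 0
  step true = refl
  step false = refl

ec≗ : ∀ {n} {E F : ES n} → (∀ i j → E i j ≡ F i j) → ec E ≡ ec F
ec≗ {E = E} {F} h = ≤-antisym (ec-⊆ (λ i j p → trans (sym (h i j)) p)) (ec-⊆ (λ i j p → trans (h i j) p))

ec12≤ : ∀ {n} (E F F′ : ES n) → (∀ i j → 𝟙 (E i j) ≤ 𝟙 (F i j) + 𝟙 (F′ i j)) → ec E ≤ ec F + ec F′
ec12≤ {n} E F F′ h = lin 4 (λ a b c d → a ⊕ b ≼ c ⊕ d ⇛ 1 ⊢ a ≼ c ⊕ d) (ec E) (ec (none {n})) (ec F) (ec F′)
    (ec22 E none F F′ (λ i j → subst (_≤ 𝟙 (F i j) + 𝟙 (F′ i j)) (sym (+-identityʳ _)) (h i j)))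

ec21≤ : ∀ {n} (E E′ F : ES n) → (∀ i j → 𝟙 (E i j) + 𝟙 (E′ i j) ≤ 𝟙 (F i j)) → ec E + ec E′ ≤ ec F
ec21≤ {n} E E′ F h = lin 4 (λ a b c d → a ⊕ b ≼ c ⊕ d ⇛ d ≐ κ 0 ⇛ 1 ⊢ a ⊕ b ≼ c) (ec E) (ec E′) (ec F) (ec (none {n}))
    (ec22 E E′ F none (λ i j → subst (𝟙 (E i j) + 𝟙 (E′ i j) ≤_) (sym (+-identityʳ _)) (h i j))) (ec-none n)

ec12 : ∀ {n} (E F F′ : ES n) → (∀ i j → 𝟙 (E i j) ≡ 𝟙 (F i j) + 𝟙 (F′ i j)) → ec E ≡ ec F + ec F′
ec12 E F F′ h = ≤-antisym (ec12≤ E F F′ (λ i j → ≤-reflexive (h i j)))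
    (ec21≤ F F′ E (λ i j → ≤-reflexive (sym (h i j))))

-- Bridge between singletons and truth tables: what `X` does at `t` becomes an implication from
-- `i == t`.
at : ∀ {n} (X : VS n) {t b} → X t ≡ b → ∀ i → (i == t) ≡ true → X i ≡ b
at X p i q = trans (cong X (==⇒≡ q)) p

-- Cardinalities

∣∪∣+∣∩∣ : ∀ {n} (X Y : VS n) → ∣ X ∪ Y ∣ + ∣ X ∩ Y ∣ ≡ ∣ X ∣ + ∣ Y ∣
∣∪∣+∣∩∣ X Y = cnt22 (X ∪ Y) (X ∩ Y) X Y (λ i → tab 2 (λ a b → ⊩ 𝟙 (b ∨ a) + 𝟙 (b ∧ a) ≃ 𝟙 b + 𝟙 a) (Y i) (X i))

∣∩∣+∣∖∣ : ∀ {n} (X Y : VS n) → ∣ X ∣ ≡ ∣ X ∩ Y ∣ + ∣ X ∖ Y ∣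
∣∩∣+∣∖∣ X Y = cnt12 X (X ∩ Y) (X ∖ Y) (λ i → tab 2 (λ a b → ⊩ 𝟙 a ≃ 𝟙 (a ∧ b) + 𝟙 (a ∧ not b)) (X i) (Y i))

∣⊆∣+∣∖∣ : ∀ {n} (X Y : VS n) → Y ⊆ X → ∣ X ∣ ≡ ∣ Y ∣ + ∣ X ∖ Y ∣
∣⊆∣+∣∖∣ X Y h = cnt12 X Y (X ∖ Y) (λ i → tab 2 (λ a b → a ⊃ b ⇛ ⊩ 𝟙 b ≃ 𝟙 a + 𝟙 (b ∧ not a)) (Y i) (X i) (h i))

opaque
  unfolding ∣_∣

  cnt-empty : ∀ {n} {X : VS n} → (∀ i → X i ≡ false) → ∣ X ∣ ≡ 0
  cnt-empty {n} h = trans (sum-cong (λ i → cong 𝟙 (h i))) (sum-0 n)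

  cnt-single : ∀ {n} (t : Fin n) → ∣ ⟨ t ⟩ ∣ ≡ 1
  cnt-single {suc n} zero = cong suc (cnt-empty {n} (λ i → ≢⇒== {i = suc i} {zero} (λ ())))
  cnt-single {suc n} (suc t) = trans (cnt≗ {n} (λ i → shift i (i ≟ t))) (cnt-single t)
    where
    shift : ∀ i → Dec (i ≡ t) → (Fin.suc i == suc t) ≡ (i == t)
    shift i (yes refl) = trans (==-refl (Fin.suc i)) (sym (==-refl i))
    shift i (no p) = trans (≢⇒== {i = Fin.suc i} {suc t} (λ { refl → p refl })) (sym (≢⇒== p))

cnt-pos : ∀ {n} {X : VS n} {t} → X t ≡ true → 1 ≤ ∣ X ∣
cnt-pos {X = X} {t} p = subst (_≤ ∣ X ∣) (cnt-single t) (cnt≤ {X = ⟨ t ⟩} {X} (at X p))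

cnt-split : ∀ {n} (X Q : VS n) {t} → X t ≡ true → ∣ X ∩ Q ∣ ≡ 𝟙 (Q t) + ∣ (X ∖ ⟨ t ⟩) ∩ Q ∣
cnt-split X Q {t} p = trans
  (cnt12 (X ∩ Q) (⟨ t ⟩ ∩ Q) ((X ∖ ⟨ t ⟩) ∩ Q) (λ i →
    (tab 3 (λ a b c → a ⊃ b ⇛ ⊩ 𝟙 (b ∧ c) ≃ 𝟙 (a ∧ c) + 𝟙 ((b ∧ not a) ∧ c)) (i == t) (X i) (Q i) (at X p i))))
  (cong (_+ ∣ (X ∖ ⟨ t ⟩) ∩ Q ∣) (value-at (Q t) refl))
  where
  value-at : ∀ b → Q t ≡ b → ∣ ⟨ t ⟩ ∩ Q ∣ ≡ 𝟙 b
  value-at true q = trans (cnt≗ (λ i → tab 2 (λ a b → a ⊃ b ⇛ ⊩ a ∧ b ⇔ a) (i == t) (Q i) (at Q q i))) (cnt-single t)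
  value-at false q = cnt-empty (λ i → tab 2 (λ a b → a ⊃ not b ⇛ ⊩ ∼ (a ∧ b)) (i == t) (Q i) (at (∁ Q) (not-intro q) i))

cnt-rem : ∀ {n} (X : VS n) {t} → X t ≡ true → ∣ X ∣ ≡ suc ∣ X ∖ ⟨ t ⟩ ∣
cnt-rem X {t} p = trans (cnt≗ {X = X} {X ∩ full} (λ i → sym (𝔹.∧-identityʳ (X i))))
  (trans (cnt-split X full p) (cong suc (cnt≗ {X = (X ∖ ⟨ t ⟩) ∩ full} {X ∖ ⟨ t ⟩} (λ i → 𝔹.∧-identityʳ _))))

cnt-add : ∀ {n} (X : VS n) {t} → X t ≡ false → ∣ X ∪ ⟨ t ⟩ ∣ ≡ suc ∣ X ∣
cnt-add X {t} p = trans (cnt-rem (X ∪ ⟨ t ⟩) {t} (tab 2 (λ a b → ! a ⇛ ⊩ ! (b ∨ a)) (t == t) (X t) (==-refl t)))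
  (cong suc (cnt≗ (λ i → tab 2 (λ a b → a ⊃ not b ⇛ ⊩ (b ∨ a) ∧ not a ⇔ b) (i == t) (X i) (at (∁ X) (not-intro p) i))))

empty? : ∀ {n} (X : VS n) → Empty? X
empty? X with any? (λ i → X i 𝔹.≟ true)
... | yes p = inj₁ p
... | no p = inj₂ (λ i → 𝔹.¬-not (λ q → p (i , q)))

abstract
  pos⇒NE : ∀ {n} (X : VS n) → 1 ≤ ∣ X ∣ → NE X
  pos⇒NE X h with empty? X
  ... | inj₁ p = p
  ... | inj₂ q = ⊥-elim (1≰0 (subst (1 ≤_) (cnt-empty q) h))

abstract
  cnt-pick : ∀ {n} (X : VS n) {k} → ∣ X ∣ ≡ suc k → ∃[ t ] (X t ≡ true × ∣ X ∖ ⟨ t ⟩ ∣ ≡ k)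
  cnt-pick X {k} h = let t , p = pos⇒NE X (subst (1 ≤_) (sym h) (s≤s z≤n)) in
    t , p , suc-injective (trans (sym (cnt-rem X p)) h)

cnt-two : ∀ {n} {X : VS n} {s t} → X s ≡ true → X t ≡ true → s ≢ t → 2 ≤ ∣ X ∣
cnt-two {X = X} {s} {t} p q s≢t = subst (2 ≤_) (sym (cnt-rem X p))
  (s≤s (cnt-pos {X = X ∖ ⟨ s ⟩} {t} (q & ≢⇒not (≢-sym s≢t))))

⊆⇒∣∣-eq : ∀ {n} {X Y : VS n} → X ⊆ Y → ∣ Y ∣ ≤ ∣ X ∣ → Y ⊆ X
⊆⇒∣∣-eq {X = X} {Y} X⊆Y h i p with bool (X i)
... | inj₁ q = q
... | inj₂ q = ⊥-elim (lin 3 (λ a b c → a ≼ b ⇛ a ≑ b ⊕ c ⇛ κ 1 ≼ c ⇛ ⊢⊥) (∣ Y ∣) (∣ X ∣) (∣ Y ∖ X ∣) h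
    (∣⊆∣+∣∖∣ Y X X⊆Y) (cnt-pos {X = Y ∖ X} (p & not-intro q)))

-- Edge counts

ins≗ : ∀ {n} (E : ES n) {X Y : VS n} → (∀ i → X i ≡ Y i) → ins E X ≡ ins E Y
ins≗ E h = ec≗ (λ i j → cong (E i j ∧_) (cong₂ _∧_ (h i) (h j)))

tch≗ : ∀ {n} (E : ES n) {X Y : VS n} → (∀ i → X i ≡ Y i) → tch E X ≡ tch E Y
tch≗ E h = ec≗ (λ i j → cong (E i j ∧_) (cong₂ _∨_ (h i) (h j)))

inn-simple : ∀ {n} {E : ES n} → Simple E → ∀ X → Simple (inn E X)
inn-simple {E = E} s X = simple
  (λ i j → tab 4 (λ a b c d → a ⇔ b ⇛ ⊩ a ∧ d ∧ c ⇔ b ∧ c ∧ d) (E i j) (E j i) (X j) (X i) (symm s i j))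
  (λ i → cong (_∧ (X i ∧ X i)) (irr s i))

inc-simple : ∀ {n} {E : ES n} → Simple E → ∀ X → Simple (inc E X)
inc-simple {E = E} s X = simple
  (λ i j → tab 4 (λ a b c d → a ⇔ b ⇛ ⊩ a ∧ (d ∨ c) ⇔ b ∧ (c ∨ d)) (E i j) (E j i) (X j) (X i) (symm s i j))
  (λ i → cong (_∧ (X i ∨ X i)) (irr s i))

opaque
  unfolding ∣_∣

  -- The indicator of `i == t` and `E t j`, summed over ordered pairs, gives the degree when read by
  -- rows and the edges at `t` when read by unordered pairs.
  star : ∀ {n} (E : ES n) → Simple E → ∀ t → tch E ⟨ t ⟩ ≡ ∣ E t ∣
  star {n} E sE t = trans (ec-esum (inc E ⟨ t ⟩))
    (trans (≤-antisym (esum-mono (λ i j → ≤-reflexive (pointwise i j)))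
        (esum-mono (λ i j → ≤-reflexive (sym (pointwise i j)))))
    (trans (sym (+-identityʳ _)) (trans (cong (esum (λ i j → g i j + g j i) +_) (sym diagonal))
    (trans (sym (sum-pairs g)) (trans (sum-cong row) (trans (sum-const ∣ E t ∣ ⟨ t ⟩)
    (trans (cong (∣ E t ∣ *_) (cnt-single t)) (*-identityʳ _))))))))
    where
    g : Fin n → Fin n → ℕ
    g i j = 𝟙 ((i == t) ∧ E t j)
    left : ∀ i j → (i == t) ≡ true → E i j ≡ E t j
    left i j p = cong (λ k → E k j) (==⇒≡ p)
    right : ∀ i j → (j == t) ≡ true → E i j ≡ E t i
    right i j p = trans (symm sE i j) (left j i p)
    pointwise : ∀ i j → 𝟙 (inc E ⟨ t ⟩ i j) ≡ g i j + g j i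
    pointwise i j with i == t in p | j == t in q
    ... | false | false = cong 𝟙 (𝔹.∧-zeroʳ (E i j))
    ... | true | false = trans (cong 𝟙 (trans (𝔹.∧-identityʳ (E i j)) (left i j p))) (sym (+-identityʳ _))
    ... | false | true = cong 𝟙 (trans (𝔹.∧-identityʳ (E i j)) (right i j q))
    ... | true | true with ==⇒≡ {i = i} p | ==⇒≡ {i = j} q
    ... | refl | refl rewrite irr sE i = refl
    diagonal : sumFin (λ i → g i i) ≡ 0
    diagonal = cnt-empty (λ i → diag i (i ≟ t))
      where
      diag : ∀ i → Dec (i ≡ t) → ((i == t) ∧ E t i) ≡ false
      diag i (yes refl) = trans (cong ((i == t) ∧_) (irr sE i)) (𝔹.∧-zeroʳ _)
      diag i (no p) = cong (_∧ E t i) (≢⇒== p)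
    row : ∀ i → sumFin (g i) ≡ (if ⟨ t ⟩ i then ∣ E t ∣ else 0)
    row i with i == t
    ... | true = refl
    ... | false = sum-0 n

-- The gain is the star of `t` in the graph induced by the larger set. For `tch` the same argument
-- applies in the graph induced by the complement, and the removals are the additions read
-- backwards.
ins-add : ∀ {n} {E : ES n} → Simple E → ∀ (Y : VS n) {t} → Y t ≡ false → ins E (Y ∪ ⟨ t ⟩) ≡ ins E Y + dg E t Y
ins-add {n} {E} sE Y {t} p = trans
  (ec12 F (inn E Y) (inc F ⟨ t ⟩) (λ i j → tab 5 (λ a b c d e → a ⊃ not b ⇛ c ⊃ not d ⇛ ⊩ 𝟙 (e ∧ (b ∨ a) ∧ (d ∨ c)) ≃ 𝟙
      (e ∧ b ∧ d) + 𝟙 ((e ∧ (b ∨ a) ∧ (d ∨ c)) ∧ (a ∨ c))) (i == t) (Y i) (j == t) (Y j) (E i j)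
      (at (∁ Y) (not-intro p) i) (at (∁ Y) (not-intro p) j)))
  (cong (ins E Y +_) (trans (star F (inn-simple sE (Y ∪ ⟨ t ⟩)) t) (cnt≗ (λ z →
    (tab 5 (λ a b c d e → ! a ⇛ b ⊃ not c ⇛ ⊩ c ∧ (e ∨ a) ∧ (d ∨ b) ⇔ c ∧ d) (t == t) (z == t) (E t z) (Y z) (Y t)
        (==-refl t) (at (∁ (E t)) (not-intro (irr sE t)) z))))))
  where
  F : ES n
  F = inn E (Y ∪ ⟨ t ⟩)

tch-add : ∀ {n} {E : ES n} → Simple E → ∀ (S : VS n) {t} → S t ≡ false → tch E (S ∪ ⟨ t ⟩) ≡ tch E S + dg E t (∁ S)
tch-add {n} {E} sE S {t} p = trans
  (ec12 (inc E (S ∪ ⟨ t ⟩)) (inc E S) (inc F ⟨ t ⟩) (λ i j → tab 5 (λ a b c d e → ⊩ 𝟙 (e ∧ ((d ∨ c) ∨ b ∨ a)) ≃ 𝟙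
      (e ∧ (d ∨ b)) + 𝟙 ((e ∧ not d ∧ not b) ∧ (c ∨ a))) (j == t) (S j) (i == t) (S i) (E i j)))
  (cong (tch E S +_) (trans (star F (inn-simple sE (∁ S)) t) (cnt≗ (λ z →
    (tab 3 (λ a b c → ∼ a ⇛ ⊩ c ∧ not a ∧ not b ⇔ c ∧ not b) (S t) (S z) (E t z) p)))))
  where
  F : ES n
  F = inn E (∁ S)

∖∪-restore : ∀ {n} (X : VS n) {t} → X t ≡ true → ∀ i → X i ≡ ((X ∖ ⟨ t ⟩) ∪ ⟨ t ⟩) i
∖∪-restore X {t} p i = tab 2 (λ a b → a ⊃ b ⇛ ⊩ b ⇔ (b ∧ not a) ∨ a) (i == t) (X i) (at X p i)

∉∖ : ∀ {n} (X : VS n) t → (X ∖ ⟨ t ⟩) t ≡ false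
∉∖ X t = tab 2 (λ a b → ! a ⇛ ⊩ ∼ (b ∧ not a)) (t == t) (X t) (==-refl t)

ins-rem : ∀ {n} {E : ES n} → Simple E → ∀ (Y : VS n) {t} → Y t ≡ true → ins E Y ≡ ins E (Y ∖ ⟨ t ⟩) + dg E t Y
ins-rem {E = E} sE Y {t} p = trans (ins≗ E (∖∪-restore Y p)) (trans (ins-add sE (Y ∖ ⟨ t ⟩) (∉∖ Y t))
  (cong (ins E (Y ∖ ⟨ t ⟩) +_) (cnt≗ (λ z →
    (tab 3 (λ a b c → a ⊃ not b ⇛ ⊩ b ∧ c ∧ not a ⇔ b ∧ c) (z == t) (E t z) (Y z)
        (at (∁ (E t)) (not-intro (irr sE t)) z))))))

tch-rem : ∀ {n} {E : ES n} → Simple E → ∀ (S : VS n) {t} → S t ≡ true → tch E S ≡ tch E (S ∖ ⟨ t ⟩) + dg E t (∁ S)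
tch-rem {E = E} sE S {t} p = trans (tch≗ E (∖∪-restore S p)) (trans (tch-add sE (S ∖ ⟨ t ⟩) (∉∖ S t))
  (cong (tch E (S ∖ ⟨ t ⟩) +_) (cnt≗ (λ z →
    (tab 3 (λ a b c → a ⊃ not b ⇛ ⊩ b ∧ not (c ∧ not a) ⇔ b ∧ not c) (z == t) (E t z) (S z)
        (at (∁ (E t)) (not-intro (irr sE t)) z))))))

opaque
  unfolding ∣_∣

  -- Handshake: an edge inside `S` is counted at both ends, an edge leaving `S` at one, and `tch`
  -- plus `ins` weighs them in the same way.
  degree-sum : ∀ {n} {E : ES n} → Simple E → ∀ (S : VS n) → tch E S + ins E S ≡ sumFin
      (λ v → if S v then ∣ E v ∣ else 0)
  degree-sum {n} {E} sE S = trans (sym (ec-+ (inc E S) (inn E S)))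
    (trans (≤-antisym (esum-mono (λ i j → ≤-reflexive (pointwise i j)))
        (esum-mono (λ i j → ≤-reflexive (sym (pointwise i j)))))
    (trans (sym (+-identityʳ _)) (trans (cong (esum (λ i j → g i j + g j i) +_) (sym diagonal))
    (trans (sym (sum-pairs g)) (sum-cong row)))))
    where
    g : Fin n → Fin n → ℕ
    g i j = 𝟙 (S i ∧ E i j)
    pointwise : ∀ i j → 𝟙 (inc E S i j) + 𝟙 (inn E S i j) ≡ g i j + g j i
    pointwise i j = tab 4 (λ a b c d → a ⇔ b ⇛ ⊩ 𝟙 (a ∧ (d ∨ c)) + 𝟙 (a ∧ d ∧ c) ≃ 𝟙 (d ∧ a) + 𝟙 (c ∧ b)) (E i j)
        (E j i) (S j) (S i) (symm sE i j)
    diagonal : sumFin (λ i → g i i) ≡ 0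
    diagonal = cnt-empty (λ i → trans (cong (S i ∧_) (irr sE i)) (𝔹.∧-zeroʳ _))
    row : ∀ i → sumFin (g i) ≡ (if S i then ∣ E i ∣ else 0)
    row i with S i
    ... | true = refl
    ... | false = sum-0 n

degree-sum-const : ∀ {n} {E : ES n} → Simple E → ∀ (S : VS n) c → (∀ v → S v ≡ true → ∣ E v ∣ ≡ c) → tch E S + ins E S
    ≡ c * ∣ S ∣
degree-sum-const {E = E} sE S c h = trans (degree-sum sE S) (trans (sum-cong (λ v → step v (bool (S v))))
    (sum-const c S))
  where
  step : ∀ v → Decided (S v) → (if S v then ∣ E v ∣ else 0) ≡ (if S v then c else 0)
  step v (inj₁ p) rewrite p = h v p
  step v (inj₂ p) rewrite p = refl

-- Supermodularity of induced edges. Together with its dual `tch-sub` it uncrosses two tight or two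
-- cotight sets.
ins-super : ∀ {n} (E : ES n) (X Y : VS n) → ins E X + ins E Y ≤ ins E (X ∪ Y) + ins E (X ∩ Y)
ins-super E X Y = ec22 (inn E X) (inn E Y) (inn E (X ∪ Y)) (inn E (X ∩ Y)) (λ i j →
  (tab 5 (λ a b c d e → ⊩ 𝟙 (c ∧ b ∧ a) + 𝟙 (c ∧ e ∧ d) ≦ 𝟙 (c ∧ (b ∨ e) ∧ (a ∨ d)) + 𝟙 (c ∧ (b ∧ e) ∧ a ∧ d)) (X j)
      (X i) (E i j) (Y j) (Y i)))

tch-sub : ∀ {n} (E : ES n) (S T : VS n) → tch E (S ∪ T) + tch E (S ∩ T) ≤ tch E S + tch E T
tch-sub E S T = ec22 (inc E (S ∪ T)) (inc E (S ∩ T)) (inc E S) (inc E T) (λ i j →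
  (tab 5 (λ a b c d e → ⊩ 𝟙 (e ∧ ((d ∨ c) ∨ b ∨ a)) + 𝟙 (e ∧ ((d ∧ c) ∨ (b ∧ a))) ≦ 𝟙 (e ∧ (d ∨ b)) + 𝟙 (e ∧ (c ∨ a)))
      (T j) (S j) (T i) (S i) (E i j)))

-- Mixed uncrossing of a tight with a cotight set. It passes to differences, since not touching `W`
-- means being induced by its complement.
ins-tch-cross : ∀ {n} (E : ES n) (Y W : VS n) → ins E Y + tch E (W ∖ Y) ≤ ins E (Y ∖ W) + tch E W
ins-tch-cross E Y W = ec22 (inn E Y) (inc E (W ∖ Y)) (inn E (Y ∖ W)) (inc E W) (λ i j →
  (tab 5 (λ a b c d e → ⊩ 𝟙 (c ∧ b ∧ a) + 𝟙 (c ∧ ((e ∧ not b) ∨ (d ∧ not a))) ≦ 𝟙 (c ∧ (b ∧ not e) ∧ a ∧ not d) + 𝟙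
      (c ∧ (e ∨ d))) (Y j) (Y i) (E i j) (W j) (W i)))

-- Single edges

pair : ∀ {n} → Fin n → Fin n → ES n
pair a b i j = ((i == a) ∧ (j == b)) ∨ ((i == b) ∧ (j == a))

infixl 7 _⊖_
_⊖_ : ∀ {n} → ES n → Fin n × Fin n → ES n
(E ⊖ (a , b)) i j = E i j ∧ not (pair a b i j)

pair-symm : ∀ {n} (a b i j : Fin n) → pair a b i j ≡ pair a b j i
pair-symm a b i j = tab 4 (λ a b c d → ⊩ (d ∧ c) ∨ (b ∧ a) ⇔ (a ∧ b) ∨ (c ∧ d)) (j == a) (i == b) (j == b) (i == a)

pair-simple : ∀ {n} {a b : Fin n} → a ≢ b → Simple (pair a b)
pair-simple {a = a} {b} a≢b = simple (pair-symm a b) (λ i → tab 2 (λ a b → a ⊃ not b ⇛ ⊩ ∼ ((a ∧ b) ∨ (b ∧ a))) (i == a)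
    (i == b) (λ p → not-intro (trans (cong (_== b) (==⇒≡ {i = i} p)) (≢⇒== a≢b))))

pair-self : ∀ {n} (a b : Fin n) → pair a b a b ≡ true
pair-self a b = tab 4 (λ a b c d → ! a ⇛ ! b ⇛ ⊩ ! ((a ∧ b) ∨ (d ∧ c))) (a == a) (b == b) (b == a) (a == b) (==-refl a)
    (==-refl b)

pair-elim : ∀ {n} {a b i j : Fin n} → pair a b i j ≡ true → (i ≡ a × j ≡ b) ⊎ (i ≡ b × j ≡ a)
pair-elim {a = a} {b} {i} {j} p with bool ((i == a) ∧ (j == b))
... | inj₁ q = inj₁ (==⇒≡ (∧ˡ (i == a) (j == b) q) , ==⇒≡ (∧ʳ (i == a) (j == b) q))
... | inj₂ q = inj₂ (==⇒≡ (tab 4 (λ a b c d → ∼ (b ∧ a) ⇛ ! ((b ∧ a) ∨ (d ∧ c)) ⇛ ⊩ ! d) (j == b) (i == a) (j == a)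
    (i == b) q p) ,
                     ==⇒≡ (tab 4 (λ a b c d → ∼ (b ∧ a) ⇛ ! ((b ∧ a) ∨ (d ∧ c)) ⇛ ⊩ ! c) (j == b) (i == a) (j == a)
                         (i == b) q p))

-- A symmetric property of the ends of one edge holds in both orders; in this form it can be a
-- premise of a truth table.
pair-apart : ∀ {n} {a b : Fin n} (Q : Fin n → Fin n → Bool) → (∀ i j → Q i j ≡ Q j i) → Q a b ≡ true → ∀ i j → pair a b
    i j ≡ true → Q i j ≡ true
pair-apart {a = a} {b} Q Q-symm q i j v with pair-elim {a = a} {b} {i} {j} v
... | inj₁ (refl , refl) = q
... | inj₂ (refl , refl) = trans (Q-symm i j) q

pair-⊆ : ∀ {n} {E : ES n} → Simple E → ∀ {a b} → E a b ≡ true → pair a b ⊆ₑ E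
pair-⊆ sE {a} {b} p i j q with pair-elim {a = a} {b} {i} {j} q
... | inj₁ (refl , refl) = p
... | inj₂ (refl , refl) = trans (symm sE i j) p

ec-pair : ∀ {n} {a b : Fin n} → a ≢ b → ec (pair a b) ≡ 1
ec-pair {n} {a} {b} a≢b = trans
  (ec≗ (λ i j → tab 4 (λ a b c d → ⊩ (d ∧ c) ∨ (b ∧ a) ⇔ ((d ∧ c) ∨ (b ∧ a)) ∧ (d ∨ a)) (j == a) (i == b) (j == b)
      (i == a)))
  (trans (star (pair a b) (pair-simple a≢b) a)
  (trans (cnt≗ (λ j → tab 4 (λ a b c d → ! a ⇛ ∼ b ⇛ ⊩ (a ∧ d) ∨ (b ∧ c) ⇔ d) (a == a) (a == b) (j == a) (j == b)
      (==-refl a) (≢⇒== a≢b)))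
  (cnt-single b)))

ec-rem : ∀ {n} {E : ES n} → Simple E → ∀ {a b} → E a b ≡ true → ec E ≡ suc (ec (E ⊖ (a , b)))
ec-rem {E = E} sE {a} {b} p = trans
  (ec12 E (pair a b) (E ⊖ (a , b)) (λ i j → tab 2 (λ a b → a ⊃ b ⇛ ⊩ 𝟙 b ≃ 𝟙 a + 𝟙 (b ∧ not a)) (pair a b i j) (E i j)
      (pair-⊆ sE p i j)))
  (cong (_+ ec (E ⊖ (a , b))) (ec-pair (adj≢ sE p)))

ec-pos : ∀ {n} {E : ES n} → Simple E → ∀ {a b} → E a b ≡ true → 1 ≤ ec E
ec-pos sE p = subst (1 ≤_) (sym (ec-rem sE p)) (s≤s z≤n)

edge? : ∀ {n} (E : ES n) → Edge? E
edge? E with any? (λ a → any? (λ b → E a b 𝔹.≟ true))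
... | yes p = inj₁ p
... | no p = inj₂ (λ a b → 𝔹.¬-not (λ q → p (a , b , q)))

ec-empty : ∀ {n} {E : ES n} → (∀ a b → E a b ≡ false) → ec E ≡ 0
ec-empty {n} h = trans (ec≗ h) (ec-none n)

abstract
  ec-edge : ∀ {n} (E : ES n) → 1 ≤ ec E → ∃[ a ] ∃[ b ] E a b ≡ true
  ec-edge E h with edge? E
  ... | inj₁ p = p
  ... | inj₂ q = ⊥-elim (1≰0 (subst (1 ≤_) (ec-empty q) h))

⊖-simple : ∀ {n} {E : ES n} → Simple E → ∀ p → Simple (E ⊖ p)
⊖-simple {E = E} sE (a , b) = simple (λ i j → tab 4 (λ a b c d → a ⇔ b ⇛ c ⇔ d ⇛ ⊩ a ∧ not c ⇔ b ∧ not d) (E i j)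
    (E j i) (pair a b i j) (pair a b j i) (symm sE i j) (pair-symm a b i j))
  (λ i → cong (_∧ not (pair a b i i)) (irr sE i))

⊖-⊆ : ∀ {n} (E : ES n) p → E ⊖ p ⊆ₑ E
⊖-⊆ E (a , b) i j q = ∧ˡ (E i j) (not (pair a b i j)) q

-- Exhaustive search over vertex sets

-- Search runs over vectors, which represent functions only up to pointwise equality, so a searched
-- property must depend on values alone.
Respects : ∀ {n} → (VS n → Set) → Set
Respects P = ∀ {X Y} → (∀ i → X i ≡ Y i) → P X → P Y

abstract
  search : ∀ {n} (P : VS n → Set) → Respects P → (∀ X → Dec (P X)) → Dec (∃ P)
  search P resp P? with anySubset? (λ v → P? (lookup v))
  ... | yes (v , p) = yes (lookup v , p)
  ... | no q = no (λ { (X , p) → q (tabulate X , resp (λ i → sym (lookup∘tabulate X i)) p) })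

  minimise : ∀ {n} (P : VS n → Set) → Respects P → (∀ X → Dec (P X)) →
             (μ : VS n → ℕ) → (∀ {X Y} → (∀ i → X i ≡ Y i) → μ X ≡ μ Y) →
             ∀ X → P X → ∃[ Y ] (P Y × (∀ Z → P Z → μ Y ≤ μ Z))
  minimise P resp P? μ μ≗ X p = go X p (<-wellFounded (μ X))
    where
    go : ∀ X → P X → Acc _<_ (μ X) → ∃[ Y ] (P Y × (∀ Z → P Z → μ Y ≤ μ Z))
    go X p (acc rec) with search (λ Z → P Z × μ Z < μ X) (λ e q → resp e (proj₁ q) , subst (_< μ X) (μ≗ e) (proj₂ q))
                          (λ Z → P? Z ×-dec (μ Z <? μ X))
    ... | yes (Z , q , lt) = go Z q (rec lt)
    ... | no none = X , p , (λ Z q → ≮⇒≥ (λ lt → none (Z , q , lt)))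

abstract
  maximise : ∀ {n} (P : VS n → Set) → Respects P → (∀ X → Dec (P X)) → ∀ X → P X → ∃[ Y ]
      (P Y × (∀ Z → P Z → ∣ Z ∣ ≤ ∣ Y ∣))
  maximise {n} P resp P? X p with minimise P resp P? (λ Y → ∣ ∁ Y ∣) (λ e → cnt≗ (λ i → cong not (e i))) X p
  ... | Y , q , least = Y , q , λ Z r → (lin 5 (λ a b c d e → a ≼ b ⇛ c ≐ d ⊕ a ⇛ c ≑ e ⊕ b ⇛ 1 ⊢ e ≼ d) (∣ ∁ Y ∣)
      (∣ ∁ Z ∣) (∣ full {n} ∣) (∣ Y ∣) (∣ Z ∣) (least Z r) (compl Y) (compl Z))
    where
    compl : ∀ (X : VS n) → ∣ full {n} ∣ ≡ ∣ X ∣ + ∣ ∁ X ∣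
    compl X = cnt12 full X (∁ X) (λ i → tab 1 (λ a → ⊩ 𝟙 true ≃ 𝟙 a + 𝟙 (not a)) (X i))

-- The three neighbours of a vertex of degree three

-- `count` turns the number of neighbours in an arbitrary set into three indicators; this is how
-- cubic vertices enter the arithmetic.
record Triple {n} (X : VS n) (a b c : Fin n) : Set where
  field
    ∈a : X a ≡ true
    ∈b : X b ≡ true
    ∈c : X c ≡ true
    a≢b : a ≢ b
    a≢c : a ≢ c
    b≢c : b ≢ c
    count : ∀ Q → ∣ X ∩ Q ∣ ≡ 𝟙 (Q a) + 𝟙 (Q b) + 𝟙 (Q c)
  members : ∀ {z} → X z ≡ true → z ≡ a ⊎ z ≡ b ⊎ z ≡ c
  members {z} p with a ≟ z | b ≟ z | c ≟ z
  ... | yes q | _ | _ = inj₁ (sym q)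
  ... | no _ | yes q | _ = inj₂ (inj₁ (sym q))
  ... | no _ | no _ | yes q = inj₂ (inj₂ (sym q))
  ... | no x | no y | no w = ⊥-elim (1≰0 (subst (1 ≤_)
    (trans (count ⟨ z ⟩) (cong₂ _+_ (cong₂ _+_ (cong 𝟙 (≢⇒== x)) (cong 𝟙 (≢⇒== y))) (cong 𝟙 (≢⇒== w))))
    (cnt-pos {X = X ∩ ⟨ z ⟩} (p & ==-refl z))))

triple-of : ∀ {n} {X : VS n} → ∣ X ∣ ≡ 3 → ∀ {a b c} → X a ≡ true → X b ≡ true → X c ≡ true → a ≢ b → a ≢ c → b ≢ c
    → Triple X a b c
triple-of {X = X} h {a} {b} {c} pa pb pc a≢b a≢c b≢c = record { ∈a = pa ; ∈b = pb ; ∈c = pc ; a≢b = a≢b ; a≢c = a≢c ;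
    b≢c = b≢c
  ; count = λ Q → (≤-antisym (lin 11 (λ a b c d e f g h i j k → a ≐ b ⊕ c ⇛ c ≐ d ⊕ e ⇛ e ≐ f ⊕ g ⇛ g ≼ h ⇛ i ≐ κ 3 ⇛ i
      ≑ 𝕤 j ⇛ j ≑ 𝕤 k ⇛ k ≑ 𝕤 h ⇛ 1 ⊢ a ≼ b ⊕ d ⊕ f) (∣ X ∩ Q ∣) (𝟙 (Q a)) (∣ (X ∖ ⟨ a ⟩) ∩ Q ∣) (𝟙 (Q b))
      (∣ (X ∖ ⟨ a ⟩ ∖ ⟨ b ⟩) ∩ Q ∣) (𝟙 (Q c)) (∣ (X ∖ ⟨ a ⟩ ∖ ⟨ b ⟩ ∖ ⟨ c ⟩) ∩ Q ∣) (∣ X ∖ ⟨ a ⟩ ∖ ⟨ b ⟩ ∖ ⟨ c ⟩ ∣)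
      (∣ X ∣) (∣ X ∖ ⟨ a ⟩ ∣) (∣ X ∖ ⟨ a ⟩ ∖ ⟨ b ⟩ ∣) (cnt-split X Q pa) (cnt-split (X ∖ ⟨ a ⟩) Q qb)
      (cnt-split (X ∖ ⟨ a ⟩ ∖ ⟨ b ⟩) Q qc) (cnt≤ {X = (X ∖ ⟨ a ⟩ ∖ ⟨ b ⟩ ∖ ⟨ c ⟩) ∩ Q} {X ∖ ⟨ a ⟩ ∖ ⟨ b ⟩ ∖ ⟨ c ⟩}
      (λ i p → ∧ˡ ((((X i) ∧ not (i == a)) ∧ not (i == b)) ∧ not (i == c)) (Q i) p)) h (cnt-rem X pa)
      (cnt-rem (X ∖ ⟨ a ⟩) qb) (cnt-rem (X ∖ ⟨ a ⟩ ∖ ⟨ b ⟩) qc))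
      (lin 7 (λ a b c d e f g → a ≑ b ⊕ c ⇛ c ≑ d ⊕ e ⇛ e ≑ f ⊕ g ⇛ 1 ⊢ b ⊕ d ⊕ f ≼ a) (∣ X ∩ Q ∣) (𝟙 (Q a))
      (∣ (X ∖ ⟨ a ⟩) ∩ Q ∣) (𝟙 (Q b)) (∣ (X ∖ ⟨ a ⟩ ∖ ⟨ b ⟩) ∩ Q ∣) (𝟙 (Q c)) (∣ (X ∖ ⟨ a ⟩ ∖ ⟨ b ⟩ ∖ ⟨ c ⟩) ∩ Q ∣)
      (cnt-split X Q pa) (cnt-split (X ∖ ⟨ a ⟩) Q qb) (cnt-split (X ∖ ⟨ a ⟩ ∖ ⟨ b ⟩) Q qc))) }
  where
  qb : (X ∖ ⟨ a ⟩) b ≡ true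
  qb = pb & ≢⇒not (≢-sym a≢b)
  qc : (X ∖ ⟨ a ⟩ ∖ ⟨ b ⟩) c ≡ true
  qc = (pc & ≢⇒not (≢-sym a≢c)) & ≢⇒not (≢-sym b≢c)

triple : ∀ {n} (X : VS n) → ∣ X ∣ ≡ 3 → ∃[ a ] ∃[ b ] ∃[ c ] Triple X a b c
triple X h with cnt-pick X h
... | a , pa , h₁ with cnt-pick (X ∖ ⟨ a ⟩) h₁
... | b , pb , h₂ with cnt-pick (X ∖ ⟨ a ⟩ ∖ ⟨ b ⟩) h₂
... | c , pc , _ = a , b , c , triple-of h pa (∧ˡ (X b) (not (b == a)) pb) (∧ˡ (X c) (not (c == a)) (∧ˡ _ _ pc))
  (λ e → ==-≢ (not-elim (∧ʳ (X b) (not (b == a)) pb)) (sym e))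
  (λ e → ==-≢ (not-elim (∧ʳ (X c) (not (c == a)) (∧ˡ _ _ pc))) (sym e))
  (λ e → ==-≢ (not-elim (∧ʳ ((X c) ∧ not (c == a)) (not (c == b)) pc)) (sym e))

triple-swap₁₂ : ∀ {n} {X : VS n} {a b c} → Triple X a b c → Triple X b a c
triple-swap₁₂ {a = a} {b} {c} t = record { ∈a = ∈b ; ∈b = ∈a ; ∈c = ∈c ; a≢b = λ e → a≢b (sym e) ; a≢c = b≢c ; b≢c = a≢c
  ; count = λ Q → trans (count Q) (cong (_+ 𝟙 (Q c)) (+-comm (𝟙 (Q a)) (𝟙 (Q b)))) }
  where open Triple t

triple-swap₂₃ : ∀ {n} {X : VS n} {a b c} → Triple X a b c → Triple X a c b
triple-swap₂₃ {a = a} {b} {c} t = record { ∈a = ∈a ; ∈b = ∈c ; ∈c = ∈b ; a≢b = a≢c ; a≢c = a≢b ; b≢c = λ e → b≢c (sym e)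
  ; count = λ Q → trans (count Q) (trans (+-assoc (𝟙 (Q a)) (𝟙 (Q b)) (𝟙 (Q c)))
      (trans (cong (𝟙 (Q a) +_) (+-comm (𝟙 (Q b)) (𝟙 (Q c)))) (sym (+-assoc (𝟙 (Q a)) (𝟙 (Q c)) (𝟙 (Q b)))))) }
  where open Triple t

infixl 6 _∪ₑ_ _⊞_
_∪ₑ_ : ∀ {n} → ES n → ES n → ES n
(E ∪ₑ F) i j = E i j ∨ F i j

_⊞_ : ∀ {n} → ES n → Fin n × Fin n → ES n
E ⊞ (a , b) = E ∪ₑ pair a b

∪ₑ-simple : ∀ {n} {E F : ES n} → Simple E → Simple F → Simple (E ∪ₑ F)
∪ₑ-simple sE sF = simple (λ i j → cong₂ _∨_ (symm sE i j) (symm sF i j)) (λ i → cong₂ _∨_ (irr sE i) (irr sF i))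

ins-none : ∀ {n} (E : ES n) {Y : VS n} → (∀ i → Y i ≡ false) → ins E Y ≡ 0
ins-none E {Y} h = ec-empty (λ i j → tab 3 (λ a b c → ∼ a ⇛ ⊩ ∼ (c ∧ a ∧ b)) (Y i) (Y j) (E i j) (h i))

ins≤ec : ∀ {n} (E : ES n) (X : VS n) → ins E X ≤ ec E
ins≤ec E X = ec-⊆ {E = inn E X} {E} (λ i j p → ∧ˡ (E i j) ((X i) ∧ (X j)) p)

-- Circuits and bases

-- Sparsity is required only for sets that miss a vertex of `X`, with all edges they induce. A
-- subgraph on all of `X` that lacks an edge is controlled by `size`, so nothing of the circuit
-- condition is lost.
record Circ {n} (E : ES n) (X : VS n) (F : ES n) : Set where
  field
    simpleᶜ : Simple F
    ⊆E : F ⊆ₑ E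
    within : ∀ i j → F i j ≡ true → X i ≡ true
    size : ec F + 1 ≡ 2 * ∣ X ∣
    sparse : ∀ Y → Y ⊆ X → NE Y → ∀ {x} → X x ≡ true → Y x ≡ false → ins F Y + 2 ≤ 2 * ∣ Y ∣
  within₂ : ∀ i j → F i j ≡ true → X j ≡ true
  within₂ i j p = within j i (trans (symm simpleᶜ j i) p)

-- A (2,2)-tight graph: an independent set that spans every pair of vertices of `A`, as
-- `fundamental` shows. It plays the part of a basis.
record Tight {n} (J : ES n) (A : VS n) : Set where
  field
    simpleᵗ : Simple J
    within : ∀ i j → J i j ≡ true → A i ≡ true
    size : ec J + 2 ≡ 2 * ∣ A ∣
    sparse : ∀ Y → NE Y → ins J Y + 2 ≤ 2 * ∣ Y ∣
    nonempty : NE A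
  within₂ : ∀ i j → J i j ≡ true → A j ≡ true
  within₂ i j p = within j i (trans (symm simpleᵗ j i) p)

circ-mono : ∀ {n} {E E′ : ES n} {X F} → E ⊆ₑ E′ → Circ E X F → Circ E′ X F
circ-mono h c = record { simpleᶜ = simpleᶜ ; ⊆E = λ i j p → h i j (⊆E i j p) ; within = within ; size = size ; sparse
    = sparse }
  where open Circ c

-- Without `x` at most 2(|X| - 1) - 2 of the 2|X| - 1 edges remain. If `x` is the only vertex, the
-- one edge that `size` demands has no room.
circ-degree : ∀ {n} {E : ES n} {X F} → Circ E X F → ∀ {x} → X x ≡ true → 3 ≤ dg F x X
circ-degree {n} {E} {X} {F} c {x} p with empty? (X ∖ ⟨ x ⟩)
... | inj₁ ne = lin 6 (λ a b c d e f → a ≐ b ⊕ c ⇛ b ⊹ 2 ≼ 2 ⊗ d ⇛ 2 ⊠ e ≑ 𝕤 d ⇛ f ⊹ 1 ≑ 2 ⊗ e ⇛ f ≼ a ⇛ 1 ⊢ κ 3 ≼ c)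
    (ins F X) (ins F (X ∖ ⟨ x ⟩)) (dg F x X) (∣ X ∖ ⟨ x ⟩ ∣) (∣ X ∣) (ec F) (ins-rem simpleᶜ X p)
    (sparse (X ∖ ⟨ x ⟩) (λ i q → ∧ˡ (X i) (not (i == x)) q) ne p (∉∖ X x)) (cnt-rem X p) size
    (ec-⊆ (λ i j q → q & within i j q & within₂ i j q))
  where open Circ c
... | inj₂ none = ⊥-elim (adj≢ simpleᶜ ab (trans (only a (within a b ab)) (sym (only b (within₂ a b ab)))))
  where
  open Circ c
  edge : ∃[ a ] ∃[ b ] F a b ≡ true
  edge = ec-edge F (lin 3 (λ a b c → a ⊹ 1 ≑ 2 ⊗ b ⇛ 2 ⊠ b ≑ 𝕤 c ⇛ 1 ⊢ κ 1 ≼ a) (ec F) (∣ X ∣) (∣ X ∖ ⟨ x ⟩ ∣) size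
      (cnt-rem X p))
  a b : Fin n
  a = proj₁ edge
  b = proj₁ (proj₂ edge)
  ab : F a b ≡ true
  ab = proj₂ (proj₂ edge)
  only : ∀ i → X i ≡ true → i ≡ x
  only i q = ==⇒≡ (tab 2 (λ a b → ! a ⇛ ∼ (a ∧ not b) ⇛ ⊩ ! b) (X i) (i == x) q (none i))

circ-covers : ∀ {n} {E : ES n} {X F} {U : VS n} → Circ E X F → (∀ i j → E i j ≡ true → U i ≡ true) → X ⊆ U
circ-covers {X = X} {F} c h i p with pos⇒NE (F i ∩ X) (≤-trans (s≤s z≤n) (circ-degree c p))
... | j , q = h i j (Circ.⊆E c i j (∧ˡ (F i j) (X j) q))

-- Of the 2|X| - 1 edges at most 2(|X| - |S|) - 2 avoid `S`.
circ-tch : ∀ {n} {E : ES n} {X F} → Circ E X F → ∀ S → S ⊆ X → NE S → ∀ {x} → X x ≡ true → S x ≡ false →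
           2 * ∣ S ∣ + 1 ≤ tch F S
circ-tch {n} {E} {X} {F} c S S⊆X (s , sS) {x} p q = lin 6 (λ a b c d e f → a ⊹ 2 ≼ 2 ⊗ b ⇛ 2 ⊠ c ≑ d ⊕ b ⇛ e ⊹ 1 ≑ 2 ⊗ c
    ⇛ e ≼ a ⊕ f ⇛ 1 ⊢ (2 ⊗ d) ⊹ 1 ≼ f) (ins F (X ∖ S)) (∣ X ∖ S ∣) (∣ X ∣) (∣ S ∣) (ec F) (tch F S)
    (sparse (X ∖ S) (λ i r → ∧ˡ (X i) (not (S i)) r) (x , p & not-intro q) (S⊆X s sS)
    (tab 2 (λ a b → ! a ⇛ ⊩ ∼ (b ∧ not a)) (S s) (X s) sS)) (∣⊆∣+∣∖∣ X S S⊆X) size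
    (ec12≤ F (inn F (X ∖ S)) (inc F S) (λ i j → tab 5 (λ a b c d e → a ⊃ b ⇛ a ⊃ c ⇛ ⊩ 𝟙 a ≦ 𝟙
    (a ∧ (b ∧ not e) ∧ c ∧ not d) + 𝟙 (a ∧ (e ∨ d))) (F i j) (X i) (X j) (S j) (S i) (within i j) (within₂ i j)))
  where open Circ c

-- Minimality of circuits. The smaller one either misses a vertex, where it violates the sparsity of
-- the larger, or covers all vertices with too few edges.
circ-⊄ : ∀ {n} {E E′ : ES n} {X F Y H} → Circ E X F → Circ E′ Y H → H ⊆ₑ F → ∀ {a b} → F a b ≡ true → H a b ≡ false → ⊥
circ-⊄ {n} {E} {E′} {X} {F} {Y} {H} c d H⊆F {a} {b} p q with empty? (X ∖ Y)
... | inj₁ (x , r) = lin 3 (λ a b c → a ⊹ 2 ≼ 2 ⊗ b ⇛ c ≼ a ⇛ c ⊹ 1 ≑ 2 ⊗ b ⇛ ⊢⊥) (ins F Y) (∣ Y ∣) (ec H)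
    (C.sparse Y Y⊆X ne (∧ˡ (X x) (not (Y x)) r) (not-elim (∧ʳ (X x) (not (Y x)) r)))
    (ec-⊆ (λ i j s → H⊆F i j s & D.within i j s & D.within₂ i j s)) D.size
  where
  module C = Circ c
  module D = Circ d
  Y⊆X : Y ⊆ X
  Y⊆X = circ-covers d′ C.within
    where
    d′ : Circ F Y H
    d′ = record { simpleᶜ = D.simpleᶜ ; ⊆E = H⊆F ; within = D.within ; size = D.size ; sparse = D.sparse }
  ne : NE Y
  ne = pos⇒NE Y (lin 2 (λ a b → a ⊹ 1 ≐ 2 ⊗ b ⇛ 2 ⊢ κ 1 ≼ b) (ec H) (∣ Y ∣) D.size)
... | inj₂ none = lin 5 (λ a b c d e → a ⊹ 1 ≐ 2 ⊗ b ⇛ c ⊹ 1 ≑ 2 ⊗ d ⇛ 2 ⊠ b ≼ d ⇛ a ≑ 𝕤 e ⇛ c ≼ e ⇛ ⊢⊥) (ec F) (∣ X ∣)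
    (ec H) (∣ Y ∣) (ec (F ⊖ (a , b))) C.size D.size (cnt≤ {X = X} {Y}
    (λ i s → tab 2 (λ a b → ! a ⇛ ∼ (a ∧ not b) ⇛ ⊩ ! b) (X i) (Y i) s (none i))) (ec-rem C.simpleᶜ p) (ec-⊆ H⊆)
  where
  module C = Circ c
  module D = Circ d
  H⊆ : H ⊆ₑ F ⊖ (a , b)
  H⊆ i j s with bool (pair a b i j)
  ... | inj₂ t = H⊆F i j s & not-intro t
  ... | inj₁ t with pair-elim {a = a} {b} {i} {j} t
  ... | inj₁ (refl , refl) = ⊥-elim (clash s q)
  ... | inj₂ (refl , refl) = ⊥-elim (clash s (trans (symm D.simpleᶜ i j) q))

-- A set containing `X` is bounded by the total, now 2|X| - 2; any other set by the sparsity of the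
-- circuit on its trace in `X`.
circ-tight : ∀ {n} {E : ES n} {X F} → Circ E X F → ∀ {a b} → F a b ≡ true → Tight (F ⊖ (a , b)) X
circ-tight {n} {E} {X} {F} c {a} {b} p = record
  { simpleᵗ = ⊖-simple simpleᶜ (a , b)
  ; within = λ i j q → within i j (⊖-⊆ F (a , b) i j q)
  ; size = size⁻
  ; sparse = sparse⁻
  ; nonempty = a , within a b p }
  where
  open Circ c
  size⁻ : ec (F ⊖ (a , b)) + 2 ≡ 2 * ∣ X ∣
  size⁻ = lin 3 (λ a b c → a ⊹ 1 ≐ 2 ⊗ b ⇛ a ≑ 𝕤 c ⇛ 1 ⊢ c ⊹ 2 ≐ 2 ⊗ b) (ec F) (∣ X ∣) (ec (F ⊖ (a , b))) size
      (ec-rem simpleᶜ p)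
  restrict : ∀ Y → ins (F ⊖ (a , b)) Y ≤ ins F (Y ∩ X)
  restrict Y = ec-⊆ {E = inn (F ⊖ (a , b)) Y} {inn F (Y ∩ X)}
      (λ i j q → tab 6 (λ a b c d e f → ! ((d ∧ not c) ∧ b ∧ a) ⇛ d ⊃ e ⇛ d ⊃ f ⇛ ⊩ ! (d ∧ (b ∧ e) ∧ a ∧ f)) (Y j) (Y i)
      (pair a b i j) (F i j) (X i) (X j) q (within i j) (within₂ i j))
  sparse⁻ : ∀ Y → NE Y → ins (F ⊖ (a , b)) Y + 2 ≤ 2 * ∣ Y ∣
  sparse⁻ Y (y , yY) with empty? (X ∖ Y) | empty? (Y ∩ X)
  ... | inj₁ (x , q) | inj₁ ne = lin 5 (λ a b c d e → a ≼ b ⇛ b ⊹ 2 ≼ 2 ⊗ c ⇛ 2 ⊠ d ≑ c ⊕ e ⇛ 1 ⊢ a ⊹ 2 ≼ 2 ⊗ d)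
      (ins (F ⊖ (a , b)) Y) (ins F (Y ∩ X)) (∣ Y ∩ X ∣) (∣ Y ∣) (∣ Y ∖ X ∣) (restrict Y)
      (sparse (Y ∩ X) (λ i r → ∧ʳ (Y i) (X i) r) ne (∧ˡ (X x) (not (Y x)) q)
      (tab 2 (λ a b → ! (b ∧ not a) ⇛ ⊩ ∼ (a ∧ b)) (Y x) (X x) q)) (∣∩∣+∣∖∣ Y X)
  ... | _ | inj₂ none = lin 3 (λ a b c → a ≼ b ⇛ b ≐ κ 0 ⇛ 2 ⊠ κ 1 ≼ c ⇛ 1 ⊢ a ⊹ 2 ≼ 2 ⊗ c) (ins (F ⊖ (a , b)) Y)
      (ins F (Y ∩ X)) (∣ Y ∣) (restrict Y) (ins-none F none) (cnt-pos {X = Y} yY)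
  ... | inj₂ none | _ = lin 4 (λ a b c d → a ≼ b ⇛ b ⊹ 2 ≐ 2 ⊗ c ⇛ 2 ⊠ c ≼ d ⇛ 1 ⊢ a ⊹ 2 ≼ 2 ⊗ d) (ins (F ⊖ (a , b)) Y)
      (ec (F ⊖ (a , b))) (∣ X ∣) (∣ Y ∣) (ins≤ec (F ⊖ (a , b)) Y) size⁻
      (cnt≤ {X = X} {Y} (λ i s → tab 2 (λ a b → ! a ⇛ ∼ (a ∧ not b) ⇛ ⊩ ! b) (X i) (Y i) s (none i)))

-- The circuit is carried by a smallest tight set containing both ends of the new edge.
fundamental : ∀ {n} {J : ES n} {A} → Tight J A → ∀ {a b} → A a ≡ true → A b ≡ true → a ≢ b → J a b ≡ false →
              ∃[ X ] ∃[ F ] (Circ (J ⊞ (a , b)) X F × F a b ≡ true)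
fundamental {n} {J} {A} t {a} {b} pa pb a≢b q = Z , F , circuit ,
    ((tab 2 (λ a b → ! a ⇛ ⊩ ! (b ∨ a)) (pair a b a b) (J a b) (pair-self a b)) & (Za & Zb))
  where
  open Tight t
  P : VS n → Set
  P Z = Z a ≡ true × Z b ≡ true × ins J Z + 2 ≡ 2 * ∣ Z ∣
  smallest = minimise P (λ e (x , y , z) → trans (sym (e a)) x , trans (sym (e b)) y ,
                 trans (cong (_+ 2) (sym (ins≗ J e))) (trans z (cong (2 *_) (cnt≗ e))))
               (λ Z → (Z a 𝔹.≟ true) ×-dec ((Z b 𝔹.≟ true) ×-dec (ins J Z + 2 ≟ⁿ 2 * ∣ Z ∣)))
               ∣_∣ cnt≗ A (pa , pb , trans (cong (_+ 2) (≤-antisym (ins≤ec J A)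
                   (ec-⊆ (λ i j p → p & within i j p & within₂ i j p)))) size)
  Z : VS n
  Z = proj₁ smallest
  Za : Z a ≡ true
  Za = proj₁ (proj₁ (proj₂ smallest))
  Zb : Z b ≡ true
  Zb = proj₁ (proj₂ (proj₁ (proj₂ smallest)))
  Zt : ins J Z + 2 ≡ 2 * ∣ Z ∣
  Zt = proj₂ (proj₂ (proj₁ (proj₂ smallest)))
  F : ES n
  F = inn (J ⊞ (a , b)) Z
  sF : Simple F
  sF = inn-simple (∪ₑ-simple simpleᵗ (pair-simple a≢b)) Z
  both : ∀ i j → pair a b i j ≡ true → Z i ∧ Z j ≡ true
  both i j r with pair-elim {a = a} {b} {i} {j} r
  ... | inj₁ (refl , refl) = Za & Zb
  ... | inj₂ (refl , refl) = Zb & Za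
  notJ : ∀ i j → pair a b i j ≡ true → not (J i j) ≡ true
  notJ i j r with pair-elim {a = a} {b} {i} {j} r
  ... | inj₁ (refl , refl) = not-intro q
  ... | inj₂ (refl , refl) = not-intro (trans (symm simpleᵗ i j) q)
  ecF : ec F ≡ ins J Z + ec (pair a b)
  ecF = ec12 F (inn J Z) (pair a b) (λ i j → tab 4 (λ a b c d → a ⊃ c ∧ b ⇛ a ⊃ not d ⇛ ⊩ 𝟙 ((d ∨ a) ∧ c ∧ b) ≃ 𝟙
      (d ∧ c ∧ b) + 𝟙 a) (pair a b i j) (Z j) (Z i) (J i j) (both i j) (notJ i j))
  sub : ∀ Y → Y ⊆ Z → NE Y → ∀ {x} → Z x ≡ true → Y x ≡ false → ins F Y + 2 ≤ 2 * ∣ Y ∣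
  sub Y Y⊆Z ne {x} r s with bool (Y a ∧ Y b)
  -- A smaller set with both ends is not tight, by the choice of `Z`, so it has room for the new
  -- edge.
  ... | inj₁ u = lin 4 (λ a b c d → a ≼ b ⊕ c ⇛ c ≐ κ 1 ⇛ 𝕤 (b ⊹ 2) ≼ 2 ⊗ d ⇛ 1 ⊢ a ⊹ 2 ≼ 2 ⊗ d) (ins F Y) (ins J Y)
      (ec (pair a b)) (∣ Y ∣) (ec12≤ (inn F Y) (inn J Y) (pair a b)
      (λ i j → tab 6 (λ a b c d e f → ⊩ 𝟙 (((f ∨ e) ∧ d ∧ c) ∧ b ∧ a) ≦ 𝟙 (f ∧ b ∧ a) + 𝟙 e) (Y j) (Y i) (Z j) (Z i)
      (pair a b i j) (J i j))) (ec-pair a≢b) (≤∧≢⇒< (sparse Y ne)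
      (λ e → <⇒≱ smaller (proj₂ (proj₂ smallest) Y ((∧ˡ (Y a) (Y b) u) , (∧ʳ (Y a) (Y b) u) , e))))
    where
    smaller : ∣ Y ∣ < ∣ Z ∣
    smaller = lin 3 (λ a b c → a ≑ b ⊕ c ⇛ κ 1 ≼ c ⇛ 1 ⊢ 𝕤 b ≼ a) (∣ Z ∣) (∣ Y ∣) (∣ Z ∖ Y ∣) (∣⊆∣+∣∖∣ Z Y Y⊆Z)
        (cnt-pos {X = Z ∖ Y} (r & not-intro s))
  ... | inj₂ u = lin 3 (λ a b c → a ≼ b ⇛ b ⊹ 2 ≼ 2 ⊗ c ⇛ 1 ⊢ a ⊹ 2 ≼ 2 ⊗ c) (ins F Y) (ins J Y) (∣ Y ∣)
      (ec-⊆ {E = inn F Y} {inn J Y} (λ i j v → tab 6 (λ a b c d e f → ! (((f ∨ e) ∧ d ∧ c) ∧ b ∧ a) ⇛ e ⊃ not (b ∧ a) ⇛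
      ⊩ ! (f ∧ b ∧ a)) (Y j) (Y i) (Z j) (Z i) (pair a b i j) (J i j) v (apart i j))) (sparse Y ne)
    where
    apart : ∀ i j → pair a b i j ≡ true → not (Y i ∧ Y j) ≡ true
    apart i j v with pair-elim {a = a} {b} {i} {j} v
    ... | inj₁ (refl , refl) = not-intro u
    ... | inj₂ (refl , refl) = not-intro (trans (𝔹.∧-comm (Y b) (Y a)) u)
  circuit : Circ (J ⊞ (a , b)) Z F
  circuit = record
    { simpleᶜ = sF
    ; ⊆E = λ i j p → (∧ˡ ((J i j) ∨ (pair a b i j)) ((Z i) ∧ (Z j)) p)
    ; within = λ i j p → (∧ˡ (Z i) (Z j) (∧ʳ ((J i j) ∨ (pair a b i j)) _ p))
    ; size = lin 4 (λ a b c d → a ≐ b ⊕ c ⇛ c ≐ κ 1 ⇛ b ⊹ 2 ≐ 2 ⊗ d ⇛ 1 ⊢ a ⊹ 1 ≐ 2 ⊗ d) (ec F) (ins J Z)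
        (ec (pair a b)) (∣ Z ∣) ecF (ec-pair a≢b) Zt
    ; sparse = sub }

-- Extending bases

-- A condition of Hall type: it guarantees 2|S| edges of `L` that extend every tight graph on `A` to
-- one on `A ∪ S`, that is, a basis of the contraction by `A`.
record Fan {n} (S A : VS n) (L : ES n) : Set where
  field
    simpleˡ : Simple L
    touches : ∀ i j → L i j ≡ true → S i ∨ S j ≡ true
    within : ∀ i j → L i j ≡ true → A i ∨ S i ≡ true
    many : ∀ T → T ⊆ S → 2 * ∣ T ∣ ≤ tch L T
    sparse : ∀ Y → Y ⊆ S → NE Y → ins L Y + 2 ≤ 2 * ∣ Y ∣
  within₂ : ∀ i j → L i j ≡ true → A j ∨ S j ≡ true
  within₂ i j p = within j i (trans (symm simpleˡ j i) p)

-- An edge avoiding a largest critical set (tch L M = 2|M|) can be dropped.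
module FanDrop {n} {S A : VS n} {L} (f : Fan S A L) (M : VS n) (M⊆S : M ⊆ S) (Mt : tch L M ≡ 2 * ∣ M ∣)
    (largest : ∀ T → T ⊆ S → tch L T ≡ 2 * ∣ T ∣ → ∣ T ∣ ≤ ∣ M ∣)
    (a b : Fin n) (ab : L a b ≡ true) (Ma : M a ≡ false) (Mb : M b ≡ false) where
  open Fan f

  drop-≤ : ∀ T → tch L T ≤ tch (L ⊖ (a , b)) T + 1
  drop-≤ T = lin 3 (λ a b c → a ≐ κ 1 ⇛ b ≼ c ⊕ a ⇛ 1 ⊢ b ≼ c ⊹ 1) (ec (pair a b)) (tch L T) (tch (L ⊖ (a , b)) T)
      (ec-pair (adj≢ simpleˡ ab)) (ec12≤ (inc L T) (inc (L ⊖ (a , b)) T) (pair a b)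
      (λ i j → tab 4 (λ a b c d → ⊩ 𝟙 (c ∧ (b ∨ a)) ≦ 𝟙 ((c ∧ not d) ∧ (b ∨ a)) + 𝟙 d) (T j) (T i) (L i j)
      (pair a b i j)))

  drop-≡ : ∀ T → T a ∨ T b ≡ false → tch L T ≤ tch (L ⊖ (a , b)) T
  drop-≡ T q = ec-⊆ {E = inc L T} {inc (L ⊖ (a , b)) T} (λ i j r →
        (tab 4 (λ a b c d → ! (c ∧ (b ∨ a)) ⇛ d ⊃ not (b ∨ a) ⇛ ⊩ ! ((c ∧ not d) ∧ (b ∨ a))) (T j) (T i) (L i j)
            (pair a b i j) r (pair-apart (λ i j → not (T i ∨ T j)) (λ i j → cong not (𝔹.∨-comm (T i) (T j)))
            (not-intro q) i j)))

  -- The number of touching edges is submodular, so critical sets are closed under union with `M`;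
  -- hence the largest one contains them all.
  critical : ∀ T → T ⊆ S → tch L T ≤ 2 * ∣ T ∣ → tch L (M ∪ T) ≡ 2 * ∣ M ∪ T ∣
  critical T T⊆S le = ≤-antisym (lin 8 (λ a b c d e f g h → a ⊕ b ≼ c ⊕ d ⇛ c ≐ 2 ⊗ e ⇛ d ≼ 2 ⊗ f ⇛ 2 ⊠ g ⊕ h ≑ e ⊕ f ⇛
      2 ⊗ h ≼ b ⇛ 1 ⊢ a ≼ 2 ⊗ g) (tch L (M ∪ T)) (tch L (M ∩ T)) (tch L M) (tch L T) (∣ M ∣) (∣ T ∣) (∣ M ∪ T ∣)
      (∣ M ∩ T ∣) (tch-sub L M T) Mt le (∣∪∣+∣∩∣ M T) (many (M ∩ T) (λ i r → tab 3 (λ a b c → ! (b ∧ a) ⇛ b ⊃ c ⇛ ⊩ ! c)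
      (T i) (M i) (S i) r (M⊆S i)))) (lin 2 (λ a b → 2 ⊗ b ≼ a ⇛ 1 ⊢ 2 ⊗ b ≼ a) (tch L (M ∪ T)) (∣ M ∪ T ∣)
      (many (M ∪ T) (λ i r → tab 3 (λ a b c → ! (b ∨ a) ⇛ b ⊃ c ⇛ a ⊃ c ⇛ ⊩ ! c) (T i) (M i) (S i) r (M⊆S i) (T⊆S i))))

  noncritical : ∀ T → T ⊆ S → ∀ {t} → (T ∖ M) t ≡ true → ¬ (tch L T ≤ 2 * ∣ T ∣)
  noncritical T T⊆S q le = lin 3 (λ a b c → a ≼ b ⇛ a ≑ b ⊕ c ⇛ κ 1 ≼ c ⇛ ⊢⊥) (∣ M ∪ T ∣) (∣ M ∣) (∣ T ∖ M ∣)
      (largest (M ∪ T) (λ i r → tab 3 (λ a b c → ! (b ∨ a) ⇛ b ⊃ c ⇛ a ⊃ c ⇛ ⊩ ! c) (T i) (M i) (S i) r (M⊆S i) (T⊆S i))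
      (critical T T⊆S le)) (cnt12 (M ∪ T) M (T ∖ M) (λ i → tab 2 (λ a b → ⊩ 𝟙 (b ∨ a) ≃ 𝟙 b + 𝟙 (a ∧ not b)) (T i)
      (M i))) (cnt-pos {X = T ∖ M} q)

  many⁻ : ∀ T → T ⊆ S → 2 * ∣ T ∣ ≤ tch (L ⊖ (a , b)) T
  many⁻ T T⊆S with bool (T a) | bool (T b)
  ... | inj₁ p | _ = lin 3 (λ a b c → a ≼ b ⊹ 1 ⇛ 𝕤 (2 ⊗ c) ≼ a ⇛ 1 ⊢ 2 ⊗ c ≼ b) (tch L T) (tch (L ⊖ (a , b)) T) (∣ T ∣)
      (drop-≤ T) (≰⇒> (noncritical T T⊆S (p & not-intro Ma)))
  ... | inj₂ _ | inj₁ p = lin 3 (λ a b c → a ≼ b ⊹ 1 ⇛ 𝕤 (2 ⊗ c) ≼ a ⇛ 1 ⊢ 2 ⊗ c ≼ b) (tch L T) (tch (L ⊖ (a , b)) T)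
      (∣ T ∣) (drop-≤ T) (≰⇒> (noncritical T T⊆S (p & not-intro Mb)))
  ... | inj₂ p | inj₂ q = ≤-trans (many T T⊆S) (drop-≡ T (cong₂ _∨_ p q))

  fan-drop : Fan S A (L ⊖ (a , b))
  fan-drop = record
      { simpleˡ = ⊖-simple simpleˡ (a , b)
      ; touches = λ i j p → touches i j (⊖-⊆ L (a , b) i j p)
      ; within = λ i j p → within i j (⊖-⊆ L (a , b) i j p)
      ; many = many⁻
      ; sparse = λ Y Y⊆S ne → ≤-trans (+-monoˡ-≤ 2 (ec-⊆ {E = inn (L ⊖ (a , b)) Y} {inn L Y} (λ i j p →
          (tab 4 (λ a b c d → ! ((d ∧ not c) ∧ b ∧ a) ⇛ ⊩ ! (d ∧ b ∧ a)) (Y j) (Y i) (pair a b i j) (L i j) p))))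
              (sparse Y Y⊆S ne) }

-- A largest critical set is touched by at most 2|S| edges, fewer than `L` has, so some edge avoids
-- it.
fan-step : ∀ {n} {S A : VS n} {L} → Fan S A L → 2 * ∣ S ∣ < ec L → ∃[ a ] ∃[ b ] (L a b ≡ true × Fan S A (L ⊖ (a , b)))
fan-step {n} {S} {A} {L} f h = step (maximise Critical respects decidable (λ _ → false) empty-critical)
  where
  Critical : VS n → Set
  Critical M = (∀ i → (M ∖ S) i ≡ false) × tch L M ≡ 2 * ∣ M ∣
  respects : Respects Critical
  respects e (x , y) = (λ i → trans (cong (λ z → z ∧ not (S i)) (sym (e i))) (x i)) , trans (sym (tch≗ L e))
      (trans y (cong (2 *_) (cnt≗ e)))
  decidable : ∀ M → Dec (Critical M)
  decidable M = all? (λ i → (M ∖ S) i 𝔹.≟ false) ×-dec (tch L M ≟ⁿ 2 * ∣ M ∣)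
  empty-critical : Critical (λ _ → false)
  empty-critical = (λ _ → refl) , trans (ec-empty (λ i j → 𝔹.∧-zeroʳ (L i j)))
      (sym (cong (2 *_) (cnt-empty {n} (λ _ → refl))))
  step : ∃[ M ] (Critical M × (∀ T → Critical T → ∣ T ∣ ≤ ∣ M ∣)) → ∃[ a ] ∃[ b ] (L a b ≡ true × Fan S A (L ⊖ (a , b)))
  step (M , (M⊆ , Mt) , large) = drop (ec-edge R (lin 5 (λ a b c d e → a ≼ b ⊕ c ⇛ b ≐ 2 ⊗ d ⇛ 2 ⊠ d ≼ e ⇛ 𝕤 (2 ⊗ e) ≼ a
      ⇛ 1 ⊢ κ 1 ≼ c) (ec L) (tch L M) (ec R) (∣ M ∣) (∣ S ∣)
      (ec12≤ L (inc L M) R (λ i j → tab 3 (λ a b c → ⊩ 𝟙 a ≦ 𝟙 (a ∧ (c ∨ b)) + 𝟙 (a ∧ not (c ∨ b))) (L i j) (M j)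
      (M i))) Mt (cnt≤ M⊆S) h))
    where
    R : ES n
    R i j = L i j ∧ not (M i ∨ M j)
    M⊆S : M ⊆ S
    M⊆S i p = tab 2 (λ a b → ! a ⇛ ∼ (a ∧ not b) ⇛ ⊩ ! b) (M i) (S i) p (M⊆ i)
    drop : ∃[ a ] ∃[ b ] R a b ≡ true → ∃[ a ] ∃[ b ] (L a b ≡ true × Fan S A (L ⊖ (a , b)))
    drop (a , b , q) = a , b , ab , FanDrop.fan-drop f M M⊆S Mt
      (λ T T⊆S Tt → large T ((λ i → tab 2 (λ a b → a ⊃ b ⇛ ⊩ ∼ (a ∧ not b)) (T i) (S i) (T⊆S i)) , Tt)) a b ab
      (tab 3 (λ a b c → ! (c ∧ not (b ∨ a)) ⇛ ⊩ ∼ b) (M b) (M a) (L a b) q)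
          (tab 3 (λ a b c → ! (c ∧ not (b ∨ a)) ⇛ ⊩ ∼ a) (M b) (M a) (L a b) q)
      where
      ab : L a b ≡ true
      ab = ∧ˡ (L a b) (not ((M a) ∨ (M b))) q

abstract
  fan-trim : ∀ {n} {S A : VS n} {L} → Fan S A L → ∃[ K ] (Fan S A K × K ⊆ₑ L × ec K ≡ 2 * ∣ S ∣)
  fan-trim {n} {S} {A} {L} f = go (ec L) L f ≤-refl (<-≤-connex (2 * ∣ S ∣) (ec L))
    where
    Result : ES n → Set
    Result L = ∃[ K ] (Fan S A K × K ⊆ₑ L × ec K ≡ 2 * ∣ S ∣)
    go : ∀ k L → Fan S A L → ec L ≤ k → 2 * ∣ S ∣ < ec L ⊎ ec L ≤ 2 * ∣ S ∣ → Result L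
    go k L f bound (inj₂ h) = L , f , (λ _ _ p → p) , ≤-antisym h (≤-trans (Fan.many f S (λ _ p → p))
      (ec-⊆ {E = inc L S} {L} (λ i j p → ∧ˡ (L i j) ((S i) ∨ (S j)) p)))
    go zero L f bound (inj₁ h) = ⊥-elim (lin 2 (λ a b → 𝕤 (2 ⊗ a) ≼ b ⇛ b ≼ κ 0 ⇛ ⊢⊥) (∣ S ∣) (ec L) h bound)
    go (suc k) L f bound (inj₁ h) = continue (fan-step f h)
      where
      weaken : ∀ {p} → Result (L ⊖ p) → Result L
      weaken {p} (K , fK , K⊆ , eq) = K , fK , (λ i j q → ⊖-⊆ L p i j (K⊆ i j q)) , eq
      continue : ∃[ a ] ∃[ b ] (L a b ≡ true × Fan S A (L ⊖ (a , b))) → Result L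
      continue (a , b , ab , f′) = weaken (go k (L ⊖ (a , b)) f′
        (lin 3 (λ a b c → a ≑ 𝕤 b ⇛ a ≼ 𝕤 c ⇛ 1 ⊢ b ≼ c) (ec L) (ec (L ⊖ (a , b))) k (ec-rem (Fan.simpleˡ f) ab) bound)
        (<-≤-connex (2 * ∣ S ∣) (ec (L ⊖ (a , b)))))

-- If `Y` meets `A`, at least twice as many of the 2|S| selected edges as there are vertices of `S`
-- outside `Y` are not inside `Y`, which leaves at most 2|S ∩ Y| for it. If `Y` avoids `A`, the
-- sparsity of the fan suffices.
extend : ∀ {n} {J : ES n} {A S : VS n} {L} → Tight J A → (∀ i → A i ≡ true → S i ≡ false) → Fan S A L →
         ∃[ K ] (K ⊆ₑ L × Tight (J ∪ₑ K) (A ∪ S) × ec K ≡ 2 * ∣ S ∣)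
extend {n} {J} {A} {S} {L} t A∩S f with fan-trim f
... | K , fK , K⊆L , eq = K , K⊆L , record
    { simpleᵗ = ∪ₑ-simple simpleᵗ simpleˡ
    ; within = λ i j p → (tab 4 (λ a b c d → ! (b ∨ a) ⇛ b ⊃ c ⇛ a ⊃ c ∨ d ⇛ ⊩ ! (c ∨ d)) (K i j) (J i j) (A i) (S i) p
        (within i j) (Fan.within fK i j))
    ; size = lin 6 (λ a b c d e f → a ≐ b ⊕ c ⇛ b ⊹ 2 ≐ 2 ⊗ d ⇛ c ≐ 2 ⊗ e ⇛ 2 ⊠ f ≑ d ⊕ e ⇛ 1 ⊢ a ⊹ 2 ≐ 2 ⊗ f)
        (ec (J ∪ₑ K)) (ec J) (ec K) (∣ A ∣) (∣ S ∣) (∣ A ∪ S ∣)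
        (ec12 (J ∪ₑ K) J K (λ i j → tab 6 (λ a b c d e f → a ⊃ c ∨ b ⇛ d ⊃ e ⇛ d ⊃ f ⇛ e ⊃ not c ⇛ f ⊃ not b ⇛ ⊩ 𝟙
        (d ∨ a) ≃ 𝟙 d + 𝟙 a) (K i j) (S j) (S i) (J i j) (A i) (A j) (touches i j) (within i j) (within₂ i j)
        (λ p → not-intro (A∩S i p)) (λ p → not-intro (A∩S j p)))) size eq
        (cnt12 (A ∪ S) A S (λ i → tab 2 (λ a b → a ⊃ not b ⇛ ⊩ 𝟙 (a ∨ b) ≃ 𝟙 a + 𝟙 b) (A i) (S i)
        (λ p → not-intro (A∩S i p))))
    ; sparse = sub
    ; nonempty = proj₁ nonempty , (tab 2 (λ a b → ! a ⇛ ⊩ ! (a ∨ b)) (A (proj₁ nonempty)) (S (proj₁ nonempty))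
        (proj₂ nonempty)) } , eq
  where
  open Tight t
  open Fan fK using (simpleˡ; touches; many) renaming (sparse to sparseK)
  inJ : ∀ Y → ins J Y ≤ ins J (Y ∩ A)
  inJ Y = ec-⊆ {E = inn J Y} {inn J (Y ∩ A)} (λ i j p → tab 5 (λ a b c d e → ! (c ∧ b ∧ a) ⇛ c ⊃ d ⇛ c ⊃ e ⇛ ⊩ !
      (c ∧ (b ∧ d) ∧ a ∧ e)) (Y j) (Y i) (J i j) (A i) (A j) p (within i j) (within₂ i j))
  both : ∀ Y → ins (J ∪ₑ K) Y ≤ ins J Y + ins K Y
  both Y = ec12≤ (inn (J ∪ₑ K) Y) (inn J Y) (inn K Y) (λ i j → tab 4 (λ a b c d → ⊩ 𝟙 ((d ∨ c) ∧ b ∧ a) ≦ 𝟙 (d ∧ b ∧ a)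
      + 𝟙 (c ∧ b ∧ a)) (Y j) (Y i) (K i j) (J i j))
  sub : ∀ Y → NE Y → ins (J ∪ₑ K) Y + 2 ≤ 2 * ∣ Y ∣
  sub Y (y , yY) with empty? (Y ∩ A) | empty? (Y ∩ S)
  ... | inj₁ ne | _ = lin 12 (λ a b c d e f g h i j k l → a ≼ b ⊕ c ⇛ b ≼ d ⇛ d ⊹ 2 ≼ 2 ⊗ e ⇛ f ≐ 2 ⊗ g ⇛ c ⊕ h ≼ f ⇛ 2
      ⊗ i ≼ h ⇛ 2 ⊠ g ≐ j ⊕ i ⇛ 2 ⊠ k ≑ e ⊕ l ⇛ 2 ⊠ j ≼ l ⇛ 1 ⊢ a ⊹ 2 ≼ 2 ⊗ k) (ins (J ∪ₑ K) Y) (ins J Y) (ins K Y)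
      (ins J (Y ∩ A)) (∣ Y ∩ A ∣) (ec K) (∣ S ∣) (tch K (S ∖ Y)) (∣ S ∖ Y ∣) (∣ S ∩ Y ∣) (∣ Y ∣) (∣ Y ∖ A ∣) (both Y)
      (inJ Y) (sparse (Y ∩ A) ne) eq (ec21≤ (inn K Y) (inc K (S ∖ Y)) K
      (λ i j → tab 5 (λ a b c d e → ⊩ 𝟙 (c ∧ b ∧ a) + 𝟙 (c ∧ ((e ∧ not b) ∨ (d ∧ not a))) ≦ 𝟙 c) (Y j) (Y i) (K i j)
      (S j) (S i))) (many (S ∖ Y) (λ i p → ∧ˡ (S i) (not (Y i)) p)) (∣∩∣+∣∖∣ S Y) (∣∩∣+∣∖∣ Y A)
      (cnt≤ {X = S ∩ Y} {Y ∖ A} (λ i p → tab 3 (λ a b c → ! (b ∧ a) ⇛ c ⊃ not b ⇛ ⊩ ! (a ∧ not c)) (Y i) (S i) (A i) p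
      (λ p → not-intro (A∩S i p))))
  ... | inj₂ none | inj₁ ne = lin 8 (λ a b c d e f g h → a ≼ b ⊕ c ⇛ b ≼ d ⇛ d ≐ κ 0 ⇛ c ≼ e ⇛ e ⊹ 2 ≼ 2 ⊗ f ⇛ 2 ⊠ g ≑ f
      ⊕ h ⇛ 1 ⊢ a ⊹ 2 ≼ 2 ⊗ g) (ins (J ∪ₑ K) Y) (ins J Y) (ins K Y) (ins J (Y ∩ A)) (ins K (Y ∩ S)) (∣ Y ∩ S ∣) (∣ Y ∣)
      (∣ Y ∖ S ∣) (both Y) (inJ Y) (ins-none J none) (inK none) (sparseK (Y ∩ S) (λ i p → ∧ʳ (Y i) (S i) p) ne)
      (∣∩∣+∣∖∣ Y S)
    where
    inK : (∀ i → (Y ∩ A) i ≡ false) → ins K Y ≤ ins K (Y ∩ S)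
    inK none = ec-⊆ {E = inn K Y} {inn K (Y ∩ S)} (λ i j p → tab 7 (λ a b c d e f g → ! (c ∧ b ∧ a) ⇛ ∼ (b ∧ d) ⇛ ∼
        (a ∧ e) ⇛ c ⊃ d ∨ f ⇛ c ⊃ e ∨ g ⇛ ⊩ ! (c ∧ (b ∧ f) ∧ a ∧ g)) (Y j) (Y i) (K i j) (A i) (A j) (S i) (S j) p
        (none i) (none j) (Fan.within fK i j) (Fan.within₂ fK i j))
  ... | inj₂ none | inj₂ none′ = lin 5 (λ a b c d e → a ≼ b ⊕ c ⇛ b ≼ d ⇛ d ≐ κ 0 ⇛ c ≐ κ 0 ⇛ 2 ⊠ κ 1 ≼ e ⇛ 1 ⊢ a ⊹ 2 ≼
      2 ⊗ e) (ins (J ∪ₑ K) Y) (ins J Y) (ins K Y) (ins J (Y ∩ A)) (∣ Y ∣) (both Y) (inJ Y) (ins-none J none)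
      (ec-empty (λ i j → tab 5 (λ a b c d e → ∼ (b ∧ a) ⇛ ∼ (b ∧ c) ⇛ d ⊃ a ∨ c ⇛ ⊩ ∼ (d ∧ b ∧ e)) (A i) (Y i) (S i)
      (K i j) (Y j) (none i) (none′ i) (Fan.within fK i j))) (cnt-pos {X = Y} yY)

-- Circuit elimination and connectedness

Through : ∀ {n} (E : ES n) (a b c d : Fin n) → Set
Through E a b c d = ∃[ X ] ∃[ F ] (Circ E X F × F a b ≡ true × F c d ≡ true)

through-mono : ∀ {n} {E E′ : ES n} {a b c d} → E ⊆ₑ E′ → Through E a b c d → Through E′ a b c d
through-mono h (X , F , c , p , q) = X , F , circ-mono h c , p , q

circ-in-self : ∀ {n} {E : ES n} {X F} → Circ E X F → Circ F X F
circ-in-self c = record { simpleᶜ = simpleᶜ ; ⊆E = λ _ _ p → p ; within = within ; size = size ; sparse = sparse }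
  where open Circ c

pair-∉ : ∀ {n} {E : ES n} → Simple E → ∀ {a b} → E a b ≡ false → ∀ i j → pair a b i j ≡ true → not (E i j) ≡ true
pair-∉ {E = E} sE q = pair-apart (λ i j → not (E i j)) (λ i j → cong not (symm sE i j)) (not-intro q)

-- The part of a circuit touching vertices outside A, minus one edge, still extends a basis of A.
circ-fan : ∀ {n} {E : ES n} {X F} → Circ E X F → ∀ (A : VS n) {x} → X x ≡ true → A x ≡ true →
           ∀ {c d} → F c d ≡ true → Fan (X ∖ A) A (inc (F ⊖ (c , d)) (X ∖ A))
circ-fan {n} {E} {X} {F} circ A {x} Xx Ax {c} {d} cd = record
  { simpleˡ = inc-simple (⊖-simple simpleᶜ (c , d)) (X ∖ A)
  ; touches = λ i j p → (tab 6 (λ a b c d e f → ! ((f ∧ not e) ∧ ((d ∧ not c) ∨ (b ∧ not a))) ⇛ ⊩ !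
      ((d ∧ not c) ∨ (b ∧ not a))) (A j) (X j) (A i) (X i) (pair c d i j) (F i j) p)
  ; within = λ i j p → (tab 6 (λ a b c d e f → ! ((f ∧ not e) ∧ ((d ∧ not c) ∨ (b ∧ not a))) ⇛ f ⊃ d ⇛ ⊩ !
      (c ∨ (d ∧ not c))) (A j) (X j) (A i) (X i) (pair c d i j) (F i j) p (within i j))
  ; many = λ T T⊆S → many T T⊆S (empty? T)
  ; sparse = λ Y Y⊆S ne → ≤-trans (+-monoˡ-≤ 2 (ec-⊆ {E = inn L Y} {inn F Y} (λ i j p →
      (tab 8 (λ a b c d e f g h → ! (((h ∧ not g) ∧ ((f ∧ not e) ∨ (d ∧ not c))) ∧ b ∧ a) ⇛ ⊩ ! (h ∧ b ∧ a)) (Y j) (Y i)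
          (A j) (X j) (A i) (X i) (pair c d i j) (F i j) p))))
      (sparse Y (⊆X Y Y⊆S) ne Xx (∌x Y Y⊆S)) }
  where
  open Circ circ
  L : ES n
  L = inc (F ⊖ (c , d)) (X ∖ A)
  ⊆X : ∀ T → T ⊆ X ∖ A → T ⊆ X
  ⊆X T T⊆S i p = tab 3 (λ a b c → ! a ⇛ a ⊃ c ∧ not b ⇛ ⊩ ! c) (T i) (A i) (X i) p (T⊆S i)
  ∌x : ∀ T → T ⊆ X ∖ A → T x ≡ false
  ∌x T T⊆S = tab 3 (λ a b c → ! a ⇛ b ⊃ c ∧ not a ⇛ ⊩ ∼ b) (A x) (T x) (X x) Ax (T⊆S x)
  many : ∀ T → T ⊆ X ∖ A → Empty? T → 2 * ∣ T ∣ ≤ tch L T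
  many T T⊆S (inj₂ none) = lin 2 (λ a b → 2 ⊠ a ≐ κ 0 ⇛ 1 ⊢ 2 ⊗ a ≼ b) (∣ T ∣) (tch L T) (cnt-empty none)
  many T T⊆S (inj₁ ne) = lin 4 (λ a b c d → (2 ⊗ a) ⊹ 1 ≼ b ⇛ c ≐ κ 1 ⇛ b ≼ d ⊕ c ⇛ 1 ⊢ 2 ⊗ a ≼ d) (∣ T ∣) (tch F T)
      (ec (pair c d)) (tch L T) (circ-tch circ T (⊆X T T⊆S) ne Xx (∌x T T⊆S)) (ec-pair (adj≢ simpleᶜ cd))
      (ec12≤ (inc F T) (inc L T) (pair c d) (λ i j → tab 8 (λ a b c d e f g h → a ⊃ c ∧ not b ⇛ d ⊃ f ∧ not e ⇛ ⊩ 𝟙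
      (g ∧ (a ∨ d)) ≦ 𝟙 (((g ∧ not h) ∧ ((c ∧ not b) ∨ (f ∧ not e))) ∧ (a ∨ d)) + 𝟙 h) (T i) (A i) (X i) (T j) (A j)
      (X j) (F i j) (pair c d i j) (T⊆S i) (T⊆S j)))

-- Strong elimination: extend the basis H − ab of Y by F − cd to a basis of X ∪ Y, which then spans cd.
abstract
  eliminate : ∀ {n} {E E′ : ES n} {X F Y H} → Circ E X F → Circ E′ Y H → ∀ {a b c d} → F a b ≡ true → H a b ≡ true →
              F c d ≡ true → H c d ≡ false → ∃[ Z ] ∃[ K ] (Circ ((F ∪ₑ H) ⊖ (a , b)) Z K × K c d ≡ true)
  eliminate {n} {E} {E′} {X} {F} {Y} {H} cF cH {a} {b} {c} {d} Fab Hab Fcd Hcd =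
    finish (extend (circ-tight cH Hab) (λ i p → tab 2 (λ a b → ! a ⇛ ⊩ ∼ (b ∧ not a)) (Y i) (X i) p)
      (circ-fan cF Y (C.within a b Fab) (D.within a b Hab) Fcd))
    where
    module C = Circ cF
    module D = Circ cH
    S : VS n
    S = X ∖ Y
    L : ES n
    L = inc (F ⊖ (c , d)) S
    finish : ∃[ K ] (K ⊆ₑ L × Tight ((H ⊖ (a , b)) ∪ₑ K) (Y ∪ S) × ec K ≡ 2 * ∣ S ∣) →
             ∃[ Z ] ∃[ K ] (Circ ((F ∪ₑ H) ⊖ (a , b)) Z K × K c d ≡ true)
    finish (K , K⊆L , t , _) = mono (fundamental t (covers c (C.within c d Fcd)) (covers d (C.within₂ c d Fcd))
        (adj≢ C.simpleᶜ Fcd)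
        (tab 7 (λ a b c d e f g → ∼ a ⇛ ! b ⇛ c ⊃ (f ∧ not b) ∧ (e ∨ d) ⇛ ⊩ ∼ ((a ∧ not g) ∨ c)) (H c d) (pair c d c d)
            (K c d) (S d) (S c) (F c d) (pair a b c d) Hcd (pair-self c d) (K⊆L c d)))
      where
      covers : ∀ i → X i ≡ true → (Y ∪ S) i ≡ true
      covers i p = tab 2 (λ a b → ! a ⇛ ⊩ ! (b ∨ (a ∧ not b))) (X i) (Y i) p
      ⊆ : ((H ⊖ (a , b)) ∪ₑ K) ⊞ (c , d) ⊆ₑ (F ∪ₑ H) ⊖ (a , b)
      ⊆ i j p = tab 7 (λ a b c d e f g → ! (((d ∧ not c) ∨ b) ∨ a) ⇛ b ⊃ (g ∧ not a) ∧ (f ∨ e) ⇛ a ⊃ g ⇛ a ⊃ not d ⇛ c ⊃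
          d ⇛ c ⊃ not (f ∨ e) ⇛ ⊩ ! ((g ∨ d) ∧ not c)) (pair c d i j) (K i j) (pair a b i j) (H i j) (S j) (S i) (F i j)
          p (K⊆L i j) (pair-⊆ C.simpleᶜ Fcd i j) (pair-∉ D.simpleᶜ Hcd i j) (pair-⊆ D.simpleᶜ Hab i j)
          (pair-apart (λ i j → not (S i ∨ S j)) (λ i j → cong not (𝔹.∨-comm (S i) (S j)))
          (tab 4 (λ a b c d → ! a ⇛ ! b ⇛ ⊩ ! (not ((d ∧ not a) ∨ (c ∧ not b)))) (Y a) (Y b) (X b) (X a)
          (D.within a b Hab) (D.within₂ a b Hab)) i j)
      mono : ∃[ Z ] ∃[ M ] (Circ (((H ⊖ (a , b)) ∪ₑ K) ⊞ (c , d)) Z M × M c d ≡ true) →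
             ∃[ Z ] ∃[ M ] (Circ ((F ∪ₑ H) ⊖ (a , b)) Z M × M c d ≡ true)
      mono (Z , M , circ , p) = Z , M , circ-mono ⊆ circ , p

-- Oxley, Matroid Theory, Proposition 4.1.2: two eliminations shrink the union of the two circuits.
abstract
  circ-trans : ∀ {n} {E : ES n} {X F Y H} → Circ E X F → Circ E Y H → ∀ {a b} → F a b ≡ true → H a b ≡ true →
               ∀ {c d p q} → F c d ≡ true → H p q ≡ true → Through E c d p q
  circ-trans {n} {E} {X} {F} {Y} {H} cF cH {a} {b} Fab Hab {c} {d} {p} {q} Fcd Hpq = go (ec (F ∪ₑ H)) cF cH ≤-refl Fab
      Hab Fcd Hpq
    where
    go : ∀ k {X F Y H} → Circ E X F → Circ E Y H → ec (F ∪ₑ H) ≤ k → ∀ {a b} → F a b ≡ true → H a b ≡ true → F c d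
        ≡ true → H p q ≡ true → Through E c d p q
    go k {X} {F} {Y} {H} cF cH bound {a} {b} Fab Hab Fcd Hpq = split (bool (H c d)) (bool (F p q))
      where
      module C = Circ cF
      module D = Circ cH
      F∪H⊆E : F ∪ₑ H ⊆ₑ E
      F∪H⊆E i j r = tab 3 (λ a b c → ! (b ∨ a) ⇛ b ⊃ c ⇛ a ⊃ c ⇛ ⊩ ! c) (H i j) (F i j) (E i j) r (C.⊆E i j) (D.⊆E i j)
      split : Decided (H c d) → Decided (F p q) → Through E c d p q
      split (inj₁ Hcd) _ = Y , H , cH , Hcd , Hpq
      split _ (inj₁ Fpq) = X , F , cF , Fcd , Fpq
      split (inj₂ Hcd) (inj₂ Fpq) = second (eliminate cF cH Fab Hab Fcd Hcd)
        where
        second : ∃[ Z ] ∃[ K ] (Circ ((F ∪ₑ H) ⊖ (a , b)) Z K × K c d ≡ true) → Through E c d p q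
        second (Z , K , cK , Kcd) = split₂ (bool (K p q)) (edge? (λ i j → K i j ∧ not (F i j)))
          where
          module K = Circ cK
          K⊆ : K ⊆ₑ F ∪ₑ H
          K⊆ i j r = ⊖-⊆ (F ∪ₑ H) (a , b) i j (K.⊆E i j r)
          cK′ : Circ E Z K
          cK′ = circ-mono (λ i j r → F∪H⊆E i j (⊖-⊆ (F ∪ₑ H) (a , b) i j r)) cK
          split₂ : Decided (K p q) → Edge? (λ i j → K i j ∧ not (F i j)) → Through E c d p q
          split₂ (inj₁ Kpq) _ = Z , K , cK′ , Kcd , Kpq
          -- A circuit inside `F` that lacks `ab` contradicts minimality. So `K` leaves `F` through
          -- an edge of `H`, and that edge is eliminated next.
          split₂ (inj₂ _) (inj₂ K⊆F) = ⊥-elim (circ-⊄ cF cK (λ i j r → tab 2 (λ a b → ! a ⇛ ∼ (a ∧ not b) ⇛ ⊩ ! b)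
              (K i j) (F i j) r (K⊆F i j)) Fab
            (tab 4 (λ a b c d → a ⊃ (d ∨ c) ∧ not b ⇛ ! b ⇛ ⊩ ∼ a) (K a b) (pair a b a b) (H a b) (F a b) (K.⊆E a b)
                (pair-self a b)))
          split₂ (inj₂ Kpq) (inj₁ (i , j , h)) = third (eliminate cH cK Hij Kij Hpq Kpq)
            where
            Kij : K i j ≡ true
            Kij = ∧ˡ (K i j) (not (F i j)) h
            Fij : F i j ≡ false
            Fij = not-elim (∧ʳ (K i j) (not (F i j)) h)
            Hij : H i j ≡ true
            Hij = tab 2 (λ a b → ∼ a ⇛ ! (a ∨ b) ⇛ ⊩ ! b) (F i j) (H i j) Fij (K⊆ i j Kij)
            third : ∃[ Z′ ] ∃[ M ] (Circ ((H ∪ₑ K) ⊖ (i , j)) Z′ M × M p q ≡ true) → Through E c d p q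
            third (Z′ , M , cM , Mpq) = split₃ (bool (M c d)) (edge? (λ x y → M x y ∧ not (H x y)))
              where
              module M = Circ cM
              M⊆ : M ⊆ₑ H ∪ₑ K
              M⊆ x y r = ⊖-⊆ (H ∪ₑ K) (i , j) x y (M.⊆E x y r)
              cM′ : Circ E Z′ M
              cM′ = circ-mono (λ x y r → F∪H⊆E x y (tab 4 (λ a b c d → ! ((c ∨ b) ∧ not a) ⇛ b ⊃ d ∨ c ⇛ ⊩ ! (d ∨ c))
                  (pair i j x y) (K x y) (H x y) (F x y) r (K⊆ x y))) cM
              -- The edge `ij` belonged to `H` only and `M` avoids it, so the union of the two
              -- circuits shrinks.
              smaller : ∀ {k} → ec (F ∪ₑ H) ≤ suc k → ec (F ∪ₑ M) ≤ k
              smaller {k} le = lin 4 (λ a b c d → a ≼ 𝕤 b ⇛ a ≑ 𝕤 c ⇛ d ≼ c ⇛ 1 ⊢ d ≼ b) (ec (F ∪ₑ H)) k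
                  (ec ((F ∪ₑ H) ⊖ (i , j))) (ec (F ∪ₑ M)) le (ec-rem (∪ₑ-simple C.simpleᶜ D.simpleᶜ) {i} {j}
                  (tab 2 (λ a b → ! a ⇛ ⊩ ! (b ∨ a)) (H i j) (F i j) Hij)) (ec-⊆ {E = F ∪ₑ M} {(F ∪ₑ H) ⊖ (i , j)}
                  (λ x y r → tab 5 (λ a b c d e → ! (b ∨ a) ⇛ c ⊃ not b ⇛ a ⊃ (e ∨ d) ∧ not c ⇛ d ⊃ b ∨ e ⇛ ⊩ !
                  ((b ∨ e) ∧ not c)) (M x y) (F x y) (pair i j x y) (K x y) (H x y) r (pair-∉ C.simpleᶜ Fij x y)
                  (M.⊆E x y) (K⊆ x y)))
              split₃ : Decided (M c d) → Edge? (λ x y → M x y ∧ not (H x y)) → Through E c d p q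
              split₃ (inj₁ Mcd) _ = Z′ , M , cM′ , Mcd , Mpq
              split₃ (inj₂ _) (inj₂ M⊆H) = ⊥-elim (circ-⊄ cH cM (λ x y r → tab 2 (λ a b → ! a ⇛ ∼ (a ∧ not b) ⇛ ⊩ ! b)
                  (M x y) (H x y) r (M⊆H x y)) Hij
                (tab 4 (λ a b c d → a ⊃ (d ∨ c) ∧ not b ⇛ ! b ⇛ ⊩ ∼ a) (M i j) (pair i j i j) (K i j) (H i j) (M.⊆E i j)
                    (pair-self i j)))
              split₃ (inj₂ _) (inj₁ (x , y , r)) = again k bound
                where
                Mxy : M x y ≡ true
                Mxy = ∧ˡ (M x y) (not (H x y)) r
                Fxy : F x y ≡ true
                Fxy = tab 4 (λ a b c d → ! (b ∧ not a) ⇛ b ⊃ a ∨ c ⇛ c ⊃ d ∨ a ⇛ ⊩ ! d) (H x y) (M x y) (K x y) (F x y)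
                    r (M⊆ x y) (K⊆ x y)
                again : ∀ k → ec (F ∪ₑ H) ≤ k → Through E c d p q
                again zero le = ⊥-elim (lin 1 (λ a → a ≼ κ 0 ⇛ κ 1 ≼ a ⇛ ⊢⊥) (ec (F ∪ₑ H)) le
                    (ec-pos (∪ₑ-simple C.simpleᶜ D.simpleᶜ) {i} {j} (tab 2 (λ a b → ! a ⇛ ⊩ ! (b ∨ a)) (H i j) (F i j)
                    Hij)))
                again (suc k′) le = go k′ cF cM′ (smaller le) Fxy Mxy Fcd Mpq

-- Connectedness together with a tight basis on all of `U`. The basis is what allows further edges
-- or ears to be added without a new search for circuits.
record Block {n} (E : ES n) (U : VS n) : Set where
  field
    simpleᵇ : Simple E
    within : ∀ i j → E i j ≡ true → U i ≡ true
    basis : ES n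
    tight : Tight basis U
    basis⊆ : basis ⊆ₑ E
    linked : ∀ {a b c d} → E a b ≡ true → E c d ≡ true → Through E a b c d
  within₂ : ∀ i j → E i j ≡ true → U j ≡ true
  within₂ i j p = within j i (trans (symm simpleᵇ j i) p)

through-trans : ∀ {n} {E : ES n} {a b c d p q} → Through E a b c d → Through E a b p q → Through E c d p q
through-trans (X , F , cF , Fab , Fcd) (Y , H , cH , Hab , Hpq) = circ-trans cF cH Fab Hab Fcd Hpq

through-swap : ∀ {n} {E : ES n} {a b c d} → Through E a b c d → Through E c d a b
through-swap (X , F , cF , p , q) = X , F , cF , q , p

-- Edges spanned by a basis are in circuits with edges of that basis.
saturate : ∀ {n} {E E₀ J : ES n} {U} → Simple E → (∀ i j → E i j ≡ true → U i ≡ true) → Tight J U → J ⊆ₑ E₀ → J ⊆ₑ E →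
           ∀ {a b} → (∀ c d → E₀ c d ≡ true → Through E a b c d) → Block E U
saturate {n} {E} {E₀} {J} {U} sE within t J⊆E₀ J⊆E {a} {b} link = record
  { simpleᵇ = sE ; within = within ; basis = J ; tight = t ; basis⊆ = J⊆E
  ; linked = λ {c} {d} {p} {q} cd pq → through-trans (link′ c d cd (bool (J c d))) (link′ p q pq (bool (J p q))) }
  where
  link′ : ∀ c d → E c d ≡ true → Decided (J c d) → Through E a b c d
  link′ c d cd (inj₁ p) = link c d (J⊆E₀ c d p)
  link′ c d cd (inj₂ Jcd) = finish (fundamental t (within c d cd) (within d c (trans (symm sE d c) cd)) (adj≢ sE cd)
      Jcd)
    where
    finish : ∃[ X ] ∃[ F ] (Circ (J ⊞ (c , d)) X F × F c d ≡ true) → Through E a b c d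
    finish (X , F , cF , Fcd) = go (ec-edge (F ⊖ (c , d))
        (lin 3 (λ a b c → a ≐ 𝕤 b ⇛ a ⊹ 1 ≑ 2 ⊗ c ⇛ 2 ⊠ κ 2 ≼ c ⇛ 1 ⊢ κ 1 ≼ b) (ec F) (ec (F ⊖ (c , d))) (∣ X ∣)
        (ec-rem simpleᶜ Fcd) size (cnt-two {X = X} (Circ.within cF c d Fcd) (within₂ c d Fcd) (adj≢ simpleᶜ Fcd))))
      where
      open Circ cF hiding (within)
      cF′ : Circ E X F
      cF′ = circ-mono (λ i j p → tab 3 (λ a b c → ! (b ∨ a) ⇛ b ⊃ c ⇛ a ⊃ c ⇛ ⊩ ! c) (pair c d i j) (J i j) (E i j) p
          (J⊆E i j) (pair-⊆ sE cd i j)) cF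
      go : ∃[ i ] ∃[ j ] (F ⊖ (c , d)) i j ≡ true → Through E a b c d
      go (i , j , p) = through-trans (through-swap (link i j
          (J⊆E₀ i j (tab 3 (λ a b c → ! (b ∧ not a) ⇛ b ⊃ c ∨ a ⇛ ⊩ ! c) (pair c d i j) (F i j) (J i j) p (⊆E i j)))))
        (X , F , cF′ , ⊖-⊆ F (c , d) i j p , Fcd)

tight≗ : ∀ {n} {J : ES n} {A B : VS n} → (∀ i → A i ≡ B i) → Tight J A → Tight J B
tight≗ e t = record { simpleᵗ = simpleᵗ ; within = λ i j p → trans (sym (e i)) (within i j p)
  ; size = trans size (cong (2 *_) (cnt≗ e)) ; sparse = sparse ; nonempty = proj₁ nonempty , trans (sym (e _))
      (proj₂ nonempty) }
  where open Tight t

block≗ : ∀ {n} {E : ES n} {A B : VS n} → (∀ i → A i ≡ B i) → Block E A → Block E B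
block≗ e b = record { simpleᵇ = simpleᵇ ; within = λ i j p → trans (sym (e i)) (within i j p) ; basis = basis
  ; tight = tight≗ e tight ; basis⊆ = basis⊆ ; linked = linked }
  where open Block b

circ-block : ∀ {n} {E : ES n} {X F} → Circ E X F → ∀ {a b} → F a b ≡ true → Block F X
circ-block {F = F} c {a} {b} ab = record { simpleᵇ = simpleᶜ ; within = within ; basis = F ⊖ (a , b) ; tight
    = circ-tight c ab
    ; basis⊆ = ⊖-⊆ F (a , b) ; linked = λ p q → _ , F , circ-in-self c , p , q }
  where open Circ c

-- The basis already spans `U`, so an added edge closes a circuit with basis edges and inherits
-- their connections.
grow : ∀ {n} {E E′ : ES n} {U : VS n} → Block E U → Simple E′ → E ⊆ₑ E′ → (∀ i j → E′ i j ≡ true → U i ≡ true) →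
       ∀ {a b} → E a b ≡ true → Block E′ U
grow b sE′ E⊆E′ within′ ab = saturate {E₀ = _} sE′ within′ tight basis⊆ (λ i j p → E⊆E′ i j (basis⊆ i j p))
  (λ c d cd → through-mono E⊆E′ (linked ab cd))
  where open Block b

-- The circuit minus the shared edge supplies the basis edges missing outside `U`, and the shared
-- edge links old and new edges by transitivity.
join : ∀ {n} {E E₁ E′ : ES n} {U X : VS n} {F} → Block E U → Circ E₁ X F → ∀ {a b} → E a b ≡ true → F a b ≡ true →
       Simple E′ → E ⊆ₑ E′ → F ⊆ₑ E′ → (∀ i j → E′ i j ≡ true → U i ∨ X i ≡ true) → Block E′ (U ∪ X)
join {n} {E} {E₁} {E′} {U} {X} {F} blk c {a} {b} Eab Fab sE′ E⊆E′ F⊆E′ within′ =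
  finish (extend tight (λ i p → tab 2 (λ a b → ! a ⇛ ⊩ ∼ (b ∧ not a)) (U i) (X i) p)
      (circ-fan c U (C.within a b Fab) (within a b Eab) Fab))
  where
  open Block blk
  module C = Circ c
  L : ES n
  L = inc (F ⊖ (a , b)) (X ∖ U)
  same : ∀ i → (U ∪ (X ∖ U)) i ≡ (U ∪ X) i
  same i = tab 2 (λ a b → ⊩ a ∨ (b ∧ not a) ⇔ a ∨ b) (U i) (X i)
  finish : ∃[ K ] (K ⊆ₑ L × Tight (basis ∪ₑ K) (U ∪ (X ∖ U)) × ec K ≡ 2 * ∣ X ∖ U ∣) → Block E′ (U ∪ X)
  finish (K , K⊆L , t , _) = saturate {E₀ = E ∪ₑ F} sE′ within′ (tight≗ same t) J⊆ (λ i j p →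
      (tab 3 (λ a b c → ! (b ∨ a) ⇛ b ⊃ c ⇛ a ⊃ c ⇛ ⊩ ! c) (F i j) (E i j) (E′ i j) (J⊆ i j p) (E⊆E′ i j) (F⊆E′ i j)))
      (λ c d p → link c d p (bool (E c d)))
    where
    J⊆ : basis ∪ₑ K ⊆ₑ E ∪ₑ F
    J⊆ i j p = tab 9 (λ a b c d e f g h i → ! (b ∨ a) ⇛ b ⊃ c ⇛ a ⊃ (i ∧ not h) ∧ ((g ∧ not f) ∨ (e ∧ not d)) ⇛ ⊩ !
        (c ∨ i)) (K i j) (basis i j) (E i j) (U j) (X j) (U i) (X i) (pair a b i j) (F i j) p (basis⊆ i j) (K⊆L i j)
    link : ∀ c d → (E ∪ₑ F) c d ≡ true → Decided (E c d) → Through E′ a b c d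
    link x y p (inj₁ q) = through-mono E⊆E′ (linked Eab q)
    link x y p (inj₂ q) = X , F , circ-mono F⊆E′ (circ-in-self c) , Fab , (tab 2 (λ a b → ! (b ∨ a) ⇛ ∼ b ⇛ ⊩ ! a)
        (F x y) (E x y) p q)

-- Adding an ear: W with its incident edges becomes a circuit after contracting U, and W has two attachments in U.
record Ear {n} (A : ES n) (U W : VS n) : Set where
  field
    simpleᵃ : Simple A
    within : ∀ i j → A i j ≡ true → U i ∨ W i ≡ true
    disjoint : ∀ i → U i ≡ true → W i ≡ false
    many : ∀ S → S ⊆ W → NE S → 2 * ∣ S ∣ + 1 ≤ tch A S
    sparse : ∀ Y → Y ⊆ W → NE Y → ins A Y + 2 ≤ 2 * ∣ Y ∣
    total : tch A W ≡ 2 * ∣ W ∣ + 1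
    u₁ u₂ w₁ w₂ : Fin n
    u₁≢u₂ : u₁ ≢ u₂
    Uu₁ : U u₁ ≡ true
    Uu₂ : U u₂ ≡ true
    Ww₁ : W w₁ ≡ true
    Ww₂ : W w₂ ≡ true
    att₁ : A u₁ w₁ ≡ true
    att₂ : A u₂ w₂ ≡ true

-- The surplus of one in the bound on touching edges pays for the omitted edge.
fan-without : ∀ {n} {A : ES n} {U W : VS n} → Simple A → (∀ i j → A i j ≡ true → U i ∨ W i ≡ true)
    → (∀ S → S ⊆ W → NE S → 2 * ∣ S ∣ + 1 ≤ tch A S) →
  (∀ Y → Y ⊆ W → NE Y → ins A Y + 2 ≤ 2 * ∣ Y ∣) → ∀ {a b} → A a b ≡ true → Fan W U (inc A W ⊖ (a , b))
fan-without {n} {A} {U} {W} sA within many sparse {a} {b} Aab = record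
  { simpleˡ = ⊖-simple (inc-simple sA W) (a , b)
  ; touches = λ i j q → (∧ʳ (A i j) ((W i) ∨ (W j)) (∧ˡ _ _ q))
  ; within = λ i j q → within i j (∧ˡ (A i j) ((W i) ∨ (W j)) (∧ˡ _ _ q))
  ; many = λ T T⊆W → manyL T T⊆W (empty? T)
  ; sparse = λ Y Y⊆W ne → ≤-trans (+-monoˡ-≤ 2 (ec-⊆ {E = inn L Y} {inn A Y} (λ i j q →
      (tab 6 (λ a b c d e f → ! (((f ∧ (e ∨ d)) ∧ not c) ∧ b ∧ a) ⇛ ⊩ ! (f ∧ b ∧ a)) (Y j) (Y i) (pair a b i j) (W j)
          (W i) (A i j) q)))) (sparse Y Y⊆W ne) }
  where
  L : ES n
  L = inc A W ⊖ (a , b)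
  manyL : ∀ T → T ⊆ W → Empty? T → 2 * ∣ T ∣ ≤ tch L T
  manyL T T⊆W (inj₂ none) = lin 2 (λ a b → 2 ⊠ a ≐ κ 0 ⇛ 1 ⊢ 2 ⊗ a ≼ b) (∣ T ∣) (tch L T) (cnt-empty none)
  manyL T T⊆W (inj₁ ne) = lin 4 (λ a b c d → (2 ⊗ a) ⊹ 1 ≼ b ⇛ c ≐ κ 1 ⇛ b ≼ d ⊕ c ⇛ 1 ⊢ 2 ⊗ a ≼ d) (∣ T ∣) (tch A T)
      (ec (pair a b)) (tch L T) (many T T⊆W ne) (ec-pair (adj≢ sA Aab))
      (ec12≤ (inc A T) (inc L T) (pair a b) (λ i j → tab 6 (λ a b c d e f → a ⊃ b ⇛ c ⊃ d ⇛ ⊩ 𝟙 (e ∧ (a ∨ c)) ≦ 𝟙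
      (((e ∧ (b ∨ d)) ∧ not f) ∧ (a ∨ c)) + 𝟙 f) (T i) (W i) (T j) (W j) (A i j) (pair a b i j) (T⊆W i) (T⊆W j)))

-- All edges at `W` but one, `ab`, extend the basis of `U`. The fundamental circuit of `ab` turns
-- out to use an edge inside `U` and to cover `W`, so `join` applies.
ear : ∀ {n} {A : ES n} {U W : VS n} → Ear A U W → Block (inn A U) U → Block A (U ∪ W)
ear {n} {A} {U} {W} e blk = start (ec-edge (inc A W) (lin 2 (λ a b → a ≑ (2 ⊗ b) ⊹ 1 ⇛ 1 ⊢ κ 1 ≼ a) (tch A W) (∣ W ∣)
    total))
  where
  open Ear e
  open Block blk using (basis; tight; basis⊆)
  module B = Block blk
  module T = Tight tight
  start : ∃[ a ] ∃[ b ] inc A W a b ≡ true → Block A (U ∪ W)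
  start (a , b , p) = step (extend tight disjoint fan)
    where
    Aab : A a b ≡ true
    Aab = ∧ˡ (A a b) ((W a) ∨ (W b)) p
    L : ES n
    L = (inc A W) ⊖ (a , b)
    fan : Fan W U L
    fan = fan-without simpleᵃ within many sparse Aab
    step : ∃[ K ] (K ⊆ₑ L × Tight (basis ∪ₑ K) (U ∪ W) × ec K ≡ 2 * ∣ W ∣) → Block A (U ∪ W)
    step (K , K⊆L , t , _) = step₂ (fundamental t (within a b Aab) (within b a (trans (symm simpleᵃ b a) Aab))
        (adj≢ simpleᵃ Aab) Jab)
      where
      Jab : basis a b ∨ K a b ≡ false
      Jab = tab 6 (λ a b c d e f → a ⊃ (e ∧ (d ∨ c)) ∧ not b ⇛ ! b ⇛ ! (e ∧ (d ∨ c)) ⇛ f ⊃ not d ⇛ f ⊃ not c ⇛ ⊩ ∼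
          (f ∨ a)) (K a b) (pair a b a b) (W b) (W a) (A a b) (basis a b) (K⊆L a b) (pair-self a b) p
          (λ q → not-intro (disjoint a (T.within a b q))) (λ q → not-intro (disjoint b (T.within₂ a b q)))
      step₂ : ∃[ X ] ∃[ F ] (Circ ((basis ∪ₑ K) ⊞ (a , b)) X F × F a b ≡ true) → Block A (U ∪ W)
      step₂ (X , F , c , Fab) = step₃ (edge? (λ i j → F i j ∧ not (W i ∨ W j)))
        where
        module C = Circ c
        F⊆A : F ⊆ₑ A
        F⊆A i j q = tab 8 (λ a b c d e f g h → ! ((c ∨ b) ∨ a) ⇛ c ⊃ f ∧ e ∧ d ⇛ b ⊃ (f ∧ (h ∨ g)) ∧ not a ⇛ a ⊃ f ⇛ ⊩ !
            f) (pair a b i j) (K i j) (basis i j) (U j) (U i) (A i j) (W j) (W i) (C.⊆E i j q) (basis⊆ i j) (K⊆L i j)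
            (pair-⊆ simpleᵃ Aab i j)
        X⊆ : X ⊆ U ∪ W
        X⊆ = circ-covers (circ-mono F⊆A (circ-in-self c)) within
        ∣W∣ : ∣ W ∣ ≡ ∣ X ∩ W ∣ + ∣ W ∖ X ∣
        ∣W∣ = cnt12 W (X ∩ W) (W ∖ X) (λ i → tab 2 (λ a b → ⊩ 𝟙 a ≃ 𝟙 (b ∧ a) + 𝟙 (a ∧ not b)) (W i) (X i))
        not-inside : ¬ (∣ X ∖ W ∣ ≤ 0)
        not-inside le = lin 3 (λ a b c → a ⊹ 2 ≼ 2 ⊗ b ⇛ c ⊹ 1 ≑ 2 ⊗ b ⇛ c ≼ a ⇛ ⊢⊥) (ins A X) (∣ X ∣) (ec F)
            (sparse X X⊆W (a , C.within a b Fab)) C.size (ec-⊆ {E = F} {inn A X} (λ i j q → F⊆A i j q & C.within i j q &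
            C.within₂ i j q))
          where
          X⊆W : X ⊆ W
          X⊆W i q = by (bool (W i))
            where
            by : Decided (W i) → W i ≡ true
            by (inj₁ r) = r
            by (inj₂ r) = ⊥-elim (1≰0 (≤-trans (cnt-pos {X = X ∖ W} {i} (q & not-intro r)) le))
        step₃ : Edge? (λ i j → F i j ∧ not (W i ∨ W j)) → Block A (U ∪ W)
        step₃ (inj₂ none) = ⊥-elim (contra (empty? (W ∖ X)))
          where
          few : ec F + tch A (W ∖ X) ≤ tch A W
          few = ec21≤ F (inc A (W ∖ X)) (inc A W) (λ i j → tab 6 (λ a b c d e f → a ⊃ b ⇛ ∼ (a ∧ not (d ∨ c)) ⇛ a ⊃ e ⇛
              a ⊃ f ⇛ ⊩ 𝟙 a + 𝟙 (b ∧ ((d ∧ not e) ∨ (c ∧ not f))) ≦ 𝟙 (b ∧ (d ∨ c))) (F i j) (A i j) (W j) (W i) (X i)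
              (X j) (F⊆A i j) (none i j) (C.within i j) (C.within₂ i j))
          missing : (∀ i → (W ∖ X) i ≡ false) → ∀ {u w} → U u ≡ true → W w ≡ true → A u w ≡ true → X u ≡ false → ⊥
          missing W⊆X {u} {w} Uu Ww uw Xu = not-inside (lin 8 (λ a b c d e f g h → a ⊕ b ≼ c ⇛ b ≑ κ 1 ⇛ c ≐ (2 ⊗ d) ⊹ 1
              ⇛ a ⊹ 1 ≑ 2 ⊗ e ⇛ 2 ⊠ d ≐ f ⊕ g ⇛ 2 ⊠ g ≐ κ 0 ⇛ 2 ⊠ e ≑ f ⊕ h ⇛ 2 ⊢ h ≼ κ 0) (ec F) (ec (pair u w))
              (tch A W) (∣ W ∣) (∣ X ∣) (∣ X ∩ W ∣) (∣ W ∖ X ∣) (∣ X ∖ W ∣)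
              (ec21≤ F (pair u w) (inc A W) (λ i j → tab 7 (λ a b c d e f g → a ⊃ b ⇛ ∼ (a ∧ not (d ∨ c)) ⇛ e ⊃ b ⇛ a ⊃
              f ⇛ a ⊃ g ⇛ e ⊃ (d ∨ c) ∧ not (f ∧ g) ⇛ ⊩ 𝟙 a + 𝟙 e ≦ 𝟙 (b ∧ (d ∨ c))) (F i j) (A i j) (W j) (W i)
              (pair u w i j) (X i) (X j) (F⊆A i j) (none i j) (pair-⊆ simpleᵃ uw i j) (C.within i j) (C.within₂ i j)
              (pair-apart (λ i j → (W i ∨ W j) ∧ not (X i ∧ X j)) (λ i j → cong₂ _∧_ (𝔹.∨-comm (W i) (W j))
              (cong not (𝔹.∧-comm (X i) (X j)))) (tab 4 (λ a b c d → ! a ⇛ ∼ b ⇛ ⊩ ! ((d ∨ a) ∧ not (b ∧ c))) (W w)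
              (X u) (X w) (W u) Ww Xu) i j))) (ec-pair (adj≢ simpleᵃ uw)) total C.size ∣W∣ (cnt-empty W⊆X)
              (∣∩∣+∣∖∣ X W))
          contra : Empty? (W ∖ X) → ⊥
          contra (inj₁ ne) = not-inside (lin 8 (λ a b c d e f g h → a ⊕ b ≼ c ⇛ (2 ⊗ d) ⊹ 1 ≼ b ⇛ c ≐ (2 ⊗ e) ⊹ 1 ⇛ a ⊹
              1 ≑ 2 ⊗ f ⇛ 2 ⊠ e ≐ g ⊕ d ⇛ 2 ⊠ f ≑ g ⊕ h ⇛ 2 ⊢ h ≼ κ 0) (ec F) (tch A (W ∖ X)) (tch A W) (∣ W ∖ X ∣)
              (∣ W ∣) (∣ X ∣) (∣ X ∩ W ∣) (∣ X ∖ W ∣) few (many (W ∖ X) (λ i q → ∧ˡ (W i) (not (X i)) q) ne) total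
              C.size ∣W∣ (∣∩∣+∣∖∣ X W))
          contra (inj₂ W⊆X) = by (bool (X u₁)) (bool (X u₂))
            where
            by : Decided (X u₁) → Decided (X u₂) → ⊥
            by (inj₂ q) _ = missing W⊆X Uu₁ Ww₁ att₁ q
            by _ (inj₂ q) = missing W⊆X Uu₂ Ww₂ att₂ q
            by (inj₁ q) (inj₁ r) = lin 8 (λ a b c d e f g h → a ⊕ b ≼ c ⇛ c ≐ (2 ⊗ d) ⊹ 1 ⇛ a ⊹ 1 ≑ 2 ⊗ e ⇛ 2 ⊠ d ≐ f ⊕
                g ⇛ 2 ⊠ g ≐ κ 0 ⇛ 2 ⊠ e ≑ f ⊕ h ⇛ 2 ⊠ κ 2 ≼ h ⇛ ⊢⊥) (ec F) (tch A (W ∖ X)) (tch A W) (∣ W ∣) (∣ X ∣)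
                (∣ X ∩ W ∣) (∣ W ∖ X ∣) (∣ X ∖ W ∣) few total C.size ∣W∣ (cnt-empty W⊆X) (∣∩∣+∣∖∣ X W)
                (cnt-two {X = X ∖ W} (q & not-intro (disjoint u₁ Uu₁)) (r & not-intro (disjoint u₂ Uu₂)) u₁≢u₂)
        step₃ (inj₁ (x , y , q)) = final (empty? (W ∖ X))
          where
          Fxy : F x y ≡ true
          Fxy = ∧ˡ (F x y) (not ((W x) ∨ (W y))) q
          Wx : W x ≡ false
          Wx = tab 3 (λ a b c → ! (c ∧ not (b ∨ a)) ⇛ ⊩ ∼ b) (W y) (W x) (F x y) q
          Uxy : inn A U x y ≡ true
          Uxy = tab 6 (λ a b c d e f → ! a ⇛ ! (d ∧ not (c ∨ b)) ⇛ ! (e ∨ c) ⇛ ! (f ∨ b) ⇛ ⊩ ! (a ∧ e ∧ f)) (A x y)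
              (W y) (W x) (F x y) (U x) (U y) (F⊆A x y Fxy) q (X⊆ x (C.within x y Fxy)) (X⊆ y (C.within₂ x y Fxy))
          touching : NE (X ∩ W)
          touching = by (bool (W a))
            where
            by : Decided (W a) → NE (X ∩ W)
            by (inj₁ r) = a , C.within a b Fab & r
            by (inj₂ r) = b , C.within₂ a b Fab & (tab 3 (λ a b c → ∼ a ⇛ ! (c ∧ (a ∨ b)) ⇛ ⊩ ! b) (W a) (W b) (A a b) r
                p)
          final : Empty? (W ∖ X) → Block A (U ∪ W)
          -- The covered and the uncovered part of `W` are touched by disjoint edge sets, each with
          -- a surplus of one; together they exceed the total surplus of one.
          final (inj₁ ne) = ⊥-elim (lin 6 (λ a b c d e f → (2 ⊗ a) ⊹ 1 ≼ b ⇛ (2 ⊗ c) ⊹ 1 ≼ d ⇛ e ≐ (2 ⊗ f) ⊹ 1 ⇛ 2 ⊠ f ≐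
              a ⊕ c ⇛ b ⊕ d ≼ e ⇛ ⊢⊥) (∣ X ∩ W ∣) (tch F (X ∩ W)) (∣ W ∖ X ∣) (tch A (W ∖ X)) (tch A W) (∣ W ∣)
              (circ-tch c (X ∩ W) (λ i r → ∧ˡ (X i) (W i) r) touching (C.within x y Fxy)
              (tab 2 (λ a b → ∼ a ⇛ ⊩ ∼ (b ∧ a)) (W x) (X x) Wx)) (many (W ∖ X) (λ i q → ∧ˡ (W i) (not (X i)) q) ne)
              total ∣W∣ (ec21≤ (inc F (X ∩ W)) (inc A (W ∖ X)) (inc A W)
              (λ i j → tab 6 (λ a b c d e f → a ⊃ b ⇛ a ⊃ c ⇛ a ⊃ d ⇛ ⊩ 𝟙 (a ∧ ((c ∧ f) ∨ (d ∧ e))) + 𝟙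
              (b ∧ ((f ∧ not c) ∨ (e ∧ not d))) ≦ 𝟙 (b ∧ (f ∨ e))) (F i j) (A i j) (X i) (X j) (W j) (W i) (F⊆A i j)
              (C.within i j) (C.within₂ i j))))
          final (inj₂ W⊆X) = block≗ (λ i → tab 3 (λ a b c → ∼ (b ∧ not a) ⇛ a ⊃ c ∨ b ⇛ ⊩ c ∨ a ⇔ c ∨ b) (X i) (W i)
              (U i) (W⊆X i) (X⊆ i))
            (join blk c Uxy Fxy simpleᵃ (λ i j r → ∧ˡ (A i j) ((U i) ∧ (U j)) r) F⊆A
              (λ i j r → tab 3 (λ a b c → ! (b ∨ a) ⇛ ∼ (a ∧ not c) ⇛ ⊩ ! (b ∨ c)) (W i) (U i) (X i) (within i j r)
                  (W⊆X i)))

-- Circuits relative to a contracted set: tight sets, cotight sets, obstacles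

cnt-three : ∀ {n} {X : VS n} {a b c} → X a ≡ true → X b ≡ true → X c ≡ true → a ≢ b → a ≢ c → b ≢ c → 3 ≤ ∣ X ∣
cnt-three {X = X} {a} {b} {c} pa pb pc a≢b a≢c b≢c = subst (3 ≤_) (sym (cnt-rem X pa))
  (s≤s (cnt-two {X = X ∖ ⟨ a ⟩} (pb & ≢⇒not (≢-sym a≢b)) (pc & ≢⇒not (≢-sym a≢c)) b≢c))

three-only : ∀ {n} {X : VS n} → ∣ X ∣ ≡ 3 → ∀ {a b c} → X a ≡ true → X b ≡ true → X c ≡ true → a ≢ b → a ≢ c → b ≢ c →
             ∀ {z} → z ≢ a → z ≢ b → z ≢ c → X z ≡ false
three-only {X = X} h {a} {b} {c} pa pb pc a≢b a≢c b≢c {z} za zb zc = by (bool (X z))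
  where
  by : Decided (X z) → X z ≡ false
  by (inj₂ p) = p
  by (inj₁ p) = ⊥-elim (lin 2 (λ a b → a ≐ κ 3 ⇛ a ≑ 𝕤 b ⇛ κ 3 ≼ b ⇛ ⊢⊥) (∣ X ∣) (∣ X ∖ ⟨ z ⟩ ∣) h (cnt-rem X p)
      (cnt-three {X = X ∖ ⟨ z ⟩} (pa & ≢⇒not (≢-sym za)) (pb & ≢⇒not (≢-sym zb)) (pc & ≢⇒not (≢-sym zc)) a≢b a≢c b≢c))

dg-∁ : ∀ {n} (A : ES n) t Q → ∣ A t ∣ ≡ dg A t Q + dg A t (∁ Q)
dg-∁ A t Q = ∣∩∣+∣∖∣ (A t) Q

dg≤size : ∀ {n} {A : ES n} → Simple A → ∀ t Y → dg A t Y ≤ ∣ Y ∖ ⟨ t ⟩ ∣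
dg≤size {A = A} sA t Y = cnt≤ {X = A t ∩ Y} {Y ∖ ⟨ t ⟩}
    (λ i p → tab 3 (λ a b c → ! (b ∧ a) ⇛ c ⊃ not b ⇛ ⊩ ! (a ∧ not c)) (Y i) (A t i) (i == t) p
    (at (∁ (A t)) (not-intro (irr sA t)) i))

∖⟨⟩-intro : ∀ {n} {X : VS n} {i t} → X i ≡ true → i ≢ t → (X ∖ ⟨ t ⟩) i ≡ true
∖⟨⟩-intro p q = p & ≢⇒not q

-- The graph A is a circuit relative to U: contracting U to a point gives a (2,2)-circuit.
record Relative {n : ℕ} (A : ES n) (U : VS n) : Set where
  field
    simpleʳ : Simple A
    many : ∀ S → S ⊆ ∁ U → NE S → 2 * ∣ S ∣ + 1 ≤ tch A S
    sparse : ∀ Y → Y ⊆ ∁ U → NE Y → ins A Y + 2 ≤ 2 * ∣ Y ∣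
    total : tch A (∁ U) ≡ 2 * ∣ ∁ U ∣ + 1

Attached : ∀ {n} → ES n → VS n → Set
Attached A U = ∃[ u₁ ] ∃[ u₂ ] ∃[ w₁ ] ∃[ w₂ ] (u₁ ≢ u₂ × (U u₁ ≡ true × U u₂ ≡ true) × (U w₁ ≡ false × U w₂ ≡ false) ×
    (A u₁ w₁ ≡ true × A u₂ w₂ ≡ true))

Apex : ∀ {n} → ES n → VS n → Set
Apex A U = ∃[ x ] ((∀ i → U i ≡ (i == x)) × 4 ≤ ∣ A x ∣)

-- The equality cases of `many` and `sparse`. In the contracted graph the complement of a cotight
-- set, which contains the contracted vertex, is tight; so cotight sets are the tight sets through
-- that vertex, seen from outside.
Cotight TightSet : ∀ {n} → ES n → VS n → VS n → Set
Cotight A U S = S ⊆ ∁ U × tch A S ≡ 2 * ∣ S ∣ + 1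
TightSet A U Y = Y ⊆ ∁ U × ins A Y + 2 ≡ 2 * ∣ Y ∣

-- The edge-reduction that contracts v onto u and drops the edge vy.
Legal : ∀ {n} → ES n → VS n → (v u y : Fin n) → Set
Legal A U v u y = U v ≡ false × A v u ≡ true × A v y ≡ true × u ≢ y × (∀ z → A v z ≡ true → z ≢ u → z ≢ y → A u z
    ≡ false)

-- A set touching `vy` at `y` alone loses an edge and must not be cotight. A set with `u` and `v`
-- but not `y` loses the vertex `v` and only the edge `uv`, so it must not be tight.
Obstacle : ∀ {n} → ES n → VS n → (v u y : Fin n) → Set
Obstacle A U v u y =
  (∃[ S ] (Cotight A U S × S y ≡ true × S u ≡ false × S v ≡ false)) ⊎
  (∃[ Y ] (TightSet A U Y × Y v ≡ true × Y u ≡ true × Y y ≡ false))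

cubic : ∀ {n} → ES n → VS n → VS n
cubic A U v = not (U v) ∧ (∣ A v ∣ ≡ᵇ 3)

module RelativeFacts {n : ℕ} {A : ES n} {U : VS n} (rel : Relative A U) where
  open Relative rel
  private
    sA : Simple A
    sA = simpleʳ
    D : VS n
    D = cubic A U

  ≢adj : ∀ {i j} → A i j ≡ true → i ≢ j
  ≢adj = adj≢ sA

  flip : ∀ {i j b} → A i j ≡ b → A j i ≡ b
  flip {i} {j} p = trans (symm sA j i) p

  D-U : ∀ {v} → D v ≡ true → U v ≡ false
  D-U {v} p = not-elim (∧ˡ (not (U v)) (∣ A v ∣ ≡ᵇ 3) p)

  D-deg : ∀ {v} → D v ≡ true → ∣ A v ∣ ≡ 3
  D-deg {v} p = ≡ᵇ⇒≡ ∣ A v ∣ 3 (subst T (sym (q p)) _)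
    where
    q : not (U v) ∧ (∣ A v ∣ ≡ᵇ 3) ≡ true → (∣ A v ∣ ≡ᵇ 3) ≡ true
    q p = ∧ʳ (not (U v)) (∣ A v ∣ ≡ᵇ 3) p

  deg-D : ∀ {v} → U v ≡ false → ∣ A v ∣ ≡ 3 → D v ≡ true
  deg-D {v} p q = not-intro p & T⇒≡ (≡⇒≡ᵇ ∣ A v ∣ 3 q)

  single-⊆ : ∀ {v} → U v ≡ false → ⟨ v ⟩ ⊆ ∁ U
  single-⊆ {v} p i q = at (∁ U) (not-intro p) i q

  deg≥3 : ∀ {v} → U v ≡ false → 3 ≤ ∣ A v ∣
  deg≥3 {v} p = lin 3 (λ a b c → (2 ⊗ a) ⊹ 1 ≼ b ⇛ 2 ⊠ a ≑ κ 1 ⇛ b ≐ c ⇛ 1 ⊢ κ 3 ≼ c) (∣ ⟨ v ⟩ ∣) (tch A ⟨ v ⟩)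
      (∣ A v ∣) (many ⟨ v ⟩ (single-⊆ p) (v , ==-refl v)) (cnt-single v) (star A sA v)

  deg≥4 : ∀ {v} → U v ≡ false → D v ≡ false → 4 ≤ ∣ A v ∣
  deg≥4 {v} p q = ≤∧≢⇒< (deg≥3 p) (λ e → clash (deg-D p (sym e)) q)

  -- Supermodularity forces equality in the bounds for union and intersection; the common vertex
  -- makes the bound available for the intersection.
  tight-∪∩ : ∀ {Y Z} → TightSet A U Y → TightSet A U Z → ∀ {x} → Y x ≡ true → Z x ≡ true → TightSet A U (Y ∪ Z) ×
      TightSet A U (Y ∩ Z)
  tight-∪∩ {Y} {Z} (Y⊆ , Yt) (Z⊆ , Zt) {x} p q = (∪⊆ , ∪-tight) , (∩⊆ , ∩-tight)
    where
    ∪⊆ : Y ∪ Z ⊆ ∁ U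
    ∪⊆ i r = tab 3 (λ a b c → ! (b ∨ a) ⇛ b ⊃ not c ⇛ a ⊃ not c ⇛ ⊩ ! (not c)) (Z i) (Y i) (U i) r (Y⊆ i) (Z⊆ i)
    ∩⊆ : Y ∩ Z ⊆ ∁ U
    ∩⊆ i r = tab 3 (λ a b c → ! (b ∧ a) ⇛ b ⊃ not c ⇛ ⊩ ! (not c)) (Z i) (Y i) (U i) r (Y⊆ i)
    su : ins A (Y ∪ Z) + 2 ≤ 2 * ∣ Y ∪ Z ∣
    su = sparse (Y ∪ Z) ∪⊆ (x , (tab 2 (λ a b → ! a ⇛ ⊩ ! (a ∨ b)) (Y x) (Z x) p))
    si : ins A (Y ∩ Z) + 2 ≤ 2 * ∣ Y ∩ Z ∣
    si = sparse (Y ∩ Z) ∩⊆ (x , p & q)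
    ∪-tight : ins A (Y ∪ Z) + 2 ≡ 2 * ∣ Y ∪ Z ∣
    ∪-tight = ≤-antisym (lin 2 (λ a b → a ⊹ 2 ≼ 2 ⊗ b ⇛ 1 ⊢ a ⊹ 2 ≼ 2 ⊗ b) (ins A (Y ∪ Z)) (∣ Y ∪ Z ∣) su)
        (lin 8 (λ a b c d e f g h → c ⊹ 2 ≼ 2 ⊗ d ⇛ e ⊹ 2 ≑ 2 ⊗ f ⇛ g ⊹ 2 ≑ 2 ⊗ h ⇛ e ⊕ g ≼ a ⊕ c ⇛ 2 ⊠ b ⊕ d ≐ f ⊕ h ⇛
        1 ⊢ 2 ⊗ b ≼ a ⊹ 2) (ins A (Y ∪ Z)) (∣ Y ∪ Z ∣) (ins A (Y ∩ Z)) (∣ Y ∩ Z ∣) (ins A Y) (∣ Y ∣) (ins A Z) (∣ Z ∣)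
        si Yt Zt (ins-super A Y Z) (∣∪∣+∣∩∣ Y Z))
    ∩-tight : ins A (Y ∩ Z) + 2 ≡ 2 * ∣ Y ∩ Z ∣
    ∩-tight = ≤-antisym (lin 2 (λ a b → a ⊹ 2 ≼ 2 ⊗ b ⇛ 1 ⊢ a ⊹ 2 ≼ 2 ⊗ b) (ins A (Y ∩ Z)) (∣ Y ∩ Z ∣) si)
        (lin 8 (λ a b c d e f g h → a ⊹ 2 ≼ 2 ⊗ b ⇛ e ⊹ 2 ≑ 2 ⊗ f ⇛ g ⊹ 2 ≑ 2 ⊗ h ⇛ e ⊕ g ≼ a ⊕ c ⇛ 2 ⊠ b ⊕ d ≐ f ⊕ h ⇛
        1 ⊢ 2 ⊗ d ≼ c ⊹ 2) (ins A (Y ∪ Z)) (∣ Y ∪ Z ∣) (ins A (Y ∩ Z)) (∣ Y ∩ Z ∣) (ins A Y) (∣ Y ∣) (ins A Z) (∣ Z ∣)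
        su Yt Zt (ins-super A Y Z) (∣∪∣+∣∩∣ Y Z))

  -- A vertex is worth two in the bound, so its removal from a tight set must cost at least two
  -- edges. `cotight-deg` is the dual for adding a vertex to a cotight set.
  tight-deg : ∀ {Y} → TightSet A U Y → ∀ {v w} → Y v ≡ true → Y w ≡ true → w ≢ v → 2 ≤ dg A v Y
  tight-deg {Y} (Y⊆ , Yt) {v} {w} p q w≢v = lin 5 (λ a b c d e → a ⊹ 2 ≑ 2 ⊗ b ⇛ a ≐ c ⊕ d ⇛ 2 ⊠ b ≑ 𝕤 e ⇛ c ⊹ 2 ≼ 2 ⊗ e
      ⇛ 1 ⊢ κ 2 ≼ d) (ins A Y) (∣ Y ∣) (ins A (Y ∖ ⟨ v ⟩)) (dg A v Y) (∣ Y ∖ ⟨ v ⟩ ∣) Yt (ins-rem sA Y p) (cnt-rem Y p)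
      (sparse (Y ∖ ⟨ v ⟩) (λ i r → Y⊆ i (∧ˡ (Y i) (not (i == v)) r)) (w , ∖⟨⟩-intro {X = Y} q w≢v))

  ∪⟨⟩-⊆ : ∀ {S v} → S ⊆ ∁ U → U v ≡ false → S ∪ ⟨ v ⟩ ⊆ ∁ U
  ∪⟨⟩-⊆ {S} {v} S⊆ p i q = tab 3 (λ a b c → ! (b ∨ a) ⇛ b ⊃ not c ⇛ a ⊃ not c ⇛ ⊩ ! (not c)) (i == v) (S i) (U i) q
      (S⊆ i) (at (∁ U) (not-intro p) i)

  ∪⟨⟩-∋ : ∀ (S : VS n) v → (S ∪ ⟨ v ⟩) v ≡ true
  ∪⟨⟩-∋ S v = tab 2 (λ a b → ! a ⇛ ⊩ ! (b ∨ a)) (v == v) (S v) (==-refl v)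

  cotight-deg : ∀ {S} → Cotight A U S → ∀ {v} → U v ≡ false → S v ≡ false → 2 ≤ dg A v (∁ S)
  cotight-deg {S} (S⊆ , St) {v} Uv p = lin 5 (λ a b c d e → a ≐ (2 ⊗ b) ⊹ 1 ⇛ c ≐ a ⊕ d ⇛ 2 ⊠ e ≑ 𝕤 b ⇛ (2 ⊗ e) ⊹ 1 ≼ c
      ⇛ 1 ⊢ κ 2 ≼ d) (tch A S) (∣ S ∣) (tch A (S ∪ ⟨ v ⟩)) (dg A v (∁ S)) (∣ S ∪ ⟨ v ⟩ ∣) St (tch-add sA S p)
      (cnt-add S p) (many (S ∪ ⟨ v ⟩) (∪⟨⟩-⊆ S⊆ Uv) (v , ∪⟨⟩-∋ S v))

  -- Touching and inner edges of a set of cubic vertices sum to 3|S|, and at least 2|S| + 1 of them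
  -- touch.
  forest : ∀ S → S ⊆ D → NE S → ins A S + 1 ≤ ∣ S ∣
  forest S S⊆D ne = lin 3 (λ a b c → a ⊕ b ≐ 3 ⊗ c ⇛ (2 ⊗ c) ⊹ 1 ≼ a ⇛ 1 ⊢ b ⊹ 1 ≼ c) (tch A S) (ins A S) (∣ S ∣)
      (degree-sum-const sA S 3 (λ v p → D-deg (S⊆D v p))) (many S (λ i p → not-intro (D-U (S⊆D i p))) ne)

  D-triangle : ∀ {a b c} → D a ≡ true → D b ≡ true → D c ≡ true → A a b ≡ true → A a c ≡ true → A b c ≡ true → ⊥
  D-triangle {a} {b} {c} Da Db Dc ab ac bc = lin 8 (λ a b c d e f g h → a ⊹ 1 ≼ b ⇛ a ≑ c ⊕ d ⇛ c ≑ e ⊕ f ⇛ b ≐ 𝕤 g ⇛ g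
      ≐ 𝕤 h ⇛ h ≐ κ 1 ⇛ κ 2 ≼ d ⇛ κ 1 ≼ f ⇛ ⊢⊥) (ins A Y₃) (∣ Y₃ ∣) (ins A Y₂) (dg A c Y₂) (ins A ⟨ a ⟩) (dg A b ⟨ a ⟩)
      (∣ Y₂ ∣) (∣ ⟨ a ⟩ ∣) (forest Y₃ Y⊆D (c , ∪⟨⟩-∋ Y₂ c)) (ins-add sA Y₂ {c} c∉) (ins-add sA ⟨ a ⟩ {b} (≢⇒== b≢a))
      (cnt-add Y₂ {c} c∉) (cnt-add ⟨ a ⟩ {b} (≢⇒== b≢a)) (cnt-single a)
      (cnt-two {X = A c ∩ Y₂} {a} {b} (flip ac & (tab 2 (λ a b → ! a ⇛ ⊩ ! (a ∨ b)) (a == a) (a == b) (==-refl a)))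
      (flip bc & ∪⟨⟩-∋ ⟨ a ⟩ b) (≢adj ab)) (cnt-pos {X = A b ∩ ⟨ a ⟩} {a} (flip ab & ==-refl a))
    where
    Y₂ Y₃ : VS n
    Y₂ = ⟨ a ⟩ ∪ ⟨ b ⟩
    Y₃ = Y₂ ∪ ⟨ c ⟩
    b≢a : b ≢ a
    b≢a e = ≢adj ab (sym e)
    c∉ : Y₂ c ≡ false
    c∉ = cong₂ _∨_ (≢⇒== (≢-sym (≢adj ac))) (≢⇒== (≢-sym (≢adj bc)))
    Y⊆D : Y₃ ⊆ D
    Y⊆D i p = tab 4 (λ a b c d → ! ((c ∨ b) ∨ a) ⇛ c ⊃ d ⇛ b ⊃ d ⇛ a ⊃ d ⇛ ⊩ ! d) (i == c) (i == b) (i == a) (D i) p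
        (at D Da i) (at D Db i) (at D Dc i)

  -- Two vertices are worth four in the bound, but removing `t` and then `p` costs at most three
  -- edges. `cotight-pair` is the dual.
  tight-pair : ∀ {Y} → TightSet A U Y → ∀ {t p} → Y t ≡ true → Y p ≡ true → p ≢ t → dg A t Y ≤ 2 → dg A p (Y ∖ ⟨ t ⟩) ≤
      1 → ⊥
  tight-pair {Y} (Y⊆ , Yt) {t} {p} Yt∈ Yp p≢t dt dp = by (empty? R)
    where
    Q R : VS n
    Q = Y ∖ ⟨ t ⟩
    R = Q ∖ ⟨ p ⟩
    Qp : Q p ≡ true
    Qp = ∖⟨⟩-intro {X = Y} Yp p≢t
    by : Empty? R → ⊥
    by (inj₁ ne) = lin 8 (λ a b c d e f g h → a ⊹ 2 ≑ 2 ⊗ b ⇛ a ≐ c ⊕ d ⇛ c ≐ e ⊕ f ⇛ 2 ⊠ b ≑ 𝕤 g ⇛ 2 ⊠ g ≑ 𝕤 h ⇛ d ≼ κ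
        2 ⇛ f ≼ κ 1 ⇛ e ⊹ 2 ≼ 2 ⊗ h ⇛ ⊢⊥) (ins A Y) (∣ Y ∣) (ins A Q) (dg A t Y) (ins A R) (dg A p Q) (∣ Q ∣) (∣ R ∣) Yt
        (ins-rem sA Y Yt∈) (ins-rem sA Q Qp) (cnt-rem Y Yt∈) (cnt-rem Q Qp) dt dp
        (sparse R (λ i r → Y⊆ i (∧ˡ (Y i) (not (i == t)) (∧ˡ _ _ r))) ne)
    by (inj₂ none) = lin 8 (λ a b c d e f g h → a ⊹ 2 ≑ 2 ⊗ b ⇛ a ≐ c ⊕ d ⇛ c ≐ e ⊕ f ⇛ 2 ⊠ b ≑ 𝕤 g ⇛ g ≑ 𝕤 h ⇛ e ≐ κ 0
        ⇛ d ≼ g ⇛ f ≼ h ⇛ ⊢⊥) (ins A Y) (∣ Y ∣) (ins A Q) (dg A t Y) (ins A R) (dg A p Q) (∣ Q ∣) (∣ R ∣) Yt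
        (ins-rem sA Y Yt∈) (ins-rem sA Q Qp) (cnt-rem Y Yt∈) (cnt-rem Q Qp)
        (ec-empty (λ i j → tab 3 (λ a b c → ∼ a ⇛ ⊩ ∼ (c ∧ a ∧ b)) (R i) (R j) (A i j) (none i))) (dg≤size sA t Y)
        (dg≤size sA p Q)

  cotight-pair : ∀ {S} → Cotight A U S → ∀ {t p} → U t ≡ false → U p ≡ false → S t ≡ false → S p ≡ false → p ≢ t →
                 dg A t (∁ S) ≤ 2 → dg A p (∁ (S ∪ ⟨ t ⟩)) ≤ 1 → ⊥
  cotight-pair {S} (S⊆ , St) {t} {p} Ut Up St∉ Sp∉ p≢t dt dp = lin 8 (λ a b c d e f g h → a ≐ (2 ⊗ b) ⊹ 1 ⇛ c ≐ a ⊕ d ⇛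
      e ≐ c ⊕ f ⇛ 2 ⊠ g ≑ 𝕤 b ⇛ 2 ⊠ h ≑ 𝕤 g ⇛ d ≼ κ 2 ⇛ f ≼ κ 1 ⇛ (2 ⊗ h) ⊹ 1 ≼ e ⇛ ⊢⊥) (tch A S) (∣ S ∣) (tch A Q)
      (dg A t (∁ S)) (tch A R) (dg A p (∁ Q)) (∣ Q ∣) (∣ R ∣) St (tch-add sA S St∉) (tch-add sA Q Qp) (cnt-add S St∉)
      (cnt-add Q Qp) dt dp (many R (∪⟨⟩-⊆ (∪⟨⟩-⊆ S⊆ Ut) Up) (p , ∪⟨⟩-∋ Q p))
    where
    Q R : VS n
    Q = S ∪ ⟨ t ⟩
    R = Q ∪ ⟨ p ⟩
    Qp : Q p ≡ false
    Qp = cong₂ _∨_ Sp∉ (≢⇒== p≢t)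

  -- An obstacle would separate the common neighbour `q` from the adjacent cubic vertices `t` and
  -- `p`. Removing this pair from a tight set, or adding it to a cotight one, then changes at most
  -- three edges.
  common-free : ∀ {t p q r} → D t ≡ true → D p ≡ true → Triple (A t) p q r → A p q ≡ true → ¬ Obstacle A U t p q
  common-free {t} {p} {q} {r} Dt Dp tr pq = by
    where
    open Triple tr
    p≢t : p ≢ t
    p≢t e = ≢adj ∈a (sym e)
    by : Obstacle A U t p q → ⊥
    by (inj₁ (S , cS , Sq , Sp , St)) = cotight-pair cS (D-U Dt) (D-U Dp) St Sp p≢t
      (lin 3 (λ a b c → a ≐ κ 3 ⇛ a ≑ b ⊕ c ⇛ κ 1 ≼ b ⇛ 1 ⊢ c ≼ κ 2) (∣ A t ∣) (dg A t S) (dg A t (∁ S)) (D-deg Dt)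
          (dg-∁ A t S) (cnt-pos {X = A t ∩ S} (∈b & Sq)))
      (lin 3 (λ a b c → a ≐ κ 3 ⇛ a ≑ b ⊕ c ⇛ κ 2 ≼ b ⇛ 1 ⊢ c ≼ κ 1) (∣ A p ∣) (dg A p (S ∪ ⟨ t ⟩))
          (dg A p (∁ (S ∪ ⟨ t ⟩))) (D-deg Dp) (dg-∁ A p (S ∪ ⟨ t ⟩)) (cnt-two {X = A p ∩ (S ∪ ⟨ t ⟩)} {t} {q}
          (flip ∈a & ∪⟨⟩-∋ S t) (pq & (tab 2 (λ a b → ! a ⇛ ⊩ ! (a ∨ b)) (S q) (q == t) Sq)) (λ e → ≢adj ∈b e)))
    by (inj₂ (Y , tY , Yt∈ , Yp , Yq)) = tight-pair tY Yt∈ Yp p≢t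
      (lin 3 (λ a b c → a ≐ κ 3 ⇛ a ≑ b ⊕ c ⇛ κ 1 ≼ c ⇛ 1 ⊢ b ≼ κ 2) (∣ A t ∣) (dg A t Y) (dg A t (∁ Y)) (D-deg Dt)
          (dg-∁ A t Y) (cnt-pos {X = A t ∩ ∁ Y} (∈b & not-intro Yq)))
      (lin 3 (λ a b c → a ≐ κ 3 ⇛ a ≑ b ⊕ c ⇛ κ 2 ≼ c ⇛ 1 ⊢ b ≼ κ 1) (∣ A p ∣) (dg A p (Y ∖ ⟨ t ⟩))
          (dg A p (∁ (Y ∖ ⟨ t ⟩))) (D-deg Dp) (dg-∁ A p (Y ∖ ⟨ t ⟩)) (cnt-two {X = A p ∩ ∁ (Y ∖ ⟨ t ⟩)} {t} {q}
          (flip ∈a & not-intro (∉∖ Y t)) (pq & (tab 2 (λ a b → ∼ a ⇛ ⊩ ! (not (a ∧ not b))) (Y q) (q == t) Yq))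
          (λ e → ≢adj ∈b e)))

  module Joined (att : Attached A U ⊎ Apex A U) where

    -- Outside `U` sparsity forbids so many edges, so `p` lies in `U`. Further outer vertices would
    -- push the count beyond `total`, and all outer edges end in `Y` or `p`; this rules out a second
    -- attachment and leaves the apex.
    overfull : ∀ {Y} → Y ⊆ ∁ U → NE Y → ∀ {p} → Y p ≡ false → 2 * ∣ Y ∣ + 1 ≤ ins A (Y ∪ ⟨ p ⟩) →
               (∀ i → U i ≡ (i == p)) × ∁ U ⊆ Y × 4 ≤ ∣ A p ∣
    overfull {Y} Y⊆ (y , Yy) {p} Yp h = by (bool (U p))
      where
      Goal : Set
      Goal = (∀ i → U i ≡ (i == p)) × ∁ U ⊆ Y × 4 ≤ ∣ A p ∣
      both : ∀ i j → (i == p) ∧ (j == p) ≡ true → not (A i j) ≡ true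
      both i j q = not-intro (trans (cong₂ A (==⇒≡ {i = i} (∧ˡ (i == p) (j == p) q))
          (==⇒≡ {i = j} (∧ʳ (i == p) (j == p) q))) (irr sA p))
      cover : Empty? (∁ U ∖ Y) → U p ≡ true → Goal
      cover (inj₁ ne) Up = ⊥-elim (lin 6 (λ a b c d e f → (2 ⊗ a) ⊹ 1 ≼ b ⇛ c ≐ (2 ⊗ d) ⊹ 1 ⇛ 2 ⊠ d ≐ a ⊕ e ⇛ (2 ⊗ e) ⊹
          1 ≼ f ⇛ f ⊕ b ≼ c ⇛ ⊢⊥) (∣ Y ∣) (ins A (Y ∪ ⟨ p ⟩)) (tch A (∁ U)) (∣ ∁ U ∣) (∣ ∁ U ∖ Y ∣) (tch A (∁ U ∖ Y)) h
          total (∣⊆∣+∣∖∣ (∁ U) Y Y⊆) (many (∁ U ∖ Y) (λ i q → ∧ˡ (not (U i)) (not (Y i)) q) ne)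
          (ec21≤ (inc A (∁ U ∖ Y)) (inn A (Y ∪ ⟨ p ⟩)) (inc A (∁ U))
          (λ i j → tab 7 (λ a b c d e f g → b ∧ a ⊃ not c ⇛ b ⊃ d ⇛ a ⊃ e ⇛ f ⊃ not d ⇛ g ⊃ not e ⇛ ⊩ 𝟙
          (c ∧ ((not d ∧ not f) ∨ (not e ∧ not g))) + 𝟙 (c ∧ (f ∨ b) ∧ (g ∨ a)) ≦ 𝟙 (c ∧ (not d ∨ not e))) (j == p)
          (i == p) (A i j) (U i) (U j) (Y i) (Y j) (both i j) (at U Up i) (at U Up j) (Y⊆ i) (Y⊆ j))))
      cover (inj₂ none) Up = attachments att
        where
        ∣U∣ : ∣ ∁ U ∣ ≡ ∣ Y ∣
        ∣U∣ = lin 3 (λ a b c → a ≐ b ⊕ c ⇛ c ≐ κ 0 ⇛ 1 ⊢ a ≐ b) (∣ ∁ U ∣) (∣ Y ∣) (∣ ∁ U ∖ Y ∣) (∣⊆∣+∣∖∣ (∁ U) Y Y⊆)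
            (cnt-empty none)
        other : ∀ {u w} → U u ≡ true → U w ≡ false → A u w ≡ true → u ≢ p → ⊥
        other {u} {w} Uu Uw uw u≢p = lin 5 (λ a b c d e → (2 ⊗ a) ⊹ 1 ≼ b ⇛ c ≐ (2 ⊗ d) ⊹ 1 ⇛ 2 ⊠ d ≐ a ⇛ e ≑ κ 1 ⇛ b ⊕
            e ≼ c ⇛ ⊢⊥) (∣ Y ∣) (ins A (Y ∪ ⟨ p ⟩)) (tch A (∁ U)) (∣ ∁ U ∣) (ec (pair u w)) h total ∣U∣
            (ec-pair (≢adj uw)) (ec21≤ (inn A (Y ∪ ⟨ p ⟩)) (pair u w) (inc A (∁ U))
            (λ i j → tab 8 (λ a b c d e f g h → b ∧ a ⊃ not c ⇛ d ⊃ not e ⇛ f ⊃ not g ⇛ h ⊃ c ⇛ h ⊃ (not e ∨ not g) ∧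
            not ((d ∨ b) ∧ (f ∨ a)) ⇛ ⊩ 𝟙 (c ∧ (d ∨ b) ∧ (f ∨ a)) + 𝟙 h ≦ 𝟙 (c ∧ (not e ∨ not g))) (j == p) (i == p)
            (A i j) (Y i) (U i) (Y j) (U j) (pair u w i j) (both i j) (Y⊆ i) (Y⊆ j) (pair-⊆ sA uw i j)
            (pair-apart (λ i j → (not (U i) ∨ not (U j)) ∧ not ((Y i ∨ (i == p)) ∧ (Y j ∨ (j == p))))
            (λ i j → cong₂ _∧_ (𝔹.∨-comm (not (U i)) (not (U j)))
            (cong not (𝔹.∧-comm (Y i ∨ (i == p)) (Y j ∨ (j == p)))))
            (tab 6 (λ a b c d e f → ∼ a ⇛ ! b ⇛ c ⊃ not b ⇛ ∼ d ⇛ ⊩ ! ((not b ∨ not a) ∧ not ((c ∨ d) ∧ (f ∨ e)))) (U w)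
            (U u) (Y u) (u == p) (w == p) (Y w) Uw Uu (Y⊆ u) (≢⇒== u≢p)) i j)))
        attachments : Attached A U ⊎ Apex A U → Goal
        attachments (inj₁ (u₁ , u₂ , w₁ , w₂ , u₁≢u₂ , (Uu₁ , Uu₂) , (Uw₁ , Uw₂) , (a₁ , a₂))) = ⊥-elim
            (choose (u₁ ≟ p))
          where
          choose : Dec (u₁ ≡ p) → ⊥
          choose (no q) = other Uu₁ Uw₁ a₁ q
          choose (yes q) = other Uu₂ Uw₂ a₂ (λ e → u₁≢u₂ (trans q (sym e)))
        attachments (inj₂ (x , only , four)) = subst (λ z → ∀ i → U i ≡ (i == z)) x≡p only ,
            (λ i q → tab 2 (λ a b → ! (not a) ⇛ ∼ (not a ∧ not b) ⇛ ⊩ ! b) (U i) (Y i) q (none i)) , subst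
                (λ z → 4 ≤ ∣ A z ∣) x≡p four
          where
          x≡p : x ≡ p
          x≡p = sym (==⇒≡ (trans (sym (only p)) Up))
      by : Decided (U p) → Goal
      by (inj₁ Up) = cover (empty? (∁ U ∖ Y)) Up
      by (inj₂ Up) = ⊥-elim (lin 3 (λ a b c → (2 ⊗ a) ⊹ 1 ≼ b ⇛ 2 ⊠ c ≐ 𝕤 a ⇛ b ⊹ 2 ≼ 2 ⊗ c ⇛ ⊢⊥) (∣ Y ∣)
          (ins A (Y ∪ ⟨ p ⟩)) (∣ Y ∪ ⟨ p ⟩ ∣) h (cnt-add Y Yp) (sparse (Y ∪ ⟨ p ⟩) (∪⟨⟩-⊆ Y⊆ Up) (p , ∪⟨⟩-∋ Y p)))

    -- Three neighbours make `Y` with `p` overfull. In the apex case that remains, the four or more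
    -- edges at `p` all go into `Y`, one more than `total` allows.
    tight-over : ∀ {Y} → TightSet A U Y → ∀ {y p} → Y y ≡ true → Y p ≡ false → 3 ≤ dg A p Y → ⊥
    tight-over {Y} (Y⊆ , Yt) {y} {p} Yy Yp h = final (overfull Y⊆ (y , Yy) Yp
        (lin 4 (λ a b c d → a ⊹ 2 ≑ 2 ⊗ b ⇛ κ 3 ≼ c ⇛ d ≑ a ⊕ c ⇛ 1 ⊢ (2 ⊗ b) ⊹ 1 ≼ d) (ins A Y) (∣ Y ∣) (dg A p Y)
            (ins A (Y ∪ ⟨ p ⟩)) Yt h (ins-add sA Y Yp)))
      where
      final : (∀ i → U i ≡ (i == p)) × ∁ U ⊆ Y × 4 ≤ ∣ A p ∣ → ⊥
      final (only , ⊆Y , four) = lin 7 (λ a b c d e f g → a ⊹ 2 ≑ 2 ⊗ b ⇛ c ≑ a ⊕ d ⇛ κ 4 ≼ e ⇛ e ≼ d ⇛ f ≐ (2 ⊗ g) ⊹ 1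
          ⇛ 2 ⊠ g ≼ b ⇛ c ≼ f ⇛ ⊢⊥) (ins A Y) (∣ Y ∣) (ins A (Y ∪ ⟨ p ⟩)) (dg A p Y) (∣ A p ∣) (tch A (∁ U)) (∣ ∁ U ∣)
          Yt (ins-add sA Y Yp) four (cnt≤ {X = A p} {A p ∩ Y}
          (λ i q → q & ⊆Y i (tab 3 (λ a b c → ! a ⇛ b ⊃ not a ⇛ c ⇔ b ⇛ ⊩ ! (not c)) (A p i) (i == p) (U i) q
          (at (∁ (A p)) (not-intro (irr sA p)) i) (only i)))) total (cnt≤ ⊆Y)
          (ec-⊆ {E = inn A (Y ∪ ⟨ p ⟩)} {inc A (∁ U)} (λ i j q → tab 7 (λ a b c d e f g → ! (e ∧ (d ∨ c) ∧ (b ∨ a)) ⇛ d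
          ⊃ not f ⇛ b ⊃ not g ⇛ f ⇔ c ⇛ g ⇔ a ⇛ c ∧ a ⊃ not e ⇛ ⊩ ! (e ∧ (not f ∨ not g))) (j == p) (Y j) (i == p) (Y i)
          (A i j) (U i) (U j) q (Y⊆ i) (Y⊆ j) (only i) (only j)
          (λ r → not-intro (trans (cong₂ A (==⇒≡ {i = i} (∧ˡ (i == p) (j == p) r))
          (==⇒≡ {i = j} (∧ʳ (i == p) (j == p) r))) (irr sA p)))))

-- Irreducible graphs and a minimal cotight set

StaysAttached : ∀ {n} → ES n → VS n → (v y : Fin n) → Set
StaysAttached A U v y = U y ≡ true → ∃[ w ] (U w ≡ false × w ≢ v × A y w ≡ true)

-- `not-both` ensures that the new edge `qr` touches the complement of `U`, so the contracted graph
-- gains it and the graph inside `U` does not.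
record Diamond {n : ℕ} (A : ES n) (U : VS n) (t p q r : Fin n) : Set where
  field
    Ut : U t ≡ false
    Up : U p ≡ false
    tp : A t p ≡ true
    deg-t : ∣ A t ∣ ≡ 3
    deg-p : ∣ A p ∣ ≡ 3
    q≢r : q ≢ r
    tq : A t q ≡ true
    tr : A t r ≡ true
    pq : A p q ≡ true
    pr : A p r ≡ true
    qr : A q r ≡ false
    not-both : U q ∧ U r ≡ false

record Irreducible {n : ℕ} (A : ES n) (U : VS n) : Set where
  field
    blocked : ∀ v u y → Legal A U v u y → StaysAttached A U v y → Obstacle A U v u y
    no-diamond : ∀ t p q r → ¬ Diamond A U t p q r

record MinimalCotight {n : ℕ} (A : ES n) (U W : VS n) : Set where
  field
    W⊆ : W ⊆ ∁ U
    Wt : tch A W ≡ 2 * ∣ W ∣ + 1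
    bad : Fin n
    Wbad : W bad ≡ true
    Dbad : cubic A U bad ≡ false
    least : ∀ S → S ⊆ W → tch A S ≡ 2 * ∣ S ∣ + 1 → ∀ {s} → S s ≡ true → cubic A U s ≡ false → ∣ W ∣ ≤ ∣ S ∣

module Minimal {n : ℕ} {A : ES n} {U W : VS n} (rel : Relative A U) (att : Attached A U ⊎ Apex A U)
    (irrd : Irreducible A U) (mini : MinimalCotight A U W) where
  open Relative rel
  open RelativeFacts rel
  open Joined att
  open Irreducible irrd
  open MinimalCotight mini
  sA : Simple A
  sA = simpleʳ
  D : VS n
  D = cubic A U

  W-U : ∀ {v} → W v ≡ true → U v ≡ false
  W-U {v} p = not-elim (W⊆ v p)

  -- So few touching edges make `S` cotight, and a proper cotight subset of `W` contains no
  -- non-cubic vertex, by minimality.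
  descend : ∀ S → S ⊆ W → tch A S ≤ 2 * ∣ S ∣ + 1 → ∀ {w s} → W w ≡ true → S w ≡ false → S s ≡ true → D s ≡ true
  descend S S⊆W h {w} {s} Ww Sw Ss = by (bool (D s))
    where
    by : Decided (D s) → D s ≡ true
    by (inj₁ p) = p
    by (inj₂ p) = ⊥-elim (lin 3 (λ a b c → a ≼ b ⇛ a ≑ b ⊕ c ⇛ κ 1 ≼ c ⇛ ⊢⊥) (∣ W ∣) (∣ S ∣) (∣ W ∖ S ∣)
        (least S S⊆W (≤-antisym h (many S (λ i q → W⊆ i (S⊆W i q)) (s , Ss))) Ss p) (∣⊆∣+∣∖∣ W S S⊆W)
        (cnt-pos {X = W ∖ S} (Ww & not-intro Sw)))

  -- Submodularity makes the intersection with `W` cotight, and it is a proper subset of `W`.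
  cotight-meets : ∀ {S} → Cotight A U S → ∀ {w s} → W w ≡ true → S w ≡ false → W s ≡ true → S s ≡ true → D s ≡ true
  cotight-meets {S} (S⊆ , St) {w} {s} Ww Sw Ws Ss = descend (S ∩ W) (λ i p → ∧ʳ (S i) (W i) p)
    (lin 8 (λ a b c d e f g h → a ≐ (2 ⊗ b) ⊹ 1 ⇛ c ≐ (2 ⊗ d) ⊹ 1 ⇛ e ⊕ f ≼ a ⊕ c ⇛ 2 ⊠ g ⊕ h ≑ b ⊕ d ⇛ (2 ⊗ g) ⊹ 1 ≼ e
        ⇛ 1 ⊢ f ≼ (2 ⊗ h) ⊹ 1) (tch A S) (∣ S ∣) (tch A W) (∣ W ∣) (tch A (S ∪ W)) (tch A (S ∩ W)) (∣ S ∪ W ∣)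
        (∣ S ∩ W ∣) St Wt (tch-sub A S W) (∣∪∣+∣∩∣ S W) (many (S ∪ W)
        (λ i p → tab 3 (λ a b c → ! (b ∨ a) ⇛ b ⊃ not c ⇛ a ⊃ not c ⇛ ⊩ ! (not c)) (W i) (S i) (U i) p (S⊆ i) (W⊆ i))
        (s , (tab 2 (λ a b → ! a ⇛ ⊩ ! (a ∨ b)) (S s) (W s) Ss))))
    Ww (cong (_∧ W w) Sw) (Ss & Ws)

  -- Mixed uncrossing makes the part of `W` outside `Y` cotight. The vertex `x` of `Y` outside `W`
  -- is what gives a bound for the other difference.
  tight-meets : ∀ {Y} → TightSet A U Y → ∀ {v x y} → W v ≡ true → Y v ≡ true → Y x ≡ true → W x ≡ false → W y ≡ true → Y
      y ≡ false → D y ≡ true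
  tight-meets {Y} (Y⊆ , Yt) {v} {x} {y} Wv Yv Yx Wx Wy Yy = descend (W ∖ Y) (λ i p → ∧ˡ (W i) (not (Y i)) p)
    (lin 10 (λ a b c d e f g h i j → a ⊹ 2 ≑ 2 ⊗ b ⇛ c ≐ (2 ⊗ d) ⊹ 1 ⇛ a ⊕ e ≼ f ⊕ c ⇛ f ⊹ 2 ≼ 2 ⊗ g ⇛ 2 ⊠ b ≑ h ⊕ g ⇛ 2
        ⊠ d ≐ i ⊕ j ⇛ 2 ⊠ h ≑ i ⇛ 1 ⊢ e ≼ (2 ⊗ j) ⊹ 1) (ins A Y) (∣ Y ∣) (tch A W) (∣ W ∣) (tch A (W ∖ Y))
        (ins A (Y ∖ W)) (∣ Y ∖ W ∣) (∣ Y ∩ W ∣) (∣ W ∩ Y ∣) (∣ W ∖ Y ∣) Yt Wt (ins-tch-cross A Y W)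
        (sparse (Y ∖ W) (λ i p → Y⊆ i (∧ˡ (Y i) (not (W i)) p)) (x , Yx & not-intro Wx)) (∣∩∣+∣∖∣ Y W) (∣∩∣+∣∖∣ W Y)
        (cnt≗ {X = Y ∩ W} {W ∩ Y} (λ i → 𝔹.∧-comm (Y i) (W i))))
    Wv (tab 2 (λ a b → ! a ⇛ ⊩ ∼ (b ∧ not a)) (Y v) (W v) Yv) (Wy & not-intro Yy)

  -- The edges from `v` to the outside no longer touch `W` without `v`; two of them suffice to make
  -- that set cotight.
  two-outside : ∀ {v} → W v ≡ true → 2 ≤ dg A v (∁ W) → ∀ {x} → W x ≡ true → x ≢ v → D x ≡ true
  two-outside {v} Wv h {x} Wx x≢v = descend (W ∖ ⟨ v ⟩) (λ i p → ∧ˡ (W i) (not (i == v)) p)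
    (lin 5 (λ a b c d e → κ 2 ≼ a ⇛ b ≐ (2 ⊗ c) ⊹ 1 ⇛ b ≑ d ⊕ a ⇛ 2 ⊠ c ≐ 𝕤 e ⇛ 1 ⊢ d ≼ (2 ⊗ e) ⊹ 1) (dg A v (∁ W))
        (tch A W) (∣ W ∣) (tch A (W ∖ ⟨ v ⟩)) (∣ W ∖ ⟨ v ⟩ ∣) h Wt (tch-rem sA W Wv) (cnt-rem W Wv))
    Wv (∉∖ W v) (∖⟨⟩-intro {X = W} Wx x≢v)

  cubic-two-outside : ∀ {t} → W t ≡ true → D t ≡ true → ¬ (2 ≤ dg A t (∁ W))
  cubic-two-outside {t} Wt∈ Dt h = clash (two-outside Wt∈ h Wbad (λ e → clash (trans (cong D e) Dt) Dbad)) Dbad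

  -- A cotight obstacle, or a tight one that leaves `W`, would uncross with `W` and force `y` to be
  -- cubic.
  obstacle-in-W : ∀ {v u y} → Legal A U v u y → W v ≡ true → W y ≡ true → D y ≡ false →
                  ∃[ Y ] (TightSet A U Y × Y ⊆ W × Y v ≡ true × Y u ≡ true × Y y ≡ false)
  obstacle-in-W {v} {u} {y} legal Wv Wy Dy = by (blocked v u y legal (λ Uy → ⊥-elim (clash Uy (W-U Wy))))
    where
    by : Obstacle A U v u y → ∃[ Y ] (TightSet A U Y × Y ⊆ W × Y v ≡ true × Y u ≡ true × Y y ≡ false)
    by (inj₁ (S , cS , Sy , Su , Sv)) = ⊥-elim (clash (cotight-meets cS Wv Sv Wy Sy) Dy)
    by (inj₂ (Y , tY , Yv , Yu , Yy)) = Y , tY , (λ i p → inside i p (bool (W i))) , Yv , Yu , Yy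
      where
      inside : ∀ i → Y i ≡ true → Decided (W i) → W i ≡ true
      inside i p (inj₁ q) = q
      inside i p (inj₂ q) = ⊥-elim (clash (tight-meets tY Wv Yv p q Wy Yy) Dy)

  legal₃ : ∀ {t u y z} → W t ≡ true → Triple (A t) u y z → A u z ≡ false → Legal A U t u y
  legal₃ {t} {u} {y} {z} Wt∈ tr uz = W-U Wt∈ , ∈a , ∈b , a≢b , (λ x p x≢u x≢y → third (members p) x≢u x≢y)
    where
    open Triple tr
    third : ∀ {x} → x ≡ u ⊎ x ≡ y ⊎ x ≡ z → x ≢ u → x ≢ y → A u x ≡ false
    third (inj₁ e) x≢u _ = ⊥-elim (x≢u e)
    third (inj₂ (inj₁ e)) _ x≢y = ⊥-elim (x≢y e)
    third (inj₂ (inj₂ refl)) _ _ = uz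

  one-common : ∀ {t p q r} → W t ≡ true → D t ≡ true → D p ≡ true → Triple (A t) p q r → A p q ≡ true → A p r ≡ false
      → ⊥
  one-common Wt∈ Dt Dp tr pq pr = common-free Dt Dp tr pq
      (blocked _ _ _ (legal₃ Wt∈ tr pr) (λ _ → _ , D-U Dp , (≢-sym (≢adj ∈a)) , flip pq))
    where open Triple tr

  out₂ : ∀ {t a b c} → Triple (A t) a b c → W t ≡ true → D t ≡ true → W a ≡ false → W b ≡ false → ⊥
  out₂ tr Wt∈ Dt Wa Wb = cubic-two-outside Wt∈ Dt (cnt-two {X = A _ ∩ ∁ W} (∈a & not-intro Wa) (∈b & not-intro Wb) a≢b)
    where open Triple tr

  -- Neither `p` nor `q` is cubic, by `common-free`. Contracting `t` onto one and dropping the other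
  -- is blocked by a tight set inside `W`, so both lie in `W`. The two tight sets both contain `r`,
  -- and in their intersection `t` has `r` as its only neighbour.
  one-pair : ∀ {t p q r} → W t ≡ true → D t ≡ true → Triple (A t) p q r → A p q ≡ true → A p r ≡ false → A q r ≡ false
      → ⊥
  one-pair {t} {p} {q} {r} Wt∈ Dt tr pq pr qr = by (bool (D p)) (bool (D q)) (bool (W p)) (bool (W q))
    where
    open Triple tr
    by : Decided (D p) → Decided (D q) → Decided (W p) → Decided (W q) → ⊥
    by (inj₁ Dp) _ _ _ = one-common Wt∈ Dt Dp tr pq pr
    by _ (inj₁ Dq) _ _ = one-common Wt∈ Dt Dq (triple-swap₁₂ tr) (flip pq) qr
    by (inj₂ Dp) (inj₂ Dq) (inj₂ Wp) (inj₂ Wq) = out₂ tr Wt∈ Dt Wp Wq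
    by (inj₂ Dp) (inj₂ Dq) (inj₁ Wp) (inj₂ Wq) with obstacle-in-W (legal₃ Wt∈ (triple-swap₁₂ tr) qr) Wt∈ Wp Dp
    ... | Y , tY , Y⊆W , Yt , Yq , Yp = clash (Y⊆W q Yq) Wq
    by (inj₂ Dp) (inj₂ Dq) (inj₂ Wp) (inj₁ Wq) with obstacle-in-W (legal₃ Wt∈ tr pr) Wt∈ Wq Dq
    ... | Y , tY , Y⊆W , Yt , Yp , Yq = clash (Y⊆W p Yp) Wp
    by (inj₂ Dp) (inj₂ Dq) (inj₁ Wp) (inj₁ Wq)
      with obstacle-in-W (legal₃ Wt∈ (triple-swap₁₂ tr) qr) Wt∈ Wp Dp | obstacle-in-W (legal₃ Wt∈ tr pr) Wt∈ Wq Dq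
    ... | Y , tY , _ , Yt , Yq , Yp | Z , tZ , _ , Zt , Zp , Zq = lin 4 (λ a b c d → κ 2 ≼ a ⇛ a ≐ b ⊕ c ⊕ d ⇛ b ⊕ c ⊕ d
        ≼ κ 1 ⇛ ⊢⊥) (dg A t (Y ∩ Z)) (𝟙 ((Y ∩ Z) p)) (𝟙 ((Y ∩ Z) q)) (𝟙 ((Y ∩ Z) r))
        (tight-deg (proj₂ (tight-∪∩ tY tZ Yt Zt)) (Yt & Zt) (Yr & Zr) (≢-sym (≢adj ∈c))) (count (Y ∩ Z))
        (tab 6 (λ a b c d e f → ∼ a ⇛ ∼ b ⇛ ⊩ 𝟙 (a ∧ c) + 𝟙 (d ∧ b) + 𝟙 (f ∧ e) ≦ 1) (Y p) (Z q) (Z p) (Y q) (Z r) (Y r)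
        Yp Zq)
      where
      has-r : ∀ {Y} → 2 ≤ dg A t Y → Y p ∧ Y q ≡ false → Y r ≡ true
      has-r {Y} two pq∉ = go (bool (Y r))
        where
        go : Decided (Y r) → Y r ≡ true
        go (inj₁ h) = h
        go (inj₂ h) = ⊥-elim (lin 4 (λ a b c d → κ 2 ≼ a ⇛ a ≐ b ⊕ c ⊕ d ⇛ b ⊕ c ⊕ d ≼ κ 1 ⇛ ⊢⊥) (dg A t Y) (𝟙 (Y p))
            (𝟙 (Y q)) (𝟙 (Y r)) two (count Y) (tab 3 (λ a b c → ∼ a ⇛ ∼ (c ∧ b) ⇛ ⊩ 𝟙 c + 𝟙 b + 𝟙 a ≦ 1) (Y r) (Y q)
            (Y p) h pq∉))
      Yr : Y r ≡ true
      Yr = has-r (tight-deg tY Yt Yq (≢-sym (≢adj ∈b))) (cong (_∧ Y q) Yp)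
      Zr : Z r ≡ true
      Zr = has-r (tight-deg tZ Zt Zp (≢-sym (≢adj ∈a))) (tab 2 (λ a b → ∼ a ⇛ ⊩ ∼ (b ∧ a)) (Z q) (Z p) Zq)

  -- Contract `t` onto `q` and drop `tp`. A tight obstacle contains three neighbours `t`, `q`, `r`
  -- of `p`. A cotight obstacle avoids these three, and discarding `p` from it leaves too few
  -- touching edges unless `p` was alone; then `p` is cubic and there is a diamond.
  two-pairs : ∀ {t p q r} → W t ≡ true → D t ≡ true → Triple (A t) p q r → A p q ≡ true → A p r ≡ true → A q r ≡ false
      → ⊥
  two-pairs {t} {p} {q} {r} Wt∈ Dt tr pq pr qr = by (blocked t q p (legal₃ Wt∈ (triple-swap₁₂ tr) qr)
      (λ _ → attached (bool (U q)) (bool (U r))))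
    where
    open Triple tr
    Uqr : U q ≡ true → U r ≡ true → ⊥
    Uqr Uq Ur = cubic-two-outside Wt∈ Dt (cnt-two {X = A t ∩ ∁ W}
        (∈b & (tab 2 (λ a b → ! a ⇛ b ⊃ not a ⇛ ⊩ ! (not b)) (U q) (W q) Uq (W⊆ q)))
        (∈c & (tab 2 (λ a b → ! a ⇛ b ⊃ not a ⇛ ⊩ ! (not b)) (U r) (W r) Ur (W⊆ r))) b≢c)
    attached : Decided (U q) → Decided (U r) → ∃[ w ] (U w ≡ false × w ≢ t × A p w ≡ true)
    attached (inj₂ h) _ = q , h , (≢-sym (≢adj ∈b)) , pq
    attached _ (inj₂ h) = r , h , (≢-sym (≢adj ∈c)) , pr
    attached (inj₁ x) (inj₁ y) = ⊥-elim (Uqr x y)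
    not-both : U q ∧ U r ≡ false
    not-both = go (bool (U q)) (bool (U r))
      where
      go : Decided (U q) → Decided (U r) → U q ∧ U r ≡ false
      go (inj₂ h) _ = cong (_∧ U r) h
      go (inj₁ _) (inj₂ h) = tab 2 (λ a b → ∼ a ⇛ ⊩ ∼ (b ∧ a)) (U r) (U q) h
      go (inj₁ x) (inj₁ y) = ⊥-elim (Uqr x y)
    has-r : ∀ (Q : VS n) → 2 ≤ dg A t Q → Q p ≡ false → Q r ≡ true
    has-r Q two Qp = go (bool (Q r))
      where
      go : Decided (Q r) → Q r ≡ true
      go (inj₁ h) = h
      go (inj₂ h) = ⊥-elim (lin 4 (λ a b c d → κ 2 ≼ a ⇛ a ≐ b ⊕ c ⊕ d ⇛ b ⊕ c ⊕ d ≼ κ 1 ⇛ ⊢⊥) (dg A t Q) (𝟙 (Q p))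
          (𝟙 (Q q)) (𝟙 (Q r)) two (count Q) (tab 3 (λ a b c → ∼ a ⇛ ∼ b ⇛ ⊩ 𝟙 b + 𝟙 c + 𝟙 a ≦ 1) (Q r) (Q p) (Q q) h
          Qp))
    by : Obstacle A U t q p → ⊥
    by (inj₁ (S , cS , Sp , Sq , St)) = rest (empty? (S ∖ ⟨ p ⟩))
      where
      Sr : S r ≡ false
      Sr = not-elim (has-r (∁ S) (cotight-deg cS (D-U Dt) St) (cong not Sp))
      dp : 3 ≤ dg A p (∁ S)
      dp = cnt-three {X = A p ∩ ∁ S} {t} {q} {r} (flip ∈a & not-intro St) (pq & not-intro Sq) (pr & not-intro Sr)
          (≢adj ∈b) (≢adj ∈c) b≢c
      rest : Empty? (S ∖ ⟨ p ⟩) → ⊥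
      rest (inj₁ ne) = lin 5 (λ a b c d e → a ≐ (2 ⊗ b) ⊹ 1 ⇛ a ≑ c ⊕ d ⇛ 2 ⊠ b ≐ 𝕤 e ⇛ κ 3 ≼ d ⇛ (2 ⊗ e) ⊹ 1 ≼ c ⇛ ⊢⊥)
          (tch A S) (∣ S ∣) (tch A (S ∖ ⟨ p ⟩)) (dg A p (∁ S)) (∣ S ∖ ⟨ p ⟩ ∣) (proj₂ cS) (tch-rem sA S Sp)
          (cnt-rem S Sp) dp (many (S ∖ ⟨ p ⟩) (λ i h → proj₁ cS i (∧ˡ (S i) (not (i == p)) h)) ne)
      rest (inj₂ none) = no-diamond t p q r (record { Ut = D-U Dt ; Up = not-elim (proj₁ cS p Sp) ; tp = ∈a ; deg-t
          = D-deg Dt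
        ; deg-p = lin 5 (λ a b c d e → a ≑ b ⇛ a ≐ c ⇛ c ≐ (2 ⊗ d) ⊹ 1 ⇛ 2 ⊠ d ≐ 𝕤 e ⇛ 2 ⊠ e ≐ κ 0 ⇛ 1 ⊢ b ≐ κ 3)
            (tch A ⟨ p ⟩) (∣ A p ∣) (tch A S) (∣ S ∣) (∣ S ∖ ⟨ p ⟩ ∣) (star A sA p)
            (tch≗ A {⟨ p ⟩} {S} (λ i → tab 2 (λ a b → ∼ (b ∧ not a) ⇛ a ⊃ b ⇛ ⊩ a ⇔ b) (i == p) (S i) (none i)
            (at S Sp i))) (proj₂ cS) (cnt-rem S Sp) (cnt-empty none)
        ; q≢r = b≢c ; tq = ∈b ; tr = ∈c ; pq = pq ; pr = pr ; qr = qr ; not-both = not-both })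
    by (inj₂ (Y , tY , Yt , Yq , Yp)) = tight-over tY Yt Yp (cnt-three {X = A p ∩ Y} {t} {q} {r} (flip ∈a & Yt)
        (pq & Yq)
      (pr & has-r Y (tight-deg tY Yt Yq (≢-sym (≢adj ∈b))) Yp) (≢adj ∈b) (≢adj ∈c) b≢c)

  record Neighbourhood (t : Fin n) (e : Bool) : Set where
    field
      {a b c} : Fin n
      tri : Triple (A t) a b c
      ab : A a b ≡ e
      ac : A a c ≡ e
      bc : A b c ≡ e

  classify : ∀ {t} → W t ≡ true → D t ≡ true → Neighbourhood t false ⊎ Neighbourhood t true
  classify {t} Wt∈ Dt = go (triple (A t) (D-deg Dt))
    where
    go : ∃[ a ] ∃[ b ] ∃[ c ] Triple (A t) a b c → Neighbourhood t false ⊎ Neighbourhood t true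
    go (a , b , c , tr) = by (bool (A a b)) (bool (A a c)) (bool (A b c))
      where
      by : Decided (A a b) → Decided (A a c) → Decided (A b c) → Neighbourhood t false ⊎ Neighbourhood t true
      by (inj₂ x) (inj₂ y) (inj₂ z) = inj₁ (record { tri = tr ; ab = x ; ac = y ; bc = z })
      by (inj₁ x) (inj₁ y) (inj₁ z) = inj₂ (record { tri = tr ; ab = x ; ac = y ; bc = z })
      by (inj₁ x) (inj₂ y) (inj₂ z) = ⊥-elim (one-pair Wt∈ Dt tr x y z)
      by (inj₂ x) (inj₁ y) (inj₂ z) = ⊥-elim (one-pair Wt∈ Dt (triple-swap₂₃ tr) y x (flip z))
      by (inj₂ x) (inj₂ y) (inj₁ z) = ⊥-elim (one-pair Wt∈ Dt (triple-swap₂₃ (triple-swap₁₂ tr)) z (flip x) (flip y))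
      by (inj₁ x) (inj₁ y) (inj₂ z) = ⊥-elim (two-pairs Wt∈ Dt tr x y z)
      by (inj₁ x) (inj₂ y) (inj₁ z) = ⊥-elim (two-pairs Wt∈ Dt (triple-swap₁₂ tr) (flip x) z y)
      by (inj₂ x) (inj₁ y) (inj₁ z) = ⊥-elim (two-pairs Wt∈ Dt (triple-swap₁₂ (triple-swap₂₃ tr)) (flip y) (flip z) x)

-- Cubic vertices with an independent neighbourhood do not occur

module Clusters {n : ℕ} {A : ES n} {U W : VS n} (rel : Relative A U) (att : Attached A U ⊎ Apex A U)
    (irrd : Irreducible A U) (mini : MinimalCotight A U W) where
  open Relative rel
  open RelativeFacts rel
  open Joined att
  open Irreducible irrd
  open MinimalCotight mini
  open Minimal rel att irrd mini

  independent : VS n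
  independent t = (W t ∧ D t) ∧ (ins A (A t) ≡ᵇ 0)

  ind-W : ∀ {t} → independent t ≡ true → W t ≡ true
  ind-W {t} p = ∧ˡ (W t) (D t) (∧ˡ _ _ p)

  ind-D : ∀ {t} → independent t ≡ true → D t ≡ true
  ind-D {t} p = ∧ʳ (W t) (D t) (∧ˡ _ _ p)

  ind-edge : ∀ {t x y} → independent t ≡ true → A t x ≡ true → A t y ≡ true → A x y ≡ false
  ind-edge {t} {x} {y} p tx ty = go (bool (A x y))
    where
    zero-edges : ins A (A t) ≡ 0
    zero-edges = ≡ᵇ⇒≡ (ins A (A t)) 0 (subst T (sym (∧ʳ ((W t) ∧ (D t)) (ins A (A t) ≡ᵇ 0) p)) _)
    go : Decided (A x y) → A x y ≡ false
    go (inj₂ q) = q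
    go (inj₁ q) = ⊥-elim (lin 1 (λ a → a ≐ κ 0 ⇛ κ 1 ≼ a ⇛ ⊢⊥) (ins A (A t)) zero-edges
        (ec-pos (inn-simple sA (A t)) {x} {y} (q & tx & ty)))

  nbh-independent : ∀ {t} → W t ≡ true → D t ≡ true → Neighbourhood t false → independent t ≡ true
  nbh-independent {t} Wt∈ Dt nb = (Wt∈ & Dt) & T⇒≡ (≡⇒≡ᵇ (ins A (A t)) 0 (ec-empty (λ i j → 𝔹.¬-not (λ h →
      absurd i j (∧ˡ (A i j) ((A t i) ∧ (A t j)) h) (members (∧ˡ (A t i) (A t j) (∧ʳ (A i j) _ h)))
          (members (∧ʳ (A t i) (A t j) (∧ʳ (A i j) _ h)))))))
    where
    open Neighbourhood nb
    open Triple tri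
    absurd : ∀ i j → A i j ≡ true → i ≡ a ⊎ i ≡ b ⊎ i ≡ c → j ≡ a ⊎ j ≡ b ⊎ j ≡ c → ⊥
    absurd i j h (inj₁ refl) (inj₁ refl) = ≢adj h refl
    absurd i j h (inj₁ refl) (inj₂ (inj₁ refl)) = clash h ab
    absurd i j h (inj₁ refl) (inj₂ (inj₂ refl)) = clash h ac
    absurd i j h (inj₂ (inj₁ refl)) (inj₁ refl) = clash (flip h) ab
    absurd i j h (inj₂ (inj₁ refl)) (inj₂ (inj₁ refl)) = ≢adj h refl
    absurd i j h (inj₂ (inj₁ refl)) (inj₂ (inj₂ refl)) = clash h bc
    absurd i j h (inj₂ (inj₂ refl)) (inj₁ refl) = clash (flip h) ac
    absurd i j h (inj₂ (inj₂ refl)) (inj₂ (inj₁ refl)) = clash (flip h) bc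
    absurd i j h (inj₂ (inj₂ refl)) (inj₂ (inj₂ refl)) = ≢adj h refl

  -- A complete neighbourhood of `z` contains `t` and a vertex adjacent to `t`, which with `z` forms
  -- two adjacent neighbours of `t`.
  ind-closed : ∀ {t z} → independent t ≡ true → W z ≡ true → D z ≡ true → A t z ≡ true → independent z ≡ true
  ind-closed {t} {z} p Wz Dz tz = go (classify Wz Dz)
    where
    go : Neighbourhood z false ⊎ Neighbourhood z true → independent z ≡ true
    go (inj₁ nb) = nbh-independent Wz Dz nb
    go (inj₂ nb) = ⊥-elim (by (members (flip tz)))
      where
      open Neighbourhood nb
      open Triple tri
      by : t ≡ a ⊎ t ≡ b ⊎ t ≡ c → ⊥
      by (inj₁ refl) = clash ∈b (ind-edge p tz ab)
      by (inj₂ (inj₁ refl)) = clash ∈a (ind-edge p tz (flip ab))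
      by (inj₂ (inj₂ refl)) = clash ∈a (ind-edge p tz (flip ac))

  -- `tree` is the lower bound on edges that connected graphs satisfy; with `forest` it makes `T` a
  -- tree without any mention of paths.
  record Cluster (t₀ : Fin n) (T : VS n) : Set where
    field
      ⊆ind : T ⊆ independent
      root : T t₀ ≡ true
      tree : ∣ T ∣ ≤ ins A T + 1

  ClosedCluster : Fin n → Set
  ClosedCluster t₀ = ∃[ T ] (Cluster t₀ T × (∀ i j → A i j ≡ true → T i ≡ true → independent j ≡ true → T j ≡ true))

  grow-cluster : ∀ {t₀} k T → Cluster t₀ T → ∣ independent ∖ T ∣ ≤ k → ClosedCluster t₀
  grow-cluster {t₀} k T cl bound = go k bound (edge? (λ i j → A i j ∧ (T i ∧ (independent j ∧ not (T j)))))
    where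
    open Cluster cl
    go : ∀ k → ∣ independent ∖ T ∣ ≤ k → Edge? (λ i j → A i j ∧ (T i ∧ (independent j ∧ not (T j)))) → ClosedCluster t₀
    go k bound (inj₂ none) = T , cl , (λ i j ij Ti Ij → tab 4 (λ a b c d → ∼ (d ∧ c ∧ b ∧ not a) ⇛ ! d ⇛ ! c ⇛ ! b ⇛ ⊩ !
        a) (T j) (independent j) (T i) (A i j) (none i j) ij Ti Ij)
    go zero bound (inj₁ (i , j , h)) = ⊥-elim (1≰0 (≤-trans
        (cnt-pos {X = independent ∖ T} {j} (∧ʳ (T i) ((independent j) ∧ not (T j)) (∧ʳ (A i j) _ h))) bound))
    go (suc k) bound (inj₁ (i , j , h)) = grow-cluster k (T ∪ ⟨ j ⟩) (record
        { ⊆ind = λ x p → (tab 3 (λ a b c → ! (b ∨ a) ⇛ b ⊃ c ⇛ a ⊃ c ⇛ ⊩ ! c) (x == j) (T x) (independent x) p (⊆ind x)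
            (at independent Ij x))
        ; root = tab 2 (λ a b → ! a ⇛ ⊩ ! (a ∨ b)) (T t₀) (t₀ == j) root
        ; tree = (lin 5 (λ a b c d e → a ≐ 𝕤 b ⇛ c ≑ d ⊕ e ⇛ b ≼ d ⊹ 1 ⇛ κ 1 ≼ e ⇛ 1 ⊢ a ≼ c ⊹ 1) (∣ T ∪ ⟨ j ⟩ ∣)
            (∣ T ∣) (ins A (T ∪ ⟨ j ⟩)) (ins A T) (dg A j T) (cnt-add T Tj) (ins-add sA T Tj) tree
            (cnt-pos {X = A j ∩ T} {i} (flip (∧ˡ (A i j) ((T i) ∧ (independent j) ∧ not (T j)) h) &
            (∧ˡ (T i) ((independent j) ∧ not (T j)) (∧ʳ (A i j) _ h))))) })
        (lin 4 (λ a b c d → a ≼ 𝕤 b ⇛ a ≑ 𝕤 c ⇛ c ≑ d ⇛ 1 ⊢ d ≼ b) (∣ independent ∖ T ∣) k (∣ independent ∖ T ∖ ⟨ j ⟩ ∣)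
            (∣ independent ∖ (T ∪ ⟨ j ⟩) ∣) bound (cnt-rem (independent ∖ T) {j} (Ij & not-intro Tj))
            (cnt≗ {X = independent ∖ T ∖ ⟨ j ⟩} {independent ∖ (T ∪ ⟨ j ⟩)}
            (λ x → tab 3 (λ a b c → ⊩ (c ∧ not b) ∧ not a ⇔ c ∧ not (b ∨ a)) (x == j) (T x) (independent x))))
      where
      Ij : independent j ≡ true
      Ij = ∧ˡ (independent j) (not (T j)) (∧ʳ (T i) _ (∧ʳ (A i j) _ h))
      Tj : T j ≡ false
      Tj = not-elim (∧ʳ (independent j) (not (T j)) (∧ʳ (T i) _ (∧ʳ (A i j) _ h)))

  module FromCluster {t₀ : Fin n} {T : VS n} (cl : Cluster t₀ T)
      (closed : ∀ i j → A i j ≡ true → T i ≡ true → independent j ≡ true → T j ≡ true) where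
    open Cluster cl

    T⊆D : T ⊆ D
    T⊆D i p = ind-D (⊆ind i p)

    T⊆W : T ⊆ W
    T⊆W i p = ind-W (⊆ind i p)

    tch-T : tch A T + ins A T ≡ 3 * ∣ T ∣
    tch-T = degree-sum-const sA T 3 (λ v p → D-deg (T⊆D v p))

    -- T spans |T| − 1 edges and sends 2|T| + 1 edges to its surroundings, so a tight set containing only a part of T would lose too many.
    absorb : ∀ {Z} → TightSet A U Z → ∀ {t s u} → T t ≡ true → Z t ≡ true → A t s ≡ true → T s ≡ false → Z s ≡ false → Z
        u ≡ true → u ≢ t → T ⊆ Z
    absorb {Z} (Z⊆ , Zt) {t} {s} {u} Tt Zt∈ ts Ts Zs Zu u≢t i Ti = by (bool (Z i))
      where
      -- `Q` collects edges that leave `Z` from the part of `T` in `Z`: those within `T`, which form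
      -- `P`, and the exit `ts`. `E₂` consists of the edges of `T` not inside `Z`.
      P Q E₂ : ES n
      P = btw A (T ∩ Z) (T ∖ Z)
      Q i j = P i j ∨ pair t s i j
      E₂ i j = A i j ∧ ((T i ∧ T j) ∧ not (Z i ∧ Z j))
      facts : ∀ i j → pair t s i j ≡ true → (((T i ∧ Z i) ∨ (T j ∧ Z j)) ∧ (not (Z i ∧ Z j) ∧ not (T i ∧ T j))) ≡ true
      facts = pair-apart (λ i j → ((T i ∧ Z i) ∨ (T j ∧ Z j)) ∧ (not (Z i ∧ Z j) ∧ not (T i ∧ T j)))
        (λ i j → tab 4 (λ a b c d → ⊩ ((b ∧ d) ∨ (a ∧ c)) ∧ not (d ∧ c) ∧ not (b ∧ a) ⇔ ((a ∧ c) ∨ (b ∧ d)) ∧ not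
            (c ∧ d) ∧ not (a ∧ b)) (T j) (T i) (Z j) (Z i))
        (tab 4 (λ a b c d → ! a ⇛ ! b ⇛ ∼ c ⇛ ∼ d ⇛ ⊩ ! (((a ∧ b) ∨ (c ∧ d)) ∧ not (b ∧ d) ∧ not (a ∧ c))) (T t) (Z t)
            (T s) (Z s) Tt Zt∈ Ts Zs)
      ∣Z∣ : ∣ Z ∣ ≡ ∣ T ∩ Z ∣ + ∣ Z ∖ T ∣
      ∣Z∣ = cnt12 Z (T ∩ Z) (Z ∖ T) (λ i → tab 2 (λ a b → ⊩ 𝟙 a ≃ 𝟙 (b ∧ a) + 𝟙 (a ∧ not b)) (Z i) (T i))
      contra : (T ∖ Z) i ≡ true → Empty? (Z ∖ T) → ⊥
      contra p (inj₁ ne) = lin 15 (λ a b c d e f g h i j k l m n o → a ⊹ 2 ≑ 2 ⊗ b ⇛ 2 ⊠ b ≑ c ⊕ d ⇛ e ⊹ 2 ≼ 2 ⊗ d ⇛ a ⊕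
          f ≼ e ⊕ g ⇛ f ≑ h ⊕ i ⇛ i ≑ κ 1 ⇛ g ⊕ j ≐ 3 ⊗ c ⇛ k ⊹ 1 ≼ l ⇛ m ≑ c ⊕ l ⇛ m ≼ n ⊹ 1 ⇛ n ≼ j ⊕ o ⇛ o ≼ k ⊕ h ⇛
          ⊢⊥) (ins A Z) (∣ Z ∣) (∣ T ∩ Z ∣) (∣ Z ∖ T ∣) (ins A (Z ∖ T)) (ec Q) (tch A (T ∩ Z)) (ec P) (ec (pair t s))
          (ins A (T ∩ Z)) (ins A (T ∖ Z)) (∣ T ∖ Z ∣) (∣ T ∣) (ins A T) (ec E₂) Zt ∣Z∣
          (sparse (Z ∖ T) (λ j q → Z⊆ j (∧ˡ (Z j) (not (T j)) q)) ne) (ec22 (inn A Z) Q (inn A (Z ∖ T)) (inc A (T ∩ Z))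
          (λ i j → tab 6 (λ a b c d e f → a ⊃ ((c ∧ e) ∨ (b ∧ d)) ∧ not (e ∧ d) ∧ not (c ∧ b) ⇛ a ⊃ f ⇛ ⊩ 𝟙 (f ∧ e ∧ d)
          + 𝟙 ((f ∧ (((c ∧ e) ∧ b ∧ not d) ∨ ((c ∧ not e) ∧ b ∧ d))) ∨ a) ≦ 𝟙 (f ∧ (e ∧ not c) ∧ d ∧ not b) + 𝟙
          (f ∧ ((c ∧ e) ∨ (b ∧ d)))) (pair t s i j) (T j) (T i) (Z j) (Z i) (A i j) (facts i j) (pair-⊆ sA ts i j)))
          (ec12 Q P (pair t s) (λ i j → tab 6 (λ a b c d e f → a ⊃ ((c ∧ e) ∨ (b ∧ d)) ∧ not (e ∧ d) ∧ not (c ∧ b) ⇛ ⊩ 𝟙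
          ((f ∧ (((c ∧ e) ∧ b ∧ not d) ∨ ((c ∧ not e) ∧ b ∧ d))) ∨ a) ≃ 𝟙
          (f ∧ (((c ∧ e) ∧ b ∧ not d) ∨ ((c ∧ not e) ∧ b ∧ d))) + 𝟙 a) (pair t s i j) (T j) (T i) (Z j) (Z i) (A i j)
          (facts i j))) (ec-pair (≢adj ts)) (degree-sum-const sA (T ∩ Z) 3 (λ v q → D-deg (T⊆D v (∧ˡ (T v) (Z v) q))))
          (forest (T ∖ Z) (λ j q → T⊆D j (∧ˡ (T j) (not (Z j)) q)) (i , p)) (∣∩∣+∣∖∣ T Z) tree
          (ec12≤ (inn A T) (inn A (T ∩ Z)) E₂ (λ i j → tab 5 (λ a b c d e → ⊩ 𝟙 (c ∧ b ∧ a) ≦ 𝟙 (c ∧ (b ∧ e) ∧ a ∧ d) +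
          𝟙 (c ∧ (b ∧ a) ∧ not (e ∧ d))) (T j) (T i) (A i j) (Z j) (Z i)))
          (ec12≤ E₂ (inn A (T ∖ Z)) P (λ i j → tab 5 (λ a b c d e → ⊩ 𝟙 (e ∧ (d ∧ c) ∧ not (b ∧ a)) ≦ 𝟙
          (e ∧ (d ∧ not b) ∧ c ∧ not a) + 𝟙 (e ∧ (((d ∧ b) ∧ c ∧ not a) ∨ ((d ∧ not b) ∧ c ∧ a)))) (Z j) (Z i) (T j)
          (T i) (A i j)))
      contra p (inj₂ none) = lin 2 (λ a b → a ⊹ 2 ≑ 2 ⊗ b ⇛ κ 2 ≼ b ⇛ a ⊹ 1 ≼ b ⇛ ⊢⊥) (ins A Z) (∣ Z ∣) Zt
          (cnt-two {X = Z} Zt∈ Zu (≢-sym u≢t)) (forest Z (λ j q → T⊆D j (tab 2 (λ a b → ! a ⇛ ∼ (a ∧ not b) ⇛ ⊩ ! b)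
          (Z j) (T j) q (none j))) (t , Zt∈))
      by : Decided (Z i) → Z i ≡ true
      by (inj₁ q) = q
      by (inj₂ q) = ⊥-elim (contra (Ti & not-intro q) (empty? (Z ∖ T)))

    record Exit (t s : Fin n) : Set where
      field
        Tt : T t ≡ true
        ts : A t s ≡ true
        Ws : W s ≡ true
        Ts : T s ≡ false

    record Barrier (t s : Fin n) : Set where
      field
        Z : VS n
        tightZ : TightSet A U Z
        T⊆Z : T ⊆ Z
        Zs : Z s ≡ false
        two : 2 ≤ dg A t Z

    -- The outer end `s` is not cubic, for otherwise it would be independent too and belong to the
    -- closed set `T`. So contracting `t` onto another neighbour and dropping `ts` is blocked by a
    -- tight set within `W`, and `absorb` puts all of `T` into it.
    barrier : ∀ {t s} → Exit t s → Barrier t s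
    barrier {t} {s} ex = go (triple (A t) (D-deg (T⊆D t Tt)))
      where
      open Exit ex
      Ds : D s ≡ false
      Ds = 𝔹.¬-not (λ p → clash (closed t s ts Tt (ind-closed (⊆ind t Tt) Ws p ts)) Ts)
      through : ∀ {u z} → Triple (A t) u s z → Barrier t s
      through {u} {z} tr = build (obstacle-in-W (legal₃ (T⊆W t Tt) tr
          (ind-edge (⊆ind t Tt) (Triple.∈a tr) (Triple.∈c tr))) (T⊆W t Tt) Ws Ds)
        where
        u≢t : u ≢ t
        u≢t e = ≢adj (Triple.∈a tr) (sym e)
        build : ∃[ Y ] (TightSet A U Y × Y ⊆ W × Y t ≡ true × Y u ≡ true × Y s ≡ false) → Barrier t s
        build (Y , tY , _ , Yt , Yu , Ys) = record { Z = Y ; tightZ = tY ; T⊆Z = absorb tY Tt Yt ts Ts Ys Yu u≢t ; Zs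
            = Ys ; two = tight-deg tY Yt Yu u≢t }
      go : ∃[ a ] ∃[ b ] ∃[ c ] Triple (A t) a b c → Barrier t s
      go (a , b , c , tr) = by (Triple.members tr ts)
        where
        by : s ≡ a ⊎ s ≡ b ⊎ s ≡ c → Barrier t s
        by (inj₁ refl) = through (triple-swap₁₂ tr)
        by (inj₂ (inj₁ refl)) = through tr
        by (inj₂ (inj₂ refl)) = through (triple-swap₂₃ tr)

    -- The barriers intersect in a tight set around `T` which both exits leave. Only 2|T| + 1 edges
    -- touch `T`, and losing two of them contradicts tightness. If the intersection is `T` itself,
    -- `T` is one vertex, and its two barriers must share one of its three neighbours.
    two-exits : ∀ {t s t′ s′} → Exit t s → Exit t′ s′ → pair t s t′ s′ ≡ false → ⊥
    two-exits {t} {s} {t′} {s′} ex ex′ distinct = by (empty? (Y ∖ T))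
      where
      module E = Exit ex
      module E′ = Exit ex′
      open Barrier (barrier ex)
      open Barrier (barrier ex′) using () renaming (Z to Z′; tightZ to tightZ′; T⊆Z to T⊆Z′; Zs to Zs′; two to two′)
      Y : VS n
      Y = Z ∩ Z′
      tightY : TightSet A U Y
      tightY = proj₂ (tight-∪∩ tightZ tightZ′ (T⊆Z t E.Tt) (T⊆Z′ t E.Tt))
      T⊆Y : T ⊆ Y
      T⊆Y i p = T⊆Z i p & T⊆Z′ i p
      Q : ES n
      Q i j = pair t s i j ∨ pair t′ s′ i j
      leaves : ∀ {a b} → T a ≡ true → Y b ≡ false → ∀ i j → pair a b i j ≡ true → ((T i ∨ T j) ∧ not (Y i ∧ Y j)) ≡ true
      leaves {a} {b} Ta Yb = pair-apart (λ i j → (T i ∨ T j) ∧ not (Y i ∧ Y j))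
        (λ i j → cong₂ _∧_ (𝔹.∨-comm (T i) (T j)) (cong not (𝔹.∧-comm (Y i) (Y j))))
            (tab 4 (λ a b c d → ! a ⇛ ∼ b ⇛ ⊩ ! ((a ∨ d) ∧ not (c ∧ b))) (T a) (Y b) (Y a) (T b) Ta Yb)
      Ys : Y s ≡ false
      Ys = cong (_∧ Z′ s) Zs
      Ys′ : Y s′ ≡ false
      Ys′ = tab 2 (λ a b → ∼ a ⇛ ⊩ ∼ (b ∧ a)) (Z′ s′) (Z s′) Zs′
      ∣Y∣ : ∣ Y ∣ ≡ ∣ T ∣ + ∣ Y ∖ T ∣
      ∣Y∣ = ∣⊆∣+∣∖∣ Y T T⊆Y
      by : Empty? (Y ∖ T) → ⊥
      by (inj₁ ne) = lin 10 (λ a b c d e f g h i j → a ⊹ 2 ≑ 2 ⊗ b ⇛ 2 ⊠ b ≑ c ⊕ d ⇛ e ⊹ 2 ≼ 2 ⊗ d ⇛ f ⊕ g ≐ 3 ⊗ c ⇛ c ≼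
          g ⊹ 1 ⇛ a ⊕ h ≼ e ⊕ f ⇛ h ≑ i ⊕ j ⇛ i ≑ κ 1 ⇛ j ≑ κ 1 ⇛ ⊢⊥) (ins A Y) (∣ Y ∣) (∣ T ∣) (∣ Y ∖ T ∣)
          (ins A (Y ∖ T)) (tch A T) (ins A T) (ec Q) (ec (pair t s)) (ec (pair t′ s′)) (proj₂ tightY) ∣Y∣
          (sparse (Y ∖ T) (λ i p → proj₁ tightY i (∧ˡ (Y i) (not (T i)) p)) ne) tch-T tree
          (ec22 (inn A Y) Q (inn A (Y ∖ T)) (inc A T) (λ i j → tab 7 (λ a b c d e f g → a ⊃ (e ∨ d) ∧ not (c ∧ b) ⇛ f ⊃
          (e ∨ d) ∧ not (c ∧ b) ⇛ a ⊃ g ⇛ f ⊃ g ⇛ ⊩ 𝟙 (g ∧ c ∧ b) + 𝟙 (a ∨ f) ≦ 𝟙 (g ∧ (c ∧ not e) ∧ b ∧ not d) + 𝟙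
          (g ∧ (e ∨ d))) (pair t s i j) (Y j) (Y i) (T j) (T i) (pair t′ s′ i j) (A i j) (leaves E.Tt Ys i j)
          (leaves E′.Tt Ys′ i j) (pair-⊆ sA E.ts i j) (pair-⊆ sA E′.ts i j)))
          (ec12 Q (pair t s) (pair t′ s′) (λ i j → tab 2 (λ a b → a ⊃ not b ⇛ ⊩ 𝟙 (b ∨ a) ≃ 𝟙 b + 𝟙 a) (pair t′ s′ i j)
          (pair t s i j) (pair-apart (λ i j → not (pair t s i j)) (λ i j → cong not (pair-symm t s i j))
          (not-intro distinct) i j))) (ec-pair (≢adj E.ts)) (ec-pair (≢adj E′.ts))
      by (inj₂ none) = lin 3 (λ a b c → a ≼ κ 1 ⇛ b ≐ a ⊕ c ⇛ c ≐ κ 0 ⇛ κ 2 ≼ b ⇛ ⊢⊥) (∣ T ∣) (∣ Y ∣) (∣ Y ∖ T ∣) one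
          ∣Y∣ (cnt-empty none) big
        where
        one : ∣ T ∣ ≤ 1
        one = lin 5 (λ a b c d e → a ⊹ 2 ≑ 2 ⊗ b ⇛ 2 ⊠ b ≑ c ⊕ d ⇛ 2 ⊠ d ≑ κ 0 ⇛ e ⊹ 1 ≼ c ⇛ a ≼ e ⇛ 1 ⊢ c ≼ κ 1)
            (ins A Y) (∣ Y ∣) (∣ T ∣) (∣ Y ∖ T ∣) (ins A T) (proj₂ tightY) ∣Y∣ (cnt-empty none)
            (forest T T⊆D (t , E.Tt)) (ec-⊆ {E = inn A Y} {inn A T}
            (λ i j p → tab 5 (λ a b c d e → ! (c ∧ b ∧ a) ⇛ ∼ (b ∧ not d) ⇛ ∼ (a ∧ not e) ⇛ ⊩ ! (c ∧ d ∧ e)) (Y j) (Y i)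
            (A i j) (T i) (T j) p (none i) (none j)))
        same : t ≡ t′
        same = go (t ≟ t′)
          where
          go : Dec (t ≡ t′) → t ≡ t′
          go (yes e) = e
          go (no e) = ⊥-elim (1≰0 (≤-pred′ (≤-trans (cnt-two {X = T} E.Tt E′.Tt e) one)))
            where
            ≤-pred′ : 2 ≤ 1 → 1 ≤ 0
            ≤-pred′ (s≤s h) = h
        common : 1 ≤ dg A t Y
        common = lin 6 (λ a b c d e f → κ 2 ≼ a ⇛ κ 2 ≼ b ⇛ c ≐ κ 3 ⇛ d ⊕ e ≑ a ⊕ b ⇛ d ≼ c ⇛ e ≼ f ⇛ 1 ⊢ κ 1 ≼ f)
            (dg A t Z) (dg A t Z′) (∣ A t ∣) (∣ (A t ∩ Z) ∪ (A t ∩ Z′) ∣) (∣ (A t ∩ Z) ∩ (A t ∩ Z′) ∣) (dg A t Y) two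
            (subst (λ x → 2 ≤ dg A x Z′) (sym same) two′) (D-deg (T⊆D t E.Tt)) (∣∪∣+∣∩∣ (A t ∩ Z) (A t ∩ Z′))
            (cnt≤ {X = (A t ∩ Z) ∪ (A t ∩ Z′)} {A t} (λ i p → tab 3 (λ a b c → ! ((b ∧ c) ∨ (b ∧ a)) ⇛ ⊩ ! b) (Z′ i)
            (A t i) (Z i) p)) (cnt≤ {X = (A t ∩ Z) ∩ (A t ∩ Z′)} {A t ∩ Y}
            (λ i p → tab 3 (λ a b c → ! ((b ∧ c) ∧ b ∧ a) ⇛ ⊩ ! (b ∧ c ∧ a)) (Z′ i) (A t i) (Z i) p))
        big : 2 ≤ ∣ Y ∣
        big = go (pos⇒NE (A t ∩ Y) common)
          where
          go : NE (A t ∩ Y) → 2 ≤ ∣ Y ∣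
          go (m , p) = cnt-two {X = Y} {t} {m} (T⊆Y t E.Tt) (∧ʳ (A t m) (Y m) p) (≢adj (∧ˡ (A t m) (Y m) p))

    B : ES n
    B = btw A T (W ∖ T)

    sB : Simple B
    sB = simple (λ i j → tab 6 (λ a b c d e f → a ⇔ b ⇛ ⊩ a ∧ ((d ∧ f ∧ not c) ∨ ((e ∧ not d) ∧ c)) ⇔ b ∧
        ((c ∧ e ∧ not d) ∨ ((f ∧ not c) ∧ d))) (A i j) (A j i) (T j) (T i) (W i) (W j) (symm sA i j))
                (λ i → cong (_∧ _) (irr sA i))

    orient : ∀ {E} → Simple E → E ⊆ₑ B → ∀ {i j} → E i j ≡ true → ∃[ t ] ∃[ s ] (Exit t s × E t s ≡ true)
    orient {E} sE E⊆B {i} {j} h = go (bool (T i))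
      where
      go : Decided (T i) → ∃[ t ] ∃[ s ] (Exit t s × E t s ≡ true)
      go (inj₁ Ti) = i , j , record { Tt = Ti ; ts = tab 5 (λ a b c d e → ! (e ∧ ((b ∧ d ∧ not a) ∨ ((c ∧ not b) ∧ a)))
          ⇛ ⊩ ! e) (T j) (T i) (W i) (W j) (A i j) (E⊆B i j h)
        ; Ws = tab 5 (λ a b c d e → ! a ⇛ ! (e ∧ ((a ∧ d ∧ not b) ∨ ((c ∧ not a) ∧ b))) ⇛ ⊩ ! d) (T i) (T j) (W i) (W j)
            (A i j) Ti (E⊆B i j h)
        ; Ts = (tab 5 (λ a b c d e → ! a ⇛ ! (e ∧ ((a ∧ d ∧ not b) ∨ ((c ∧ not a) ∧ b))) ⇛ ⊩ ∼ b) (T i) (T j) (W i)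
            (W j) (A i j) Ti (E⊆B i j h)) } , h
      go (inj₂ Ti) = j , i , record { Tt = tab 5 (λ a b c d e → ∼ a ⇛ ! (e ∧ ((a ∧ d ∧ not b) ∨ ((c ∧ not a) ∧ b))) ⇛ ⊩
          ! b) (T i) (T j) (W i) (W j) (A i j) Ti (E⊆B i j h)
        ; ts = flip (tab 5 (λ a b c d e → ! (e ∧ ((b ∧ d ∧ not a) ∨ ((c ∧ not b) ∧ a))) ⇛ ⊩ ! e) (T j) (T i) (W i) (W j)
            (A i j) (E⊆B i j h))
        ; Ws = (tab 5 (λ a b c d e → ∼ a ⇛ ! (e ∧ ((a ∧ d ∧ not b) ∨ ((c ∧ not a) ∧ b))) ⇛ ⊩ ! c) (T i) (T j) (W i)
            (W j) (A i j) Ti (E⊆B i j h)) ; Ts = Ti } , trans (symm sE j i) h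

    -- At least 2|T| + 1 edges touch `T`, and at most one of them touches the rest of `W`. So that
    -- rest is cotight, although it contains `bad`.
    few-exits : ec B ≤ 1 → ⊥
    few-exits h = clash (descend (W ∖ T) (λ i p → ∧ˡ (W i) (not (T i)) p)
        (lin 8 (λ a b c d e f g h → a ≼ κ 1 ⇛ b ≐ (2 ⊗ c) ⊹ 1 ⇛ 2 ⊠ c ≐ d ⊕ e ⇛ f ⊕ g ≑ 3 ⊗ d ⇛ g ⊹ 1 ≼ d ⇛ f ⊕ h ≼ b ⊕
            a ⇛ 1 ⊢ h ≼ (2 ⊗ e) ⊹ 1) (ec B) (tch A W) (∣ W ∣) (∣ T ∣) (∣ W ∖ T ∣) (tch A T) (ins A T) (tch A (W ∖ T)) h
            Wt (∣⊆∣+∣∖∣ W T T⊆W) tch-T (forest T T⊆D (t₀ , root)) (ec22 (inc A T) (inc A (W ∖ T)) (inc A W) B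
            (λ i j → tab 5 (λ a b c d e → a ⊃ b ⇛ c ⊃ d ⇛ ⊩ 𝟙 (e ∧ (a ∨ c)) + 𝟙 (e ∧ ((b ∧ not a) ∨ (d ∧ not c))) ≦ 𝟙
            (e ∧ (b ∨ d)) + 𝟙 (e ∧ ((a ∧ d ∧ not c) ∨ ((b ∧ not a) ∧ c)))) (T i) (W i) (T j) (W j) (A i j) (T⊆W i)
            (T⊆W j))))
        (T⊆W t₀ root) (tab 2 (λ a b → ! a ⇛ ⊩ ∼ (b ∧ not a)) (T t₀) (W t₀) root)
            (Wbad & not-intro (𝔹.¬-not (λ p → clash (T⊆D bad p) Dbad)))) Dbad

    impossible : ⊥
    impossible = go (edge? B)
      where
      go : Edge? B → ⊥
      go (inj₂ none) = few-exits (lin 1 (λ a → a ≐ κ 0 ⇛ 1 ⊢ a ≼ κ 1) (ec B) (ec-empty none))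
      go (inj₁ (i , j , h)) = first (orient sB (λ _ _ p → p) h)
        where
        first : ∃[ t ] ∃[ s ] (Exit t s × B t s ≡ true) → ⊥
        first (t , s , ex , Bts) = second (edge? (B ⊖ (t , s)))
          where
          second : Edge? ((B ⊖ (t , s))) → ⊥
          second (inj₂ none) = few-exits (lin 2 (λ a b → a ≐ 𝕤 b ⇛ b ≐ κ 0 ⇛ 1 ⊢ a ≼ κ 1) (ec B) (ec (B ⊖ (t , s)))
              (ec-rem sB Bts) (ec-empty none))
          second (inj₁ (x , y , h)) = third (orient (⊖-simple sB (t , s)) (⊖-⊆ B (t , s)) h)
            where
            third : ∃[ t′ ] ∃[ s′ ] (Exit t′ s′ × (B ⊖ (t , s)) t′ s′ ≡ true) → ⊥
            third (t′ , s′ , ex′ , h′) = two-exits ex ex′ (not-elim (∧ʳ (B t′ s′) (not (pair t s t′ s′)) h′))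

  complete : ∀ {t} → W t ≡ true → D t ≡ true → Neighbourhood t true
  complete {t} Wt∈ Dt = go (classify Wt∈ Dt)
    where
    go : Neighbourhood t false ⊎ Neighbourhood t true → Neighbourhood t true
    go (inj₂ nb) = nb
    go (inj₁ nb) = ⊥-elim (finish (grow-cluster ∣ independent ∖ ⟨ t ⟩ ∣ ⟨ t ⟩ (record
        { ⊆ind = λ i p → at independent (nbh-independent Wt∈ Dt nb) i p ; root = ==-refl t
        ; tree = (lin 2 (λ a b → a ≐ κ 1 ⇛ 1 ⊢ a ≼ b ⊹ 1) (∣ ⟨ t ⟩ ∣) (ins A ⟨ t ⟩) (cnt-single t)) }) ≤-refl))
      where
      finish : ClosedCluster t → ⊥
      finish (T , cl , closed) = FromCluster.impossible cl closed

-- Cubic vertices in copies of K₄, and the two exceptional graphs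

record LooksLikeK5⁻ {n : ℕ} (A : ES n) : Set where
  field
    {t s p q r} : Fin n
    cover : ∀ i → i ≢ t → i ≢ s → i ≢ p → i ≢ q → i ≢ r → ⊥
    t≢s : t ≢ s
    ts : A t s ≡ false
    tp : A t p ≡ true
    tq : A t q ≡ true
    tr : A t r ≡ true
    sp : A s p ≡ true
    sq : A s q ≡ true
    sr : A s r ≡ true
    pq : A p q ≡ true
    pr : A p r ≡ true
    qr : A q r ≡ true

record LooksLikeB₁ {n : ℕ} (A : ES n) : Set where
  field
    {x y t d s s′} : Fin n
    cover : ∀ i → i ≢ x → i ≢ y → i ≢ t → i ≢ d → i ≢ s → i ≢ s′ → ⊥
    t≢s : t ≢ s
    t≢s′ : t ≢ s′
    d≢s : d ≢ s
    d≢s′ : d ≢ s′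
    ts : A t s ≡ false
    ts′ : A t s′ ≡ false
    ds : A d s ≡ false
    ds′ : A d s′ ≡ false
    xy : A x y ≡ true
    tx : A t x ≡ true
    ty : A t y ≡ true
    td : A t d ≡ true
    dx : A d x ≡ true
    dy : A d y ≡ true
    ss′ : A s s′ ≡ true
    sx : A s x ≡ true
    sy : A s y ≡ true
    s′x : A s′ x ≡ true
    s′y : A s′ y ≡ true

cnt⊆two : ∀ {n} {X : VS n} {q r} → (∀ z → X z ≡ true → z ≡ q ⊎ z ≡ r) → ∣ X ∣ ≤ 2
cnt⊆two {n} {X} {q} {r} h = lin 5 (λ a b c d e → a ⊕ b ≐ c ⊕ d ⇛ c ≐ κ 1 ⇛ d ≐ κ 1 ⇛ e ≼ a ⇛ 1 ⊢ e ≼ κ 2)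
    (∣ ⟨ q ⟩ ∪ ⟨ r ⟩ ∣) (∣ ⟨ q ⟩ ∩ ⟨ r ⟩ ∣) (∣ ⟨ q ⟩ ∣) (∣ ⟨ r ⟩ ∣) (∣ X ∣) (∣∪∣+∣∩∣ ⟨ q ⟩ ⟨ r ⟩) (cnt-single q)
    (cnt-single r) (cnt≤ {X = X} {⟨ q ⟩ ∪ ⟨ r ⟩} (λ z p → go z (h z p)))
  where
  go : ∀ z → z ≡ q ⊎ z ≡ r → (z == q) ∨ (z == r) ≡ true
  go z (inj₁ refl) = cong (_∨ (z == r)) (==-refl z)
  go z (inj₂ refl) = tab 2 (λ a b → ! a ⇛ ⊩ ! (b ∨ a)) (z == z) (z == q) (==-refl z)

three-of-three : ∀ {n} {X : VS n} → ∣ X ∣ ≡ 3 → ∀ {p q r} → (∀ z → X z ≡ true → z ≡ p ⊎ z ≡ q ⊎ z ≡ r) → X p ≡ true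
three-of-three {X = X} h {p} {q} {r} ⊆ = go (bool (X p))
  where
  go : Decided (X p) → X p ≡ true
  go (inj₁ e) = e
  go (inj₂ e) = ⊥-elim (lin 1 (λ a → a ≑ κ 3 ⇛ a ≼ κ 2 ⇛ ⊢⊥) (∣ X ∣) h (cnt⊆two {X = X} (λ z Xz → rest z Xz (⊆ z Xz))))
    where
    rest : ∀ z → X z ≡ true → z ≡ p ⊎ z ≡ q ⊎ z ≡ r → z ≡ q ⊎ z ≡ r
    rest z Xz (inj₁ refl) = ⊥-elim (clash Xz e)
    rest z Xz (inj₂ o) = o

module Cases {n : ℕ} {A : ES n} {U W : VS n} (rel : Relative A U) (att : Attached A U ⊎ Apex A U)
    (irrd : Irreducible A U) (mini : MinimalCotight A U W) (noK5 : ¬ LooksLikeK5⁻ A) (noB1 : ¬ LooksLikeB₁ A) where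
  open Relative rel
  open RelativeFacts rel
  open Joined att
  open Irreducible irrd
  open MinimalCotight mini
  open Minimal rel att irrd mini
  open Clusters rel att irrd mini using (complete)

  record Around (t z : Fin n) : Set where
    field
      {x y} : Fin n
      tri : Triple (A t) z x y
      zx : A z x ≡ true
      zy : A z y ≡ true
      xy : A x y ≡ true

  around : ∀ {t z} → W t ≡ true → D t ≡ true → A t z ≡ true → Around t z
  around {t} {z} Wt∈ Dt tz = go (complete Wt∈ Dt)
    where
    go : Neighbourhood t true → Around t z
    go nb = by (Triple.members tri tz)
      where
      open Neighbourhood nb
      by : z ≡ a ⊎ z ≡ b ⊎ z ≡ c → Around t z
      by (inj₁ refl) = record { tri = tri ; zx = ab ; zy = ac ; xy = bc }
      by (inj₂ (inj₁ refl)) = record { tri = triple-swap₁₂ tri ; zx = flip ab ; zy = bc ; xy = ac }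
      by (inj₂ (inj₂ refl)) = record { tri = triple-swap₁₂ (triple-swap₂₃ tri) ; zx = flip ac ; zy = flip bc ; xy = ab }

  -- A cubic vertex of `W` with one neighbour outside `W`; two are already excluded. Its
  -- nonexistence is what `nbr-in-W` rests on.
  record Cut (t p q r : Fin n) : Set where
    field
      Wt∈ : W t ≡ true
      Dt : D t ≡ true
      tri : Triple (A t) p q r
      pq : A p q ≡ true
      pr : A p r ≡ true
      qr : A q r ≡ true
      Wp : W p ≡ true
      Wq : W q ≡ true
      Wr : W r ≡ false

  cut-swap : ∀ {t p q r} → Cut t p q r → Cut t q p r
  cut-swap c = record { Wt∈ = Wt∈ ; Dt = Dt ; tri = triple-swap₁₂ tri ; pq = flip pq ; pr = qr ; qr = pr ; Wp = Wq ; Wq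
      = Wp ; Wr = Wr }
    where open Cut c

  module CutFacts {t p q r : Fin n} (cut : Cut t p q r) where
    open Cut cut
    open Triple tri
    W₁ W₂ S : VS n
    W₁ = W ∖ ⟨ t ⟩
    W₂ = W₁ ∖ ⟨ p ⟩
    S = W₂ ∖ ⟨ q ⟩

    p≢t : p ≢ t
    p≢t e = ≢adj ∈a (sym e)
    q≢t : q ≢ t
    q≢t e = ≢adj ∈b (sym e)
    W₁p : W₁ p ≡ true
    W₁p = ∖⟨⟩-intro {X = W} Wp p≢t
    W₂q : W₂ q ≡ true
    W₂q = ∖⟨⟩-intro {X = W₁} (∖⟨⟩-intro {X = W} Wq q≢t) (≢-sym a≢b)

    dt : dg A t (∁ W) ≡ 1
    dt = trans (count (∁ W)) (tab 3 (λ a b c → ! a ⇛ ! b ⇛ ∼ c ⇛ ⊩ 𝟙 (not a) + 𝟙 (not b) + 𝟙 (not c) ≃ 1) (W p) (W q)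
        (W r) Wp Wq Wr)

    out-p : ∀ {y} → A p y ≡ true → W y ≡ false → (A p ∩ ∁ W₁) y ≡ true
    out-p {y} py Wy = py & (tab 2 (λ a b → ∼ a ⇛ ⊩ ! (not (a ∧ not b))) (W y) (y == t) Wy)
    out-q : ∀ {y} → A q y ≡ true → W y ≡ false → (A q ∩ ∁ W₂) y ≡ true
    out-q {y} qy Wy = qy & (tab 3 (λ a b c → ∼ a ⇛ ⊩ ! (not ((a ∧ not c) ∧ not b))) (W y) (y == p) (y == t) Wy)
    pt∈ : (A p ∩ ∁ W₁) t ≡ true
    pt∈ = flip ∈a & not-intro (∉∖ W t)
    qt∈ : (A q ∩ ∁ W₂) t ≡ true
    qt∈ = flip ∈b & (tab 3 (λ a b c → ! a ⇛ ⊩ ! (not ((c ∧ not a) ∧ not b))) (t == t) (t == p) (W t) (==-refl t))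
    qp∈ : (A q ∩ ∁ W₂) p ≡ true
    qp∈ = flip pq & not-intro (∉∖ W₁ p)
    t≢r : t ≢ r
    t≢r = ≢adj ∈c

    dp : 2 ≤ dg A p (∁ W₁)
    dp = cnt-two {X = A p ∩ ∁ W₁} pt∈ (out-p pr Wr) t≢r
    dq : 3 ≤ dg A q (∁ W₂)
    dq = cnt-three {X = A q ∩ ∁ W₂} qt∈ qp∈ (out-q qr Wr) (≢-sym p≢t) t≢r a≢c

    sizes : ∣ W ∣ ≡ ∣ S ∣ + 3
    sizes = lin 4 (λ a b c d → a ≐ 𝕤 b ⇛ b ≐ 𝕤 c ⇛ c ≐ 𝕤 d ⇛ 1 ⊢ a ≐ d ⊹ 3) (∣ W ∣) (∣ W₁ ∣) (∣ W₂ ∣) (∣ S ∣)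
        (cnt-rem W Wt∈) (cnt-rem W₁ W₁p) (cnt-rem W₂ W₂q)

    -- Of the 2|W| + 1 = 2|S| + 7 edges touching `W`, peeling off `t` takes one, the edge `tr`. Then
    -- `p` takes at least two and `q` at least three.
    balance : tch A S + (dg A p (∁ W₁) + dg A q (∁ W₂)) ≡ 2 * ∣ S ∣ + 6
    balance = lin 9 (λ a b c d e f g h i → 2 ⊠ a ≐ b ⊹ 3 ⇛ c ≐ (2 ⊗ a) ⊹ 1 ⇛ d ≑ κ 1 ⇛ c ≑ e ⊕ d ⇛ e ≑ f ⊕ g ⇛ f ≑ h ⊕ i
        ⇛ 1 ⊢ h ⊕ (g ⊕ i) ≐ (2 ⊗ b) ⊹ 6) (∣ W ∣) (∣ S ∣) (tch A W) (dg A t (∁ W)) (tch A W₁) (tch A W₂) (dg A p (∁ W₁))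
        (tch A S) (dg A q (∁ W₂)) sizes Wt dt (tch-rem sA W Wt∈) (tch-rem sA W₁ W₁p) (tch-rem sA W₂ W₂q)

    S⊆W : S ⊆ W
    S⊆W i h = ∧ˡ (W i) (not (i == t)) (∧ˡ _ _ (∧ˡ _ _ h))

    place : ∀ {z} → W z ≡ true → z ≢ t → z ≢ p → z ≢ q → S z ≡ true
    place Wz z≢t z≢p z≢q = ∖⟨⟩-intro {X = W₂} (∖⟨⟩-intro {X = W₁} (∖⟨⟩-intro {X = W} Wz z≢t) z≢p) z≢q

    nbr-t : ∀ {z} → z ≢ p → z ≢ q → z ≢ r → A t z ≡ false
    nbr-t {z} z≢p z≢q z≢r = 𝔹.¬-not (λ h → go (members h))
      where
      go : z ≡ p ⊎ z ≡ q ⊎ z ≡ r → ⊥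
      go (inj₁ e) = z≢p e
      go (inj₂ (inj₁ e)) = z≢q e
      go (inj₂ (inj₂ e)) = z≢r e

    module Empty (none : ∀ i → S i ≡ false) where
      small : ∀ {z} → W z ≡ true → z ≢ t → z ≢ p → z ≢ q → ⊥
      small {z} Wz z≢t z≢p z≢q = clash (place Wz z≢t z≢p z≢q) (none z)

      tS : tch A S ≡ 0
      tS = ec-empty (λ i j → tab 3 (λ a b c → ∼ a ⇛ ∼ b ⇛ ⊩ ∼ (c ∧ (a ∨ b))) (S i) (S j) (A i j) (none i) (none j))

      -- When `W` is `t`, `p`, `q` only, a further outer neighbour `x` of `p` exhausts the six edges
      -- left, three at each of `p` and `q`. Then `q` is cubic, and contracting `p` onto `x` while
      -- dropping `pr` has no obstacle.
      module Third {x : Fin n} (px : A p x ≡ true) (Wx : W x ≡ false) (x≢r : x ≢ r) where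
        t≢x : t ≢ x
        t≢x e = clash (subst (λ z → W z ≡ true) e Wt∈) Wx
        q≢x : q ≢ x
        q≢x e = clash (subst (λ z → W z ≡ true) e Wq) Wx
        p≢x : p ≢ x
        p≢x = ≢adj px
        dp≥3 : 3 ≤ dg A p (∁ W₁)
        dp≥3 = cnt-three {X = A p ∩ ∁ W₁} pt∈ (out-p pr Wr) (out-p px Wx) t≢r t≢x (≢-sym x≢r)
        dp≡3 : dg A p (∁ W₁) ≡ 3
        dp≡3 = ≤-antisym (lin 4 (λ a b c d → a ⊕ (b ⊕ c) ≐ (2 ⊗ d) ⊹ 6 ⇛ a ≑ κ 0 ⇛ 2 ⊠ d ≐ κ 0 ⇛ κ 3 ≼ c ⇛ 1 ⊢ b ≼ κ 3)
            (tch A S) (dg A p (∁ W₁)) (dg A q (∁ W₂)) (∣ S ∣) balance tS (cnt-empty none) dq)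
            (lin 1 (λ a → κ 3 ≼ a ⇛ 1 ⊢ κ 3 ≼ a) (dg A p (∁ W₁)) dp≥3)
        dq≡3 : dg A q (∁ W₂) ≡ 3
        dq≡3 = lin 4 (λ a b c d → a ⊕ (b ⊕ c) ≐ (2 ⊗ d) ⊹ 6 ⇛ a ≑ κ 0 ⇛ 2 ⊠ d ≐ κ 0 ⇛ b ≑ κ 3 ⇛ 1 ⊢ c ≐ κ 3) (tch A S)
            (dg A p (∁ W₁)) (dg A q (∁ W₂)) (∣ S ∣) balance tS (cnt-empty none) dp≡3
        nbr-p : ∀ {z} → A p z ≡ true → z ≢ t → z ≢ q → z ≢ r → z ≢ x → ⊥
        nbr-p {z} pz z≢t z≢q z≢r z≢x = go (bool (W z))
          where
          go : Decided (W z) → ⊥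
          go (inj₁ Wz) = small Wz z≢t (≢-sym (≢adj pz)) z≢q
          go (inj₂ Wz) = clash (out-p pz Wz) (three-only {X = A p ∩ ∁ W₁} dp≡3 pt∈ (out-p pr Wr) (out-p px Wx) t≢r t≢x
              (≢-sym x≢r) z≢t z≢r z≢x)
        deg-q : ∣ A q ∣ ≡ 3
        deg-q = ≤-antisym (≤-trans (cnt≤ {X = A q} {A q ∩ ∁ W₂} (λ i h → h & not-intro (𝔹.¬-not (λ e → clash
            (∖⟨⟩-intro {X = W₂} e (≢-sym (≢adj h))) (none i))))) (≤-reflexive dq≡3)) (deg≥3 (W-U Wq))
        nbr-q : ∀ {z} → z ≢ t → z ≢ p → z ≢ r → A q z ≡ false
        nbr-q = three-only {X = A q} deg-q (flip ∈b) (flip pq) qr (≢-sym p≢t) t≢r a≢c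

        legal : Legal A U p x r
        legal = W-U Wp , px , pr , x≢r , (λ z pz z≢x z≢r → go z pz z≢x z≢r (z ≟ t) (z ≟ q))
          where
          go : ∀ z → A p z ≡ true → z ≢ x → z ≢ r → Dec (z ≡ t) → Dec (z ≡ q) → A x z ≡ false
          go z pz z≢x z≢r (yes refl) _ = flip (nbr-t (≢-sym p≢x) (≢-sym q≢x) x≢r)
          go z pz z≢x z≢r (no _) (yes refl) = flip (nbr-q (≢-sym t≢x) (≢-sym p≢x) x≢r)
          go z pz z≢x z≢r (no z≢t) (no z≢q) = ⊥-elim (nbr-p pz z≢t z≢q z≢r z≢x)

        -- If t and q both missed Q, the set Q would contain at most the neighbour x of p.
        third-in : ∀ (Q : VS n) → 2 ≤ dg A p Q → Q r ≡ false → Q t ≡ false → Q q ≡ false → ⊥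
        third-in Q two Qr Qt Qq = lin 2 (λ a b → κ 2 ≼ a ⇛ b ≐ κ 1 ⇛ a ≼ b ⇛ ⊢⊥) (dg A p Q) (∣ ⟨ x ⟩ ∣) two
            (cnt-single x) (cnt≤ {X = A p ∩ Q} {⟨ x ⟩} (λ z h → only z h))
          where
          only : ∀ z → (A p ∩ Q) z ≡ true → (z == x) ≡ true
          only z h = 𝔹.¬-not (λ e → nbr-p (∧ˡ (A p z) (Q z) h) (∈≢∉ {X = Q} Qz Qt) (∈≢∉ {X = Q} Qz Qq)
              (∈≢∉ {X = Q} Qz Qr) (==-≢ e))
            where
            Qz : Q z ≡ true
            Qz = ∧ʳ (A p z) (Q z) h
        count-q : ∀ (Q : VS n) → Q r ≡ false → 2 ≤ dg A q Q → Q t ≡ true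
        count-q Q Qr two = go (bool (Q t))
          where
          go : Decided (Q t) → Q t ≡ true
          go (inj₁ h) = h
          go (inj₂ Qt) = ⊥-elim (lin 3 (λ a b c → κ 2 ≼ a ⇛ b ≐ κ 3 ⇛ b ≑ a ⊕ c ⇛ κ 2 ≼ c ⇛ ⊢⊥) (dg A q Q) (∣ A q ∣)
              (dg A q (∁ Q)) two deg-q (dg-∁ A q Q) (cnt-two {X = A q ∩ ∁ Q} (flip ∈b & not-intro Qt)
              (qr & not-intro Qr) t≢r))
        count-t : ∀ (Q : VS n) → Q r ≡ false → 2 ≤ dg A t Q → Q q ≡ true
        count-t Q Qr two = go (bool (Q q))
          where
          go : Decided (Q q) → Q q ≡ true
          go (inj₁ h) = h
          go (inj₂ Qq) = ⊥-elim (lin 3 (λ a b c → κ 2 ≼ a ⇛ b ≐ κ 3 ⇛ b ≑ a ⊕ c ⇛ κ 2 ≼ c ⇛ ⊢⊥) (dg A t Q) (∣ A t ∣)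
              (dg A t (∁ Q)) two (D-deg Dt) (dg-∁ A t Q) (cnt-two {X = A t ∩ ∁ Q} (∈b & not-intro Qq)
              (∈c & not-intro Qr) b≢c))

        contradiction : ⊥
        contradiction = by (blocked p x r legal (λ _ → t , W-U Wt∈ , (≢-sym p≢t) , flip ∈c))
          where
          by : Obstacle A U p x r → ⊥
          by (inj₁ (Q , cQ , Qr , Qx , Qp)) = split (bool (Q t)) (bool (Q q))
            where
            Dr : ∁ Q r ≡ false
            Dr = cong not Qr
            close : Q t ≡ false → Q q ≡ false → ⊥
            close Qt Qq = cotight-pair cQ (W-U Wt∈) (W-U Wq) Qt Qq q≢t
              (lin 3 (λ a b c → a ≐ κ 3 ⇛ a ≑ b ⊕ c ⇛ κ 1 ≼ b ⇛ 1 ⊢ c ≼ κ 2) (∣ A t ∣) (dg A t Q) (dg A t (∁ Q))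
                  (D-deg Dt) (dg-∁ A t Q) (cnt-pos {X = A t ∩ Q} (∈c & Qr)))
              (lin 3 (λ a b c → a ≐ κ 3 ⇛ a ≑ b ⊕ c ⇛ κ 2 ≼ b ⇛ 1 ⊢ c ≼ κ 1) (∣ A q ∣) (dg A q (Q ∪ ⟨ t ⟩))
                  (dg A q (∁ (Q ∪ ⟨ t ⟩))) deg-q (dg-∁ A q (Q ∪ ⟨ t ⟩)) (cnt-two {X = A q ∩ (Q ∪ ⟨ t ⟩)} {t} {r}
                  (flip ∈b & ∪⟨⟩-∋ Q t) (qr & (tab 2 (λ a b → ! a ⇛ ⊩ ! (a ∨ b)) (Q r) (r == t) Qr)) t≢r))
            split : Decided (Q t) → Decided (Q q) → ⊥
            split (inj₁ Qt) (inj₁ Qq) = third-in (∁ Q) (cotight-deg cQ (W-U Wp) Qp) Dr (cong not Qt) (cong not Qq)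
            split (inj₂ Qt) _ = close Qt (not-elim (count-t (∁ Q) Dr (cotight-deg cQ (W-U Wt∈) Qt)))
            split _ (inj₂ Qq) = close (not-elim (count-q (∁ Q) Dr (cotight-deg cQ (W-U Wq) Qq))) Qq
          by (inj₂ (Y , tY , Yp , Yx , Yr)) = split (bool (Y t)) (bool (Y q))
            where
            close : Y t ≡ true → Y q ≡ true → ⊥
            close Yt Yq = tight-pair tY Yt Yq q≢t
              (lin 3 (λ a b c → a ≐ κ 3 ⇛ a ≑ b ⊕ c ⇛ κ 1 ≼ c ⇛ 1 ⊢ b ≼ κ 2) (∣ A t ∣) (dg A t Y) (dg A t (∁ Y))
                  (D-deg Dt) (dg-∁ A t Y) (cnt-pos {X = A t ∩ ∁ Y} (∈c & not-intro Yr)))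
              (lin 3 (λ a b c → a ≐ κ 3 ⇛ a ≑ b ⊕ c ⇛ κ 2 ≼ c ⇛ 1 ⊢ b ≼ κ 1) (∣ A q ∣) (dg A q (Y ∖ ⟨ t ⟩))
                  (dg A q (∁ (Y ∖ ⟨ t ⟩))) deg-q (dg-∁ A q (Y ∖ ⟨ t ⟩)) (cnt-two {X = A q ∩ ∁ (Y ∖ ⟨ t ⟩)} {t} {r}
                  (flip ∈b & not-intro (∉∖ Y t)) (qr & (tab 2 (λ a b → ∼ a ⇛ ⊩ ! (not (a ∧ not b))) (Y r) (r == t) Yr))
                  t≢r))
            split : Decided (Y t) → Decided (Y q) → ⊥
            split (inj₂ Yt) (inj₂ Yq) = third-in Y (tight-deg tY Yp Yx (≢-sym p≢x)) Yr Yt Yq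
            split (inj₁ Yt) _ = close Yt (count-t Y Yr (tight-deg tY Yt Yp p≢t))
            split _ (inj₁ Yq) = close (count-q Y Yr (tight-deg tY Yq Yp a≢b)) Yq

    -- A nonempty `S` needs 2|S| + 1 touching edges, so the balance holds with two edges at `p` and
    -- three at `q`. Hence `S` is cotight and cubic, and `p`, `q` have no outer neighbour besides
    -- `r`.
    module Nonempty {s : Fin n} (Ss : S s ≡ true) where
      tS : tch A S ≡ 2 * ∣ S ∣ + 1
      tS = ≤-antisym (lin 4 (λ a b c d → a ⊕ (b ⊕ c) ≐ (2 ⊗ d) ⊹ 6 ⇛ κ 2 ≼ b ⇛ κ 3 ≼ c ⇛ 1 ⊢ a ≼ (2 ⊗ d) ⊹ 1) (tch A S)
          (dg A p (∁ W₁)) (dg A q (∁ W₂)) (∣ S ∣) balance dp dq)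
        (many S (λ i h → W⊆ i (S⊆W i h)) (s , Ss))
      St : S t ≡ false
      St = tab 4 (λ a b c d → ! a ⇛ ⊩ ∼ (((d ∧ not a) ∧ not c) ∧ not b)) (t == t) (t == q) (t == p) (W t) (==-refl t)
      Sp : S p ≡ false
      Sp = tab 4 (λ a b c d → ! a ⇛ ⊩ ∼ (((d ∧ not c) ∧ not a) ∧ not b)) (p == p) (p == q) (p == t) (W p) (==-refl p)
      Sq : S q ≡ false
      Sq = ∉∖ W₂ q
      Sr : S r ≡ false
      Sr = 𝔹.¬-not (λ h → clash (S⊆W r h) Wr)
      S⊆D : S ⊆ D
      S⊆D i h = descend S S⊆W (≤-reflexive tS) Wt∈ St h
      out-only : ∀ {x y} → x ≡ p ⊎ x ≡ q → A x y ≡ true → W y ≡ false → y ≡ r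
      out-only {x} {y} x∈ xy Wy = go (y ≟ r) x∈
        where
        t≢y : t ≢ y
        t≢y e = clash (subst (λ z → W z ≡ true) e Wt∈) Wy
        go : Dec (y ≡ r) → x ≡ p ⊎ x ≡ q → y ≡ r
        go (yes e) _ = e
        go (no e) (inj₁ refl) = ⊥-elim (lin 4 (λ a b c d → a ⊕ (b ⊕ c) ≐ (2 ⊗ d) ⊹ 6 ⇛ a ≑ (2 ⊗ d) ⊹ 1 ⇛ κ 3 ≼ c ⇛ κ 3 ≼
            b ⇛ ⊢⊥) (tch A S) (dg A p (∁ W₁)) (dg A q (∁ W₂)) (∣ S ∣) balance tS dq
            (cnt-three {X = A p ∩ ∁ W₁} pt∈ (out-p pr Wr) (out-p xy Wy) t≢r t≢y (≢-sym e)))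
        go (no e) (inj₂ refl) = ⊥-elim (clash (out-q xy Wy) (three-only {X = A q ∩ ∁ W₂}
          (≤-antisym (lin 4 (λ a b c d → a ⊕ (b ⊕ c) ≐ (2 ⊗ d) ⊹ 6 ⇛ a ≑ (2 ⊗ d) ⊹ 1 ⇛ κ 2 ≼ b ⇛ 1 ⊢ c ≼ κ 3) (tch A S)
              (dg A p (∁ W₁)) (dg A q (∁ W₂)) (∣ S ∣) balance tS dp)
              (lin 1 (λ a → κ 3 ≼ a ⇛ 1 ⊢ κ 3 ≼ a) (dg A q (∁ W₂)) dq))
          qt∈ qp∈ (out-q qr Wr) (≢-sym p≢t) t≢r a≢c (≢-sym t≢y) (λ f → clash (subst (λ z → W z ≡ true) (sym f) Wp) Wy)
              e))

      S≢t : ∀ {x} → S x ≡ true → A x t ≡ false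
      S≢t {x} Sx = flip (nbr-t (∈≢∉ {X = S} Sx Sp) (∈≢∉ {X = S} Sx Sq) (∈≢∉ {X = S} Sx Sr))

      in-W : ∀ {x z} → S x ≡ true → A x z ≡ true → W z ≡ true → S z ≡ false → z ≡ p ⊎ z ≡ q
      in-W {x} {z} Sx xz Wz Sz = go (z ≟ p) (z ≟ q)
        where
        go : Dec (z ≡ p) → Dec (z ≡ q) → z ≡ p ⊎ z ≡ q
        go (yes e) _ = inj₁ e
        go _ (yes e) = inj₂ e
        go (no e) (no f) = ⊥-elim (clash (place Wz (λ g → clash xz (subst (λ w → A x w ≡ false) (sym g) (S≢t Sx))) e f)
            Sz)

      -- Of the three neighbours of `x` only `z` is outside `W`. The other two are not both in `S`,
      -- where they would form a cubic triangle with `x`; so one is `p` or `q`, and `z`, being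
      -- adjacent to it, is `r`.
      stay : ∀ {x z} → S x ≡ true → A x z ≡ true → W z ≡ false → z ≡ r
      stay {x} {z} Sx xz Wz = go (around (S⊆W x Sx) (S⊆D x Sx) xz)
        where
        go : Around x z → z ≡ r
        go ar = by (bool (W u)) (bool (W v)) (bool (S u)) (bool (S v))
          where
          open Around ar renaming (x to u; y to v; tri to tri′; zx to zu; zy to zv; xy to uv)
          module T′ = Triple tri′
          by : Decided (W u) → Decided (W v) → Decided (S u) → Decided (S v) → z ≡ r
          by (inj₂ Wu) _ _ _ = ⊥-elim (out₂ tri′ (S⊆W x Sx) (S⊆D x Sx) Wz Wu)
          by _ (inj₂ Wv) _ _ = ⊥-elim (out₂ (triple-swap₂₃ tri′) (S⊆W x Sx) (S⊆D x Sx) Wz Wv)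
          by (inj₁ Wu) _ (inj₂ Su) _ = out-only (in-W Sx T′.∈b Wu Su) (flip zu) Wz
          by _ (inj₁ Wv) _ (inj₂ Sv) = out-only (in-W Sx T′.∈c Wv Sv) (flip zv) Wz
          by _ _ (inj₁ Su) (inj₁ Sv) = ⊥-elim (D-triangle (S⊆D x Sx) (S⊆D u Su) (S⊆D v Sv) T′.∈b T′.∈c uv)

      all-stay : ∀ {x y} → W x ≡ true → W y ≡ false → A x y ≡ true → y ≡ r
      all-stay {x} {y} Wx Wy xy = go (x ≟ t) (x ≟ p) (x ≟ q)
        where
        go : Dec (x ≡ t) → Dec (x ≡ p) → Dec (x ≡ q) → y ≡ r
        go (yes refl) _ _ = by (members xy)
          where
          by : y ≡ p ⊎ y ≡ q ⊎ y ≡ r → y ≡ r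
          by (inj₁ refl) = ⊥-elim (clash Wp Wy)
          by (inj₂ (inj₁ refl)) = ⊥-elim (clash Wq Wy)
          by (inj₂ (inj₂ e)) = e
        go _ (yes e) _ = out-only (inj₁ e) xy Wy
        go _ _ (yes e) = out-only (inj₂ e) xy Wy
        go (no e) (no f) (no g) = stay (place Wx e f g) xy Wy

      -- All 2|W| + 1 edges touching `W` lie in `W` together with `r`, so `overfull` shows that
      -- these are all the vertices.
      enclosed : (∀ i → U i ≡ (i == r)) × ∁ U ⊆ W × 4 ≤ ∣ A r ∣
      enclosed = overfull W⊆ (t , Wt∈) Wr (lin 3 (λ a b c → a ≑ (2 ⊗ b) ⊹ 1 ⇛ a ≼ c ⇛ 1 ⊢ (2 ⊗ b) ⊹ 1 ≼ c) (tch A W)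
          (∣ W ∣) (ins A (W ∪ ⟨ r ⟩)) Wt (ec-⊆ {E = inc A W} {inn A (W ∪ ⟨ r ⟩)}
          (λ i j h → tab 5 (λ a b c d e → ! (c ∧ (b ∨ a)) ⇛ c ∧ b ∧ not a ⊃ d ⇛ c ∧ a ∧ not b ⊃ e ⇛ ⊩ !
          (c ∧ (b ∨ e) ∧ (a ∨ d))) (W j) (W i) (A i j) (j == r) (i == r) h (toward i j)
          (λ k → toward j i (turn i j k)))))
        where
        toward : ∀ i j → A i j ∧ (W i ∧ not (W j)) ≡ true → (j == r) ≡ true
        toward i j h = trans (cong (_== r) (all-stay {i} {j} (∧ˡ (W i) (not (W j)) (∧ʳ (A i j) _ h))
            (not-elim (∧ʳ (W i) (not (W j)) (∧ʳ (A i j) _ h))) (∧ˡ (A i j) ((W i) ∧ not (W j)) h))) (==-refl r)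
        turn : ∀ i j → A i j ∧ (W j ∧ not (W i)) ≡ true → A j i ∧ (W j ∧ not (W i)) ≡ true
        turn i j k = tab 4 (λ a b c d → ! (c ∧ b ∧ not a) ⇛ c ⇔ d ⇛ ⊩ ! (d ∧ b ∧ not a)) (W i) (W j) (A i j) (A j i) k
            (symm sA i j)

      covered : ∀ i → i ≢ t → i ≢ p → i ≢ q → i ≢ r → S i ≡ true
      covered i i≢t i≢p i≢q i≢r = place (proj₁ (proj₂ enclosed) i (not-intro (trans (proj₁ enclosed i) (≢⇒== i≢r)))) i≢t
          i≢p i≢q

      near : ∀ {x z} → S x ≡ true → A x z ≡ true → S z ≡ false → z ≡ p ⊎ z ≡ q ⊎ z ≡ r
      near {x} {z} Sx xz Sz = go (bool (W z))
        where
        go : Decided (W z) → z ≡ p ⊎ z ≡ q ⊎ z ≡ r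
        go (inj₂ Wz) = inj₂ (inj₂ (stay Sx xz Wz))
        go (inj₁ Wz) = widen (in-W Sx xz Wz Sz)
          where
          widen : z ≡ p ⊎ z ≡ q → z ≡ p ⊎ z ≡ q ⊎ z ≡ r
          widen (inj₁ e) = inj₁ e
          widen (inj₂ e) = inj₂ (inj₁ e)

      not-t : ∀ {x} → S x ≡ true → A t x ≡ false
      not-t Sx = flip (S≢t Sx)

      t≢S : ∀ {x} → S x ≡ true → t ≢ x
      t≢S Sx e = clash (subst (λ z → S z ≡ true) (sym e) Sx) St

      -- Then `s` is joined to `p`, `q` and `r`, and its three edges leave too few for any other
      -- vertex of `S`. The five vertices form K₅⁻ with missing edge `ts`.
      lonely : (∀ i → (A s ∩ S) i ≡ false) → ⊥
      lonely none = rest (empty? (S ∖ ⟨ s ⟩))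
        where
        deg-s : ∣ A s ∣ ≡ 3
        deg-s = D-deg (S⊆D s Ss)
        ns : ∀ z → A s z ≡ true → z ≡ p ⊎ z ≡ q ⊎ z ≡ r
        ns z sz = near Ss sz (tab 2 (λ a b → ! a ⇛ ∼ (a ∧ b) ⇛ ⊩ ∼ b) (A s z) (S z) sz (none z))
        rot : ∀ {z} → z ≡ p ⊎ z ≡ q ⊎ z ≡ r → z ≡ q ⊎ z ≡ r ⊎ z ≡ p
        rot (inj₁ e) = inj₂ (inj₂ e)
        rot (inj₂ (inj₁ e)) = inj₁ e
        rot (inj₂ (inj₂ e)) = inj₂ (inj₁ e)
        rot′ : ∀ {z} → z ≡ p ⊎ z ≡ q ⊎ z ≡ r → z ≡ r ⊎ z ≡ p ⊎ z ≡ q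
        rot′ (inj₁ e) = inj₂ (inj₁ e)
        rot′ (inj₂ (inj₁ e)) = inj₂ (inj₂ e)
        rot′ (inj₂ (inj₂ e)) = inj₁ e
        rest : Empty? (S ∖ ⟨ s ⟩) → ⊥
        rest (inj₁ ne) = lin 7 (λ a b c d e f g → a ≐ (2 ⊗ b) ⊹ 1 ⇛ a ≑ c ⊕ d ⇛ 2 ⊠ b ≐ 𝕤 e ⇛ f ≑ κ 3 ⇛ f ≐ g ⊕ d ⇛ g ≐
            κ 0 ⇛ (2 ⊗ e) ⊹ 1 ≼ c ⇛ ⊢⊥) (tch A S) (∣ S ∣) (tch A (S ∖ ⟨ s ⟩)) (dg A s (∁ S)) (∣ S ∖ ⟨ s ⟩ ∣) (∣ A s ∣)
            (dg A s S) tS (tch-rem sA S Ss) (cnt-rem S Ss) deg-s (dg-∁ A s S) (cnt-empty none)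
            (many (S ∖ ⟨ s ⟩) (λ i h → W⊆ i (S⊆W i (∧ˡ (S i) (not (i == s)) h))) ne)
        rest (inj₂ single) = noK5 (record
          { t = t ; s = s ; p = p ; q = q ; r = r
          ; cover = λ i i≢t i≢s i≢p i≢q i≢r → clash (∖⟨⟩-intro {X = S} (covered i i≢t i≢p i≢q i≢r) i≢s) (single i)
          ; t≢s = t≢S Ss ; ts = not-t Ss ; tp = ∈a ; tq = ∈b ; tr = ∈c
          ; sp = three-of-three {X = A s} deg-s ns ; sq = three-of-three {X = A s} deg-s (λ z sz → rot (ns z sz)) ; sr
              = three-of-three {X = A s} deg-s (λ z sz → rot′ (ns z sz))
          ; pq = pq ; pr = pr ; qr = qr })

      -- The K₄ on `s` and `s′` has its other two vertices among `p`, `q`, `r`, hence in common with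
      -- the K₄ at `t`. Its five edges at `s` and `s′` leave too few for further vertices of `S`, so
      -- the graph is B₁.
      paired : ∀ {s′} → A s s′ ≡ true → S s′ ≡ true → ⊥
      paired {s′} ss′ Ss′ = go (around (S⊆W s Ss) (S⊆D s Ss) ss′)
        where
        go : Around s s′ → ⊥
        go ar = rest (empty? (S ∖ ⟨ s ⟩ ∖ ⟨ s′ ⟩))
          where
          open Around ar renaming (tri to tri′; zx to s′x; zy to s′y)
          module T′ = Triple tri′
          Sx : S x ≡ false
          Sx = 𝔹.¬-not (λ h → D-triangle (S⊆D s Ss) (S⊆D s′ Ss′) (S⊆D x h) ss′ T′.∈b s′x)
          Sy : S y ≡ false
          Sy = 𝔹.¬-not (λ h → D-triangle (S⊆D s Ss) (S⊆D s′ Ss′) (S⊆D y h) ss′ T′.∈c s′y)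
          Q : VS n
          Q = S ∖ ⟨ s ⟩
          s≢s′ : s ≢ s′
          s≢s′ = ≢adj ss′
          Qs′ : Q s′ ≡ true
          Qs′ = ∖⟨⟩-intro {X = S} Ss′ (≢-sym s≢s′)
          outQ : ∀ {z} → S z ≡ false → not (Q z) ≡ true
          outQ {z} Sz = tab 2 (λ a b → ∼ a ⇛ ⊩ ! (not (a ∧ not b))) (S z) (z == s) Sz
          rest : Empty? (Q ∖ ⟨ s′ ⟩) → ⊥
          rest (inj₁ ne) = lin 8 (λ a b c d e f g h → a ≐ (2 ⊗ b) ⊹ 1 ⇛ a ≑ c ⊕ d ⇛ 2 ⊠ b ≐ 𝕤 e ⇛ c ≑ f ⊕ g ⇛ 2 ⊠ e ≐ 𝕤
              h ⇛ κ 2 ≼ d ⇛ κ 3 ≼ g ⇛ (2 ⊗ h) ⊹ 1 ≼ f ⇛ ⊢⊥) (tch A S) (∣ S ∣) (tch A Q) (dg A s (∁ S)) (∣ Q ∣)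
              (tch A (Q ∖ ⟨ s′ ⟩)) (dg A s′ (∁ Q)) (∣ Q ∖ ⟨ s′ ⟩ ∣) tS (tch-rem sA S Ss) (cnt-rem S Ss)
              (tch-rem sA Q Qs′) (cnt-rem Q Qs′) (cnt-two {X = A s ∩ ∁ S} (T′.∈b & not-intro Sx) (T′.∈c & not-intro Sy)
              T′.b≢c) (cnt-three {X = A s′ ∩ ∁ Q} {s} {x} {y} (flip ss′ & not-intro (∉∖ S s)) (s′x & outQ Sx)
              (s′y & outQ Sy) (∈≢∉ {X = S} Ss Sx) (∈≢∉ {X = S} Ss Sy) T′.b≢c)
              (many (Q ∖ ⟨ s′ ⟩) (λ i h → W⊆ i (S⊆W i (∧ˡ (S i) (not (i == s)) (∧ˡ _ _ h)))) ne)
          rest (inj₂ single) = pick (near Ss T′.∈b Sx) (near Ss T′.∈c Sy)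
            where
            found : ∀ d → A t d ≡ true → A t x ≡ true → A t y ≡ true → A d x ≡ true → A d y ≡ true → S d ≡ false →
                    (∀ i → i ≢ t → i ≢ d → i ≢ x → i ≢ y → S i ≡ true) → ⊥
            found d td tx ty dx dy Sd cov = noB1 (record
              { x = x ; y = y ; t = t ; d = d ; s = s ; s′ = s′
              ; cover = λ i i≢x i≢y i≢t i≢d i≢s i≢s′ → clash (∖⟨⟩-intro {X = Q}
                  (∖⟨⟩-intro {X = S} (cov i i≢t i≢d i≢x i≢y) i≢s) i≢s′) (single i)
              ; t≢s = t≢S Ss ; t≢s′ = t≢S Ss′ ; d≢s = λ e → ∈≢∉ {X = S} Ss Sd (sym e) ; d≢s′ = λ e → ∈≢∉ {X = S} Ss′ Sd
                  (sym e)
              ; ts = not-t Ss ; ts′ = not-t Ss′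
              ; ds = flip (three-only {X = A s} (D-deg (S⊆D s Ss)) T′.∈a T′.∈b T′.∈c T′.a≢b T′.a≢c T′.b≢c
                  (λ e → ∈≢∉ {X = S} Ss′ Sd (sym e)) (≢adj dx) (≢adj dy))
              ; ds′ = flip (three-only {X = A s′} (D-deg (S⊆D s′ Ss′)) (flip ss′) s′x s′y (∈≢∉ {X = S} Ss Sx)
                  (∈≢∉ {X = S} Ss Sy) T′.b≢c (λ e → ∈≢∉ {X = S} Ss Sd (sym e)) (≢adj dx) (≢adj dy))
              ; xy = xy ; tx = tx ; ty = ty ; td = td ; dx = dx ; dy = dy ; ss′ = ss′ ; sx = T′.∈b ; sy = T′.∈c ; s′x
                  = s′x ; s′y = s′y })
            pick : x ≡ p ⊎ x ≡ q ⊎ x ≡ r → y ≡ p ⊎ y ≡ q ⊎ y ≡ r → ⊥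
            pick (inj₁ refl) (inj₁ refl) = T′.b≢c refl
            pick (inj₁ refl) (inj₂ (inj₁ refl)) = found r ∈c ∈a ∈b (flip pr) (flip qr) Sr
                (λ i a d x y → covered i a x y d)
            pick (inj₁ refl) (inj₂ (inj₂ refl)) = found q ∈b ∈a ∈c (flip pq) qr Sq (λ i a d x y → covered i a x d y)
            pick (inj₂ (inj₁ refl)) (inj₁ refl) = found r ∈c ∈b ∈a (flip qr) (flip pr) Sr
                (λ i a d x y → covered i a y x d)
            pick (inj₂ (inj₁ refl)) (inj₂ (inj₁ refl)) = T′.b≢c refl
            pick (inj₂ (inj₁ refl)) (inj₂ (inj₂ refl)) = found p ∈a ∈b ∈c pq pr Sp (λ i a d x y → covered i a d x y)
            pick (inj₂ (inj₂ refl)) (inj₁ refl) = found q ∈b ∈c ∈a qr (flip pq) Sq (λ i a d x y → covered i a y d x)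
            pick (inj₂ (inj₂ refl)) (inj₂ (inj₁ refl)) = found p ∈a ∈c ∈b pr pq Sp (λ i a d x y → covered i a d y x)
            pick (inj₂ (inj₂ refl)) (inj₂ (inj₂ refl)) = T′.b≢c refl

      contradiction : ⊥
      contradiction = go (empty? (A s ∩ S))
        where
        go : Empty? (A s ∩ S) → ⊥
        go (inj₂ none) = lonely none
        go (inj₁ (s′ , h)) = paired (∧ˡ (A s s′) (S s′) h) (∧ʳ (A s s′) (S s′) h)

    -- With S empty, 2|W| + 1 = 7 leaves room for exactly one edge from p or q to a third vertex outside W.
    extra-p : 3 ≤ dg A p (∁ W₁) → ∃[ x ] (A p x ≡ true × W x ≡ false × x ≢ r)
    extra-p h = go (pos⇒NE X₂ (lin 3 (λ a b c → κ 3 ≼ a ⇛ a ≐ 𝕤 b ⇛ b ≐ 𝕤 c ⇛ 1 ⊢ κ 1 ≼ c) (dg A p (∁ W₁)) (∣ X₁ ∣)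
        (∣ X₂ ∣) h (cnt-rem (A p ∩ ∁ W₁) pt∈) (cnt-rem X₁ (∖⟨⟩-intro {X = A p ∩ ∁ W₁} (out-p pr Wr) (≢-sym t≢r)))))
      where
      X₁ X₂ : VS n
      X₁ = (A p ∩ ∁ W₁) ∖ ⟨ t ⟩
      X₂ = X₁ ∖ ⟨ r ⟩
      go : NE X₂ → ∃[ x ] (A p x ≡ true × W x ≡ false × x ≢ r)
      go (x , m) = x , (∧ˡ (A p x) (not ((W x) ∧ not (x == t))) (∧ˡ _ _ (∧ˡ _ _ m))) ,
        (tab 4 (λ a b c d → ! (((d ∧ not (c ∧ not b)) ∧ not b) ∧ not a) ⇛ ⊩ ∼ c) (x == r) (x == t) (W x) (A p x) m) ,
        ==-≢ (tab 4 (λ a b c d → ! (((d ∧ not (c ∧ not b)) ∧ not b) ∧ not a) ⇛ ⊩ ∼ a) (x == r) (x == t) (W x) (A p x) m)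

  no-cut : ∀ {t p q r} → Cut t p q r → ⊥
  no-cut {t} {p} {q} {r} cut = go (empty? S)
    where
    open CutFacts cut
    module Sw = CutFacts (cut-swap cut)
    go : Empty? S → ⊥
    go (inj₁ (s , Ss)) = Nonempty.contradiction Ss
    go (inj₂ none) = split (<-≤-connex 2 (dg A p (∁ W₁)))
      where
      none′ : ∀ i → Sw.S i ≡ false
      none′ i = tab 4 (λ a b c d → ∼ (((d ∧ not c) ∧ not b) ∧ not a) ⇛ ⊩ ∼ (((d ∧ not c) ∧ not a) ∧ not b)) (i == q)
          (i == p) (i == t) (W i) (none i)
      use : ∃[ x ] (A p x ≡ true × W x ≡ false × x ≢ r) → ⊥
      use (x , px , Wx , x≢r) = Empty.Third.contradiction none px Wx x≢r
      use′ : ∃[ x ] (A q x ≡ true × W x ≡ false × x ≢ r) → ⊥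
      use′ (x , qx , Wx , x≢r) = Sw.Empty.Third.contradiction none′ qx Wx x≢r
      split : 2 < dg A p (∁ W₁) ⊎ dg A p (∁ W₁) ≤ 2 → ⊥
      split (inj₁ h) = use (extra-p h)
      split (inj₂ h) = use′ (Sw.extra-p (lin 6 (λ a b c d e f → a ⊕ (b ⊕ c) ≑ (2 ⊗ d) ⊹ 6 ⇛ a ≐ κ 0 ⇛ 2 ⊠ d ≑ κ 0 ⇛ b ≼
          κ 2 ⇛ c ≐ 𝕤 e ⇛ e ≼ f ⇛ 1 ⊢ κ 3 ≼ f) (tch A S) (dg A p (∁ W₁)) (dg A q (∁ W₂)) (∣ S ∣)
          (∣ (A q ∩ ∁ W₂) ∖ ⟨ p ⟩ ∣) (dg A q (∁ W₁)) balance (Empty.tS none) (cnt-empty none) h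
          (cnt-rem (A q ∩ ∁ W₂) qp∈) (cnt≤ {X = (A q ∩ ∁ W₂) ∖ ⟨ p ⟩} {A q ∩ ∁ W₁}
          (λ z m → tab 3 (λ a b c → ! ((c ∧ not (b ∧ not a)) ∧ not a) ⇛ ⊩ ! (c ∧ not b)) (z == p) (W₁ z) (A q z) m))))

  nbr-in-W : ∀ {t z} → W t ≡ true → D t ≡ true → A t z ≡ true → W z ≡ true
  nbr-in-W {t} {z} Wt∈ Dt tz = go (around Wt∈ Dt tz)
    where
    go : Around t z → W z ≡ true
    go ar = by (bool (W z)) (bool (W x)) (bool (W y))
      where
      open Around ar
      by : Decided (W z) → Decided (W x) → Decided (W y) → W z ≡ true
      by (inj₁ Wz) _ _ = Wz
      by (inj₂ Wz) (inj₂ Wx) _ = ⊥-elim (out₂ tri Wt∈ Dt Wz Wx)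
      by (inj₂ Wz) _ (inj₂ Wy) = ⊥-elim (out₂ (triple-swap₂₃ tri) Wt∈ Dt Wz Wy)
      by (inj₂ Wz) (inj₁ Wx) (inj₁ Wy) = ⊥-elim (no-cut (record { Wt∈ = Wt∈ ; Dt = Dt ; tri = triple-swap₂₃
          (triple-swap₁₂ tri) ; pq = xy ; pr = flip zx ; qr = flip zy ; Wp = Wx ; Wq = Wy ; Wr = Wz }))

-- The average degree in the minimal cotight set

sum-disjoint : ∀ {n} (f : Fin n → ℕ) (P Y : VS n) → (∀ i → P i ≡ true → Y i ≡ false) →
  sumFin (λ i → if (P ∪ Y) i then f i else 0) ≡ sumFin (λ i → if P i then f i else 0) + sumFin
      (λ i → if Y i then f i else 0)
sum-disjoint {n} f P Y h = trans (sum-cong (λ i → step i (bool (P i)) (bool (Y i)))) (sum-+ {n} _ _)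
  where
  step : ∀ i → Decided (P i) → Decided (Y i) → (if P i ∨ Y i then f i else 0) ≡ (if P i then f i else 0) +
      (if Y i then f i else 0)
  step i (inj₁ p) (inj₁ q) = ⊥-elim (clash q (h i p))
  step i (inj₁ p) (inj₂ q) rewrite p | q = sym (+-identityʳ (f i))
  step i (inj₂ p) _ rewrite p = refl

module Endgame {n : ℕ} {A : ES n} {U W : VS n} (rel : Relative A U) (att : Attached A U ⊎ Apex A U)
    (irrd : Irreducible A U) (mini : MinimalCotight A U W) (noK5 : ¬ LooksLikeK5⁻ A) (noB1 : ¬ LooksLikeB₁ A) where
  open Relative rel
  open RelativeFacts rel
  open Joined att
  open Irreducible irrd
  open MinimalCotight mini
  open Minimal rel att irrd mini
  open Cases rel att irrd mini noK5 noB1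

  -- Here `W` is tight and cotight, so 2|W| + 1 - (2|W| - 2) = 3 edges leave it. A single such edge
  -- leads to a contradiction.
  module TightW (Wtight : ins A W + 2 ≡ 2 * ∣ W ∣) where

    -- Otherwise the rest of `W` is cubic and spans a forest; with the at most |W| - 1 edges from
    -- `v` this is one edge short of tight. If `v` is alone, it is cubic, although it is `bad`.
    one-out : ∀ {v} → W v ≡ true → 2 ≤ dg A v (∁ W) → ⊥
    one-out {v} Wv h = go (empty? (W ∖ ⟨ v ⟩))
      where
      go : Empty? (W ∖ ⟨ v ⟩) → ⊥
      go (inj₁ ne) = lin 5 (λ a b c d e → a ⊹ 2 ≑ 2 ⊗ b ⇛ a ≐ c ⊕ d ⇛ 2 ⊠ b ≑ 𝕤 e ⇛ d ≼ e ⇛ c ⊹ 1 ≼ e ⇛ ⊢⊥) (ins A W)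
          (∣ W ∣) (ins A (W ∖ ⟨ v ⟩)) (dg A v W) (∣ W ∖ ⟨ v ⟩ ∣) Wtight (ins-rem sA W Wv) (cnt-rem W Wv)
          (dg≤size sA v W) (forest (W ∖ ⟨ v ⟩) (λ i m → two-outside Wv h (∧ˡ (W i) (not (i == v)) m)
          (==-≢ (not-elim (∧ʳ (W i) (not (i == v)) m)))) ne)
      go (inj₂ none) = clash (subst (λ z → D z ≡ true) (sym only) (deg-D (W-U Wv) deg)) Dbad
        where
        only : bad ≡ v
        only = ==⇒≡ (tab 2 (λ a b → ! a ⇛ ∼ (a ∧ not b) ⇛ ⊩ ! b) (W bad) (bad == v) Wbad (none bad))
        deg : ∣ A v ∣ ≡ 3
        deg = ≤-antisym (lin 7 (λ a b c d e f g → a ≐ b ⊕ c ⇛ b ≼ d ⇛ 3 ⊠ d ≐ κ 0 ⇛ 2 ⊠ e ≐ 𝕤 d ⇛ f ≐ (2 ⊗ e) ⊹ 1 ⇛ f ≑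
            g ⊕ c ⇛ g ≑ κ 0 ⇛ 1 ⊢ a ≼ κ 3) (∣ A v ∣) (dg A v W) (dg A v (∁ W)) (∣ W ∖ ⟨ v ⟩ ∣) (∣ W ∣) (tch A W)
            (tch A (W ∖ ⟨ v ⟩)) (dg-∁ A v W) (dg≤size sA v W) (cnt-empty none) (cnt-rem W Wv) Wt (tch-rem sA W Wv)
            (ec-empty (λ i j → tab 3 (λ a b c → ∼ a ⇛ ∼ b ⇛ ⊩ ∼ (c ∧ (a ∨ b))) (R i) (R j) (A i j) (none i) (none j))))
            (lin 7 (λ a b c d e f g → a ≑ b ⊕ c ⇛ 2 ⊠ d ≑ κ 0 ⇛ 2 ⊠ e ≑ 𝕤 d ⇛ f ≑ (2 ⊗ e) ⊹ 1 ⇛ f ≐ g ⊕ c ⇛ g ≐ κ 0 ⇛ 1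
            ⊢ κ 3 ≼ a) (∣ A v ∣) (dg A v W) (dg A v (∁ W)) (∣ W ∖ ⟨ v ⟩ ∣) (∣ W ∣) (tch A W) (tch A (W ∖ ⟨ v ⟩))
            (dg-∁ A v W) (cnt-empty none) (cnt-rem W Wv) Wt (tch-rem sA W Wv)
            (ec-empty (λ i j → tab 3 (λ a b c → ∼ a ⇛ ∼ b ⇛ ⊩ ∼ (c ∧ (a ∨ b))) (R i) (R j) (A i j) (none i) (none j))))
          where
          R : VS n
          R = W ∖ ⟨ v ⟩

    module Crossing {v u : Fin n} (Wv : W v ≡ true) (Wu : W u ≡ false) (vu : A v u ≡ true) where

      common-in-W : ∀ {z} → A v z ≡ true → A u z ≡ true → W z ≡ true
      common-in-W {z} vz uz = go (bool (W z))
        where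
        go : Decided (W z) → W z ≡ true
        go (inj₁ h) = h
        go (inj₂ h) = ⊥-elim (one-out Wv (cnt-two {X = A v ∩ ∁ W} (vu & not-intro Wu) (vz & not-intro h) (≢adj uz)))

      unique : ∀ {z z′} → A v z ≡ true → A u z ≡ true → A v z′ ≡ true → A u z′ ≡ true → z′ ≡ z
      unique {z} {z′} vz uz vz′ uz′ = go (z′ ≟ z)
        where
        go : Dec (z′ ≡ z) → z′ ≡ z
        go (yes e) = e
        go (no e) = ⊥-elim (tight-over (W⊆ , Wtight) Wv Wu (cnt-three {X = A u ∩ W} {v} {z} {z′} (flip vu & Wv)
            (uz & common-in-W vz uz) (uz′ & common-in-W vz′ uz′) (≢adj vz) (≢adj vz′) (≢-sym e)))

      forced : ∀ {y} → A v y ≡ true → W y ≡ true → (∀ z → A v z ≡ true → A u z ≡ true → z ≡ y) → D y ≡ true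
      forced {y} vy Wy only = by (blocked v u y (W-U Wv , vu , vy , (λ e → clash (subst (λ z → W z ≡ true) (sym e) Wy)
          Wu) ,
          (λ z vz _ z≢y → 𝔹.¬-not (λ uz → z≢y (only z vz uz)))) (λ Uy → ⊥-elim (clash Uy (W-U Wy))))
        where
        by : Obstacle A U v u y → D y ≡ true
        by (inj₁ (S , cS , Sy , Su , Sv)) = cotight-meets cS Wv Sv Wy Sy
        by (inj₂ (Y , tY , Yv , Yu , Yy)) = tight-meets tY Wv Yv Yu Wu Wy Yy

      -- A common neighbour of `v` and `u` would be a cubic vertex of `W` with `u` outside. Without
      -- one, all neighbours of `v` in `W` are cubic, and the K₄ at one of them contains a cubic
      -- triangle.
      contradiction : ⊥
      contradiction = go (empty? (A v ∩ A u))
        where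
        go : Empty? (A v ∩ A u) → ⊥
        go (inj₁ (z , m)) = clash (nbr-in-W Wz (forced vz Wz (λ z′ vz′ uz′ → unique vz uz vz′ uz′)) (flip uz)) Wu
          where
          vz : A v z ≡ true
          vz = ∧ˡ (A v z) (A u z) m
          uz : A u z ≡ true
          uz = ∧ʳ (A v z) (A u z) m
          Wz : W z ≡ true
          Wz = common-in-W vz uz
        go (inj₂ none) = start (pos⇒NE (A v ∩ W) (lin 3 (λ a b c → a ≐ b ⊕ c ⇛ κ 3 ≼ a ⇛ 𝕤 c ≼ κ 2 ⇛ 1 ⊢ κ 1 ≼ b)
            (∣ A v ∣) (dg A v W) (dg A v (∁ W)) (dg-∁ A v W) (deg≥3 (W-U Wv)) (≰⇒> (one-out Wv))))
          where
          all-cubic : ∀ {y} → A v y ≡ true → W y ≡ true → D y ≡ true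
          all-cubic {y} vy Wy = forced vy Wy (λ z vz uz → ⊥-elim (clash (vz & uz) (none z)))
          start : NE (A v ∩ W) → ⊥
          start (y , m) = finish (around Wy Dy (flip vy))
            where
            vy : A v y ≡ true
            vy = ∧ˡ (A v y) (W y) m
            Wy : W y ≡ true
            Wy = ∧ʳ (A v y) (W y) m
            Dy : D y ≡ true
            Dy = all-cubic vy Wy
            finish : Around y v → ⊥
            finish ar = D-triangle Dy (all-cubic a.zx (nbr-in-W Wy Dy t.∈b)) (all-cubic a.zy (nbr-in-W Wy Dy t.∈c)) t.∈b
                t.∈c a.xy
              where
              module a = Around ar
              module t = Triple a.tri

    impossible : ⊥
    impossible = go (ec-edge X (lin 4 (λ a b c d → a ⊹ 2 ≐ 2 ⊗ b ⇛ c ≑ (2 ⊗ b) ⊹ 1 ⇛ c ≼ a ⊕ d ⇛ 1 ⊢ κ 1 ≼ d) (ins A W)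
        (∣ W ∣) (tch A W) (ec X) Wtight Wt (ec12≤ (inc A W) (inn A W) X
        (λ i j → tab 3 (λ a b c → ⊩ 𝟙 (c ∧ (b ∨ a)) ≦ 𝟙 (c ∧ b ∧ a) + 𝟙 (c ∧ ((b ∧ not a) ∨ (not b ∧ a)))) (W j) (W i)
        (A i j)))))
      where
      X : ES n
      X i j = A i j ∧ ((W i ∧ not (W j)) ∨ (not (W i) ∧ W j))
      go : ∃[ i ] ∃[ j ] X i j ≡ true → ⊥
      go (i , j , h) = by (bool (W i))
        where
        ij : A i j ≡ true
        ij = ∧ˡ (A i j) (((W i) ∧ not (W j)) ∨ (not (W i) ∧ (W j))) h
        by : Decided (W i) → ⊥
        by (inj₁ Wi) = Crossing.contradiction Wi (tab 3 (λ a b c → ! a ⇛ ! (c ∧ ((a ∧ not b) ∨ (not a ∧ b))) ⇛ ⊩ ∼ b)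
            (W i) (W j) (A i j) Wi h) ij
        by (inj₂ Wi) = Crossing.contradiction (tab 3 (λ a b c → ∼ a ⇛ ! (c ∧ ((a ∧ not b) ∨ (not a ∧ b))) ⇛ ⊩ ! b) (W i)
            (W j) (A i j) Wi h) Wi (flip ij)

  -- The maximal tight subsets of W partition W, and the degrees in each average at least four.
  module LooseW (Wloose : ins A W + 3 ≤ 2 * ∣ W ∣) where

    degrees : VS n → ℕ
    degrees P = sumFin (λ v → if P v then ∣ A v ∣ else 0)

    record Maximal (v : Fin n) : Set where
      field
        Y : VS n
        Y⊆W : Y ⊆ W
        Yv : Y v ≡ true
        tightY : TightSet A U Y
        absorbs : ∀ Z → Z ⊆ W → TightSet A U Z → ∀ {x} → Z x ≡ true → Y x ≡ true → Z ⊆ Y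

    maximal : ∀ {v} → W v ≡ true → Maximal v
    maximal {v} Wv = go (maximise P respects decidable ⟨ v ⟩
        ((λ i → tab 2 (λ a b → a ⊃ b ⇛ ⊩ ∼ (a ∧ not b)) (i == v) (W i) (at W Wv i)) , ==-refl v ,
            (≤-antisym (lin 5 (λ a b c d e → 2 ⊠ a ≑ κ 1 ⇛ b ≐ c ⊕ d ⇛ d ≼ e ⇛ e ≐ κ 0 ⇛ c ≐ κ 0 ⇛ 1 ⊢ b ⊹ 2 ≼ 2 ⊗ a)
            (∣ ⟨ v ⟩ ∣) (ins A ⟨ v ⟩) (ins A (⟨ v ⟩ ∖ ⟨ v ⟩)) (dg A v ⟨ v ⟩) (∣ ⟨ v ⟩ ∖ ⟨ v ⟩ ∣) (cnt-single v)
            (ins-rem sA ⟨ v ⟩ (==-refl v)) (dg≤size sA v ⟨ v ⟩) (cnt-empty nothing)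
            (ec-empty (λ i j → tab 3 (λ a b c → ⊩ ∼ (c ∧ (b ∧ not b) ∧ a ∧ not a)) (j == v) (i == v) (A i j))))
            (lin 2 (λ a b → 2 ⊠ a ≐ κ 1 ⇛ 1 ⊢ 2 ⊗ a ≼ b ⊹ 2) (∣ ⟨ v ⟩ ∣) (ins A ⟨ v ⟩) (cnt-single v)))))
      where
      nothing : ∀ i → (⟨ v ⟩ ∖ ⟨ v ⟩) i ≡ false
      nothing i = tab 1 (λ a → ⊩ ∼ (a ∧ not a)) (i == v)
      P : VS n → Set
      P Y = (∀ i → (Y ∖ W) i ≡ false) × Y v ≡ true × ins A Y + 2 ≡ 2 * ∣ Y ∣
      respects : Respects P
      respects e (x , y , z) = (λ i → trans (cong (_∧ not (W i)) (sym (e i))) (x i)) , trans (sym (e v)) y , trans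
          (cong (_+ 2) (sym (ins≗ A e))) (trans z (cong (2 *_) (cnt≗ e)))
      decidable : ∀ Y → Dec (P Y)
      decidable Y = all? (λ i → (Y ∖ W) i 𝔹.≟ false) ×-dec ((Y v 𝔹.≟ true) ×-dec (ins A Y + 2 ≟ⁿ 2 * ∣ Y ∣))
      go : ∃[ Y ] (P Y × (∀ Z → P Z → ∣ Z ∣ ≤ ∣ Y ∣)) → Maximal v
      go (Y , (Y⊆ , Yv , Yt) , large) = record { Y = Y ; Y⊆W = Y⊆W ; Yv = Yv ; tightY = tY ; absorbs = absorbs }
        where
        Y⊆W : Y ⊆ W
        Y⊆W i h = tab 2 (λ a b → ! a ⇛ ∼ (a ∧ not b) ⇛ ⊩ ! b) (Y i) (W i) h (Y⊆ i)
        tY : TightSet A U Y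
        tY = (λ i h → W⊆ i (Y⊆W i h)) , Yt
        absorbs : ∀ Z → Z ⊆ W → TightSet A U Z → ∀ {x} → Z x ≡ true → Y x ≡ true → Z ⊆ Y
        absorbs Z Z⊆W tZ {x} Zx Yx i Zi = ⊆⇒∣∣-eq {X = Y} {Y ∪ Z} (λ j h → tab 2 (λ a b → ! a ⇛ ⊩ ! (a ∨ b)) (Y j) (Z j)
            h)
          (large (Y ∪ Z) ((λ j → tab 3 (λ a b c → a ⊃ b ⇛ c ⊃ b ⇛ ⊩ ∼ ((a ∨ c) ∧ not b)) (Y j) (W j) (Z j) (Y⊆W j)
              (Z⊆W j)) , (tab 2 (λ a b → ! a ⇛ ⊩ ! (a ∨ b)) (Y v) (Z v) Yv) , proj₂ (proj₁ (tight-∪∩ tY tZ Yx Zx)))) i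
              (tab 2 (λ a b → ! a ⇛ ⊩ ! (b ∨ a)) (Z i) (Y i) Zi)

    -- If `Y` is touched by at least 2|Y| + 2 edges, these and its 2|Y| - 2 inner edges give 4|Y|.
    -- Otherwise `Y` is cotight, and proper in `W` because `W` is not tight, hence cubic; but it
    -- absorbs the tight K₄ at `v`, which would contain a cubic triangle.
    heavy : ∀ {v} → W v ≡ true → (m : Maximal v) → 4 * ∣ Maximal.Y m ∣ ≤ degrees (Maximal.Y m)
    heavy {v} Wv m = go (<-≤-connex (2 * ∣ Y ∣ + 1) (tch A Y)) (empty? (W ∖ Y))
      where
      open Maximal m
      go : 2 * ∣ Y ∣ + 1 < tch A Y ⊎ tch A Y ≤ 2 * ∣ Y ∣ + 1 → Empty? (W ∖ Y) → 4 * ∣ Y ∣ ≤ degrees Y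
      go (inj₁ h) _ = lin 4 (λ a b c d → 𝕤 ((2 ⊗ a) ⊹ 1) ≼ b ⇛ c ⊹ 2 ≑ 2 ⊗ a ⇛ b ⊕ c ≐ d ⇛ 1 ⊢ 4 ⊗ a ≼ d) (∣ Y ∣)
          (tch A Y) (ins A Y) (degrees Y) h (proj₂ tightY) (degree-sum sA Y)
      go (inj₂ h) (inj₂ none) = ⊥-elim (lin 4 (λ a b c d → a ⊹ 3 ≼ 2 ⊗ b ⇛ c ⊹ 2 ≑ 2 ⊗ d ⇛ 2 ⊠ b ≐ d ⇛ a ≑ c ⇛ ⊢⊥)
          (ins A W) (∣ W ∣) (ins A Y) (∣ Y ∣) Wloose (proj₂ tightY) (cnt≗ same) (ins≗ A same))
        where
        same : ∀ i → W i ≡ Y i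
        same i = tab 2 (λ a b → ∼ (b ∧ not a) ⇛ a ⊃ b ⇛ ⊩ b ⇔ a) (Y i) (W i) (none i) (Y⊆W i)
      go (inj₂ h) (inj₁ (w , e)) = ⊥-elim (contra (complete-at Wv Dv))
        where
        Y⊆D : Y ⊆ D
        Y⊆D i q = descend Y Y⊆W h (∧ˡ (W w) (not (Y w)) e) (not-elim (∧ʳ (W w) (not (Y w)) e)) q
        Dv : D v ≡ true
        Dv = Y⊆D v Yv
        complete-at : W v ≡ true → D v ≡ true → Neighbourhood v true
        complete-at = Clusters.complete rel att irrd mini
        contra : Neighbourhood v true → ⊥
        contra nb = D-triangle (Y⊆D a (K⊆Y a Ka)) (Y⊆D b (K⊆Y b Kb)) (Y⊆D c (K⊆Y c (∪⟨⟩-∋ K₃ c))) ab ac bc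
          where
          open Neighbourhood nb
          open Triple tri
          K₂ K₃ K : VS n
          K₂ = ⟨ v ⟩ ∪ ⟨ a ⟩
          K₃ = K₂ ∪ ⟨ b ⟩
          K = K₃ ∪ ⟨ c ⟩
          va : v ≢ a
          va = ≢adj ∈a
          vb : v ≢ b
          vb = ≢adj ∈b
          vc : v ≢ c
          vc = ≢adj ∈c
          a∉ : ⟨ v ⟩ a ≡ false
          a∉ = ≢⇒== (≢-sym va)
          b∉ : K₂ b ≡ false
          b∉ = cong₂ _∨_ (≢⇒== (≢-sym vb)) (≢⇒== (≢-sym a≢b))
          c∉ : K₃ c ≡ false
          c∉ = cong₂ _∨_ (cong₂ _∨_ (≢⇒== (≢-sym vc)) (≢⇒== (≢-sym a≢c))) (≢⇒== (≢-sym b≢c))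
          K₂v : K₂ v ≡ true
          K₂v = tab 2 (λ a b → ! a ⇛ ⊩ ! (a ∨ b)) (v == v) (v == a) (==-refl v)
          K₃v : K₃ v ≡ true
          K₃v = tab 2 (λ a b → ! a ⇛ ⊩ ! (a ∨ b)) (K₂ v) (v == b) K₂v
          K₃a : K₃ a ≡ true
          K₃a = tab 2 (λ a b → ! a ⇛ ⊩ ! (a ∨ b)) (K₂ a) (a == b) (∪⟨⟩-∋ ⟨ v ⟩ a)
          Kv : K v ≡ true
          Kv = tab 2 (λ a b → ! a ⇛ ⊩ ! (a ∨ b)) (K₃ v) (v == c) K₃v
          Ka : K a ≡ true
          Ka = tab 2 (λ a b → ! a ⇛ ⊩ ! (a ∨ b)) (K₃ a) (a == c) K₃a
          Kb : K b ≡ true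
          Kb = tab 2 (λ a b → ! a ⇛ ⊩ ! (a ∨ b)) (K₃ b) (b == c) (∪⟨⟩-∋ K₂ b)
          K⊆W : K ⊆ W
          K⊆W i q = tab 5 (λ a b c d e → ! (((d ∨ c) ∨ b) ∨ a) ⇛ d ⊃ e ⇛ c ⊃ e ⇛ b ⊃ e ⇛ a ⊃ e ⇛ ⊩ ! e) (i == c)
              (i == b) (i == a) (i == v) (W i) q (at W Wv i) (at W (nbr-in-W Wv Dv ∈a) i) (at W (nbr-in-W Wv Dv ∈b) i)
              (at W (nbr-in-W Wv Dv ∈c) i)
          size-K : ∣ K ∣ ≡ 4
          size-K = lin 4 (λ a b c d → a ≐ 𝕤 b ⇛ b ≐ 𝕤 c ⇛ c ≐ 𝕤 d ⇛ d ≐ κ 1 ⇛ 1 ⊢ a ≐ κ 4) (∣ K ∣) (∣ K₃ ∣) (∣ K₂ ∣)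
              (∣ ⟨ v ⟩ ∣) (cnt-add K₃ c∉) (cnt-add K₂ b∉) (cnt-add ⟨ v ⟩ a∉) (cnt-single v)
          K-tight : ins A K + 2 ≡ 2 * ∣ K ∣
          K-tight = ≤-antisym (lin 2 (λ a b → b ⊹ 2 ≼ 2 ⊗ a ⇛ 1 ⊢ b ⊹ 2 ≼ 2 ⊗ a) (∣ K ∣) (ins A K)
              (sparse K (λ i q → W⊆ i (K⊆W i q)) (v , Kv))) (lin 8 (λ a b c d e f g h → 2 ⊠ a ≐ κ 4 ⇛ b ≑ c ⊕ d ⇛ c ≑ e
              ⊕ f ⇛ e ≑ g ⊕ h ⇛ κ 1 ≼ h ⇛ κ 2 ≼ f ⇛ κ 3 ≼ d ⇛ 1 ⊢ 2 ⊗ a ≼ b ⊹ 2) (∣ K ∣) (ins A K) (ins A K₃)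
              (dg A c K₃) (ins A K₂) (dg A b K₂) (ins A ⟨ v ⟩) (dg A a ⟨ v ⟩) size-K (ins-add sA K₃ c∉)
              (ins-add sA K₂ b∉) (ins-add sA ⟨ v ⟩ a∉) (cnt-pos {X = A a ∩ ⟨ v ⟩} (flip ∈a & ==-refl v))
              (cnt-two {X = A b ∩ K₂} (flip ∈b & K₂v) (flip ab & ∪⟨⟩-∋ ⟨ v ⟩ a) va)
              (cnt-three {X = A c ∩ K₃} (flip ∈c & K₃v) (flip ac & K₃a) (flip bc & ∪⟨⟩-∋ K₂ b) va vb a≢b))
          K⊆Y : K ⊆ Y
          K⊆Y = absorbs K K⊆W ((λ i q → W⊆ i (K⊆W i q)) , K-tight) Kv Yv

    -- `P` is a union of maximal tight sets, recorded as the property that a tight subset of `W`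
    -- meeting `P` lies in `P`; so the next maximal tight set is disjoint from it.
    sweep : ∀ k P → P ⊆ W → (∀ Z → Z ⊆ W → TightSet A U Z → ∀ {x} → Z x ≡ true → P x ≡ true → Z ⊆ P) → 4 * ∣ P ∣ ≤
        degrees P → ∣ W ∖ P ∣ ≤ k → 4 * ∣ W ∣ ≤ degrees W
    sweep k P P⊆W closed bound size = go k size (empty? (W ∖ P))
      where
      go : ∀ k → ∣ W ∖ P ∣ ≤ k → Empty? (W ∖ P) → 4 * ∣ W ∣ ≤ degrees W
      go k size (inj₂ none) = lin 4 (λ a b c d → 4 ⊗ a ≼ b ⇛ 4 ⊠ a ≑ c ⇛ b ≐ d ⇛ 1 ⊢ 4 ⊗ c ≼ d) (∣ P ∣) (degrees P)
          (∣ W ∣) (degrees W) bound (cnt≗ same) (sum-cong (λ i → cong (λ z → if z then ∣ A i ∣ else 0) (same i)))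
        where
        same : ∀ i → P i ≡ W i
        same i = tab 2 (λ a b → ∼ (b ∧ not a) ⇛ a ⊃ b ⇛ ⊩ a ⇔ b) (P i) (W i) (none i) (P⊆W i)
      go zero size (inj₁ (v , h)) = ⊥-elim (1≰0 (≤-trans (cnt-pos {X = W ∖ P} {v} h) size))
      go (suc k) size (inj₁ (v , h)) = step (maximal Wv)
        where
        Wv : W v ≡ true
        Wv = ∧ˡ (W v) (not (P v)) h
        Pv : P v ≡ false
        Pv = not-elim (∧ʳ (W v) (not (P v)) h)
        step : Maximal v → 4 * ∣ W ∣ ≤ degrees W
        step m = sweep k (P ∪ Y) (λ i q → tab 3 (λ a b c → ! (b ∨ a) ⇛ b ⊃ c ⇛ a ⊃ c ⇛ ⊩ ! c) (Y i) (P i) (W i) q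
            (P⊆W i) (Y⊆W i)) closed′
            (lin 7 (λ a b c d e f g → a ≑ b ⊕ c ⇛ 4 ⊗ d ≼ b ⇛ 4 ⊗ e ≼ c ⇛ 4 ⊠ f ⊕ g ≐ d ⊕ e ⇛ 1 ⊢ 4 ⊗ f ≼ a)
                (degrees (P ∪ Y)) (degrees P) (degrees Y) (∣ P ∣) (∣ Y ∣) (∣ P ∪ Y ∣) (∣ P ∩ Y ∣)
                (sum-disjoint (λ i → ∣ A i ∣) P Y disjoint) bound (heavy Wv m) (∣∪∣+∣∩∣ P Y))
            (lin 4 (λ a b c d → a ≼ 𝕤 b ⇛ a ≑ 𝕤 c ⇛ d ≼ c ⇛ 1 ⊢ d ≼ b) (∣ W ∖ P ∣) k (∣ W ∖ P ∖ ⟨ v ⟩ ∣)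
                (∣ W ∖ (P ∪ Y) ∣) size (cnt-rem (W ∖ P) h) (cnt≤ {X = W ∖ (P ∪ Y)} {W ∖ P ∖ ⟨ v ⟩}
                (λ i q → tab 4 (λ a b c d → ! (c ∧ not (b ∨ a)) ⇛ d ⊃ a ⇛ ⊩ ! ((c ∧ not b) ∧ not d)) (Y i) (P i) (W i)
                (i == v) q (at Y Yv i))))
          where
          open Maximal m
          disjoint : ∀ i → P i ≡ true → Y i ≡ false
          disjoint i Pi = 𝔹.¬-not (λ Yi → clash (closed Y Y⊆W tightY Yi Pi v Yv) Pv)
          closed′ : ∀ Z → Z ⊆ W → TightSet A U Z → ∀ {x} → Z x ≡ true → (P ∪ Y) x ≡ true → Z ⊆ P ∪ Y
          closed′ Z Z⊆W tZ {x} Zx q i Zi = by (bool (P x))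
            where
            by : Decided (P x) → P i ∨ Y i ≡ true
            by (inj₁ Px) = tab 2 (λ a b → ! a ⇛ ⊩ ! (a ∨ b)) (P i) (Y i) (closed Z Z⊆W tZ Zx Px i Zi)
            by (inj₂ Px) = tab 2 (λ a b → ! a ⇛ ⊩ ! (b ∨ a)) (Y i) (P i)
                (absorbs Z Z⊆W tZ Zx (tab 2 (λ a b → ∼ a ⇛ ! (a ∨ b) ⇛ ⊩ ! b) (P x) (Y x) Px q) i Zi)

    impossible : ⊥
    -- The degrees in `W` sum to `tch` plus `ins`, at most 2|W| + 1 plus 2|W| - 3, which is below
    -- 4|W|.
    impossible = lin 4 (λ a b c d → 4 ⊗ a ≼ b ⇛ c ⊕ d ≑ b ⇛ d ⊹ 3 ≼ 2 ⊗ a ⇛ c ≐ (2 ⊗ a) ⊹ 1 ⇛ ⊢⊥) (∣ W ∣) (degrees W)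
        (tch A W) (ins A W) (sweep ∣ W ∖ ∅ ∣ ∅ (λ i ()) (λ Z _ _ _ ()) (lin 2 (λ a b → 4 ⊠ a ≐ κ 0 ⇛ 1 ⊢ 4 ⊗ a ≼ b)
        (∣ ∅ ∣) (degrees ∅) (cnt-empty {X = ∅} (λ _ → refl))) ≤-refl) (degree-sum sA W) Wloose Wt
      where
      ∅ : VS n
      ∅ _ = false

  impossible : ⊥
  impossible = go (<-≤-connex (ins A W + 2) (2 * ∣ W ∣))
    where
    go : ins A W + 2 < 2 * ∣ W ∣ ⊎ 2 * ∣ W ∣ ≤ ins A W + 2 → ⊥
    go (inj₁ h) = LooseW.impossible (lin 2 (λ a b → 𝕤 (a ⊹ 2) ≼ 2 ⊗ b ⇛ 1 ⊢ a ⊹ 3 ≼ 2 ⊗ b) (ins A W) (∣ W ∣) h)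
    go (inj₂ h) = TightW.impossible (≤-antisym (sparse W W⊆ (bad , Wbad)) h)

-- By `total` the whole complement of `U` is cotight, so a least cotight set with a non-cubic vertex
-- exists.
irreducible-impossible : ∀ {n} {A : ES n} {U : VS n} → Relative A U → Attached A U ⊎ Apex A U → Irreducible A U → ¬
    LooksLikeK5⁻ A → ¬ LooksLikeB₁ A →
  ∀ {b} → U b ≡ false → cubic A U b ≡ false → ⊥
irreducible-impossible {n} {A} {U} rel att irrd noK5 noB1 {b} Ub Db =
    go (minimise P respects decidable ∣_∣ cnt≗ (∁ U) ((λ i → 𝔹.∧-inverseʳ (∁ U i)) , total , b , not-intro Ub , Db))
  where
  open Relative rel
  P : VS n → Set
  P W = (∀ i → (W ∖ ∁ U) i ≡ false) × tch A W ≡ 2 * ∣ W ∣ + 1 × ∃[ s ] (W s ≡ true × cubic A U s ≡ false)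
  respects : Respects P
  respects e (x , y , s , p , q) = (λ i → trans (cong (λ z → z ∧ not (∁ U i)) (sym (e i))) (x i)) , trans
      (sym (tch≗ A e)) (trans y (cong (λ z → 2 * z + 1) (cnt≗ e))) , s , trans (sym (e s)) p , q
  decidable : ∀ W → Dec (P W)
  decidable W = all? (λ i → (W ∖ ∁ U) i 𝔹.≟ false) ×-dec
      ((tch A W ≟ⁿ 2 * ∣ W ∣ + 1) ×-dec any? (λ s → (W s 𝔹.≟ true) ×-dec (cubic A U s 𝔹.≟ false)))
  go : ∃[ W ] (P W × (∀ Z → P Z → ∣ W ∣ ≤ ∣ Z ∣)) → ⊥
  go (W , (W⊆ , Wt , s , Ws , Ds) , small) = Endgame.impossible rel att irrd mini noK5 noB1
    where
    W⊆′ : W ⊆ ∁ U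
    W⊆′ i p = tab 2 (λ a b → ! a ⇛ ∼ (a ∧ not (not b)) ⇛ ⊩ ! (not b)) (W i) (U i) p (W⊆ i)
    mini : MinimalCotight A U W
    mini = record { W⊆ = W⊆′ ; Wt = Wt ; bad = s ; Wbad = Ws ; Dbad = Ds
      ; least = λ S S⊆W St {x} Sx Dx → small S ((λ i → tab 3 (λ a b c → a ⊃ b ⇛ b ⊃ not c ⇛ ⊩ ∼ (a ∧ not (not c))) (S i)
          (W i) (U i) (S⊆W i) (W⊆′ i)) , St , x , Sx , Dx) }

-- From a reduced contracted circuit back to a block

block-≗ₑ : ∀ {n} {E E′ : ES n} {U : VS n} → (∀ i j → E i j ≡ E′ i j) → Block E U → Block E′ U
block-≗ₑ {E = E} {E′} e b = record
  { simpleᵇ = simple (λ i j → trans (sym (e i j)) (trans (symm simpleᵇ i j) (e j i)))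
      (λ i → trans (sym (e i i)) (irr simpleᵇ i))
  ; within = λ i j p → within i j (trans (e i j) p) ; basis = basis ; tight = tight ; basis⊆ = λ i j p → trans
      (sym (e i j)) (basis⊆ i j p)
  ; linked = λ {a} {b} {c} {d} p q → through-mono (λ i j r → trans (sym (e i j)) r)
      (linked (trans (e a b) p) (trans (e c d) q)) }
  where open Block b

-- `Relative` with an arbitrary `W` in place of the complement of `U`: reduced graphs keep the old
-- vertex type, and deleted vertices remain as isolated ones outside `U` and `W`.
record RelativeOn {n : ℕ} (A : ES n) (U W : VS n) : Set where
  field
    simpleᵒ : Simple A
    within : ∀ i j → A i j ≡ true → U i ∨ W i ≡ true
    disjoint : ∀ i → U i ≡ true → W i ≡ false
    many : ∀ S → S ⊆ W → NE S → 2 * ∣ S ∣ + 1 ≤ tch A S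
    sparse : ∀ Y → Y ⊆ W → NE Y → ins A Y + 2 ≤ 2 * ∣ Y ∣
    total : tch A W ≡ 2 * ∣ W ∣ + 1
  within₂ : ∀ i j → A i j ≡ true → U j ∨ W j ≡ true
  within₂ i j p = within j i (trans (symm simpleᵒ j i) p)

AttachedTo : ∀ {n} → ES n → VS n → VS n → Set
AttachedTo A U W = ∃[ u₁ ] ∃[ u₂ ] ∃[ w₁ ] ∃[ w₂ ] (u₁ ≢ u₂ × (U u₁ ≡ true × U u₂ ≡ true) × (W w₁ ≡ true × W w₂ ≡ true)
    × (A u₁ w₁ ≡ true × A u₂ w₂ ≡ true))

rebuild-ear : ∀ {n} {A : ES n} {U W : VS n} → RelativeOn A U W → AttachedTo A U W → Block (inn A U) U → Block A (U ∪ W)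
rebuild-ear r (u₁ , u₂ , w₁ , w₂ , ne , (Uu₁ , Uu₂) , (Ww₁ , Ww₂) , (a₁ , a₂)) = ear (record
  { simpleᵃ = simpleᵒ ; within = within ; disjoint = disjoint ; many = many ; sparse = sparse ; total = total
  ; u₁ = u₁ ; u₂ = u₂ ; w₁ = w₁ ; w₂ = w₂ ; u₁≢u₂ = ne ; Uu₁ = Uu₁ ; Uu₂ = Uu₂ ; Ww₁ = Ww₁ ; Ww₂ = Ww₂ ; att₁ = a₁ ;
      att₂ = a₂ })
  where open RelativeOn r

-- Contracting one vertex changes nothing, so the relative circuit is a circuit. For a set
-- containing `x`, count the edges touching the missing part of `W`.
rebuild-apex : ∀ {n} {A : ES n} {U W : VS n} → RelativeOn A U W → ∀ {x} → (∀ i → U i ≡ (i == x)) → Circ A (U ∪ W) A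
rebuild-apex {n} {A} {U} {W} r {x} only = record
  { simpleᶜ = simpleᵒ
  ; ⊆E = λ _ _ p → p
  ; within = within
  ; size = lin 4 (λ a b c d → a ≐ b ⇛ b ≐ (2 ⊗ c) ⊹ 1 ⇛ 2 ⊠ d ≑ 𝕤 c ⇛ 1 ⊢ a ⊹ 1 ≐ 2 ⊗ d) (ec A) (tch A W) (∣ W ∣)
      (∣ U ∪ W ∣) all-touch total sizeV
  ; sparse = λ Y Y⊆ ne {z} Vz Yz → sub Y Y⊆ ne Vz Yz (bool (Y x)) }
  where
  open RelativeOn r
  Ux : U x ≡ true
  Ux = trans (only x) (==-refl x)
  not-both : ∀ i j → A i j ≡ true → not (U i ∧ U j) ≡ true
  not-both i j p = not-intro (𝔹.¬-not (λ q → clash (trans (cong₂ A (sym (same i (∧ˡ (U i) (U j) q)))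
      (sym (same j (∧ʳ (U i) (U j) q)))) p) (irr simpleᵒ x)))
    where
    same : ∀ i → U i ≡ true → i ≡ x
    same i p = ==⇒≡ (trans (sym (only i)) p)
  all-touch : ec A ≡ tch A W
  all-touch = ec≗ (λ i j → tab 5 (λ a b c d e → a ⊃ c ∨ b ⇛ a ⊃ e ∨ d ⇛ a ⊃ not (c ∧ e) ⇛ ⊩ a ⇔ a ∧ (b ∨ d)) (A i j)
      (W i) (U i) (W j) (U j) (within i j) (within₂ i j) (not-both i j))
  sizeV : ∣ U ∪ W ∣ ≡ suc ∣ W ∣
  sizeV = trans (cnt≗ {X = U ∪ W} {W ∪ ⟨ x ⟩} (λ i → trans (𝔹.∨-comm (U i) (W i)) (cong (W i ∨_) (only i))))
      (cnt-add W (disjoint x Ux))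
  sub : ∀ Y → Y ⊆ U ∪ W → NE Y → ∀ {z} → (U ∪ W) z ≡ true → Y z ≡ false → Decided (Y x) → ins A Y + 2 ≤ 2 * ∣ Y ∣
  sub Y Y⊆ ne {z} Vz Yz (inj₂ Yx) = sparse Y (λ i p → tab 4 (λ a b c d → ! a ⇛ a ⊃ c ∨ b ⇛ c ⇔ d ⇛ d ⊃ not a ⇛ ⊩ ! b)
      (Y i) (W i) (U i) (i == x) p (Y⊆ i) (only i) (at (∁ Y) (not-intro Yx) i)) ne
  sub Y Y⊆ ne {z} Vz Yz (inj₁ Yx) = lin 8 (λ a b c d e f g h → a ≐ (2 ⊗ b) ⊹ 1 ⇛ (2 ⊗ c) ⊹ 1 ≼ d ⇛ e ⊕ d ≼ a ⇛ 2 ⊠ b ≐ f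
      ⊕ c ⇛ 2 ⊠ g ≑ 𝕤 h ⇛ 2 ⊠ f ≼ h ⇛ 1 ⊢ e ⊹ 2 ≼ 2 ⊗ g) (tch A W) (∣ W ∣) (∣ W ∖ Y ∣) (tch A (W ∖ Y)) (ins A Y)
      (∣ W ∩ Y ∣) (∣ Y ∣) (∣ Y ∖ ⟨ x ⟩ ∣) total (many (W ∖ Y) (λ i p → ∧ˡ (W i) (not (Y i)) p)
      (z , (tab 4 (λ a b c d → ! (b ∨ a) ⇛ ∼ c ⇛ b ⇔ d ⇛ d ⊃ c ⇛ ⊩ ! (a ∧ not c)) (W z) (U z) (Y z) (z == x) Vz Yz
      (only z) (at Y Yx z)))) (ec21≤ (inn A Y) (inc A (W ∖ Y)) (inc A W)
      (λ i j → tab 7 (λ a b c d e f g → a ⊃ c ∨ b ⇛ a ⊃ e ∨ d ⇛ a ⊃ not (c ∧ e) ⇛ ⊩ 𝟙 (a ∧ g ∧ f) + 𝟙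
      (a ∧ ((b ∧ not g) ∨ (d ∧ not f))) ≦ 𝟙 (a ∧ (b ∨ d))) (A i j) (W i) (U i) (W j) (U j) (Y j) (Y i) (within i j)
      (within₂ i j) (not-both i j))) (∣∩∣+∣∖∣ W Y) (cnt-rem Y Yx)
      (cnt≤ {X = W ∩ Y} {Y ∖ ⟨ x ⟩} (λ i p → tab 3 (λ a b c → ! (b ∧ a) ⇛ c ⊃ not b ⇛ ⊩ ! (a ∧ not c)) (Y i) (W i)
      (i == x) p (at (∁ W) (not-intro (disjoint x Ux)) i)))

-- Splitting off the edges at one vertex

tch-split : ∀ {n} {A : ES n} → Simple A → ∀ (S : VS n) {v} → S v ≡ false → tch A S ≡ tch (inn A (∁ ⟨ v ⟩)) S + dg A v S
tch-split {n} {A} sA S {v} Sv = trans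
  (ec12 (inc A S) (inc (inn A (∁ ⟨ v ⟩)) S) (inc (inc A S) ⟨ v ⟩)
      (λ i j → tab 5 (λ a b c d e → ⊩ 𝟙 (c ∧ (b ∨ a)) ≃ 𝟙 ((c ∧ not e ∧ not d) ∧ (b ∨ a)) + 𝟙 ((c ∧ (b ∨ a)) ∧ (e ∨ d)))
      (S j) (S i) (A i j) (j == v) (i == v)))
  (cong (tch (inn A (∁ ⟨ v ⟩)) S +_) (trans (star (inc A S) (inc-simple sA S) v)
      (cnt≗ (λ z → tab 3 (λ a b c → ∼ a ⇛ ⊩ c ∧ (a ∨ b) ⇔ c ∧ b) (S v) (S z) (A v z) Sv))))

ins-without : ∀ {n} (A : ES n) (Y : VS n) {v} → Y v ≡ false → ins (inn A (∁ ⟨ v ⟩)) Y ≡ ins A Y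
ins-without A Y {v} Yv = ec≗ (λ i j → tab 5 (λ a b c d e → a ⊃ not b ⇛ c ⊃ not d ⇛ ⊩ (e ∧ not a ∧ not c) ∧ b ∧ d ⇔ e ∧ b
    ∧ d) (i == v) (Y i) (j == v) (Y j) (A i j) (at (∁ Y) (not-intro Yv) i) (at (∁ Y) (not-intro Yv) j))

-- Contracting the edge vu onto u and dropping the edge vy

moved : ∀ {n} → ES n → (v u y : Fin n) → VS n
moved A v u y z = A v z ∧ (not (z == y) ∧ not (z == u))

spokes : ∀ {n} → ES n → (v u y : Fin n) → ES n
spokes A v u y i j = ((i == u) ∧ moved A v u y j) ∨ ((j == u) ∧ moved A v u y i)

contract : ∀ {n} → ES n → (v u y : Fin n) → ES n
contract A v u y = inn A (∁ ⟨ v ⟩) ∪ₑ spokes A v u y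

module Contraction {n : ℕ} {A : ES n} {U : VS n} (rel : Relative A U) {v u y : Fin n} (legal : Legal A U v u y) where
  open Relative rel
  open RelativeFacts rel
  sA : Simple A
  sA = simpleʳ
  Uv : U v ≡ false
  Uv = proj₁ legal
  vu : A v u ≡ true
  vu = proj₁ (proj₂ legal)
  vy : A v y ≡ true
  vy = proj₁ (proj₂ (proj₂ legal))
  u≢y : u ≢ y
  u≢y = proj₁ (proj₂ (proj₂ (proj₂ legal)))
  far : ∀ z → A v z ≡ true → z ≢ u → z ≢ y → A u z ≡ false
  far = proj₂ (proj₂ (proj₂ (proj₂ legal)))
  u≢v : u ≢ v
  u≢v e = ≢adj vu (sym e)

  N : VS n
  N = moved A v u y
  K A₋ A′ : ES n
  K = spokes A v u y
  A₋ = inn A (∁ ⟨ v ⟩)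
  A′ = contract A v u y

  Nu : N u ≡ false
  Nu = tab 3 (λ a b c → ! a ⇛ ⊩ ∼ (c ∧ not b ∧ not a)) (u == u) (u == y) (A v u) (==-refl u)
  Nv : N v ≡ false
  Nv = tab 3 (λ a b c → ∼ a ⇛ ⊩ ∼ (a ∧ not c ∧ not b)) (A v v) (v == u) (v == y) (irr sA v)
  N-far : ∀ {z} → N z ≡ true → A u z ≡ false
  N-far {z} p = far z (∧ˡ (A v z) (not (z == y) ∧ not (z == u)) p)
      (==-≢ (not-elim (∧ʳ (not (z == y)) (not (z == u)) (∧ʳ (A v z) _ p))))
      (==-≢ (not-elim (∧ˡ (not (z == y)) (not (z == u)) (∧ʳ (A v z) _ p))))

  sK : Simple K
  sK = simple (λ i j → 𝔹.∨-comm ((i == u) ∧ N j) ((j == u) ∧ N i))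
      (λ i → tab 2 (λ a b → a ⊃ not b ⇛ ⊩ ∼ ((a ∧ b) ∨ (a ∧ b))) (i == u) (N i) (at (∁ N) (not-intro Nu) i))

  sA′ : Simple A′
  sA′ = ∪ₑ-simple (inn-simple sA (∁ ⟨ v ⟩)) sK

  K-far : ∀ i j → K i j ≡ true → not (A i j) ≡ true
  K-far i j p = go (bool ((i == u) ∧ N j))
    where
    go : Decided ((i == u) ∧ N j) → not (A i j) ≡ true
    go (inj₁ q) = not-intro (trans (cong (λ z → A z j) (==⇒≡ {i = i} (∧ˡ (i == u) (N j) q)))
        (N-far (∧ʳ (i == u) (N j) q)))
    go (inj₂ q) = not-intro (trans (symm sA i j) (trans (cong (λ z → A z i)
        (==⇒≡ {i = j} (tab 4 (λ a b c d → ∼ (b ∧ a) ⇛ ! ((b ∧ a) ∨ (d ∧ c)) ⇛ ⊩ ! d) (N j) (i == u) (N i) (j == u) q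
        p))) (N-far (tab 4 (λ a b c d → ∼ (b ∧ a) ⇛ ! ((b ∧ a) ∨ (d ∧ c)) ⇛ ⊩ ! c) (N j) (i == u) (N i) (j == u) q p))))

  split-v : ∀ Q → dg A v Q ≡ ∣ N ∩ Q ∣ + 𝟙 (Q u) + 𝟙 (Q y)
  split-v Q = lin 6 (λ a b c d e f → a ≐ b ⊕ c ⇛ c ≐ d ⊕ e ⇛ e ≐ f ⇛ 1 ⊢ a ≐ f ⊕ b ⊕ d) (dg A v Q) (𝟙 (Q u))
      (∣ (A v ∖ ⟨ u ⟩) ∩ Q ∣) (𝟙 (Q y)) (∣ (A v ∖ ⟨ u ⟩ ∖ ⟨ y ⟩) ∩ Q ∣) (∣ N ∩ Q ∣) (cnt-split (A v) Q vu)
      (cnt-split (A v ∖ ⟨ u ⟩) Q {y} (∖⟨⟩-intro {X = A v} vy (≢-sym u≢y))) (cnt≗ {X = (A v ∖ ⟨ u ⟩ ∖ ⟨ y ⟩) ∩ Q} {N ∩ Q}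
      (λ z → tab 4 (λ a b c d → ⊩ ((d ∧ not c) ∧ not b) ∧ a ⇔ (d ∧ not b ∧ not c) ∧ a) (Q z) (z == y) (z == u) (A v z)))

  tch-K : ∀ S → tch K S ≡ ∣ (λ z → N z ∧ (S u ∨ S z)) ∣
  tch-K S = trans (ec≗ {E = inc K S} {inc (inc K S) ⟨ u ⟩}
      (λ i j → tab 6 (λ a b c d e f → ⊩ ((f ∧ e) ∨ (d ∧ c)) ∧ (b ∨ a) ⇔ (((f ∧ e) ∨ (d ∧ c)) ∧ (b ∨ a)) ∧ (f ∨ d)) (S j)
      (S i) (N i) (j == u) (N j) (i == u)))
    (trans (star (inc K S) (inc-simple sK S) u) (cnt≗ (λ z → tab 6 (λ a b c d e f → ! a ⇛ ∼ b ⇛ ⊩ ((a ∧ f) ∨ (e ∧ b)) ∧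
        (d ∨ c) ⇔ f ∧ (d ∨ c)) (u == u) (N u) (S z) (S u) (z == u) (N z) (==-refl u) Nu)))

  ins-K : ∀ Y → ins K Y ≡ ∣ (λ z → N z ∧ (Y u ∧ Y z)) ∣
  ins-K Y = trans (ec≗ {E = inn K Y} {inc (inn K Y) ⟨ u ⟩}
      (λ i j → tab 6 (λ a b c d e f → ⊩ ((f ∧ e) ∨ (d ∧ c)) ∧ b ∧ a ⇔ (((f ∧ e) ∨ (d ∧ c)) ∧ b ∧ a) ∧ (f ∨ d)) (Y j)
      (Y i) (N i) (j == u) (N j) (i == u)))
    (trans (star (inn K Y) (inn-simple sK Y) u) (cnt≗ (λ z → tab 6 (λ a b c d e f → ! a ⇛ ∼ b ⇛ ⊩ ((a ∧ f) ∨ (e ∧ b)) ∧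
        d ∧ c ⇔ f ∧ d ∧ c) (u == u) (N u) (Y z) (Y u) (z == u) (N z) (==-refl u) Nu)))

  tch-A′ : ∀ S → tch A′ S ≡ tch A₋ S + tch K S
  tch-A′ S = ec12 (inc A′ S) (inc A₋ S) (inc K S) (λ i j → tab 6
      (λ a b c d e f → a ⊃ not b ⇛ ⊩ 𝟙 (((b ∧ not f ∧ not e) ∨ a) ∧ (d ∨ c)) ≃ 𝟙 ((b ∧ not f ∧ not e) ∧ (d ∨ c)) + 𝟙
      (a ∧ (d ∨ c))) (K i j) (A i j) (S j) (S i) (j == v) (i == v) (K-far i j))

  ins-A′ : ∀ Y → Y v ≡ false → ins A′ Y ≡ ins A Y + ins K Y
  ins-A′ Y Yv = trans (ec12 (inn A′ Y) (inn A₋ Y) (inn K Y)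
      (λ i j → tab 6 (λ a b c d e f → a ⊃ not b ⇛ ⊩ 𝟙 (((b ∧ not f ∧ not e) ∨ a) ∧ d ∧ c) ≃ 𝟙
      ((b ∧ not f ∧ not e) ∧ d ∧ c) + 𝟙 (a ∧ d ∧ c)) (K i j) (A i j) (Y j) (Y i) (j == v) (i == v) (K-far i j)))
    (cong (_+ ins K Y) (ins-without A Y Yv))

  -- This and the next three identities compare a set of the reduced graph with its preimage, which
  -- includes `v` exactly when the set contains `u`. Moved edges keep their status, so the counts
  -- differ only by `vu` and `vy`, where these are counted.
  tch-avoid : ∀ S → S v ≡ false → S u ≡ false → tch A S ≡ tch A′ S + 𝟙 (S y)
  tch-avoid S Sv Su = lin 8 (λ a b c d e f g h → a ≐ b ⊕ c ⇛ d ≑ b ⊕ e ⇛ c ≐ f ⊕ g ⊕ h ⇛ g ≐ κ 0 ⇛ e ≑ f ⇛ 1 ⊢ a ≐ d ⊕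
      h) (tch A S) (tch A₋ S) (dg A v S) (tch A′ S) (tch K S) (∣ N ∩ S ∣) (𝟙 (S u)) (𝟙 (S y)) (tch-split sA S Sv)
      (tch-A′ S) (split-v S) (cong 𝟙 Su) (trans (tch-K S) (cnt≗ (λ z → tab 3 (λ a b c → ∼ a ⇛ ⊩ c ∧ (a ∨ b) ⇔ c ∧ b)
      (S u) (S z) (N z) Su)))

  tch-meet : ∀ S → S v ≡ false → S u ≡ true → tch A (S ∪ ⟨ v ⟩) ≡ tch A′ S + 2
  tch-meet S Sv Su = lin 13 (λ a b c d e f g h i j k l m → a ≐ b ⊕ c ⇛ b ≐ d ⊕ e ⇛ f ≑ d ⊕ g ⇛ e ≐ h ⊕ i ⊕ j ⇛ c ≐ k ⊕ l
      ⊕ m ⇛ i ≐ κ 1 ⇛ l ≐ κ 0 ⇛ j ⊕ m ≐ κ 1 ⇛ g ≑ h ⊕ k ⇛ 1 ⊢ a ≐ f ⊹ 2) (tch A (S ∪ ⟨ v ⟩)) (tch A S) (dg A v (∁ S))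
      (tch A₋ S) (dg A v S) (tch A′ S) (tch K S) (∣ N ∩ S ∣) (𝟙 (S u)) (𝟙 (S y)) (∣ N ∩ ∁ S ∣) (𝟙 (∁ S u)) (𝟙 (∁ S y))
      (tch-add sA S Sv) (tch-split sA S Sv) (tch-A′ S) (split-v S) (split-v (∁ S)) (cong 𝟙 Su)
      (cong (λ z → 𝟙 (not z)) Su) (tab 1 (λ a → ⊩ 𝟙 a + 𝟙 (not a) ≃ 1) (S y))
      (trans (tch-K S) (cnt12 (λ z → N z ∧ (S u ∨ S z)) (N ∩ S) (N ∩ ∁ S)
      (λ z → tab 3 (λ a b c → ! a ⇛ ⊩ 𝟙 (c ∧ (a ∨ b)) ≃ 𝟙 (c ∧ b) + 𝟙 (c ∧ not b)) (S u) (S z) (N z) Su)))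

  ins-avoid : ∀ Y → Y v ≡ false → Y u ≡ false → ins A′ Y ≡ ins A Y
  ins-avoid Y Yv Yu = lin 3 (λ a b c → a ≐ b ⊕ c ⇛ c ≐ κ 0 ⇛ 1 ⊢ a ≐ b) (ins A′ Y) (ins A Y) (ins K Y) (ins-A′ Y Yv)
      (trans (ins-K Y) (cnt-empty (λ z → tab 3 (λ a b c → ∼ a ⇛ ⊩ ∼ (c ∧ a ∧ b)) (Y u) (Y z) (N z) Yu)))

  ins-meet : ∀ Y → Y v ≡ false → Y u ≡ true → ins A (Y ∪ ⟨ v ⟩) ≡ ins A′ Y + 1 + 𝟙 (Y y)
  ins-meet Y Yv Yu = lin 8 (λ a b c d e f g h → a ≐ b ⊕ c ⇛ d ≑ b ⊕ e ⇛ c ≐ f ⊕ g ⊕ h ⇛ g ≐ κ 1 ⇛ e ≑ f ⇛ 1 ⊢ a ≐ d ⊹ 1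
      ⊕ h) (ins A (Y ∪ ⟨ v ⟩)) (ins A Y) (dg A v Y) (ins A′ Y) (ins K Y) (∣ N ∩ Y ∣) (𝟙 (Y u)) (𝟙 (Y y))
      (ins-add sA Y Yv) (ins-A′ Y Yv) (split-v Y) (cong 𝟙 Yu)
      (trans (ins-K Y) (cnt≗ (λ z → tab 3 (λ a b c → ! a ⇛ ⊩ c ∧ a ∧ b ⇔ c ∧ b) (Y u) (Y z) (N z) Yu)))

  W′ : VS n
  W′ = ∁ U ∖ ⟨ v ⟩

  module Unobstructed (free : ¬ Obstacle A U v u y) (another : NE W′) where

    ⊆W′-U : ∀ {S} → S ⊆ W′ → S ⊆ ∁ U
    ⊆W′-U {S} S⊆ i p = tab 3 (λ a b c → ! a ⇛ a ⊃ not c ∧ not b ⇛ ⊩ ! (not c)) (S i) (i == v) (U i) p (S⊆ i)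
    ⊆W′-v : ∀ {S} → S ⊆ W′ → S v ≡ false
    ⊆W′-v {S} S⊆ = tab 3 (λ a b c → a ⊃ not c ∧ not b ⇛ ! b ⇛ ⊩ ∼ a) (S v) (v == v) (U v) (S⊆ v) (==-refl v)

    -- With `u` in the set, the preimage has one vertex and two touching edges more. Without `u`,
    -- only `vy` can be lost, and then the absence of a cotight obstacle leaves one edge to spare.
    many′ : ∀ S → S ⊆ W′ → NE S → 2 * ∣ S ∣ + 1 ≤ tch A′ S
    many′ S S⊆ ne = go (bool (S u)) (bool (S y))
      where
      Sv : S v ≡ false
      Sv = ⊆W′-v S⊆
      go : Decided (S u) → Decided (S y) → 2 * ∣ S ∣ + 1 ≤ tch A′ S
      go (inj₁ Su) _ = lin 4 (λ a b c d → a ≐ b ⊹ 2 ⇛ 2 ⊠ c ≑ 𝕤 d ⇛ (2 ⊗ c) ⊹ 1 ≼ a ⇛ 1 ⊢ (2 ⊗ d) ⊹ 1 ≼ b)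
          (tch A (S ∪ ⟨ v ⟩)) (tch A′ S) (∣ S ∪ ⟨ v ⟩ ∣) (∣ S ∣) (tch-meet S Sv Su) (cnt-add S Sv)
          (many (S ∪ ⟨ v ⟩) (∪⟨⟩-⊆ (⊆W′-U S⊆) Uv) (v , ∪⟨⟩-∋ S v))
      go (inj₂ Su) (inj₂ Sy) = lin 4 (λ a b c d → a ≐ b ⊕ c ⇛ c ≐ κ 0 ⇛ (2 ⊗ d) ⊹ 1 ≼ a ⇛ 1 ⊢ (2 ⊗ d) ⊹ 1 ≼ b) (tch A S)
          (tch A′ S) (𝟙 (S y)) (∣ S ∣) (tch-avoid S Sv Su) (cong 𝟙 Sy) (many S (⊆W′-U S⊆) ne)
      go (inj₂ Su) (inj₁ Sy) = lin 4 (λ a b c d → a ≐ b ⊕ c ⇛ c ≐ κ 1 ⇛ 𝕤 ((2 ⊗ d) ⊹ 1) ≼ a ⇛ 1 ⊢ (2 ⊗ d) ⊹ 1 ≼ b)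
          (tch A S) (tch A′ S) (𝟙 (S y)) (∣ S ∣) (tch-avoid S Sv Su) (cong 𝟙 Sy)
          (≤∧≢⇒< (many S (⊆W′-U S⊆) ne) (λ e → free (inj₁ (S , (⊆W′-U S⊆ , sym e) , Sy , Su , Sv))))

    sparse′ : ∀ Y → Y ⊆ W′ → NE Y → ins A′ Y + 2 ≤ 2 * ∣ Y ∣
    sparse′ Y Y⊆ ne = go (bool (Y u)) (bool (Y y))
      where
      Yv : Y v ≡ false
      Yv = ⊆W′-v Y⊆
      whole : ins A (Y ∪ ⟨ v ⟩) + 2 ≤ 2 * ∣ Y ∪ ⟨ v ⟩ ∣
      whole = sparse (Y ∪ ⟨ v ⟩) (∪⟨⟩-⊆ (⊆W′-U Y⊆) Uv) (v , ∪⟨⟩-∋ Y v)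
      go : Decided (Y u) → Decided (Y y) → ins A′ Y + 2 ≤ 2 * ∣ Y ∣
      go (inj₂ Yu) _ = lin 3 (λ a b c → a ≐ b ⇛ b ⊹ 2 ≼ 2 ⊗ c ⇛ 1 ⊢ a ⊹ 2 ≼ 2 ⊗ c) (ins A′ Y) (ins A Y) (∣ Y ∣)
          (ins-avoid Y Yv Yu) (sparse Y (⊆W′-U Y⊆) ne)
      go (inj₁ Yu) (inj₁ Yy) = lin 5 (λ a b c d e → a ≑ b ⊹ 1 ⊕ c ⇛ c ≑ κ 1 ⇛ a ⊹ 2 ≼ 2 ⊗ d ⇛ 2 ⊠ d ≐ 𝕤 e ⇛ 1 ⊢ b ⊹ 2 ≼
          2 ⊗ e) (ins A (Y ∪ ⟨ v ⟩)) (ins A′ Y) (𝟙 (Y y)) (∣ Y ∪ ⟨ v ⟩ ∣) (∣ Y ∣) (ins-meet Y Yv Yu) (cong 𝟙 Yy) whole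
          (cnt-add Y Yv)
      go (inj₁ Yu) (inj₂ Yy) = lin 5 (λ a b c d e → a ≑ b ⊹ 1 ⊕ c ⇛ c ≑ κ 0 ⇛ 2 ⊠ d ≐ 𝕤 e ⇛ 𝕤 (a ⊹ 2) ≼ 2 ⊗ d ⇛ 1 ⊢ b ⊹
          2 ≼ 2 ⊗ e) (ins A (Y ∪ ⟨ v ⟩)) (ins A′ Y) (𝟙 (Y y)) (∣ Y ∪ ⟨ v ⟩ ∣) (∣ Y ∣) (ins-meet Y Yv Yu) (cong 𝟙 Yy)
          (cnt-add Y Yv) (≤∧≢⇒< whole (λ e → free (inj₂ (Y ∪ ⟨ v ⟩ , (∪⟨⟩-⊆ (⊆W′-U Y⊆) Uv , e) , ∪⟨⟩-∋ Y v ,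
          (tab 2 (λ a b → ! a ⇛ ⊩ ! (a ∨ b)) (Y u) (u == v) Yu) , cong₂ _∨_ Yy (≢⇒== (≢-sym (≢adj vy)))))))

    ∣W′∣ : ∣ ∁ U ∣ ≡ suc ∣ W′ ∣
    ∣W′∣ = cnt-rem (∁ U) (not-intro Uv)

    -- When u lies in U the lower bound many′ W′ leaves no room for a moved edge inside U.
    in-U : U u ≡ true → tch A′ W′ + ∣ N ∩ U ∣ ≡ 2 * ∣ W′ ∣ + 1
    in-U Uu = lin 11 (λ a b c d e f g h i j k → a ≐ (2 ⊗ b) ⊹ 1 ⇛ 2 ⊠ b ≐ 𝕤 c ⇛ a ≑ d ⊕ e ⇛ e ≑ f ⇛ f ≑ g ⊕ h ⊕ i ⇛ h ≑
        κ 1 ⇛ d ≑ j ⊕ k ⇛ k ⊕ i ≑ κ 1 ⇛ 1 ⊢ j ⊕ g ≐ (2 ⊗ c) ⊹ 1) (tch A (∁ U)) (∣ ∁ U ∣) (∣ W′ ∣) (tch A W′)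
        (dg A v (∁ (∁ U))) (dg A v U) (∣ N ∩ U ∣) (𝟙 (U u)) (𝟙 (U y)) (tch A′ W′) (𝟙 (W′ y)) total ∣W′∣
        (tch-rem sA (∁ U) (not-intro Uv)) (cnt≗ {X = A v ∩ ∁ (∁ U)} {A v ∩ U}
        (λ z → cong (A v z ∧_) (𝔹.not-involutive (U z)))) (split-v U) (cong 𝟙 Uu)
        (tch-avoid W′ (∉∖ (∁ U) v) (tab 2 (λ a b → ! a ⇛ ⊩ ∼ (not a ∧ not b)) (U u) (u == v) Uu))
        (tab 2 (λ a b → ∼ a ⇛ ⊩ 𝟙 (not b ∧ not a) + 𝟙 b ≃ 1) (y == v) (U y) (≢⇒== (≢-sym (≢adj vy))))

    no-N∩U : U u ≡ true → ∣ N ∩ U ∣ ≡ 0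
    no-N∩U Uu = ≤-antisym (lin 3 (λ a b c → a ⊕ b ≐ (2 ⊗ c) ⊹ 1 ⇛ (2 ⊗ c) ⊹ 1 ≼ a ⇛ 1 ⊢ b ≼ κ 0) (tch A′ W′) (∣ N ∩ U ∣)
        (∣ W′ ∣) (in-U Uu) (many′ W′ (λ _ p → p) another)) (lin 1 (λ a → 1 ⊢ κ 0 ≼ a) (∣ N ∩ U ∣))

    total′ : tch A′ W′ ≡ 2 * ∣ W′ ∣ + 1
    total′ = go (bool (U u))
      where
      go : Decided (U u) → tch A′ W′ ≡ 2 * ∣ W′ ∣ + 1
      go (inj₁ Uu) = lin 3 (λ a b c → a ⊕ b ≐ (2 ⊗ c) ⊹ 1 ⇛ b ≑ κ 0 ⇛ 1 ⊢ a ≐ (2 ⊗ c) ⊹ 1) (tch A′ W′) (∣ N ∩ U ∣)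
          (∣ W′ ∣) (in-U Uu) (no-N∩U Uu)
      go (inj₂ Uu) = lin 5 (λ a b c d e → a ≐ (2 ⊗ b) ⊹ 1 ⇛ 2 ⊠ b ≐ 𝕤 c ⇛ a ≑ d ⇛ d ≑ e ⊹ 2 ⇛ 1 ⊢ e ≐ (2 ⊗ c) ⊹ 1)
          (tch A (∁ U)) (∣ ∁ U ∣) (∣ W′ ∣) (tch A (W′ ∪ ⟨ v ⟩)) (tch A′ W′) total ∣W′∣
          (tch≗ A (∖∪-restore (∁ U) (not-intro Uv))) (tch-meet W′ (∉∖ (∁ U) v) (not-intro Uu & ≢⇒not u≢v))

    within′ : ∀ i j → A′ i j ≡ true → U i ∨ W′ i ≡ true
    within′ i j p = tab 8 (λ a b c d e f g h → ! ((g ∧ not f ∧ not e) ∨ (d ∧ c) ∨ (b ∧ a)) ⇛ d ⊃ not f ⇛ f ⊃ not a ⇛ ⊩ !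
        (h ∨ (not h ∧ not f))) (N i) (j == u) (N j) (i == u) (j == v) (i == v) (A i j) (U i) p
        (at (∁ ⟨ v ⟩) (≢⇒not u≢v) i) (at (∁ N) (not-intro Nv) i)

    relative′ : RelativeOn A′ U W′
    relative′ = record { simpleᵒ = sA′ ; within = within′ ; disjoint = λ i p
        → (tab 2 (λ a b → ! a ⇛ ⊩ ∼ (not a ∧ not b)) (U i) (i == v) p) ; many = many′ ; sparse = sparse′ ; total
        = total′ }

    N-outside : U u ≡ true → ∀ {z} → N z ≡ true → U z ≡ false
    N-outside Uu {z} Nz = 𝔹.¬-not (λ Uz → 1≰0 (≤-trans (cnt-pos {X = N ∩ U} (Nz & Uz)) (≤-reflexive (no-N∩U Uu))))

    inside-same : ∀ i j → inn A U i j ≡ inn A′ U i j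
    inside-same i j = tab 9 (λ a b c d e f g h i → a ⊃ not b ⇛ c ⊃ not d ⇛ e ∧ b ⊃ not f ∨ not d ⇛ g ∧ d ⊃ not h ∨ not b
        ⇛ ⊩ i ∧ b ∧ d ⇔ ((i ∧ not a ∧ not c) ∨ (e ∧ f) ∨ (g ∧ h)) ∧ b ∧ d) (i == v) (U i) (j == v) (U j) (i == u) (N j)
        (j == u) (N i) (A i j) (at (∁ U) (not-intro Uv) i) (at (∁ U) (not-intro Uv) j) (toward i j) (toward j i)
      where
      toward : ∀ i j → (i == u) ∧ U i ≡ true → not (N j) ∨ not (U j) ≡ true
      toward i j p = go (bool (N j))
        where
        Uu : U u ≡ true
        Uu = subst (λ z → U z ≡ true) (==⇒≡ {i = i} (∧ˡ (i == u) (U i) p)) (∧ʳ (i == u) (U i) p)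
        go : Decided (N j) → not (N j) ∨ not (U j) ≡ true
        go (inj₁ Nj) = tab 2 (λ a b → ∼ a ⇛ ⊩ ! (not b ∨ not a)) (U j) (N j) (N-outside Uu Nj)
        go (inj₂ Nj) = cong (λ z → not z ∨ not (U j)) Nj

    keeps-vertex : ∀ {i} → U i ∨ W′ i ≡ not (i == v)
    keeps-vertex {i} = tab 2 (λ a b → a ⊃ not b ⇛ ⊩ b ∨ (not b ∧ not a) ⇔ not a) (i == v) (U i)
        (at (∁ U) (not-intro Uv) i)

    keep-edge : ∀ {a w} → A a w ≡ true → a ≢ v → w ≢ v → A′ a w ≡ true
    keep-edge {a} {w} aw a≢v w≢v = tab 4 (λ a b c d → ! a ⇛ ∼ b ⇛ ∼ c ⇛ ⊩ ! ((a ∧ not b ∧ not c) ∨ d)) (A a w) (a == v)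
        (w == v) (K a w) aw (≢⇒== a≢v) (≢⇒== w≢v)

    by-ear : AttachedTo A′ U W′ → Block (inn A U) U → Block A′ (∁ ⟨ v ⟩)
    by-ear att blk = block≗ (λ i → keeps-vertex {i}) (rebuild-ear relative′ att (block-≗ₑ inside-same blk))

    by-apex : ∀ {x} → (∀ i → U i ≡ (i == x)) → Block A′ (∁ ⟨ v ⟩)
    by-apex {x} only = block≗ (λ i → keeps-vertex {i}) (circ-block (rebuild-apex relative′ only) (proj₂ (proj₂ edge)))
      where
      edge : ∃[ a ] ∃[ b ] A′ a b ≡ true
      edge = go (ec-edge (inc A′ W′) (lin 2 (λ a b → a ≑ (2 ⊗ b) ⊹ 1 ⇛ 1 ⊢ κ 1 ≼ a) (tch A′ W′) (∣ W′ ∣) total′))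
        where
        go : ∃[ a ] ∃[ b ] inc A′ W′ a b ≡ true → ∃[ a ] ∃[ b ] A′ a b ≡ true
        go (a , b , p) = a , b , (∧ˡ (A′ a b) ((W′ a) ∨ (W′ b)) p)

    -- Only an attachment through `v` is at risk. At `u` a moved edge replaces it; at `y` the
    -- assumption supplies another; at any other vertex `a`, the edge `av` becomes `au`, and `u` is
    -- outside `U`.
    still-attached : StaysAttached A U v y → ∀ {a w} → U a ≡ true → U w ≡ false → A a w ≡ true → ∃[ w′ ]
        (W′ w′ ≡ true × A′ a w′ ≡ true)
    still-attached stays {a} {w} Ua Uw aw = go (w ≟ v)
      where
      a≢v : a ≢ v
      a≢v e = clash (subst (λ z → U z ≡ true) e Ua) Uv
      spoke : ∀ {z} → N z ≡ true → A′ u z ≡ true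
      spoke {z} Nz = tab 5 (λ a b c d e → ! a ⇛ ! b ⇛ ⊩ ! (e ∨ (b ∧ a) ∨ (d ∧ c))) (N z) (u == u) (N u) (z == u)
          (A₋ u z) Nz (==-refl u)
      ∈W′ : ∀ {z} → U z ≡ false → z ≢ v → W′ z ≡ true
      ∈W′ Uz z≢v = not-intro Uz & ≢⇒not z≢v
      go : Dec (w ≡ v) → ∃[ w′ ] (W′ w′ ≡ true × A′ a w′ ≡ true)
      go (no w≢v) = w , ∈W′ Uw w≢v , keep-edge aw a≢v w≢v
      go (yes refl) = by (a ≟ u) (a ≟ y)
        where
        by : Dec (a ≡ u) → Dec (a ≡ y) → ∃[ w′ ] (W′ w′ ≡ true × A′ a w′ ≡ true)
        by (yes refl) _ = via (pos⇒NE N (lin 6 (λ a b c d e f → κ 3 ≼ a ⇛ a ≐ b ⇛ b ≐ c ⊕ d ⊕ e ⇛ d ≐ κ 1 ⇛ e ≐ κ 1 ⇛ c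
            ≐ f ⇛ 1 ⊢ κ 1 ≼ f) (∣ A v ∣) (dg A v full) (∣ N ∩ full ∣) (𝟙 (full u)) (𝟙 (full y)) (∣ N ∣) (deg≥3 Uv)
            dg-full (split-v full) refl refl (cnt≗ {X = N ∩ full} {N} (λ z → 𝔹.∧-identityʳ (N z)))))
          where
          dg-full : ∣ A v ∣ ≡ dg A v full
          dg-full = cnt≗ {X = A v} {A v ∩ full} (λ z → sym (𝔹.∧-identityʳ (A v z)))
          via : NE N → ∃[ w′ ] (W′ w′ ≡ true × A′ u w′ ≡ true)
          via (z , Nz) = z , ∈W′ (N-outside Ua Nz) (∈≢∉ {X = N} Nz Nv) , spoke Nz
        by (no _) (yes refl) = via (stays Ua)
          where
          via : ∃[ w ] (U w ≡ false × w ≢ v × A y w ≡ true) → ∃[ w′ ] (W′ w′ ≡ true × A′ y w′ ≡ true)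
          via (w , Uw , w≢v , yw) = w , ∈W′ Uw w≢v , keep-edge yw a≢v w≢v
        by (no a≢u) (no a≢y) = u , ∈W′ (𝔹.¬-not (λ Uu → clash Ua (N-outside Uu Na))) u≢v , trans (symm sA′ a u)
            (spoke Na)
          where
          Na : N a ≡ true
          Na = flip aw & ≢⇒not a≢y & ≢⇒not a≢u

    attached′ : StaysAttached A U v y → Attached A U → AttachedTo A′ U W′
    attached′ stays (u₁ , u₂ , w₁ , w₂ , ne , (Uu₁ , Uu₂) , (Uw₁ , Uw₂) , (a₁ , a₂)) = go
        (still-attached stays Uu₁ Uw₁ a₁) (still-attached stays Uu₂ Uw₂ a₂)
      where
      go : ∃[ w′ ] (W′ w′ ≡ true × A′ u₁ w′ ≡ true) → ∃[ w′ ] (W′ w′ ≡ true × A′ u₂ w′ ≡ true) → AttachedTo A′ U W′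
      go (w₁ , p , q) (w₂ , r , s) = u₁ , u₂ , w₁ , w₂ , ne , (Uu₁ , Uu₂) , (p , r) , (q , s)

-- Replacing the two cubic vertices of a K₄⁻ by an edge

replace : ∀ {n} → ES n → (t p q r : Fin n) → ES n
replace A t p q r = inn (inn A (∁ ⟨ t ⟩)) (∁ ⟨ p ⟩) ⊞ (q , r)

module Replacement {n : ℕ} {A : ES n} {U : VS n} (rel : Relative A U) {t p q r : Fin n} (dia : Diamond A U t p q r)
    where
  open Relative rel
  open RelativeFacts rel
  open Diamond dia renaming (tr to tr′)
  sA : Simple A
  sA = simpleʳ
  A₁ A₂ A′ : ES n
  A₁ = inn A (∁ ⟨ t ⟩)
  A₂ = inn A₁ (∁ ⟨ p ⟩)
  A′ = replace A t p q r
  p≢t : p ≢ t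
  p≢t e = ≢adj tp (sym e)
  q≢t : q ≢ t
  q≢t e = ≢adj tq (sym e)
  q≢p : q ≢ p
  q≢p e = ≢adj pq (sym e)
  r≢t : r ≢ t
  r≢t e = ≢adj tr′ (sym e)
  r≢p : r ≢ p
  r≢p e = ≢adj pr (sym e)

  sA₁ : Simple A₁
  sA₁ = inn-simple sA (∁ ⟨ t ⟩)
  sA₂ : Simple A₂
  sA₂ = inn-simple sA₁ (∁ ⟨ p ⟩)
  sA′ : Simple A′
  sA′ = ∪ₑ-simple sA₂ (pair-simple q≢r)

  new : ∀ i j → pair q r i j ≡ true → not (A i j) ≡ true
  new = pair-∉ sA qr

  tch-A₂ : ∀ S → S t ≡ false → S p ≡ false → tch A S ≡ tch A₂ S + dg A t S + dg A p S
  tch-A₂ S St Sp = lin 6 (λ a b c d e f → a ≐ b ⊕ c ⇛ b ≐ d ⊕ e ⇛ e ≐ f ⇛ 1 ⊢ a ≐ d ⊕ c ⊕ f) (tch A S) (tch A₁ S)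
      (dg A t S) (tch A₂ S) (dg A₁ p S) (dg A p S) (tch-split sA S St) (tch-split sA₁ S Sp)
      (cnt≗ {X = A₁ p ∩ S} {A p ∩ S} (λ z → tab 4 (λ a b c d → ∼ a ⇛ b ⊃ not c ⇛ ⊩ (d ∧ not a ∧ not b) ∧ c ⇔ d ∧ c)
      (p == t) (z == t) (S z) (A p z) (≢⇒== p≢t) (at (∁ S) (not-intro St) z)))

  -- Five edges touch the adjacent cubic vertices `t` and `p`. Five edges and two vertices are
  -- traded for one edge, a loss of four, as the bound requires.
  grown : ∀ S → S t ≡ false → S p ≡ false → tch A (S ∪ ⟨ t ⟩ ∪ ⟨ p ⟩) ≡ tch A₂ S + 5
  grown S St Sp = lin 13 (λ a b c d e f g h i j k l m → a ≐ b ⇛ b ≐ c ⊕ d ⇛ c ≐ e ⊕ f ⇛ e ≐ g ⊕ h ⊕ i ⇛ j ≑ h ⊕ f ⇛ j ≐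
      κ 3 ⇛ k ≑ i ⊕ l ⇛ k ≐ κ 3 ⇛ l ≑ 𝕤 m ⇛ m ≑ d ⇛ 1 ⊢ a ≐ g ⊹ 5) (tch A (S ∪ ⟨ t ⟩ ∪ ⟨ p ⟩))
      (tch A ((S ∪ ⟨ t ⟩) ∪ ⟨ p ⟩)) (tch A (S ∪ ⟨ t ⟩)) (dg A p (∁ (S ∪ ⟨ t ⟩))) (tch A S) (dg A t (∁ S)) (tch A₂ S)
      (dg A t S) (dg A p S) (∣ A t ∣) (∣ A p ∣) (dg A p (∁ S)) (∣ (A p ∩ ∁ S) ∖ ⟨ t ⟩ ∣)
      (tch≗ A {S ∪ ⟨ t ⟩ ∪ ⟨ p ⟩} {(S ∪ ⟨ t ⟩) ∪ ⟨ p ⟩} (λ i → sym (𝔹.∨-assoc (S i) _ _)))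
      (tch-add sA (S ∪ ⟨ t ⟩) {p} (cong₂ _∨_ Sp (≢⇒== p≢t))) (tch-add sA S St) (tch-A₂ S St Sp) (dg-∁ A t S) deg-t
      (dg-∁ A p S) deg-p (cnt-rem (A p ∩ ∁ S) {t} (flip tp & not-intro St))
      (cnt≗ {X = (A p ∩ ∁ S) ∖ ⟨ t ⟩} {A p ∩ ∁ (S ∪ ⟨ t ⟩)}
      (λ z → tab 3 (λ a b c → ⊩ (c ∧ not b) ∧ not a ⇔ c ∧ not (b ∨ a)) (z == t) (S z) (A p z)))

  size₂ : ∀ S → S t ≡ false → S p ≡ false → ∣ S ∪ ⟨ t ⟩ ∪ ⟨ p ⟩ ∣ ≡ ∣ S ∣ + 2
  size₂ S St Sp = lin 4 (λ a b c d → a ≐ b ⇛ b ≐ 𝕤 c ⇛ c ≐ 𝕤 d ⇛ 1 ⊢ a ≐ d ⊹ 2) (∣ S ∪ ⟨ t ⟩ ∪ ⟨ p ⟩ ∣)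
      (∣ (S ∪ ⟨ t ⟩) ∪ ⟨ p ⟩ ∣) (∣ S ∪ ⟨ t ⟩ ∣) (∣ S ∣) (cnt≗ {X = S ∪ ⟨ t ⟩ ∪ ⟨ p ⟩} {(S ∪ ⟨ t ⟩) ∪ ⟨ p ⟩}
      (λ i → sym (𝔹.∨-assoc (S i) _ _))) (cnt-add (S ∪ ⟨ t ⟩) {p} (cong₂ _∨_ Sp (≢⇒== p≢t))) (cnt-add S St)

  tch-A′ : ∀ S → tch A′ S ≡ tch A₂ S + tch (pair q r) S
  tch-A′ S = ec12 (inc A′ S) (inc A₂ S) (inc (pair q r) S)
      (λ i j → tab 8 (λ a b c d e f g h → a ⊃ not b ⇛ ⊩ 𝟙 ((((b ∧ not h ∧ not g) ∧ not f ∧ not e) ∨ a) ∧ (d ∨ c)) ≃ 𝟙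
      (((b ∧ not h ∧ not g) ∧ not f ∧ not e) ∧ (d ∨ c)) + 𝟙 (a ∧ (d ∨ c))) (pair q r i j) (A i j) (S j) (S i) (j == p)
      (i == p) (j == t) (i == t) (new i j))

  tch-pair : ∀ S → S q ∨ S r ≡ true → tch (pair q r) S ≡ 1
  tch-pair S h = trans (ec≗ {E = inc (pair q r) S} {pair q r} (λ i j → tab 3 (λ a b c → a ⊃ c ∨ b ⇛ ⊩ a ∧ (c ∨ b) ⇔ a)
      (pair q r i j) (S j) (S i) (pair-apart (λ i j → S i ∨ S j) (λ i j → 𝔹.∨-comm (S i) (S j)) h i j))) (ec-pair q≢r)

  W′ : VS n
  W′ = ∁ U ∖ ⟨ t ⟩ ∖ ⟨ p ⟩

  ⊆W′-U : ∀ {S} → S ⊆ W′ → S ⊆ ∁ U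
  ⊆W′-U {S} S⊆ i h = tab 4 (λ a b c d → ! a ⇛ a ⊃ (not d ∧ not c) ∧ not b ⇛ ⊩ ! (not d)) (S i) (i == p) (i == t) (U i) h
      (S⊆ i)
  ⊆W′-t : ∀ {S} → S ⊆ W′ → S t ≡ false
  ⊆W′-t {S} S⊆ = tab 4 (λ a b c d → a ⊃ (not d ∧ not c) ∧ not b ⇛ ! c ⇛ ⊩ ∼ a) (S t) (t == p) (t == t) (U t) (S⊆ t)
      (==-refl t)
  ⊆W′-p : ∀ {S} → S ⊆ W′ → S p ≡ false
  ⊆W′-p {S} S⊆ = tab 4 (λ a b c d → a ⊃ (not d ∧ not c) ∧ not b ⇛ ! b ⇛ ⊩ ∼ a) (S p) (p == p) (p == t) (U p) (S⊆ p)
      (==-refl p)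
  grown-⊆ : ∀ {S} → S ⊆ ∁ U → S ∪ ⟨ t ⟩ ∪ ⟨ p ⟩ ⊆ ∁ U
  grown-⊆ {S} S⊆ i h = tab 4 (λ a b c d → ! (c ∨ b ∨ a) ⇛ c ⊃ not d ⇛ b ⊃ not d ⇛ a ⊃ not d ⇛ ⊩ ! (not d)) (i == p)
      (i == t) (S i) (U i) h (S⊆ i) (at (∁ U) (not-intro Ut) i) (at (∁ U) (not-intro Up) i)
  grown-∋ : ∀ S → (S ∪ ⟨ t ⟩ ∪ ⟨ p ⟩) t ≡ true
  grown-∋ S = tab 3 (λ a b c → ! a ⇛ ⊩ ! (c ∨ a ∨ b)) (t == t) (t == p) (S t) (==-refl t)

  apart : ∀ S → S t ≡ false → S p ≡ false → S q ≡ false → S r ≡ false → dg A t S ≡ 0 × dg A p S ≡ 0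
  apart S St Sp Sq Sr = cnt-empty (λ z → no-t z (z ≟ p) (z ≟ q) (z ≟ r)) , cnt-empty
      (λ z → no-p z (z ≟ t) (z ≟ q) (z ≟ r))
    where
    no-t : ∀ z → Dec (z ≡ p) → Dec (z ≡ q) → Dec (z ≡ r) → A t z ∧ S z ≡ false
    no-t z (yes refl) _ _ = tab 2 (λ a b → ∼ a ⇛ ⊩ ∼ (b ∧ a)) (S z) (A t z) Sp
    no-t z _ (yes refl) _ = tab 2 (λ a b → ∼ a ⇛ ⊩ ∼ (b ∧ a)) (S z) (A t z) Sq
    no-t z _ _ (yes refl) = tab 2 (λ a b → ∼ a ⇛ ⊩ ∼ (b ∧ a)) (S z) (A t z) Sr
    no-t z (no a) (no b) (no c) = cong (_∧ S z) (three-only {X = A t} deg-t tp tq tr′ (≢-sym q≢p) (≢-sym r≢p) q≢r a b c)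
    no-p : ∀ z → Dec (z ≡ t) → Dec (z ≡ q) → Dec (z ≡ r) → A p z ∧ S z ≡ false
    no-p z (yes refl) _ _ = tab 2 (λ a b → ∼ a ⇛ ⊩ ∼ (b ∧ a)) (S z) (A p z) St
    no-p z _ (yes refl) _ = tab 2 (λ a b → ∼ a ⇛ ⊩ ∼ (b ∧ a)) (S z) (A p z) Sq
    no-p z _ _ (yes refl) = tab 2 (λ a b → ∼ a ⇛ ⊩ ∼ (b ∧ a)) (S z) (A p z) Sr
    no-p z (no a) (no b) (no c) = cong (_∧ S z) (three-only {X = A p} deg-p (flip tp) pq pr (≢-sym q≢t) (≢-sym r≢t) q≢r
        a b c)

  many′ : ∀ S → S ⊆ W′ → NE S → 2 * ∣ S ∣ + 1 ≤ tch A′ S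
  many′ S S⊆ ne = go (bool (S q ∨ S r))
    where
    St : S t ≡ false
    St = ⊆W′-t S⊆
    Sp : S p ≡ false
    Sp = ⊆W′-p S⊆
    go : Decided (S q ∨ S r) → 2 * ∣ S ∣ + 1 ≤ tch A′ S
    go (inj₁ h) = lin 6 (λ a b c d e f → a ≑ b ⊕ c ⇛ c ≑ κ 1 ⇛ d ≐ b ⊹ 5 ⇛ 2 ⊠ e ≑ f ⊹ 2 ⇛ (2 ⊗ e) ⊹ 1 ≼ d ⇛ 1 ⊢ (2 ⊗ f)
        ⊹ 1 ≼ a) (tch A′ S) (tch A₂ S) (tch (pair q r) S) (tch A (S ∪ ⟨ t ⟩ ∪ ⟨ p ⟩)) (∣ S ∪ ⟨ t ⟩ ∪ ⟨ p ⟩ ∣) (∣ S ∣)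
        (tch-A′ S) (tch-pair S h) (grown S St Sp) (size₂ S St Sp) (many (S ∪ ⟨ t ⟩ ∪ ⟨ p ⟩) (grown-⊆ (⊆W′-U S⊆))
        (t , grown-∋ S))
    go (inj₂ h) = lin 7 (λ a b c d e f g → a ≑ b ⊕ c ⇛ d ≐ b ⊕ e ⊕ f ⇛ (2 ⊗ g) ⊹ 1 ≼ d ⇛ e ≐ κ 0 ⇛ f ≐ κ 0 ⇛ 1 ⊢ (2 ⊗ g)
        ⊹ 1 ≼ a) (tch A′ S) (tch A₂ S) (tch (pair q r) S) (tch A S) (dg A t S) (dg A p S) (∣ S ∣) (tch-A′ S)
        (tch-A₂ S St Sp) (many S (⊆W′-U S⊆) ne) (proj₁ (apart S St Sp Sq Sr)) (proj₂ (apart S St Sp Sq Sr))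
      where
      Sq : S q ≡ false
      Sq = tab 2 (λ a b → ∼ (b ∨ a) ⇛ ⊩ ∼ b) (S r) (S q) h
      Sr : S r ≡ false
      Sr = tab 2 (λ a b → ∼ (b ∨ a) ⇛ ⊩ ∼ a) (S r) (S q) h

  sparse′ : ∀ Y → Y ⊆ W′ → NE Y → ins A′ Y + 2 ≤ 2 * ∣ Y ∣
  sparse′ Y Y⊆ ne = go (bool (Y q ∧ Y r))
    where
    Yt : Y t ≡ false
    Yt = ⊆W′-t Y⊆
    Yp : Y p ≡ false
    Yp = ⊆W′-p Y⊆
    Yt′p : (Y ∪ ⟨ t ⟩) p ≡ false
    Yt′p = cong₂ _∨_ Yp (≢⇒== p≢t)
    inA₂ : ins A₂ Y ≡ ins A Y
    inA₂ = trans (ins-without A₁ Y Yp) (ins-without A Y Yt)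
    go : Decided (Y q ∧ Y r) → ins A′ Y + 2 ≤ 2 * ∣ Y ∣
    go (inj₁ h) = lin 11 (λ a b c d e f g h i j k → a ≼ b ⊕ c ⇛ c ≐ κ 1 ⇛ b ≐ d ⇛ e ≑ d ⊕ f ⇛ g ≑ e ⊕ h ⇛ 2 ⊠ i ≐ 𝕤 j ⇛
        2 ⊠ k ≐ 𝕤 i ⇛ g ⊹ 2 ≼ 2 ⊗ k ⇛ κ 2 ≼ f ⇛ κ 3 ≼ h ⇛ 1 ⊢ a ⊹ 2 ≼ 2 ⊗ j) (ins A′ Y) (ins A₂ Y) (ec (pair q r))
        (ins A Y) (ins A (Y ∪ ⟨ t ⟩)) (dg A t Y) (ins A ((Y ∪ ⟨ t ⟩) ∪ ⟨ p ⟩)) (dg A p (Y ∪ ⟨ t ⟩)) (∣ Y ∪ ⟨ t ⟩ ∣)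
        (∣ Y ∣) (∣ (Y ∪ ⟨ t ⟩) ∪ ⟨ p ⟩ ∣) (ec12≤ (inn A′ Y) (inn A₂ Y) (pair q r)
        (λ i j → tab 4 (λ a b c d → ⊩ 𝟙 ((d ∨ c) ∧ b ∧ a) ≦ 𝟙 (d ∧ b ∧ a) + 𝟙 c) (Y j) (Y i) (pair q r i j) (A₂ i j)))
        (ec-pair q≢r) inA₂ (ins-add sA Y Yt) (ins-add sA (Y ∪ ⟨ t ⟩) Yt′p) (cnt-add Y Yt) (cnt-add (Y ∪ ⟨ t ⟩) Yt′p)
        (sparse ((Y ∪ ⟨ t ⟩) ∪ ⟨ p ⟩) (∪⟨⟩-⊆ (∪⟨⟩-⊆ (⊆W′-U Y⊆) Ut) Up) (p , ∪⟨⟩-∋ (Y ∪ ⟨ t ⟩) p))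
        (cnt-two {X = A t ∩ Y} (tq & Yq) (tr′ & Yr) q≢r) (cnt-three {X = A p ∩ (Y ∪ ⟨ t ⟩)} {t} {q} {r}
        (flip tp & ∪⟨⟩-∋ Y t) (pq & cong (_∨ (q == t)) Yq) (pr & cong (_∨ (r == t)) Yr) (≢-sym q≢t) (≢-sym r≢t) q≢r)
      where
      Yq : Y q ≡ true
      Yq = ∧ˡ (Y q) (Y r) h
      Yr : Y r ≡ true
      Yr = ∧ʳ (Y q) (Y r) h
    go (inj₂ h) = lin 4 (λ a b c d → a ≼ b ⇛ b ≐ c ⇛ c ⊹ 2 ≼ 2 ⊗ d ⇛ 1 ⊢ a ⊹ 2 ≼ 2 ⊗ d) (ins A′ Y) (ins A₂ Y) (ins A Y)
        (∣ Y ∣) (ec-⊆ {E = inn A′ Y} {inn A₂ Y} (λ i j k → tab 4 (λ a b c d → ! ((d ∨ c) ∧ b ∧ a) ⇛ c ⊃ not (b ∧ a) ⇛ ⊩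
        ! (d ∧ b ∧ a)) (Y j) (Y i) (pair q r i j) (A₂ i j) k
        (pair-apart (λ i j → not (Y i ∧ Y j)) (λ i j → cong not (𝔹.∧-comm (Y i) (Y j))) (not-intro h) i j))) inA₂
        (sparse Y (⊆W′-U Y⊆) ne)

  W′t : W′ t ≡ false
  W′t = ⊆W′-t (λ _ h → h)
  W′p : W′ p ≡ false
  W′p = ⊆W′-p (λ _ h → h)

  total′ : tch A′ W′ ≡ 2 * ∣ W′ ∣ + 1
  total′ = lin 8 (λ a b c d e f g h → a ≐ b ⊕ c ⇛ c ≐ κ 1 ⇛ d ≑ b ⊹ 5 ⇛ 2 ⊠ e ≐ f ⊹ 2 ⇛ g ≐ (2 ⊗ h) ⊹ 1 ⇛ g ≑ d ⇛ 2 ⊠ h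
      ≐ e ⇛ 1 ⊢ a ≐ (2 ⊗ f) ⊹ 1) (tch A′ W′) (tch A₂ W′) (tch (pair q r) W′) (tch A (W′ ∪ ⟨ t ⟩ ∪ ⟨ p ⟩))
      (∣ W′ ∪ ⟨ t ⟩ ∪ ⟨ p ⟩ ∣) (∣ W′ ∣) (tch A (∁ U)) (∣ ∁ U ∣) (tch-A′ W′)
      (tch-pair W′ (tab 6 (λ a b c d e f → ∼ (b ∧ a) ⇛ ∼ c ⇛ ∼ d ⇛ ∼ e ⇛ ∼ f ⇛ ⊩ !
      (((not b ∧ not c) ∧ not d) ∨ ((not a ∧ not e) ∧ not f))) (U r) (U q) (q == t) (q == p) (r == t) (r == p) not-both
      (≢⇒== q≢t) (≢⇒== q≢p) (≢⇒== r≢t) (≢⇒== r≢p))) (grown W′ W′t W′p) (size₂ W′ W′t W′p) total (tch≗ A same)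
      (cnt≗ same)
    where
    same : ∀ i → ∁ U i ≡ (W′ ∪ ⟨ t ⟩ ∪ ⟨ p ⟩) i
    same i = tab 3 (λ a b c → a ⊃ not b ⇛ c ⊃ not b ⇛ ⊩ not b ⇔ ((not b ∧ not a) ∧ not c) ∨ a ∨ c) (i == t) (U i)
        (i == p) (at (∁ U) (not-intro Ut) i) (at (∁ U) (not-intro Up) i)

  V′ : VS n
  V′ = ∁ ⟨ t ⟩ ∩ ∁ ⟨ p ⟩

  keeps-vertex : ∀ i → U i ∨ W′ i ≡ V′ i
  keeps-vertex i = tab 3 (λ a b c → a ⊃ not b ⇛ c ⊃ not b ⇛ ⊩ b ∨ ((not b ∧ not a) ∧ not c) ⇔ not a ∧ not c) (i == t)
      (U i) (i == p) (at (∁ U) (not-intro Ut) i) (at (∁ U) (not-intro Up) i)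

  within′ : ∀ i j → A′ i j ≡ true → U i ∨ W′ i ≡ true
  within′ i j h = trans (keeps-vertex i) (tab 6 (λ a b c d e f → ! (((f ∧ not e ∧ not d) ∧ not c ∧ not b) ∨ a) ⇛ a ⊃ not
      e ∧ not c ⇛ ⊩ ! (not e ∧ not c)) (pair q r i j) (j == p) (i == p) (j == t) (i == t) (A i j) h (ends i j))
    where
    ends : ∀ i j → pair q r i j ≡ true → not (i == t) ∧ not (i == p) ≡ true
    ends i j h = go (pair-elim {a = q} {r} {i} {j} h)
      where
      go : (i ≡ q × j ≡ r) ⊎ (i ≡ r × j ≡ q) → not (i == t) ∧ not (i == p) ≡ true
      go (inj₁ (refl , refl)) = ≢⇒not q≢t & ≢⇒not q≢p
      go (inj₂ (refl , refl)) = ≢⇒not r≢t & ≢⇒not r≢p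

  relative′ : RelativeOn A′ U W′
  relative′ = record { simpleᵒ = sA′ ; within = within′ ; disjoint = λ i h
      → (tab 3 (λ a b c → ! a ⇛ ⊩ ∼ ((not a ∧ not c) ∧ not b)) (U i) (i == p) (i == t) h) ; many = many′ ; sparse
      = sparse′ ; total = total′ }

  inside-same : ∀ i j → inn A U i j ≡ inn A′ U i j
  inside-same i j = tab 8 (λ a b c d e f g h → a ⊃ not b ⇛ c ⊃ not b ⇛ d ⊃ not e ⇛ f ⊃ not e ⇛ g ⊃ not (b ∧ e) ⇛ ⊩ h ∧ b
      ∧ e ⇔ (((h ∧ not a ∧ not d) ∧ not c ∧ not f) ∨ g) ∧ b ∧ e) (i == t) (U i) (i == p) (j == t) (U j) (j == p)
      (pair q r i j) (A i j) (at (∁ U) (not-intro Ut) i) (at (∁ U) (not-intro Up) i) (at (∁ U) (not-intro Ut) j)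
      (at (∁ U) (not-intro Up) j) (pair-apart (λ i j → not (U i ∧ U j)) (λ i j → cong not (𝔹.∧-comm (U i) (U j)))
      (not-intro not-both) i j)

  -- An attachment through `t` or `p` sits at `q` or `r`; the new edge replaces it, since its other
  -- end lies outside `U`.
  still-attached : ∀ {a w} → U a ≡ true → U w ≡ false → A a w ≡ true → ∃[ w′ ] (W′ w′ ≡ true × A′ a w′ ≡ true)
  still-attached {a} {w} Ua Uw aw = go (w ≟ t) (w ≟ p)
    where
    a≢t : a ≢ t
    a≢t e = clash (subst (λ z → U z ≡ true) e Ua) Ut
    a≢p : a ≢ p
    a≢p e = clash (subst (λ z → U z ≡ true) e Ua) Up
    via : a ≡ q ⊎ a ≡ r → ∃[ w′ ] (W′ w′ ≡ true × A′ a w′ ≡ true)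
    via (inj₁ refl) = r , (tab 4 (λ a b c d → ∼ (b ∧ a) ⇛ ! b ⇛ ∼ c ⇛ ∼ d ⇛ ⊩ ! ((not a ∧ not c) ∧ not d)) (U r) (U q)
        (r == t) (r == p) not-both Ua (≢⇒== r≢t) (≢⇒== r≢p)) , (tab 2 (λ a b → ! a ⇛ ⊩ ! (b ∨ a)) (pair q r q r)
        (A₂ q r) (pair-self q r))
    via (inj₂ refl) = q , (tab 4 (λ a b c d → ∼ (b ∧ a) ⇛ ! a ⇛ ∼ c ⇛ ∼ d ⇛ ⊩ ! ((not b ∧ not c) ∧ not d)) (U r) (U q)
        (q == t) (q == p) not-both Ua (≢⇒== q≢t) (≢⇒== q≢p)) , trans (symm sA′ r q)
        (tab 2 (λ a b → ! a ⇛ ⊩ ! (b ∨ a)) (pair q r q r) (A₂ q r) (pair-self q r))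
    go : Dec (w ≡ t) → Dec (w ≡ p) → ∃[ w′ ] (W′ w′ ≡ true × A′ a w′ ≡ true)
    go (no w≢t) (no w≢p) = w , (tab 3 (λ a b c → ∼ a ⇛ ∼ b ⇛ ∼ c ⇛ ⊩ ! ((not a ∧ not b) ∧ not c)) (U w) (w == t)
        (w == p) Uw (≢⇒== w≢t) (≢⇒== w≢p)) ,
      (tab 6 (λ a b c d e f → ! a ⇛ ∼ b ⇛ ∼ c ⇛ ∼ d ⇛ ∼ e ⇛ ⊩ ! (((a ∧ not d ∧ not b) ∧ not e ∧ not c) ∨ f)) (A a w)
          (w == t) (w == p) (a == t) (a == p) (pair q r a w) aw (≢⇒== w≢t) (≢⇒== w≢p) (≢⇒== a≢t) (≢⇒== a≢p))
    go (yes refl) _ = via (pick (a ≟ q) (a ≟ r))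
      where
      pick : Dec (a ≡ q) → Dec (a ≡ r) → a ≡ q ⊎ a ≡ r
      pick (yes e) _ = inj₁ e
      pick _ (yes e) = inj₂ e
      pick (no e) (no f) = ⊥-elim (clash (flip aw) (three-only {X = A t} deg-t tp tq tr′ (≢-sym q≢p) (≢-sym r≢p) q≢r a≢p
          e f))
    go (no _) (yes refl) = via (pick (a ≟ q) (a ≟ r))
      where
      pick : Dec (a ≡ q) → Dec (a ≡ r) → a ≡ q ⊎ a ≡ r
      pick (yes e) _ = inj₁ e
      pick _ (yes e) = inj₂ e
      pick (no e) (no f) = ⊥-elim (clash (flip aw) (three-only {X = A p} deg-p (flip tp) pq pr (≢-sym q≢t) (≢-sym r≢t)
          q≢r a≢t e f))

  attached′ : Attached A U → AttachedTo A′ U W′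
  attached′ (u₁ , u₂ , w₁ , w₂ , ne , (Uu₁ , Uu₂) , (Uw₁ , Uw₂) , (a₁ , a₂)) = go (still-attached Uu₁ Uw₁ a₁)
      (still-attached Uu₂ Uw₂ a₂)
    where
    go : ∃[ w′ ] (W′ w′ ≡ true × A′ u₁ w′ ≡ true) → ∃[ w′ ] (W′ w′ ≡ true × A′ u₂ w′ ≡ true) → AttachedTo A′ U W′
    go (w₁ , x , y) (w₂ , z , s) = u₁ , u₂ , w₁ , w₂ , ne , (Uu₁ , Uu₂) , (x , z) , (y , s)

  by-ear : Attached A U → Block (inn A U) U → Block A′ V′
  by-ear att blk = block≗ keeps-vertex (rebuild-ear relative′ (attached′ att) (block-≗ₑ inside-same blk))

  by-apex : ∀ {x} → (∀ i → U i ≡ (i == x)) → Block A′ V′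
  by-apex only = block≗ keeps-vertex (circ-block (rebuild-apex relative′ only) {q} {r}
      (tab 2 (λ a b → ! a ⇛ ⊩ ! (b ∨ a)) (pair q r q r) (A₂ q r) (pair-self q r)))

-- Replacing an edge of a circuit by a gadget

-- The 2|N| + 1 edges of `L` pay for the new vertices and for the replaced edge `ab`. The fields say
-- that only a set containing `a`, `b` and all of `N` can reach this number; any other gains at most
-- two edges per new vertex.
record Gadget {n : ℕ} (X : VS n) (a b : Fin n) (N : VS n) (L : ES n) : Set where
  field
    simpleᵍ : Simple L
    disjoint : ∀ i → X i ≡ true → N i ≡ false
    touches : ∀ i j → L i j ≡ true → N i ∨ N j ≡ true
    within : ∀ i j → L i j ≡ true → X i ∨ N i ≡ true
    size : ec L ≡ 2 * ∣ N ∣ + 1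
    nonempty : NE N
    open-end : ∀ Y → Y a ∧ Y b ≡ false → ins L Y ≤ 2 * ∣ Y ∩ N ∣
    proper : ∀ Y {w} → N w ≡ true → Y w ≡ false → ins L Y ≤ 2 * ∣ Y ∩ N ∣
    alone : ∀ Y → (∀ i → X i ≡ true → Y i ≡ false) → NE (Y ∩ N) → ins L Y + 2 ≤ 2 * ∣ Y ∩ N ∣

-- The one set type that gains the extra edge contains `a` and `b`, and there the deleted edge `ab`
-- makes up for it.
insert-gadget : ∀ {n} {E : ES n} {X F N L a b} → Circ E X F → F a b ≡ true → Gadget X a b N L →
                Circ ((F ⊖ (a , b)) ∪ₑ L) (X ∪ N) ((F ⊖ (a , b)) ∪ₑ L)
insert-gadget {n} {E} {X} {F} {N} {L} {a} {b} c Fab g = record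
  { simpleᶜ = ∪ₑ-simple (⊖-simple C.simpleᶜ (a , b)) simpleᵍ
  ; ⊆E = λ _ _ p → p
  ; within = λ i j p → (tab 4 (λ a b c d → ! (b ∨ a) ⇛ b ⊃ c ⇛ a ⊃ c ∨ d ⇛ ⊩ ! (c ∨ d)) (L i j) (F⁻ i j) (X i) (N i) p
      (T.within i j) (within i j))
  ; size = lin 6 (λ a b c d e f → a ≐ b ⊕ c ⇛ b ⊹ 2 ≐ 2 ⊗ d ⇛ c ≐ (2 ⊗ e) ⊹ 1 ⇛ 2 ⊠ f ≑ d ⊕ e ⇛ 1 ⊢ a ⊹ 1 ≐ 2 ⊗ f)
      (ec (F⁻ ∪ₑ L)) (ec F⁻) (ec L) (∣ X ∣) (∣ N ∣) (∣ X ∪ N ∣)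
      (ec12 (F⁻ ∪ₑ L) F⁻ L (λ i j → tab 6 (λ a b c d e f → a ⊃ b ⇛ a ⊃ c ⇛ d ⊃ f ∨ e ⇛ b ⊃ not f ⇛ c ⊃ not e ⇛ ⊩ 𝟙
      (a ∨ d) ≃ 𝟙 a + 𝟙 d) (F⁻ i j) (X i) (X j) (L i j) (N j) (N i) (T.within i j) (T.within₂ i j) (touches i j)
      (λ p → not-intro (disjoint i p)) (λ p → not-intro (disjoint j p)))) T.size size
      (cnt12 (X ∪ N) X N (λ i → tab 2 (λ a b → a ⊃ not b ⇛ ⊩ 𝟙 (a ∨ b) ≃ 𝟙 a + 𝟙 b) (X i) (N i)
      (λ p → not-intro (disjoint i p))))
  ; sparse = λ Y Y⊆ ne {z} Vz Yz → sub Y Y⊆ ne Vz Yz (empty? (Y ∩ X)) (bool (Y a ∧ Y b)) (empty? (X ∖ Y)) }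
  where
  open Gadget g
  F⁻ : ES n
  F⁻ = F ⊖ (a , b)
  module C = Circ c
  t : Tight F⁻ X
  t = circ-tight c Fab
  module T = Tight t
  both : ∀ Y → ins (F⁻ ∪ₑ L) Y ≤ ins F⁻ (Y ∩ X) + ins L Y
  both Y = ec12≤ (inn (F⁻ ∪ₑ L) Y) (inn F⁻ (Y ∩ X)) (inn L Y)
      (λ i j → tab 6 (λ a b c d e f → a ⊃ b ⇛ a ⊃ c ⇛ ⊩ 𝟙 ((a ∨ f) ∧ e ∧ d) ≦ 𝟙 (a ∧ (e ∧ b) ∧ d ∧ c) + 𝟙 (f ∧ e ∧ d))
      (F⁻ i j) (X i) (X j) (Y j) (Y i) (L i j) (T.within i j) (T.within₂ i j))
  ∣Y∣ : ∀ Y → ∣ Y ∩ X ∣ + ∣ Y ∩ N ∣ ≤ ∣ Y ∣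
  ∣Y∣ Y = lin 4 (λ a b c d → a ≑ b ⊕ c ⇛ d ≼ c ⇛ 1 ⊢ b ⊕ d ≼ a) (∣ Y ∣) (∣ Y ∩ X ∣) (∣ Y ∖ X ∣) (∣ Y ∩ N ∣)
      (∣∩∣+∣∖∣ Y X) (cnt≤ {X = Y ∩ N} {Y ∖ X} (λ i p → tab 3 (λ a b c → ! (b ∧ a) ⇛ c ⊃ not a ⇛ ⊩ ! (b ∧ not c)) (N i)
      (Y i) (X i) p (λ p → not-intro (disjoint i p))))
  any-bound : ∀ Y → ins L Y ≤ 2 * ∣ Y ∩ N ∣ + 1
  any-bound Y = go (empty? (N ∖ Y))
    where
    go : Empty? (N ∖ Y) → ins L Y ≤ 2 * ∣ Y ∩ N ∣ + 1
    go (inj₁ (w , p)) = ≤-trans (proper Y {w} (∧ˡ (N w) (not (Y w)) p) (not-elim (∧ʳ (N w) (not (Y w)) p))) (m≤m+n _ 1)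
    go (inj₂ none) = lin 4 (λ a b c d → a ≼ b ⇛ b ≐ (2 ⊗ c) ⊹ 1 ⇛ 2 ⊠ c ≼ d ⇛ 1 ⊢ a ≼ (2 ⊗ d) ⊹ 1) (ins L Y) (ec L)
        (∣ N ∣) (∣ Y ∩ N ∣) (ins≤ec L Y) size (cnt≤ {X = N} {Y ∩ N}
        (λ i p → tab 2 (λ a b → ! a ⇛ ∼ (a ∧ not b) ⇛ ⊩ ! (b ∧ a)) (N i) (Y i) p (none i)))
  sub : ∀ Y → Y ⊆ X ∪ N → NE Y → ∀ {z} → (X ∪ N) z ≡ true → Y z ≡ false → Empty? (Y ∩ X) → Decided (Y a ∧ Y b) →
        Empty? (X ∖ Y) → ins (F⁻ ∪ₑ L) Y + 2 ≤ 2 * ∣ Y ∣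
  sub Y Y⊆ (y , Yy) Vz Yz (inj₂ none) _ _ = lin 6 (λ a b c d e f → a ≼ b ⊕ c ⇛ b ≐ κ 0 ⇛ 2 ⊠ d ⊕ e ≼ f ⇛ c ⊹ 2 ≼ 2 ⊗ e ⇛
      1 ⊢ a ⊹ 2 ≼ 2 ⊗ f) (ins (F⁻ ∪ₑ L) Y) (ins F⁻ (Y ∩ X)) (ins L Y) (∣ Y ∩ X ∣) (∣ Y ∩ N ∣) (∣ Y ∣) (both Y)
      (ins-none F⁻ none) (∣Y∣ Y) (alone Y (λ i p → tab 2 (λ a b → ! a ⇛ ∼ (b ∧ a) ⇛ ⊩ ∼ b) (X i) (Y i) p (none i))
      (y , (tab 3 (λ a b c → ! a ⇛ a ⊃ c ∨ b ⇛ ∼ (a ∧ c) ⇛ ⊩ ! (a ∧ b)) (Y y) (N y) (X y) Yy (Y⊆ y) (none y))))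
  sub Y Y⊆ _ Vz Yz (inj₁ ne) (inj₂ h) _ = lin 6 (λ a b c d e f → a ≼ b ⊕ c ⇛ b ⊹ 2 ≼ 2 ⊗ d ⇛ 2 ⊠ d ⊕ e ≼ f ⇛ c ≼ 2 ⊗ e ⇛
      1 ⊢ a ⊹ 2 ≼ 2 ⊗ f) (ins (F⁻ ∪ₑ L) Y) (ins F⁻ (Y ∩ X)) (ins L Y) (∣ Y ∩ X ∣) (∣ Y ∩ N ∣) (∣ Y ∣) (both Y)
      (T.sparse (Y ∩ X) ne) (∣Y∣ Y) (open-end Y h)
  sub Y Y⊆ _ Vz Yz (inj₁ ne) (inj₁ h) (inj₁ (x , p)) = lin 8 (λ a b c d e f g h → a ≼ b ⊕ c ⇛ 2 ⊠ d ⊕ e ≼ f ⇛ c ≼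
      (2 ⊗ e) ⊹ 1 ⇛ g ⊹ 2 ≼ 2 ⊗ d ⇛ b ⊕ h ≼ g ⇛ h ≑ κ 1 ⇛ 1 ⊢ a ⊹ 2 ≼ 2 ⊗ f) (ins (F⁻ ∪ₑ L) Y) (ins F⁻ (Y ∩ X))
      (ins L Y) (∣ Y ∩ X ∣) (∣ Y ∩ N ∣) (∣ Y ∣) (ins F (Y ∩ X)) (ec (pair a b)) (both Y) (∣Y∣ Y) (any-bound Y)
      (C.sparse (Y ∩ X) (λ i q → ∧ʳ (Y i) (X i) q) ne {x} (∧ˡ (X x) (not (Y x)) p)
      (tab 2 (λ a b → ! (b ∧ not a) ⇛ ⊩ ∼ (a ∧ b)) (Y x) (X x) p)) (ec21≤ (inn F⁻ (Y ∩ X)) (pair a b) (inn F (Y ∩ X))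
      (λ i j → tab 6 (λ a b c d e f → a ⊃ b ⇛ b ⊃ c ⇛ b ⊃ d ⇛ a ⊃ f ∧ e ⇛ ⊩ 𝟙 ((b ∧ not a) ∧ (f ∧ c) ∧ e ∧ d) + 𝟙 a ≦ 𝟙
      (b ∧ (f ∧ c) ∧ e ∧ d)) (pair a b i j) (F i j) (X i) (X j) (Y j) (Y i) (pair-⊆ C.simpleᶜ Fab i j) (C.within i j)
      (C.within₂ i j) (pair-apart (λ i j → Y i ∧ Y j) (λ i j → 𝔹.∧-comm (Y i) (Y j)) h i j)))
      (ec-pair (adj≢ C.simpleᶜ Fab))
  sub Y Y⊆ _ {z} Vz Yz (inj₁ ne) (inj₁ h) (inj₂ none) = lin 6 (λ a b c d e f → a ≼ b ⊕ c ⇛ 2 ⊠ d ⊕ e ≼ f ⇛ b ⊹ 2 ≼ 2 ⊗ d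
      ⇛ c ≼ 2 ⊗ e ⇛ 1 ⊢ a ⊹ 2 ≼ 2 ⊗ f) (ins (F⁻ ∪ₑ L) Y) (ins F⁻ (Y ∩ X)) (ins L Y) (∣ Y ∩ X ∣) (∣ Y ∩ N ∣) (∣ Y ∣)
      (both Y) (∣Y∣ Y) (T.sparse (Y ∩ X) ne) (proper Y {z} (tab 3 (λ a b c → ! (b ∨ a) ⇛ ∼ c ⇛ ∼ (b ∧ not c) ⇛ ⊩ ! a)
      (N z) (X z) (Y z) Vz Yz (none z)) Yz)

ins-pair : ∀ {n} {a b : Fin n} → a ≢ b → ∀ Y → ins (pair a b) Y ≤ 𝟙 (Y a ∧ Y b)
ins-pair {n} {a} {b} a≢b Y = go (bool (Y a ∧ Y b))
  where
  go : Decided (Y a ∧ Y b) → ins (pair a b) Y ≤ 𝟙 (Y a ∧ Y b)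
  go (inj₁ h) = lin 3 (λ a b c → a ≼ b ⇛ b ≐ κ 1 ⇛ c ≑ κ 1 ⇛ 1 ⊢ a ≼ c) (ins (pair a b) Y) (ec (pair a b))
      (𝟙 (Y a ∧ Y b)) (ins≤ec (pair a b) Y) (ec-pair a≢b) (cong 𝟙 h)
  go (inj₂ h) = lin 2 (λ a b → a ≐ κ 0 ⇛ 1 ⊢ a ≼ b) (ins (pair a b) Y) (𝟙 (Y a ∧ Y b))
      (ec-empty (λ i j → tab 3 (λ a b c → a ⊃ not (c ∧ b) ⇛ ⊩ ∼ (a ∧ c ∧ b)) (pair a b i j) (Y j) (Y i)
      (pair-apart (λ i j → not (Y i ∧ Y j)) (λ i j → cong not (𝔹.∧-comm (Y i) (Y j))) (not-intro h) i j)))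

ins-∪ : ∀ {n} (E F : ES n) Y → ins (E ∪ₑ F) Y ≤ ins E Y + ins F Y
ins-∪ E F Y = ec12≤ (inn (E ∪ₑ F) Y) (inn E Y) (inn F Y)
    (λ i j → tab 4 (λ a b c d → ⊩ 𝟙 ((d ∨ c) ∧ b ∧ a) ≦ 𝟙 (d ∧ b ∧ a) + 𝟙 (c ∧ b ∧ a)) (Y j) (Y i) (F i j) (E i j))

cnt-∩⟨⟩ : ∀ {n} (Y : VS n) w → ∣ Y ∩ ⟨ w ⟩ ∣ ≡ 𝟙 (Y w)
cnt-∩⟨⟩ Y w = go (bool (Y w))
  where
  go : Decided (Y w) → ∣ Y ∩ ⟨ w ⟩ ∣ ≡ 𝟙 (Y w)
  go (inj₁ h) = trans (cnt≗ {X = Y ∩ ⟨ w ⟩} {⟨ w ⟩} (λ i → tab 2 (λ a b → a ⊃ b ⇛ ⊩ b ∧ a ⇔ a) (i == w) (Y i)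
      (at Y h i))) (trans (cnt-single w) (sym (cong 𝟙 h)))
  go (inj₂ h) = trans (cnt-empty (λ i → tab 2 (λ a b → a ⊃ not b ⇛ ⊩ ∼ (b ∧ a)) (i == w) (Y i)
      (at (∁ Y) (not-intro h) i))) (sym (cong 𝟙 h))

add-pair : ∀ {n} {E : ES n} → Simple E → ∀ {a b} → a ≢ b → E a b ≡ false → ec (E ⊞ (a , b)) ≡ ec E + 1
add-pair {n} {E} sE {a} {b} a≢b p = trans (ec12 (E ⊞ (a , b)) E (pair a b)
    (λ i j → tab 2 (λ a b → a ⊃ not b ⇛ ⊩ 𝟙 (b ∨ a) ≃ 𝟙 b + 𝟙 a) (pair a b i j) (E i j) (pair-∉ sE p i j)))
    (cong (ec E +_) (ec-pair a≢b))

pair-other : ∀ {n} (a b c d : Fin n) → a ≢ c ⊎ b ≢ d → a ≢ d ⊎ b ≢ c → pair a b c d ≡ false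
pair-other a b c d h k = 𝔹.¬-not (λ p → go (pair-elim {a = a} {b} {c} {d} p) h k)
  where
  go : (c ≡ a × d ≡ b) ⊎ (c ≡ b × d ≡ a) → a ≢ c ⊎ b ≢ d → a ≢ d ⊎ b ≢ c → ⊥
  go (inj₁ (e , f)) (inj₁ x) _ = x (sym e)
  go (inj₁ (e , f)) (inj₂ x) _ = x (sym f)
  go (inj₂ (e , f)) _ (inj₁ x) = x (sym f)
  go (inj₂ (e , f)) _ (inj₂ x) = x (sym e)

claw : ∀ {n} → (w a b c : Fin n) → ES n
claw w a b c = pair w a ⊞ (w , b) ⊞ (w , c)

claw-gadget : ∀ {n} {X : VS n} {w a b c} → X w ≡ false → X a ≡ true → X b ≡ true → X c ≡ true → a ≢ b → a ≢ c → b ≢ c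
    → Gadget X a b ⟨ w ⟩ (claw w a b c)
claw-gadget {n} {X} {w} {a} {b} {c} Xw Xa Xb Xc a≢b a≢c b≢c = record
  { simpleᵍ = ∪ₑ-simple sL₂ (pair-simple w≢c)
  ; disjoint = λ i p → ≢⇒== (∈≢∉ {X = X} p Xw)
  ; touches = λ i j p → (tab 8 (λ a b c d e f g h → ! ((((d ∧ h) ∨ (g ∧ a)) ∨ (d ∧ f) ∨ (e ∧ a)) ∨ (d ∧ c) ∨ (b ∧ a)) ⇛
      ⊩ ! (d ∨ a)) (j == w) (i == c) (j == c) (i == w) (i == b) (j == b) (i == a) (j == a) p)
  ; within = λ i j p → (tab 9 (λ a b c d e f g h i → ! ((((d ∧ h) ∨ (g ∧ a)) ∨ (d ∧ f) ∨ (e ∧ a)) ∨ (d ∧ c) ∨ (b ∧ a)) ⇛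
      g ⊃ i ⇛ e ⊃ i ⇛ b ⊃ i ⇛ ⊩ ! (i ∨ d)) (j == w) (i == c) (j == c) (i == w) (i == b) (j == b) (i == a) (j == a) (X i)
      p (at X Xa i) (at X Xb i) (at X Xc i))
  ; size = lin 4 (λ a b c d → 2 ⊠ a ≑ κ 1 ⇛ b ≐ κ 1 ⇛ c ≐ b ⊹ 1 ⇛ d ≐ c ⊹ 1 ⇛ 1 ⊢ d ≐ (2 ⊗ a) ⊹ 1) (∣ ⟨ w ⟩ ∣)
      (ec (pair w a)) (ec (pair w a ⊞ (w , b))) (ec L) (cnt-single w) (ec-pair w≢a)
      (add-pair (pair-simple w≢a) w≢b (pair-other w a w b (inj₂ a≢b) (inj₁ w≢b)))
      (add-pair sL₂ w≢c (cong₂ _∨_ (pair-other w a w c (inj₂ a≢c) (inj₁ w≢c))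
      (pair-other w b w c (inj₂ b≢c) (inj₁ w≢c))))
  ; nonempty = w , ==-refl w
  ; open-end = λ Y h → (lin 6 (λ a b c d e f → a ≼ b ⊕ c ⊕ d ⇛ 2 ⊠ e ≑ f ⇛ b ⊕ c ⊕ d ≼ f ⊕ f ⇛ 1 ⊢ a ≼ 2 ⊗ e) (ins L Y)
      (𝟙 (Y w ∧ Y a)) (𝟙 (Y w ∧ Y b)) (𝟙 (Y w ∧ Y c)) (∣ Y ∩ ⟨ w ⟩ ∣) (𝟙 (Y w)) (bound Y) (cnt-∩⟨⟩ Y w)
      (tab 4 (λ a b c d → ∼ (b ∧ a) ⇛ ⊩ 𝟙 (c ∧ b) + 𝟙 (c ∧ a) + 𝟙 (c ∧ d) ≦ 𝟙 c + 𝟙 c) (Y b) (Y a) (Y w) (Y c) h))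
  ; proper = λ Y {z} Nz Yz → ≤-trans (bound Y) (≤-trans (≤-reflexive
      (gone Y (trans (sym (cong Y (==⇒≡ {i = z} Nz))) Yz))) z≤n)
  ; alone = λ Y out ne → (lin 5 (λ a b c d e → a ≼ b ⊕ c ⊕ d ⇛ 2 ⊠ κ 1 ≼ e ⇛ b ⊕ c ⊕ d ≼ κ 0 ⇛ 1 ⊢ a ⊹ 2 ≼ 2 ⊗ e)
      (ins L Y) (𝟙 (Y w ∧ Y a)) (𝟙 (Y w ∧ Y b)) (𝟙 (Y w ∧ Y c)) (∣ Y ∩ ⟨ w ⟩ ∣) (bound Y)
      (cnt-pos {X = Y ∩ ⟨ w ⟩} (proj₂ ne)) (tab 4 (λ a b c d → ∼ a ⇛ ∼ b ⇛ ∼ c ⇛ ⊩ 𝟙 (d ∧ a) + 𝟙 (d ∧ b) + 𝟙 (d ∧ c) ≦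
      0) (Y a) (Y b) (Y c) (Y w) (out a Xa) (out b Xb) (out c Xc))) }
  where
  L : ES n
  L = claw w a b c
  w≢ : ∀ {z} → X z ≡ true → w ≢ z
  w≢ Xz e = ∈≢∉ {X = X} Xz Xw (sym e)
  w≢a : w ≢ a
  w≢a = w≢ Xa
  w≢b : w ≢ b
  w≢b = w≢ Xb
  w≢c : w ≢ c
  w≢c = w≢ Xc
  sL₂ : Simple (pair w a ⊞ (w , b))
  sL₂ = ∪ₑ-simple (pair-simple w≢a) (pair-simple w≢b)
  bound : ∀ Y → ins L Y ≤ 𝟙 (Y w ∧ Y a) + 𝟙 (Y w ∧ Y b) + 𝟙 (Y w ∧ Y c)
  bound Y = lin 8 (λ a b c d e f g h → a ≼ b ⊕ c ⇛ b ≼ d ⊕ e ⇛ d ≼ f ⇛ e ≼ g ⇛ c ≼ h ⇛ 1 ⊢ a ≼ f ⊕ g ⊕ h) (ins L Y)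
      (ins (pair w a ⊞ (w , b)) Y) (ins (pair w c) Y) (ins (pair w a) Y) (ins (pair w b) Y) (𝟙 (Y w ∧ Y a))
      (𝟙 (Y w ∧ Y b)) (𝟙 (Y w ∧ Y c)) (ins-∪ (pair w a ⊞ (w , b)) (pair w c) Y) (ins-∪ (pair w a) (pair w b) Y)
      (ins-pair w≢a Y) (ins-pair w≢b Y) (ins-pair w≢c Y)
  gone : ∀ Y → Y w ≡ false → 𝟙 (Y w ∧ Y a) + 𝟙 (Y w ∧ Y b) + 𝟙 (Y w ∧ Y c) ≡ 0
  gone Y h = tab 4 (λ a b c d → ∼ a ⇛ ⊩ 𝟙 (a ∧ b) + 𝟙 (a ∧ c) + 𝟙 (a ∧ d) ≃ 0) (Y w) (Y a) (Y b) (Y c) h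

diamond : ∀ {n} → (w m a b : Fin n) → ES n
diamond w m a b = pair w m ⊞ (w , a) ⊞ (w , b) ⊞ (m , a) ⊞ (m , b)

diamond-gadget : ∀ {n} {X : VS n} {w m a b} → X w ≡ false → X m ≡ false → X a ≡ true → X b ≡ true → w ≢ m → a ≢ b
    → Gadget X a b (⟨ w ⟩ ∪ ⟨ m ⟩) (diamond w m a b)
diamond-gadget {n} {X} {w} {m} {a} {b} Xw Xm Xa Xb w≢m a≢b = record
  { simpleᵍ = s₅
  ; disjoint = λ i p → cong₂ _∨_ (≢⇒== (∈≢∉ {X = X} p Xw)) (≢⇒== (∈≢∉ {X = X} p Xm))
  ; touches = λ i j p → (tab 8 (λ a b c d e f g h → ! ((((((h ∧ a) ∨ (d ∧ g)) ∨ (h ∧ f) ∨ (e ∧ g)) ∨ (h ∧ c) ∨ (b ∧ g))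
      ∨ (d ∧ f) ∨ (e ∧ a)) ∨ (d ∧ c) ∨ (b ∧ a)) ⇛ ⊩ ! ((h ∨ d) ∨ g ∨ a)) (j == m) (i == b) (j == b) (i == m) (i == a)
      (j == a) (j == w) (i == w) p)
  ; within = λ i j p → (tab 9 (λ a b c d e f g h i → ! ((((((h ∧ a) ∨ (d ∧ g)) ∨ (h ∧ f) ∨ (e ∧ g)) ∨ (h ∧ c) ∨ (b ∧ g))
      ∨ (d ∧ f) ∨ (e ∧ a)) ∨ (d ∧ c) ∨ (b ∧ a)) ⇛ e ⊃ i ⇛ b ⊃ i ⇛ ⊩ ! (i ∨ h ∨ d)) (j == m) (i == b) (j == b) (i == m)
      (i == a) (j == a) (j == w) (i == w) (X i) p (at X Xa i) (at X Xb i))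
  ; size = lin 6 (λ a b c d e f → 2 ⊠ a ≑ κ 2 ⇛ b ≐ κ 1 ⇛ c ≐ b ⊹ 1 ⇛ d ≐ c ⊹ 1 ⇛ e ≐ d ⊹ 1 ⇛ f ≐ e ⊹ 1 ⇛ 1 ⊢ f ≐
      (2 ⊗ a) ⊹ 1) (∣ N ∣) (ec (pair w m)) (ec L₂) (ec L₃) (ec L₄) (ec L) sizeN (ec-pair w≢m) (add-pair s₁ w≢a wm-wa)
      (add-pair s₂ w≢b (cong₂ _∨_ wm-wb wa-wb)) (add-pair s₃ m≢a
      (cong₂ _∨_ (cong₂ _∨_ (pair-other w m m a (inj₁ w≢m) (inj₁ w≢a)) (pair-other w a m a (inj₁ w≢m) (inj₁ w≢a)))
      (pair-other w b m a (inj₁ w≢m) (inj₁ w≢a)))) (add-pair s₄ m≢b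
      (cong₂ _∨_ (cong₂ _∨_ (cong₂ _∨_ (pair-other w m m b (inj₁ w≢m) (inj₁ w≢b))
      (pair-other w a m b (inj₁ w≢m) (inj₁ w≢b))) (pair-other w b m b (inj₁ w≢m) (inj₁ w≢b)))
      (pair-other m a m b (inj₂ a≢b) (inj₁ m≢b))))
  ; nonempty = w , cong (_∨ (w == m)) (==-refl w)
  ; open-end = λ Y h → (lin 9 (λ a b c d e f g h i → a ≼ b ⊕ c ⊕ d ⊕ e ⊕ f ⇛ 2 ⊠ g ≑ h ⊕ i ⇛ b ⊕ c ⊕ d ⊕ e ⊕ f ≼ h ⊕ i ⊕
      h ⊕ i ⇛ 1 ⊢ a ≼ 2 ⊗ g) (ins L Y) (𝟙 (Y w ∧ Y m)) (𝟙 (Y w ∧ Y a)) (𝟙 (Y w ∧ Y b)) (𝟙 (Y m ∧ Y a)) (𝟙 (Y m ∧ Y b))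
      (∣ Y ∩ N ∣) (𝟙 (Y w)) (𝟙 (Y m)) (bound Y) (cntN Y) (tab 4 (λ a b c d → ∼ (b ∧ a) ⇛ ⊩ 𝟙 (d ∧ c) + 𝟙 (d ∧ b) + 𝟙
      (d ∧ a) + 𝟙 (c ∧ b) + 𝟙 (c ∧ a) ≦ 𝟙 d + 𝟙 c + 𝟙 d + 𝟙 c) (Y b) (Y a) (Y m) (Y w) h))
  ; proper = λ Y {z} Nz Yz → (lin 9 (λ a b c d e f g h i → a ≼ b ⊕ c ⊕ d ⊕ e ⊕ f ⇛ 2 ⊠ g ≑ h ⊕ i ⇛ b ⊕ c ⊕ d ⊕ e ⊕ f ≼ h
      ⊕ i ⊕ h ⊕ i ⇛ 1 ⊢ a ≼ 2 ⊗ g) (ins L Y) (𝟙 (Y w ∧ Y m)) (𝟙 (Y w ∧ Y a)) (𝟙 (Y w ∧ Y b)) (𝟙 (Y m ∧ Y a))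
      (𝟙 (Y m ∧ Y b)) (∣ Y ∩ N ∣) (𝟙 (Y w)) (𝟙 (Y m)) (bound Y) (cntN Y)
      (tab 4 (λ a b c d → ∼ (b ∧ a) ⇛ ⊩ 𝟙 (b ∧ a) + 𝟙 (b ∧ c) + 𝟙 (b ∧ d) + 𝟙 (a ∧ c) + 𝟙 (a ∧ d) ≦ 𝟙 b + 𝟙 a + 𝟙 b + 𝟙
      a) (Y m) (Y w) (Y a) (Y b) (missing Y Nz Yz)))
  ; alone = λ Y out ne → (lin 9 (λ a b c d e f g h i → a ≼ b ⊕ c ⊕ d ⊕ e ⊕ f ⇛ 2 ⊠ g ≑ h ⊕ i ⇛ b ⊕ c ⊕ d ⊕ e ⊕ f ⊹ 2 ≼ h
      ⊕ i ⊕ h ⊕ i ⇛ 1 ⊢ a ⊹ 2 ≼ 2 ⊗ g) (ins L Y) (𝟙 (Y w ∧ Y m)) (𝟙 (Y w ∧ Y a)) (𝟙 (Y w ∧ Y b)) (𝟙 (Y m ∧ Y a))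
      (𝟙 (Y m ∧ Y b)) (∣ Y ∩ N ∣) (𝟙 (Y w)) (𝟙 (Y m)) (bound Y) (cntN Y)
      (tab 4 (λ a b c d → ∼ a ⇛ ∼ b ⇛ ! (d ∨ c) ⇛ ⊩ 𝟙 (d ∧ c) + 𝟙 (d ∧ a) + 𝟙 (d ∧ b) + 𝟙 (c ∧ a) + 𝟙 (c ∧ b) + 2 ≦ 𝟙 d
      + 𝟙 c + 𝟙 d + 𝟙 c) (Y a) (Y b) (Y m) (Y w) (out a Xa) (out b Xb) (hit Y ne))) }
  where
  N : VS n
  N = ⟨ w ⟩ ∪ ⟨ m ⟩
  L₂ L₃ L₄ L : ES n
  L₂ = pair w m ⊞ (w , a)
  L₃ = L₂ ⊞ (w , b)
  L₄ = L₃ ⊞ (m , a)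
  L = diamond w m a b
  w≢a : w ≢ a
  w≢a e = ∈≢∉ {X = X} Xa Xw (sym e)
  w≢b : w ≢ b
  w≢b e = ∈≢∉ {X = X} Xb Xw (sym e)
  m≢a : m ≢ a
  m≢a e = ∈≢∉ {X = X} Xa Xm (sym e)
  m≢b : m ≢ b
  m≢b e = ∈≢∉ {X = X} Xb Xm (sym e)
  s₁ : Simple (pair w m)
  s₁ = pair-simple w≢m
  s₂ : Simple L₂
  s₂ = ∪ₑ-simple s₁ (pair-simple w≢a)
  s₃ : Simple L₃
  s₃ = ∪ₑ-simple s₂ (pair-simple w≢b)
  s₄ : Simple L₄
  s₄ = ∪ₑ-simple s₃ (pair-simple m≢a)
  s₅ : Simple L
  s₅ = ∪ₑ-simple s₄ (pair-simple m≢b)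
  wm-wa : pair w m w a ≡ false
  wm-wa = pair-other w m w a (inj₂ m≢a) (inj₁ w≢a)
  wm-wb : pair w m w b ≡ false
  wm-wb = pair-other w m w b (inj₂ m≢b) (inj₁ w≢b)
  wa-wb : pair w a w b ≡ false
  wa-wb = pair-other w a w b (inj₂ a≢b) (inj₁ w≢b)
  sizeN : ∣ N ∣ ≡ 2
  sizeN = trans (cnt-add ⟨ w ⟩ {m} (≢⇒== (≢-sym w≢m))) (cong suc (cnt-single w))
  cntN : ∀ Y → ∣ Y ∩ N ∣ ≡ 𝟙 (Y w) + 𝟙 (Y m)
  cntN Y = trans (cnt12 (Y ∩ N) (Y ∩ ⟨ w ⟩) (Y ∩ ⟨ m ⟩) (λ i → tab 3 (λ a b c → a ⊃ not b ⇛ ⊩ 𝟙 (c ∧ (a ∨ b)) ≃ 𝟙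
      (c ∧ a) + 𝟙 (c ∧ b)) (i == w) (i == m) (Y i) (λ p → not-intro
      (trans (cong (_== m) (==⇒≡ {i = i} p)) (≢⇒== w≢m))))) (cong₂ _+_ (cnt-∩⟨⟩ Y w) (cnt-∩⟨⟩ Y m))
  bound : ∀ Y → ins L Y ≤ 𝟙 (Y w ∧ Y m) + 𝟙 (Y w ∧ Y a) + 𝟙 (Y w ∧ Y b) + 𝟙 (Y m ∧ Y a) + 𝟙 (Y m ∧ Y b)
  bound Y = lin 14 (λ a b c d e f g h i j k l m n → a ≼ b ⊕ c ⇛ b ≼ d ⊕ e ⇛ d ≼ f ⊕ g ⇛ f ≼ h ⊕ i ⇛ h ≼ j ⇛ i ≼ k ⇛ g ≼
      l ⇛ e ≼ m ⇛ c ≼ n ⇛ 1 ⊢ a ≼ j ⊕ k ⊕ l ⊕ m ⊕ n) (ins L Y) (ins L₄ Y) (ins (pair m b) Y) (ins L₃ Y)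
      (ins (pair m a) Y) (ins L₂ Y) (ins (pair w b) Y) (ins (pair w m) Y) (ins (pair w a) Y) (𝟙 (Y w ∧ Y m))
      (𝟙 (Y w ∧ Y a)) (𝟙 (Y w ∧ Y b)) (𝟙 (Y m ∧ Y a)) (𝟙 (Y m ∧ Y b)) (ins-∪ L₄ (pair m b) Y) (ins-∪ L₃ (pair m a) Y)
      (ins-∪ L₂ (pair w b) Y) (ins-∪ (pair w m) (pair w a) Y) (ins-pair w≢m Y) (ins-pair w≢a Y) (ins-pair w≢b Y)
      (ins-pair m≢a Y) (ins-pair m≢b Y)
  missing : ∀ Y {z} → N z ≡ true → Y z ≡ false → Y w ∧ Y m ≡ false
  missing Y {z} Nz Yz = tab 4 (λ a b c d → ! (b ∨ a) ⇛ b ⊃ not c ⇛ a ⊃ not d ⇛ ⊩ ∼ (c ∧ d)) (z == m) (z == w) (Y w)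
      (Y m) Nz (λ p → not-intro (trans (sym (cong Y (==⇒≡ {i = z} p))) Yz))
      (λ p → not-intro (trans (sym (cong Y (==⇒≡ {i = z} p))) Yz))
  hit : ∀ Y → NE (Y ∩ N) → Y w ∨ Y m ≡ true
  hit Y (z , p) = tab 5 (λ a b c d e → ! (c ∧ (b ∨ a)) ⇛ b ∧ c ⊃ d ⇛ a ∧ c ⊃ e ⇛ ⊩ ! (d ∨ e)) (z == m) (z == w) (Y z)
      (Y w) (Y m) p (carry w) (carry m)
    where
    carry : ∀ k → (z == k) ∧ Y z ≡ true → Y k ≡ true
    carry k q = trans (sym (cong Y (==⇒≡ {i = z} (∧ˡ (z == k) (Y z) q)))) (∧ʳ (z == k) (Y z) q)

-- Deleting an edge ab of a block that closes a K₄ with the new vertices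

Linked : ∀ {n} → ES n → Set
Linked E = ∀ {a b c d} → E a b ≡ true → E c d ≡ true → Through E a b c d

link-all : ∀ {n} {E : ES n} {a b} → (∀ x y → E x y ≡ true → Through E a b x y) → Linked E
link-all h {a} {b} {c} {d} p q = through-trans (h a b p) (h c d q)

-- A circuit through `ab` and `ac` contains `a`, `b`, `c`, so `ab` can be rerouted over the claw at
-- `w`. A circuit through `ab` and `xy` may miss `c`; eliminating `ab` between it and the first
-- circuit gives a circuit through `xy` that meets the rerouted one.
module DeleteClaw {n : ℕ} {A : ES n} (sA : Simple A) {U : VS n} (blk : Block (inn A U) U) {w a b c : Fin n}
    (only : ∀ i → U i ≡ not (i == w))
    (tri : Triple (A w) a b c) (ab : A a b ≡ true) (ac : A a c ≡ true) where
  open Triple tri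
  module B = Block blk

  U∋ : ∀ {i} → A w i ≡ true → U i ≡ true
  U∋ {i} p = trans (only i) (≢⇒not (λ e → adj≢ sA p (sym e)))
  Uw : U w ≡ false
  Uw = trans (only w) (cong not (==-refl w))
  inside : ∀ {i j} → A i j ≡ true → U i ≡ true → U j ≡ true → inn A U i j ≡ true
  inside p q r = p & q & r
  L : ES n
  L = claw w a b c
  Aab : ES n
  Aab = A ⊖ (a , b)

  L⊆ : ∀ i j → L i j ≡ true → Aab i j ≡ true
  L⊆ i j p = tab 5 (λ a b c d e → ! ((c ∨ b) ∨ a) ⇛ c ⊃ d ⇛ b ⊃ d ⇛ a ⊃ d ⇛ c ⊃ not e ⇛ b ⊃ not e ⇛ a ⊃ not e ⇛ ⊩ !
      (d ∧ not e)) (pair w c i j) (pair w b i j) (pair w a i j) (A i j) (pair a b i j) p (pair-⊆ sA ∈a i j)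
      (pair-⊆ sA ∈b i j) (pair-⊆ sA ∈c i j) (apart a i j) (apart b i j) (apart c i j)
    where
    apart : ∀ z i j → pair w z i j ≡ true → not (pair a b i j) ≡ true
    apart z = pair-apart (λ i j → not (pair a b i j)) (λ i j → cong not (pair-symm a b i j))
        (not-intro (pair-other a b w z (inj₁ (λ e → adj≢ sA ∈a (sym e))) (inj₂ (λ e → adj≢ sA ∈b (sym e)))))

  ⊆Aab : ∀ {X F} → Circ (inn A U) X F → ∀ i j → ((F ⊖ (a , b)) ∪ₑ L) i j ≡ true → Aab i j ≡ true
  ⊆Aab {X} {F} cF i j p = tab 6 (λ a b c d e f → ! ((c ∧ not b) ∨ a) ⇛ c ⊃ f ∧ e ∧ d ⇛ a ⊃ f ∧ not b ⇛ ⊩ ! (f ∧ not b))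
      (L i j) (pair a b i j) (F i j) (U j) (U i) (A i j) p (Circ.⊆E cF i j) (L⊆ i j)

  covers : ∀ {X F} → Circ (inn A U) X F → X w ≡ false
  covers {X} cF = 𝔹.¬-not (λ p → clash (circ-covers cF B.within w p) Uw)

  module Base′ {X F} (cF : Circ (inn A U) X F) (Fab : F a b ≡ true) (Fac : F a c ≡ true) where
    C₁ : Circ ((F ⊖ (a , b)) ∪ₑ L) (X ∪ ⟨ w ⟩) ((F ⊖ (a , b)) ∪ₑ L)
    C₁ = insert-gadget cF Fab (claw-gadget (covers cF) (Circ.within cF a b Fab) (Circ.within₂ cF a b Fab)
        (Circ.within₂ cF a c Fac) a≢b a≢c b≢c)
    M : ES n
    M = (F ⊖ (a , b)) ∪ₑ L
    C₁′ : Circ Aab (X ∪ ⟨ w ⟩) M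
    C₁′ = circ-mono (⊆Aab cF) C₁
    Lwa : L w a ≡ true
    Lwa = tab 3 (λ a b c → ! a ⇛ ⊩ ! ((a ∨ c) ∨ b)) (pair w a w a) (pair w c w a) (pair w b w a) (pair-self w a)
    in-L : ∀ {x y} → L x y ≡ true → M x y ≡ true
    in-L {x} {y} p = tab 3 (λ a b c → ! a ⇛ ⊩ ! ((c ∧ not b) ∨ a)) (L x y) (pair a b x y) (F x y) p
    spoke : ∀ {y} → A w y ≡ true → L w y ≡ true
    spoke {y} p = go (members p)
      where
      go : y ≡ a ⊎ y ≡ b ⊎ y ≡ c → L w y ≡ true
      go (inj₁ refl) = Lwa
      go (inj₂ (inj₁ refl)) = tab 3 (λ a b c → ! a ⇛ ⊩ ! ((c ∨ a) ∨ b)) (pair w y w y) (pair w c w y) (pair w a w y)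
          (pair-self w y)
      go (inj₂ (inj₂ refl)) = tab 3 (λ a b c → ! a ⇛ ⊩ ! ((c ∨ b) ∨ a)) (pair w y w y) (pair w b w y) (pair w a w y)
          (pair-self w y)
    link : ∀ x y → Aab x y ≡ true → Through Aab w a x y
    link x y p = go (x ≟ w) (y ≟ w)
      where
      xy : A x y ≡ true
      xy = ⊖-⊆ A (a , b) x y p
      go : Dec (x ≡ w) → Dec (y ≡ w) → Through Aab w a x y
      go (yes refl) _ = X ∪ ⟨ w ⟩ , M , C₁′ , in-L Lwa , in-L (spoke xy)
      go _ (yes refl) = X ∪ ⟨ w ⟩ , M , C₁′ , in-L Lwa , trans (symm (Circ.simpleᶜ C₁) x w)
          (in-L (spoke (trans (symm sA w x) xy)))
      go (no x≢w) (no y≢w) = by (bool (F x y))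
        where
        U≢ : ∀ {i} → i ≢ w → U i ≡ true
        U≢ {i} e = trans (only i) (≢⇒not e)
        by : Decided (F x y) → Through Aab w a x y
        by (inj₁ Fxy) = X ∪ ⟨ w ⟩ , M , C₁′ , in-L Lwa , (tab 4
            (λ a b c d → ! a ⇛ ! (c ∧ not b) ⇛ ⊩ ! ((a ∧ not b) ∨ d)) (F x y) (pair a b x y) (A x y) (L x y) Fxy p)
        by (inj₂ Fxy) = step (B.linked (inside ab (U∋ ∈a) (U∋ ∈b)) (inside xy (U≢ x≢w) (U≢ y≢w)))
          where
          step : Through (inn A U) a b x y → Through Aab w a x y
          step (Y , H , cH , Hab , Hxy) = step₂ (eliminate cH cF Hab Fab Hxy Fxy)
            where
            step₂ : ∃[ Z ] ∃[ K ] (Circ ((H ∪ₑ F) ⊖ (a , b)) Z K × K x y ≡ true) → Through Aab w a x y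
            step₂ (Z , K , cK , Kxy) = step₃ (edge? (λ i j → K i j ∧ not (H i j)))
              where
              module K = Circ cK
              cK′ : Circ Aab Z K
              cK′ = circ-mono (λ i j q → tab 6 (λ a b c d e f → ! ((c ∨ b) ∧ not a) ⇛ c ⊃ f ∧ e ∧ d ⇛ b ⊃ f ∧ e ∧ d ⇛ ⊩
                  ! (f ∧ not a)) (pair a b i j) (F i j) (H i j) (U j) (U i) (A i j) q (Circ.⊆E cH i j) (Circ.⊆E cF i j))
                  cK
              step₃ : Edge? (λ i j → K i j ∧ not (H i j)) → Through Aab w a x y
              step₃ (inj₂ none) = ⊥-elim (circ-⊄ cH cK (λ i j q → tab 2 (λ a b → ! a ⇛ ∼ (a ∧ not b) ⇛ ⊩ ! b) (K i j)
                  (H i j) q (none i j)) Hab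
                (tab 4 (λ a b c d → a ⊃ (d ∨ c) ∧ not b ⇛ ! b ⇛ ⊩ ∼ a) (K a b) (pair a b a b) (F a b) (H a b) (K.⊆E a b)
                    (pair-self a b)))
              step₃ (inj₁ (i , j , q)) = circ-trans C₁′ cK′ {i} {j}
                (tab 5 (λ a b c d e → ! (b ∧ not a) ⇛ b ⊃ (a ∨ d) ∧ not c ⇛ ⊩ ! ((d ∧ not c) ∨ e)) (H i j) (K i j)
                    (pair a b i j) (F i j) (L i j) q (K.⊆E i j))
                (∧ˡ (K i j) (not (H i j)) q) (in-L Lwa) Kxy

  linked : Linked Aab
  linked = start (B.linked (inside ab (U∋ ∈a) (U∋ ∈b)) (inside ac (U∋ ∈a) (U∋ ∈c)))
    where
    start : Through (inn A U) a b a c → Linked Aab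
    start (X , F , cF , Fab , Fac) = link-all (Base′.link cF Fab Fac)

-- The gadget on `w` and `m` attaches only at `a` and `b`, so every circuit through `ab` can be
-- rerouted directly.
module DeleteDiamond {n : ℕ} {A : ES n} (sA : Simple A) {U : VS n} (blk : Block (inn A U) U) {w m a b : Fin n}
    (only : ∀ i → U i ≡ not ((i == w) ∨ (i == m)))
    (triw : Triple (A w) m a b) (trim : Triple (A m) w a b) (ab : A a b ≡ true) where
  module W = Triple triw
  module M = Triple trim
  module B = Block blk
  L : ES n
  L = diamond w m a b
  Aab : ES n
  Aab = A ⊖ (a , b)
  w≢m : w ≢ m
  w≢m = adj≢ sA W.∈a
  Uw : U w ≡ false
  Uw = trans (only w) (cong (λ z → not (z ∨ (w == m))) (==-refl w))
  Um : U m ≡ false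
  Um = trans (only m) (tab 2 (λ a b → ! a ⇛ ⊩ ∼ (not (b ∨ a))) (m == m) (m == w) (==-refl m))
  U∋ : ∀ {i} → i ≢ w → i ≢ m → U i ≡ true
  U∋ {i} e f = trans (only i) (cong not (cong₂ _∨_ (≢⇒== e) (≢⇒== f)))
  Ua : U a ≡ true
  Ua = U∋ (λ e → adj≢ sA W.∈b (sym e)) (λ e → adj≢ sA M.∈b (sym e))
  Ub : U b ≡ true
  Ub = U∋ (λ e → adj≢ sA W.∈c (sym e)) (λ e → adj≢ sA M.∈c (sym e))

  L⊆ : ∀ i j → L i j ≡ true → Aab i j ≡ true
  L⊆ i j p = tab 7 (λ a b c d e f g → ! ((((e ∨ d) ∨ c) ∨ b) ∨ a) ⇛ e ⊃ f ⇛ d ⊃ f ⇛ c ⊃ f ⇛ b ⊃ f ⇛ a ⊃ f ⇛ e ⊃ not g ⇛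
      d ⊃ not g ⇛ c ⊃ not g ⇛ b ⊃ not g ⇛ a ⊃ not g ⇛ ⊩ ! (f ∧ not g)) (pair m b i j) (pair m a i j) (pair w b i j)
      (pair w a i j) (pair w m i j) (A i j) (pair a b i j) p (pair-⊆ sA W.∈a i j) (pair-⊆ sA W.∈b i j)
      (pair-⊆ sA W.∈c i j) (pair-⊆ sA M.∈b i j) (pair-⊆ sA M.∈c i j) (apart Uw i j) (apart Uw i j) (apart Uw i j)
      (apart Um i j) (apart Um i j)
    where
    apart : ∀ {x z} → U x ≡ false → ∀ i j → pair x z i j ≡ true → not (pair a b i j) ≡ true
    apart {x} {z} Ux = pair-apart (λ i j → not (pair a b i j)) (λ i j → cong not (pair-symm a b i j))
        (not-intro (pair-other a b x z (inj₁ (∈≢∉ {X = U} Ua Ux)) (inj₂ (∈≢∉ {X = U} Ub Ux))))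

  build : ∀ {X F} → Circ (inn A U) X F → F a b ≡ true → Circ Aab (X ∪ (⟨ w ⟩ ∪ ⟨ m ⟩)) ((F ⊖ (a , b)) ∪ₑ L)
  build {X} {F} cF Fab = circ-mono (λ i j p → tab 6 (λ a b c d e f → ! ((c ∧ not b) ∨ a) ⇛ c ⊃ f ∧ e ∧ d ⇛ a ⊃ f ∧ not b
      ⇛ ⊩ ! (f ∧ not b)) (L i j) (pair a b i j) (F i j) (U j) (U i) (A i j) p (Circ.⊆E cF i j) (L⊆ i j))
    (insert-gadget cF Fab (diamond-gadget (out Uw) (out Um) (Circ.within cF a b Fab) (Circ.within₂ cF a b Fab) w≢m
        M.b≢c))
    where
    out : ∀ {z} → U z ≡ false → X z ≡ false
    out {z} Uz = 𝔹.¬-not (λ p → clash (circ-covers cF B.within z p) Uz)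

  Lwa : L w a ≡ true
  Lwa = tab 5 (λ a b c d e → ! a ⇛ ⊩ ! ((((e ∨ a) ∨ d) ∨ c) ∨ b)) (pair w a w a) (pair m b w a) (pair m a w a)
      (pair w b w a) (pair w m w a) (pair-self w a)
  sL : ∀ i j → L i j ≡ L j i
  sL i j = cong₂ _∨_ (cong₂ _∨_ (cong₂ _∨_ (cong₂ _∨_ (pair-symm w m i j) (pair-symm w a i j)) (pair-symm w b i j))
      (pair-symm m a i j)) (pair-symm m b i j)
  spoke-w : ∀ {y} → A w y ≡ true → L w y ≡ true
  spoke-w {y} p = go (W.members p)
    where
    go : y ≡ m ⊎ y ≡ a ⊎ y ≡ b → L w y ≡ true
    go (inj₁ refl) = tab 5 (λ a b c d e → ! a ⇛ ⊩ ! ((((a ∨ e) ∨ d) ∨ c) ∨ b)) (pair w y w y) (pair y b w y)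
        (pair y a w y) (pair w b w y) (pair w a w y) (pair-self w y)
    go (inj₂ (inj₁ refl)) = Lwa
    go (inj₂ (inj₂ refl)) = tab 5 (λ a b c d e → ! a ⇛ ⊩ ! ((((e ∨ d) ∨ a) ∨ c) ∨ b)) (pair w y w y) (pair m y w y)
        (pair m a w y) (pair w a w y) (pair w m w y) (pair-self w y)
  spoke-m : ∀ {y} → A m y ≡ true → L m y ≡ true
  spoke-m {y} p = go (M.members p)
    where
    go : y ≡ w ⊎ y ≡ a ⊎ y ≡ b → L m y ≡ true
    go (inj₁ refl) = trans (sL m w) (spoke-w W.∈a)
    go (inj₂ (inj₁ refl)) = tab 5 (λ a b c d e → ! a ⇛ ⊩ ! ((((e ∨ d) ∨ c) ∨ a) ∨ b)) (pair m y m y) (pair m b m y)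
        (pair w b m y) (pair w y m y) (pair w m m y) (pair-self m y)
    go (inj₂ (inj₂ refl)) = tab 5 (λ a b c d e → ! a ⇛ ⊩ ! ((((e ∨ d) ∨ c) ∨ b) ∨ a)) (pair m y m y) (pair m a m y)
        (pair w y m y) (pair w a m y) (pair w m m y) (pair-self m y)

  Uab : inn A U a b ≡ true
  Uab = ab & Ua & Ub

  link : ∀ x y → Aab x y ≡ true → Through Aab w a x y
  link x y p = go (x ≟ w) (y ≟ w) (x ≟ m) (y ≟ m)
    where
    xy : A x y ≡ true
    xy = ⊖-⊆ A (a , b) x y p
    use : ∀ {X F} → Circ (inn A U) X F → F a b ≡ true → F x y ≡ true ⊎ L x y ≡ true → Through Aab w a x y
    use {X} {F} cF Fab h = _ , _ , build cF Fab , (tab 3 (λ a b c → ! a ⇛ ⊩ ! ((c ∧ not b) ∨ a)) (L w a) (pair a b w a)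
        (F w a) Lwa) , pick h
      where
      pick : F x y ≡ true ⊎ L x y ≡ true → ((F ⊖ (a , b)) ∪ₑ L) x y ≡ true
      pick (inj₁ q) = tab 4 (λ a b c d → ! a ⇛ ! (c ∧ not b) ⇛ ⊩ ! ((a ∧ not b) ∨ d)) (F x y) (pair a b x y) (A x y)
          (L x y) q p
      pick (inj₂ q) = tab 3 (λ a b c → ! a ⇛ ⊩ ! ((c ∧ not b) ∨ a)) (L x y) (pair a b x y) (F x y) q
    new : L x y ≡ true → Through Aab w a x y
    new q = start (B.linked Uab Uab)
      where
      start : Through (inn A U) a b a b → Through Aab w a x y
      start (X , F , cF , Fab , _) = use cF Fab (inj₂ q)
    go : Dec (x ≡ w) → Dec (y ≡ w) → Dec (x ≡ m) → Dec (y ≡ m) → Through Aab w a x y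
    go (yes refl) _ _ _ = new (spoke-w xy)
    go _ (yes refl) _ _ = new (trans (sL x w) (spoke-w (trans (symm sA w x) xy)))
    go _ _ (yes refl) _ = new (spoke-m xy)
    go _ _ _ (yes refl) = new (trans (sL x m) (spoke-m (trans (symm sA m x) xy)))
    go (no e) (no f) (no g) (no h) = start (B.linked Uab (xy & U∋ e g & U∋ f h))
      where
      start : Through (inn A U) a b x y → Through Aab w a x y
      start (X , F , cF , Fab , Fxy) = use cF Fab (inj₁ Fxy)

  linked : Linked Aab
  linked = link-all link

-- Connected graphs on a vertex set V, and their translation to M22Connected

record Good {n : ℕ} (E : ES n) (V : VS n) : Set where
  field
    simpleᶢ : Simple E
    within : ∀ i j → E i j ≡ true → V i ≡ true
    alive : ∀ v → V v ≡ true → ∃[ w ] E v w ≡ true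
    big : 2 ≤ ec E
    linked : Linked E

block-good : ∀ {n} {E : ES n} {V : VS n} → Block E V → ∀ {a b} → V a ≡ true → V b ≡ true → a ≢ b → Good E V
block-good {n} {E} {V} blk {a} {b} Va Vb a≢b = record
  { simpleᶢ = simpleᵇ ; within = within
  ; alive = λ v Vv → go v (pos⇒NE (basis v ∩ V) (degree-two v Vv (v ≟ a)))
  ; big = lin 3 (λ a b c → a ≼ b ⇛ a ⊹ 2 ≑ 2 ⊗ c ⇛ 2 ⊠ κ 2 ≼ c ⇛ 1 ⊢ κ 2 ≼ b) (ec basis) (ec E) (∣ V ∣) (ec-⊆ basis⊆)
      T.size (cnt-two {X = V} Va Vb a≢b)
  ; linked = linked }
  where
  open Block blk
  module T = Tight tight
  go : ∀ v → NE (basis v ∩ V) → ∃[ w ] E v w ≡ true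
  go v (w , p) = w , basis⊆ v w (∧ˡ (basis v w) (V w) p)
  deg-pos : ∀ v → V v ≡ true → NE (V ∖ ⟨ v ⟩) → 1 ≤ dg basis v V
  deg-pos v Vv ne = lin 6 (λ a b c d e f → a ⊹ 2 ≑ 2 ⊗ b ⇛ c ≐ d ⊕ e ⇛ d ⊹ 2 ≼ 2 ⊗ f ⇛ 2 ⊠ b ≑ 𝕤 f ⇛ a ≼ c ⇛ 1 ⊢ κ 1 ≼
      e) (ec basis) (∣ V ∣) (ins basis V) (ins basis (V ∖ ⟨ v ⟩)) (dg basis v V) (∣ V ∖ ⟨ v ⟩ ∣) T.size
      (ins-rem T.simpleᵗ V Vv) (T.sparse (V ∖ ⟨ v ⟩) ne) (cnt-rem V Vv)
      (ec-⊆ (λ i j p → p & T.within i j p & T.within₂ i j p))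
  degree-two : ∀ v → V v ≡ true → Dec (v ≡ a) → 1 ≤ dg basis v V
  degree-two v Vv (yes refl) = deg-pos v Vv (b , ∖⟨⟩-intro {X = V} Vb (≢-sym a≢b))
  degree-two v Vv (no e) = deg-pos v Vv (a , ∖⟨⟩-intro {X = V} Va (≢-sym e))

-- A proper subgraph either misses a vertex, where sparsity applies, or keeps all of `X` and lacks
-- one of the 2|X| - 1 edges.
circ⇒circuit : ∀ {n} {E : ES n} {X F} → Simple E → Circ E X F → IsCircuit22 (record { n = n ; adj = E }) X F
circ⇒circuit {n} {E} {X} {F} sE c = (⊆E , symm simpleᶜ , λ i j p → within i j p , within₂ i j p) , total , λ V E″ sub pr
    ne → small V E″ sub pr ne
  where
  open Circ c
  total : ecount F + 1 ≡ 2 * countFin X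
  total = trans (cong (_+ 1) (sym (ec-def F))) (trans size (cong (2 *_) (∣∣-def X)))
  G : Graph
  G = record { n = n ; adj = E }
  small : ∀ V E″ → IsSub G V E″ → ProperSubOf V E″ X F → NonEmptyE E″ → ecount E″ + 2 ≤ 2 * countFin V
  small V E″ (_ , sym″ , in″) ((V⊆X , E″⊆F) , missing) (i , j , ij) = subst₂ (λ a b → a + 2 ≤ 2 * b) (ec-def E″)
      (∣∣-def V) (go missing (empty? (X ∖ V)))
    where
    inside : ∀ {x} → X x ≡ true → V x ≡ false → ec E″ + 2 ≤ 2 * ∣ V ∣
    inside {x} Xx Vx = ≤-trans (+-monoˡ-≤ 2 (ec-⊆ {E = E″} {inn F V} (λ i j p → E″⊆F i j p & proj₁ (in″ i j p) & proj₂
        (in″ i j p)))) (sparse V V⊆X (i , proj₁ (in″ i j ij)) Xx Vx)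
    go : (∃[ x ] (X x ≡ true × V x ≡ false)) ⊎ (∃[ x ] ∃[ y ] (F x y ≡ true × E″ x y ≡ false)) → Empty? (X ∖ V) → ec E″
        + 2 ≤ 2 * ∣ V ∣
    go (inj₁ (x , Xx , Vx)) _ = inside Xx Vx
    go _ (inj₁ (x , p)) = inside {x} (∧ˡ (X x) (not (V x)) p) (not-elim (∧ʳ (X x) (not (V x)) p))
    go (inj₂ (x , y , Fxy , E″xy)) (inj₂ none) = lin 5 (λ a b c d e → a ⊹ 1 ≐ 2 ⊗ b ⇛ a ≑ 𝕤 c ⇛ 2 ⊠ b ≼ d ⇛ e ≼ c ⇛ 1 ⊢
        e ⊹ 2 ≼ 2 ⊗ d) (ec F) (∣ X ∣) (ec (F ⊖ (x , y))) (∣ V ∣) (ec E″) size (ec-rem simpleᶜ Fxy)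
        (cnt≤ {X = X} {V} (λ i p → tab 2 (λ a b → ! a ⇛ ∼ (a ∧ not b) ⇛ ⊩ ! b) (X i) (V i) p (none i)))
        (ec-⊆ {E = E″} {F ⊖ (x , y)} (λ i j p → tab 3 (λ a b c → ! a ⇛ ! b ⇛ c ⊃ not b ⇛ ⊩ ! (a ∧ not c)) (F i j)
        (E″ i j) (pair x y i j) (E″⊆F i j p) p (pair-apart (λ i j → not (E″ i j)) (λ i j → cong not (sym″ i j))
        (not-intro E″xy) i j)))

circuit⇒circ : ∀ {n} {E : ES n} {X F} → Simple E → IsCircuit22 (record { n = n ; adj = E }) X F → Circ E X F
circuit⇒circ {n} {E} {X} {F} sE ((F⊆E , symF , in-X) , total , small) = record
  { simpleᶜ = simple symF irrF ; ⊆E = F⊆E ; within = λ i j p → proj₁ (in-X i j p)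
  ; size = trans (cong (_+ 1) (ec-def F)) (trans total (cong (2 *_) (sym (∣∣-def X))))
  ; sparse = λ Y Y⊆X ne {x} Xx Yx → go Y Y⊆X ne Xx Yx (edge? (inn F Y)) }
  where
  irrF : ∀ i → F i i ≡ false
  irrF i = 𝔹.¬-not (λ p → clash (F⊆E i i p) (irr sE i))
  go : ∀ Y → Y ⊆ X → NE Y → ∀ {x} → X x ≡ true → Y x ≡ false → Edge? (inn F Y) → ins F Y + 2 ≤ 2 * ∣ Y ∣
  go Y Y⊆X (y , Yy) Xx Yx (inj₂ none) = lin 2 (λ a b → a ≐ κ 0 ⇛ 2 ⊠ κ 1 ≼ b ⇛ 1 ⊢ a ⊹ 2 ≼ 2 ⊗ b) (ins F Y) (∣ Y ∣)
      (ec-empty none) (cnt-pos {X = Y} Yy)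
  go Y Y⊆X ne {x} Xx Yx (inj₁ edge) = subst₂ (λ a b → a + 2 ≤ 2 * b) (sym (ec-def (inn F Y))) (sym (∣∣-def Y))
      (small Y (inn F Y)
      ((λ i j p → F⊆E i j (inF i j p)) , symm (inn-simple (simple symF irrF) Y) , λ i j p
          → (∧ˡ (Y i) (Y j) (∧ʳ (F i j) _ p)) , (∧ʳ (Y i) (Y j) (∧ʳ (F i j) _ p)))
      ((Y⊆X , inF) , inj₁ (x , Xx , Yx)) edge)
    where
    inF : ∀ i j → inn F Y i j ≡ true → F i j ≡ true
    inF i j p = ∧ˡ (F i j) ((Y i) ∧ (Y j)) p

good⇒connected : ∀ {n} {E : ES n} {V : VS n} → Good E V → (∀ i → V i ≡ true) → M22Connected (record { n = n ; adj = E })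
good⇒connected {n} {E} g all = (λ v → alive v (all v)) , subst (2 ≤_) (ec-def E) big , λ a b c d ab cd → convert
    (linked ab cd)
  where
  open Good g
  convert : ∀ {a b c d} → Through E a b c d → ∃[ V ] ∃[ F ] (IsCircuit22 (record { n = n ; adj = E }) V F × F a b ≡ true
      × F c d ≡ true)
  convert (X , F , c , p , q) = X , F , circ⇒circuit simpleᶢ c , p , q

connected⇒linked : ∀ {n} {E : ES n} → Simple E → M22Connected (record { n = n ; adj = E }) → Linked E
connected⇒linked sE (_ , _ , link) {a} {b} {c} {d} p q with link a b c d p q
... | V , F , circuit , r , s = V , F , circuit⇒circ sE circuit , r , s

-- Removing an isolated vertex

infixl 9 _↾_ _↾ₑ_
_↾_ : ∀ {m} → VS (suc m) → Fin (suc m) → VS m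
(X ↾ v) a = X (punchIn v a)

_↾ₑ_ : ∀ {m} → ES (suc m) → Fin (suc m) → ES m
(E ↾ₑ v) a b = E (punchIn v a) (punchIn v b)

sum-punch : ∀ {m} (f : Fin (suc m) → ℕ) v → sumFin f ≡ f v + sumFin (λ a → f (punchIn v a))
sum-punch f zero = refl
sum-punch {suc m} f (suc v) = trans (cong (f zero +_) (sum-punch (λ i → f (suc i)) v)) (swap (f zero) (f (suc v)) _)
  where
  swap : ∀ a b c → a + (b + c) ≡ b + (a + c)
  swap a b c = trans (sym (+-assoc a b c)) (trans (cong (_+ c) (+-comm a b)) (+-assoc b a c))

punchIn-< : ∀ {m} (v : Fin (suc m)) a b → (toℕ (punchIn v a) <ᵇ toℕ (punchIn v b)) ≡ (toℕ a <ᵇ toℕ b)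
punchIn-< zero a b = refl
punchIn-< (suc v) zero zero = refl
punchIn-< (suc v) zero (suc b) = refl
punchIn-< (suc v) (suc a) zero = refl
punchIn-< (suc v) (suc a) (suc b) = punchIn-< v a b

opaque
  unfolding ∣_∣

  cnt-↾ : ∀ {m} (X : VS (suc m)) {v} → X v ≡ false → ∣ X ∣ ≡ ∣ X ↾ v ∣
  cnt-↾ X {v} Xv = trans (sum-punch (λ i → 𝟙 (X i)) v) (cong (λ z → 𝟙 z + ∣ X ↾ v ∣) Xv)

opaque
  unfolding ec

  ec-↾ : ∀ {m} (E : ES (suc m)) → Simple E → ∀ {v} → (∀ j → E v j ≡ false) → ec E ≡ ec (E ↾ₑ v)
  ec-↾ {m} E sE {v} Ev = trans (sum-punch row v) (trans (cong (_+ sumFin (λ a → row (punchIn v a)))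
      (trans (sum-cong {suc m} (λ j → entry v j (Ev j))) (sum-0 (suc m))))
      (sum-cong (λ a → trans (sum-punch (cell (punchIn v a)) v)
          (trans (cong (_+ sumFin (λ b → cell (punchIn v a) (punchIn v b)))
          (entry (punchIn v a) v (trans (symm sE _ v) (Ev _))))
        (sum-cong (λ b → cong (λ z → 𝟙 (z ∧ E (punchIn v a) (punchIn v b))) (punchIn-< v a b)))))))
    where
    cell : Fin (suc m) → Fin (suc m) → ℕ
    cell i j = 𝟙 ((toℕ i <ᵇ toℕ j) ∧ E i j)
    row : Fin (suc m) → ℕ
    row i = sumFin (cell i)
    entry : ∀ i j → E i j ≡ false → cell i j ≡ 0
    entry i j p = cong 𝟙 (trans (cong ((toℕ i <ᵇ toℕ j) ∧_) p) (𝔹.∧-zeroʳ _))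

lift : ∀ {m} → Fin (suc m) → VS m → VS (suc m)
lift zero Y zero = false
lift zero Y (suc i) = Y i
lift {suc m} (suc v) Y zero = Y zero
lift {suc m} (suc v) Y (suc i) = lift v (λ j → Y (suc j)) i

lift-punchIn : ∀ {m} (v : Fin (suc m)) Y a → lift v Y (punchIn v a) ≡ Y a
lift-punchIn zero Y a = refl
lift-punchIn (suc v) Y zero = refl
lift-punchIn (suc v) Y (suc a) = lift-punchIn v (λ j → Y (suc j)) a

lift-self : ∀ {m} (v : Fin (suc m)) Y → lift v Y v ≡ false
lift-self zero Y = refl
lift-self {suc m} (suc v) Y = lift-self v (λ j → Y (suc j))

punch-cases : ∀ {m} (v : Fin (suc m)) (P : Fin (suc m) → Set) → P v → (∀ a → P (punchIn v a)) → ∀ i → P i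
punch-cases v P pv pa i with v ≟ i
... | yes refl = pv
... | no v≢i = subst P (punchIn-punchOut v≢i) (pa (punchOut v≢i))

simple-↾ : ∀ {m} {E : ES (suc m)} → Simple E → ∀ v → Simple (E ↾ₑ v)
simple-↾ sE v = simple (λ a b → symm sE (punchIn v a) (punchIn v b)) (λ a → irr sE (punchIn v a))

circ-↾ : ∀ {m} {E : ES (suc m)} {X F} → Circ E X F → ∀ {v} → X v ≡ false → Circ (E ↾ₑ v) (X ↾ v) (F ↾ₑ v)
circ-↾ {m} {E} {X} {F} c {v} Xv = record
  { simpleᶜ = simple-↾ simpleᶜ v
  ; ⊆E = λ a b p → ⊆E (punchIn v a) (punchIn v b) p
  ; within = λ a b p → within (punchIn v a) (punchIn v b) p
  ; size = trans (cong (_+ 1) (sym (ec-↾ F simpleᶜ Fv))) (trans size (cong (2 *_) (cnt-↾ X Xv)))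
  ; sparse = λ Y Y⊆X (y , Yy) {x} Xx Yx → subst₂ (λ a b → a + 2 ≤ 2 * b) (same Y)
      (trans (cnt-↾ (lift v Y) (lift-self v Y)) (cnt≗ (lift-punchIn v Y)))
      (sparse (lift v Y) (punch-cases v (λ i → lift v Y i ≡ true → X i ≡ true) (λ p → ⊥-elim (clash p (lift-self v Y)))
          (λ a p → Y⊆X a (trans (sym (lift-punchIn v Y a)) p)))
        (punchIn v y , trans (lift-punchIn v Y y) Yy) Xx (trans (lift-punchIn v Y x) Yx)) }
  where
  open Circ c
  Fv : ∀ j → F v j ≡ false
  Fv j = 𝔹.¬-not (λ p → clash (within v j p) Xv)
  same : ∀ Y → ins F (lift v Y) ≡ ins (F ↾ₑ v) Y
  same Y = trans (ec-↾ (inn F (lift v Y)) (inn-simple simpleᶜ (lift v Y)) (λ j → tab 3 (λ a b c → ∼ a ⇛ ⊩ ∼ (a ∧ c ∧ b))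
      (F v j) (lift v Y j) (lift v Y v) (Fv j)))
    (ec≗ (λ a b → cong₂ (λ y z → F (punchIn v a) (punchIn v b) ∧ (y ∧ z)) (lift-punchIn v Y a) (lift-punchIn v Y b)))

good-↾ : ∀ {m} {E : ES (suc m)} {V} → Good E V → ∀ {v} → V v ≡ false → Good (E ↾ₑ v) (V ↾ v)
good-↾ {m} {E} {V} g {v} Vv = record
  { simpleᶢ = simple-↾ simpleᶢ v
  ; within = λ a b p → within (punchIn v a) (punchIn v b) p
  ; alive = λ a Va → next a (alive (punchIn v a) Va)
  ; big = subst (2 ≤_) (ec-↾ E simpleᶢ Ev) big
  ; linked = λ p q → lower (linked p q) }
  where
  open Good g
  Ev : ∀ j → E v j ≡ false
  Ev j = 𝔹.¬-not (λ p → clash (within v j p) Vv)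
  next : ∀ a → ∃[ w ] E (punchIn v a) w ≡ true → ∃[ b ] (E ↾ₑ v) a b ≡ true
  next a (w , p) = go (v ≟ w)
    where
    go : Dec (v ≡ w) → ∃[ b ] (E ↾ₑ v) a b ≡ true
    go (yes refl) = ⊥-elim (clash (trans (symm simpleᶢ v _) p) (Ev _))
    go (no v≢w) = punchOut v≢w , trans (cong (E (punchIn v a)) (punchIn-punchOut v≢w)) p
  lower : ∀ {a b c d} → Through E (punchIn v a) (punchIn v b) (punchIn v c) (punchIn v d) → Through (E ↾ₑ v) a b c d
  lower (X , F , c , p , q) = X ↾ v , F ↾ₑ v , circ-↾ c (𝔹.¬-not (λ Xv → clash (circ-covers c within v Xv) Vv)) , p , q

-- The two reductions as graph operations

-- The split takes place at `u′`. The retained vertex `suc u′` is v₁ and stands for `v`; the new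
-- vertex `zero` is v₂ and stands for `u`. Among the neighbours of `u′`, `side` selects the moved
-- ones, and the extra edge v₁x restores `vy`.
edge-reduction : ∀ {m} {A : ES (suc m)} → Simple A → ∀ {v u y} → A v u ≡ true → A v y ≡ true → u ≢ y →
  (∀ z → A v z ≡ true → z ≢ u → z ≢ y → A u z ≡ false) → Good (contract A v u y) (∁ ⟨ v ⟩) → AdmissibleEdgeReduction
      (record { n = suc m ; adj = A })
edge-reduction {m} {A} sA {v} {u} {y} vu vy u≢y far g =
    G′ , (((λ a b → symm sG a b) , irr sG) , u′ , y′ , side , y′≢u′ , side-y , iso , adjacency) , good⇒connected g′
        (λ a → ≢⇒not (punchInᵢ≢i v a))
  where
  A′ : ES (suc m)
  A′ = contract A v u y
  v≢u : v ≢ u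
  v≢u = adj≢ sA vu
  v≢y : v ≢ y
  v≢y = adj≢ sA vy
  g′ : Good (A′ ↾ₑ v) ((∁ ⟨ v ⟩) ↾ v)
  g′ = good-↾ g (cong not (==-refl v))
  G′ : Graph
  G′ = record { n = m ; adj = A′ ↾ₑ v }
  sG : Simple (A′ ↾ₑ v)
  sG = Good.simpleᶢ g′
  u′ y′ : Fin m
  u′ = punchOut v≢u
  y′ = punchOut v≢y
  pu : punchIn v u′ ≡ u
  pu = punchIn-punchOut v≢u
  py : punchIn v y′ ≡ y
  py = punchIn-punchOut v≢y
  side : VS m
  side z = A v (punchIn v z) ∧ not (punchIn v z == y)
  y′≢u′ : y′ ≢ u′
  y′≢u′ e = u≢y (trans (sym pu) (trans (cong (punchIn v) (sym e)) py))
  side-y : (A′ ↾ₑ v) u′ y′ ∧ side y′ ≡ false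
  side-y = tab 3 (λ a b c → ! a ⇛ ⊩ ∼ (c ∧ b ∧ not a)) (punchIn v y′ == y) (A v (punchIn v y′)) ((A′ ↾ₑ v) u′ y′)
      (trans (cong (_== y) py) (==-refl y))
  to : Fin (suc m) → Fin (suc m)
  to i with u ≟ i | v ≟ i
  ... | yes _ | _ = zero
  ... | no _ | yes _ = suc u′
  ... | no _ | no v≢i = suc (punchOut v≢i)
  from : Fin (suc m) → Fin (suc m)
  from zero = u
  from (suc a) with a ≟ u′
  ... | yes _ = v
  ... | no _ = punchIn v a
  to-u : to u ≡ zero
  to-u with u ≟ u | v ≟ u
  ... | yes _ | _ = refl
  ... | no e | _ = ⊥-elim (e refl)
  to-v : to v ≡ suc u′
  to-v with u ≟ v | v ≟ v
  ... | yes e | _ = ⊥-elim (v≢u (sym e))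
  ... | no _ | yes _ = refl
  ... | no _ | no e = ⊥-elim (e refl)
  to-punch : ∀ a → a ≢ u′ → to (punchIn v a) ≡ suc a
  to-punch a a≢u′ with u ≟ punchIn v a | v ≟ punchIn v a
  ... | yes e | _ = ⊥-elim (a≢u′ (sym (punchIn-injective v u′ a (trans pu e))))
  ... | no _ | yes e = ⊥-elim (punchInᵢ≢i v a (sym e))
  ... | no _ | no e = cong suc (trans (punchOut-cong v refl) (punchOut-punchIn v))
  to-from : ∀ x → to (from x) ≡ x
  to-from zero = to-u
  to-from (suc a) with a ≟ u′
  ... | yes refl = to-v
  ... | no e = to-punch a e
  from-u′ : from (suc u′) ≡ v
  from-u′ with u′ ≟ u′
  ... | yes _ = refl
  ... | no e = ⊥-elim (e refl)
  from-other : ∀ a → a ≢ u′ → from (suc a) ≡ punchIn v a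
  from-other a e with a ≟ u′
  ... | yes f = ⊥-elim (e f)
  ... | no _ = refl
  from-to : ∀ i → from (to i) ≡ i
  from-to i = punch-cases v (λ i → from (to i) ≡ i) (trans (cong from to-v) from-u′) (λ a → go a (a ≟ u′)) i
    where
    go : ∀ a → Dec (a ≡ u′) → from (to (punchIn v a)) ≡ punchIn v a
    go a (yes refl) = trans (cong (λ z → from (to z)) pu) (trans (cong from to-u) (sym pu))
    go a (no e) = trans (cong from (to-punch a e)) (from-other a e)
  iso : Fin (suc m) ↔ Fin (suc m)
  iso = mk↔ₛ′ to from to-from from-to
  S : ES (suc m)
  S = splitAdj G′ u′ y′ side
  N : VS (suc m)
  N = moved A v u y
  A′u : ∀ a → a ≢ u′ → (A′ ↾ₑ v) u′ a ≡ A u (punchIn v a) ∨ (A v (punchIn v a) ∧ not (punchIn v a == y))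
  A′u a e = trans (cong (λ z → A′ z (punchIn v a)) pu) (tab 8 (λ a b c d e f g h → ! a ⇛ ∼ b ⇛ ∼ c ⇛ ∼ d ⇛ ⊩
      (h ∧ not b ∧ not c) ∨ (a ∧ g ∧ not f ∧ not d) ∨ (d ∧ e) ⇔ h ∨ (g ∧ not f)) (u == u) (u == v) (w == v) (w == u)
      (N u) (w == y) (A v w) (A u w) (==-refl u) (≢⇒== (≢-sym v≢u)) (≢⇒== (punchInᵢ≢i v a)) w≢u)
    where
    w : Fin (suc m)
    w = punchIn v a
    w≢u : (w == u) ≡ false
    w≢u = ≢⇒== (λ f → e (punchIn-injective v a u′ (trans f (sym pu))))
  near : ∀ a → a ≢ u′ → (A′ ↾ₑ v) u′ a ∧ not (side a) ≡ A u (punchIn v a)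
  near a e = trans (cong (_∧ not (side a)) (A′u a e)) (tab 3 (λ a b c → b ∧ not a ⊃ not c ⇛ ⊩ (c ∨ (b ∧ not a)) ∧ not
      (b ∧ not a) ⇔ c) (w == y) (A v w) (A u w) (λ p → not-intro
      (far w (∧ˡ (A v w) (not (w == y)) p) (λ f → e (punchIn-injective v a u′ (trans f (sym pu))))
      (==-≢ (not-elim (∧ʳ (A v w) (not (w == y)) p))))))
    where
    w : Fin (suc m)
    w = punchIn v a
  same-y : ∀ a → (a == y′) ≡ (punchIn v a == y)
  same-y a = go (a ≟ y′)
    where
    go : Dec (a ≡ y′) → (a == y′) ≡ (punchIn v a == y)
    go (yes refl) = trans (==-refl y′) (sym (trans (cong (_== y) py) (==-refl y)))
    go (no e) = trans (≢⇒== e) (sym (≢⇒== (λ f → e (punchIn-injective v a y′ (trans f (sym py))))))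
  far-side : ∀ a → a ≢ u′ → ((A′ ↾ₑ v) u′ a ∧ side a) ∨ (a == y′) ≡ A v (punchIn v a)
  far-side a e = trans (cong₂ _∨_ (cong (_∧ side a) (A′u a e)) (same-y a))
      (tab 3 (λ a b c → a ⊃ b ⇛ ⊩ ((c ∨ (b ∧ not a)) ∧ b ∧ not a) ∨ a ⇔ b) (w == y) (A v w) (A u w) (at (A v) vy w))
    where
    w : Fin (suc m)
    w = punchIn v a
  keep : ∀ a b → a ≢ u′ → b ≢ u′ → (A′ ↾ₑ v) a b ≡ A (punchIn v a) (punchIn v b)
  keep a b e f = tab 7 (λ a b c d e f g → ∼ a ⇛ ∼ b ⇛ ∼ c ⇛ ∼ d ⇛ ⊩ (g ∧ not a ∧ not b) ∨ (c ∧ f) ∨ (d ∧ e) ⇔ g)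
      (w == v) (z == v) (w == u) (z == u) (N w) (N z) (A w z) (≢⇒== (punchInᵢ≢i v a)) (≢⇒== (punchInᵢ≢i v b))
      (≢⇒== (λ h → e (punchIn-injective v a u′ (trans h (sym pu)))))
      (≢⇒== (λ h → f (punchIn-injective v b u′ (trans h (sym pu)))))
    where
    w z : Fin (suc m)
    w = punchIn v a
    z = punchIn v b
  is : ∀ {a} → a ≡ u′ → (a == u′) ≡ true
  is e = trans (cong (_== u′) e) (==-refl u′)
  from-at : ∀ {a} → a ≡ u′ → from (suc a) ≡ v
  from-at e = trans (cong (λ a → from (suc a)) e) from-u′
  S-from : ∀ x z → S x z ≡ A (from x) (from z)
  S-from zero zero = sym (irr sA u)
  S-from zero (suc b) = go (b ≟ u′)
    where
    go : Dec (b ≡ u′) → S zero (suc b) ≡ A u (from (suc b))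
    go (yes e) = trans (cong (_∨ ((A′ ↾ₑ v) u′ b ∧ not (side b))) (is e))
        (sym (trans (cong (A u) (from-at e)) (trans (symm sA u v) vu)))
    go (no e) = trans (cong (_∨ ((A′ ↾ₑ v) u′ b ∧ not (side b))) (≢⇒== e))
        (trans (near b e) (sym (cong (A u) (from-other b e))))
  S-from (suc a) zero = trans (S-from zero (suc a)) (symm sA u (from (suc a)))
  S-from (suc a) (suc b) = go (a ≟ u′) (b ≟ u′)
    where
    F G H : Bool
    F = ((A′ ↾ₑ v) u′ b ∧ side b) ∨ (b == y′)
    G = ((A′ ↾ₑ v) u′ a ∧ side a) ∨ (a == y′)
    H = (A′ ↾ₑ v) a b
    branch : Bool → Bool → Bool
    branch p q = if p then (if q then false else F) else (if q then G else H)
    go : Dec (a ≡ u′) → Dec (b ≡ u′) → S (suc a) (suc b) ≡ A (from (suc a)) (from (suc b))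
    go (yes e) (yes f) = trans (cong₂ branch (is e) (is f)) (sym (trans (cong₂ A (from-at e) (from-at f)) (irr sA v)))
    go (yes e) (no f) = trans (cong₂ branch (is e) (≢⇒== f))
        (trans (far-side b f) (sym (cong₂ A (from-at e) (from-other b f))))
    go (no e) (yes f) = trans (cong₂ branch (≢⇒== e) (is f))
        (trans (far-side a e) (trans (symm sA v (punchIn v a)) (sym (cong₂ A (from-other a e) (from-at f)))))
    go (no e) (no f) = trans (cong₂ branch (≢⇒== e) (≢⇒== f))
        (trans (keep a b e f) (sym (cong₂ A (from-other a e) (from-other b f))))
  adjacency : ∀ i j → S (to i) (to j) ≡ A i j
  adjacency i j = trans (S-from (to i) (to j)) (cong₂ A (from-to i) (from-to j))

K₄⁻-reduction : ∀ {m} {A : ES (suc (suc m))} → Simple A → ∀ {t p q r} → A t p ≡ true → ∣ A t ∣ ≡ 3 → ∣ A p ∣ ≡ 3 → q ≢ r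
    → A t q ≡ true → A t r ≡ true → A p q ≡ true → A p r ≡ true → A q r ≡ false →
  Good (replace A t p q r) (∁ ⟨ t ⟩ ∩ ∁ ⟨ p ⟩) → AdmissibleK4Reduction (record { n = suc (suc m) ; adj = A })
K₄⁻-reduction {m} {A} sA {t} {p} {q} {r} tp deg-t deg-p q≢r tq tr pq pr qr g =
    H , (t , p , q , r , tp , trans (sym (∣∣-def (A t))) deg-t , trans (sym (∣∣-def (A p))) deg-p , q≢r , common ,
        (tq & pq) , (tr & pr) , qr , f , inj , avoid , onto , adjacency) ,
    good⇒connected g″ (λ a → ≢⇒not (proj₁ (avoid a)) & ≢⇒not (proj₂ (avoid a)))
  where
  A′ : ES (suc (suc m))
  A′ = replace A t p q r
  t≢p : t ≢ p
  t≢p = adj≢ sA tp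
  p′ : Fin (suc m)
  p′ = punchOut t≢p
  pp : punchIn t p′ ≡ p
  pp = punchIn-punchOut t≢p
  f : Fin m → Fin (suc (suc m))
  f a = punchIn t (punchIn p′ a)
  g″ : Good (A′ ↾ₑ t ↾ₑ p′) ((∁ ⟨ t ⟩ ∩ ∁ ⟨ p ⟩) ↾ t ↾ p′)
  g″ = good-↾ (good-↾ g {t} (cong (λ z → not z ∧ not (t == p)) (==-refl t))) {p′}
    (tab 2 (λ a b → ! a ⇛ ⊩ ∼ (not b ∧ not a)) (punchIn t p′ == p) (punchIn t p′ == t)
        (trans (cong (_== p) pp) (==-refl p)))
  H : Graph
  H = record { n = m ; adj = A′ ↾ₑ t ↾ₑ p′ }
  inj : ∀ {a b} → f a ≡ f b → a ≡ b
  inj {a} {b} e = punchIn-injective p′ a b (punchIn-injective t _ _ e)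
  avoid : ∀ a → f a ≢ t × f a ≢ p
  avoid a = punchInᵢ≢i t (punchIn p′ a) , λ e → punchInᵢ≢i p′ a (punchIn-injective t _ _ (trans e (sym pp)))
  onto : ∀ w → w ≢ t → w ≢ p → ∃[ a ] (f a ≡ w)
  onto w w≢t w≢p = punchOut p′≢ , trans (cong (punchIn t) (punchIn-punchOut p′≢)) (punchIn-punchOut t≢w)
    where
    t≢w : t ≢ w
    t≢w e = w≢t (sym e)
    p′≢ : p′ ≢ punchOut t≢w
    p′≢ e = w≢p (trans (sym (punchIn-punchOut t≢w)) (trans (cong (punchIn t) (sym e)) pp))
  common : ∀ w → A t w ∧ A p w ≡ true → w ≡ q ⊎ w ≡ r
  common w h = go (w ≟ q) (w ≟ r) (w ≟ p)
    where
    go : Dec (w ≡ q) → Dec (w ≡ r) → Dec (w ≡ p) → w ≡ q ⊎ w ≡ r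
    go (yes e) _ _ = inj₁ e
    go _ (yes e) _ = inj₂ e
    go _ _ (yes refl) = ⊥-elim (clash (∧ʳ (A t w) (A w w) h) (irr sA w))
    go (no a) (no b) (no c) = ⊥-elim (clash (∧ˡ (A t w) (A p w) h) (three-only {X = A t} deg-t tp tq tr (adj≢ sA pq)
        (adj≢ sA pr) q≢r c a b))
  adjacency : ∀ a b → adj H a b ≡ (A (f a) (f b) ∨ (((f a == q) ∧ (f b == r)) ∨ ((f a == r) ∧ (f b == q))))
  adjacency a b = tab 6 (λ a b c d e f → ∼ a ⇛ ∼ b ⇛ ∼ c ⇛ ∼ d ⇛ ⊩ ((f ∧ not a ∧ not c) ∧ not b ∧ not d) ∨ e ⇔ f ∨ e)
      (x == t) (x == p) (y == t) (y == p) (pair q r x y) (A x y) (≢⇒== (proj₁ (avoid a))) (≢⇒== (proj₂ (avoid a)))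
      (≢⇒== (proj₁ (avoid b))) (≢⇒== (proj₂ (avoid b)))
    where
    x y : Fin (suc (suc m))
    x = f a
    y = f b

-- Enlarging a block by circuits up to a last ear

data Outcome {n : ℕ} (A : ES n) : Set where
  deletable : ∀ a b → A a b ≡ true → Block (A ⊖ (a , b)) full → Outcome A
  circuit : Circ A full A → Outcome A
  package : ∀ U → Relative A U → Attached A U → Block (inn A U) U → Outcome A

module Exhaust {n : ℕ} {A : ES n} (sA : Simple A) (linked : Linked A) (alive : ∀ v → ∃[ w ] A v w ≡ true) where

  ⊖-keeps : ∀ {F : ES n} → Simple F → F ⊆ₑ A → ∀ {c d} → F c d ≡ false → F ⊆ₑ A ⊖ (c , d)
  ⊖-keeps {F} sF F⊆A {c} {d} Fcd i j p = tab 3 (λ a b c → ! a ⇛ ! b ⇛ c ⊃ not b ⇛ ⊩ ! (a ∧ not c)) (A i j) (F i j)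
      (pair c d i j) (F⊆A i j p) p (pair-∉ sF Fcd i j)

  -- The situation when `U` and one circuit cover all vertices and the circuit contains every edge
  -- not inside `U`: its bounds on sets outside `U` are then bounds for the whole graph.
  module Covered {U X : VS n} {F : ES n} (c : Circ A X F) (cover : ∀ i → U i ∨ X i ≡ true) {a b w : Fin n}
      (Fab : F a b ≡ true) (Ua : U a ≡ true) (Ub : U b ≡ true)
      (Xw : X w ≡ true) (Uw : U w ≡ false) (all : ∀ i j → A i j ≡ true → U i ∧ U j ≡ false → F i j ≡ true) where
    open Circ c
    Xa : X a ≡ true
    Xa = within a b Fab
    ∁U⊆X : ∁ U ⊆ X
    ∁U⊆X i p = tab 2 (λ a b → ! (not a) ⇛ ! (a ∨ b) ⇛ ⊩ ! b) (U i) (X i) p (cover i)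
    all-inc : ∀ S → S ⊆ ∁ U → inc A S ⊆ₑ F
    all-inc S S⊆ i j p = all i j (∧ˡ (A i j) ((S i) ∨ (S j)) p)
        (tab 5 (λ a b c d e → ! (c ∧ (b ∨ a)) ⇛ b ⊃ not d ⇛ a ⊃ not e ⇛ ⊩ ∼ (d ∧ e)) (S j) (S i) (A i j) (U i) (U j) p
        (S⊆ i) (S⊆ j))
    avoids : ∀ {S} → S ⊆ ∁ U → ∀ {x} → U x ≡ true → S x ≡ false
    avoids {S} S⊆ {x} Ux = tab 2 (λ a b → a ⊃ not b ⇛ ! b ⇛ ⊩ ∼ a) (S x) (U x) (S⊆ x) Ux

    many : ∀ S → S ⊆ ∁ U → NE S → 2 * ∣ S ∣ + 1 ≤ tch A S
    many S S⊆ ne = ≤-trans (circ-tch c S (λ i p → ∁U⊆X i (S⊆ i p)) ne Xa (avoids S⊆ Ua))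
      (ec-⊆ {E = inc F S} {inc A S} (λ i j p → tab 4 (λ a b c d → ! (c ∧ (b ∨ a)) ⇛ c ⊃ d ⇛ ⊩ ! (d ∧ (b ∨ a))) (S j)
          (S i) (F i j) (A i j) p (⊆E i j)))

    sparse′ : ∀ Y → Y ⊆ ∁ U → NE Y → ins A Y + 2 ≤ 2 * ∣ Y ∣
    sparse′ Y Y⊆ ne = ≤-trans (+-monoˡ-≤ 2 (ec-⊆ {E = inn A Y} {inn F Y}
        (λ i j p → tab 4 (λ a b c d → ! (c ∧ b ∧ a) ⇛ ! d ⇛ ⊩ ! (d ∧ b ∧ a)) (Y j) (Y i) (A i j) (F i j) p
        (all-inc Y Y⊆ i j (tab 3 (λ a b c → ! (c ∧ b ∧ a) ⇛ ⊩ ! (c ∧ (b ∨ a))) (Y j) (Y i) (A i j) p)))))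
      (sparse Y (λ i p → ∁U⊆X i (Y⊆ i p)) ne Xa (avoids Y⊆ Ua))

    -- If all edges leaving ∁ U end in u, then F splits at u into two sparse parts.
    two-attachments : ∀ {u} → X u ≡ true → U u ≡ true → (∀ i j → A i j ∧ ((U i ∧ not (U j)) ∧ not (i == u)) ≡ false) → ⊥
    two-attachments {u} Xu Uu none = lin 8 (λ a b c d e f g h → a ⊹ 1 ≑ 2 ⊗ b ⇛ 2 ⊠ b ≑ c ⊕ d ⇛ 2 ⊠ e ≼ d ⇛ f ⊹ 2 ≼ 2 ⊗
        c ⇛ g ⊹ 2 ≼ 2 ⊗ h ⇛ 2 ⊠ h ≐ 𝕤 e ⇛ a ≼ f ⊕ g ⇛ ⊢⊥) (ec F) (∣ X ∣) (∣ X ∩ U ∣) (∣ X ∖ U ∣) (∣ ∁ U ∣)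
        (ins F (X ∩ U)) (ins F Y) (∣ Y ∣) size (∣∩∣+∣∖∣ X U) (cnt≤ {X = ∁ U} {X ∖ U} (λ i p → ∁U⊆X i p & p))
        (sparse (X ∩ U) (λ i p → ∧ˡ (X i) (U i) p) (a , Xa & Ua) Xw (tab 2 (λ a b → ∼ a ⇛ ⊩ ∼ (b ∧ a)) (U w) (X w) Uw))
        (missing (a ≟ u)) (cnt-add (∁ U) {u} (cong not Uu))
        (ec12≤ F (inn F (X ∩ U)) (inn F Y) (λ i j → tab 10 (λ a b c d e f g h i j → a ⊃ b ⇛ a ⊃ c ⇛ a ⊃ d ⇛ e ⊃ f ⇛ a ⇔
        e ⇛ ∼ (d ∧ (i ∧ not h) ∧ not g) ⇛ ∼ (f ∧ (h ∧ not i) ∧ not j) ⇛ ⊩ 𝟙 a ≦ 𝟙 (a ∧ (b ∧ i) ∧ c ∧ h) + 𝟙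
        (a ∧ (not i ∨ g) ∧ (not h ∨ j))) (F i j) (X i) (X j) (A i j) (F j i) (A j i) (i == u) (U j) (U i) (j == u)
        (within i j) (within₂ i j) (⊆E i j) (⊆E j i) (symm simpleᶜ i j) (none i j) (none j i)))
      where
      Y : VS n
      Y = ∁ U ∪ ⟨ u ⟩
      Y⊆X : Y ⊆ X
      Y⊆X i p = tab 3 (λ a b c → ! (not b ∨ a) ⇛ not b ⊃ c ⇛ a ⊃ c ⇛ ⊩ ! c) (i == u) (U i) (X i) p (∁U⊆X i) (at X Xu i)
      other : ∀ {z} → X z ≡ true → U z ≡ true → z ≢ u → ins F Y + 2 ≤ 2 * ∣ Y ∣
      other {z} Xz Uz z≢u = sparse Y Y⊆X (w , (tab 2 (λ a b → ∼ a ⇛ ⊩ ! (not a ∨ b)) (U w) (w == u) Uw)) Xz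
          (tab 2 (λ a b → ! a ⇛ ∼ b ⇛ ⊩ ∼ (not a ∨ b)) (U z) (z == u) Uz (≢⇒== z≢u))
      missing : Dec (a ≡ u) → ins F Y + 2 ≤ 2 * ∣ Y ∣
      missing (no e) = other Xa Ua e
      missing (yes e) = other (within₂ a b Fab) Ub (λ f → adj≢ simpleᶜ Fab (trans e (sym f)))

    attached : Attached A U
    attached = first (edge? (λ i j → A i j ∧ ((U i ∧ not (U j)) ∧ not (i == a))))
      where
      second : ∀ {u v} → A u v ≡ true → U u ≡ true → U v ≡ false → Edge?
          (λ i j → A i j ∧ ((U i ∧ not (U j)) ∧ not (i == u))) → Attached A U
      second {u} {v} uv Uu Uv (inj₁ (i , j , p)) = u , i , v , j ,
          (λ e → ==-≢ (not-elim (∧ʳ ((U i) ∧ not (U j)) (not (i == u)) (∧ʳ (A i j) _ p))) (sym e)) ,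
        (Uu , (∧ˡ (U i) (not (U j)) (∧ˡ _ _ (∧ʳ (A i j) _ p)))) ,
            (Uv , (not-elim (∧ʳ (U i) (not (U j)) (∧ˡ _ _ (∧ʳ (A i j) _ p))))) ,
        (uv , (∧ˡ (A i j) (((U i) ∧ not (U j)) ∧ not (i == u)) p))
      second {u} {v} uv Uu Uv (inj₂ none) = ⊥-elim (two-attachments
          (within u v (all u v uv (tab 2 (λ a b → ∼ a ⇛ ⊩ ∼ (b ∧ a)) (U v) (U u) Uv))) Uu none)
      first : Edge? (λ i j → A i j ∧ ((U i ∧ not (U j)) ∧ not (i == a))) → Attached A U
      first (inj₁ (i , j , p)) = second {i} {j} (∧ˡ (A i j) (((U i) ∧ not (U j)) ∧ not (i == a)) p)
          (∧ˡ (U i) (not (U j)) (∧ˡ _ _ (∧ʳ (A i j) _ p)))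
        (not-elim (∧ʳ (U i) (not (U j)) (∧ˡ _ _ (∧ʳ (A i j) _ p))))
            (edge? (λ x y → A x y ∧ ((U x ∧ not (U y)) ∧ not (x == i))))
      first (inj₂ none) = ⊥-elim (two-attachments Xa Ua none)

    relative : tch A (∁ U) ≤ 2 * ∣ ∁ U ∣ + 1 → Relative A U
    relative le = record { simpleʳ = sA ; many = many ; sparse = sparse′ ; total = ≤-antisym le
        (many (∁ U) (λ _ p → p) (w , not-intro Uw)) }

    -- With a surplus of two touching edges, the basis of `U` extends without `wz` and still leaves
    -- a spare edge. Its fundamental circuit avoids `wz`, and it has an edge inside `U`, for
    -- otherwise it would be a proper part of the circuit `F`.
    second-circuit : Block (inn A U) U → 2 * ∣ ∁ U ∣ + 1 < tch A (∁ U) → ∀ {z} → A w z ≡ true →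
      ∃[ X₂ ] ∃[ F₂ ] (Circ A X₂ F₂ × NE (X₂ ∖ U) × F₂ w z ≡ false × ∃[ x ] ∃[ y ] (F₂ x y ≡ true × inn A U x y ≡ true))
    second-circuit blk large {z} wz = start (extend tight (λ i p → cong not p)
        (fan-without {U = U} sA (λ i j _ → tab 1 (λ a → ⊩ ! (a ∨ not a)) (U i)) many sparse′ wz))
      where
      open Block blk using (basis; tight; basis⊆)
      L : ES n
      L = inc A (∁ U) ⊖ (w , z)
      Goal : Set
      Goal = ∃[ X₂ ] ∃[ F₂ ] (Circ A X₂ F₂ × NE (X₂ ∖ U) × F₂ w z ≡ false × ∃[ x ] ∃[ y ]
          (F₂ x y ≡ true × inn A U x y ≡ true))
      ∣L∣ : tch A (∁ U) ≡ suc (ec L)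
      ∣L∣ = ec-rem (inc-simple sA (∁ U)) {w} {z} (tab 3 (λ a b c → ! a ⇛ ∼ b ⇛ ⊩ ! (a ∧ (not b ∨ not c))) (A w z) (U w)
          (U z) wz Uw)
      start : ∃[ K ] (K ⊆ₑ L × Tight (basis ∪ₑ K) (U ∪ ∁ U) × ec K ≡ 2 * ∣ ∁ U ∣) → Goal
      start (K , K⊆L , t , ∣K∣) = spare (edge? (λ i j → L i j ∧ not (K i j)))
        where
        spare : Edge? (λ i j → L i j ∧ not (K i j)) → Goal
        spare (inj₂ none) = ⊥-elim (lin 4 (λ a b c d → a ≐ 𝕤 b ⇛ c ≐ 2 ⊗ d ⇛ 𝕤 ((2 ⊗ d) ⊹ 1) ≼ a ⇛ b ≼ c ⇛ ⊢⊥)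
            (tch A (∁ U)) (ec L) (ec K) (∣ ∁ U ∣) ∣L∣ ∣K∣ large
            (ec-⊆ {E = L} {K} (λ i j p → tab 2 (λ a b → ! a ⇛ ∼ (a ∧ not b) ⇛ ⊩ ! b) (L i j) (K i j) p (none i j))))
        spare (inj₁ (g , h , p)) = close (fundamental t (everywhere′ g) (everywhere′ h) (adj≢ sA gh) J∌)
          where
          everywhere′ : ∀ i → (U ∪ ∁ U) i ≡ true
          everywhere′ i = tab 1 (λ a → ⊩ ! (a ∨ not a)) (U i)
          Lgh : L g h ≡ true
          Lgh = ∧ˡ (L g h) (not (K g h)) p
          gh : A g h ≡ true
          gh = ∧ˡ (A g h) (not (U g) ∨ not (U h)) (∧ˡ _ _ Lgh)
          J∌ : basis g h ∨ K g h ≡ false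
          J∌ = tab 7 (λ a b c d e f g → ! (b ∧ not a) ⇛ ! ((f ∧ (not e ∨ not d)) ∧ not c) ⇛ g ⊃ f ∧ e ∧ d ⇛ ⊩ ∼ (g ∨ a))
              (K g h) (L g h) (pair w z g h) (U h) (U g) (A g h) (basis g h) p Lgh (basis⊆ g h)
          close : ∃[ X₂ ] ∃[ F₂ ] (Circ ((basis ∪ₑ K) ⊞ (g , h)) X₂ F₂ × F₂ g h ≡ true) → Goal
          close (X₂ , F₂ , c₂ , F₂gh) = finish (edge? (λ i j → F₂ i j ∧ inn A U i j))
            where
            module C₂ = Circ c₂
            Lsym : Simple L
            Lsym = ⊖-simple (inc-simple sA (∁ U)) (w , z)
            F₂⊆ : ∀ i j → F₂ i j ≡ true → inn A U i j ∨ L i j ≡ true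
            F₂⊆ i j q = tab 5 (λ a b c d e → ! ((c ∨ b) ∨ a) ⇛ c ⊃ d ⇛ b ⊃ e ⇛ a ⊃ e ⇛ ⊩ ! (d ∨ e)) (pair g h i j)
                (K i j) (basis i j) (inn A U i j) (L i j) (C₂.⊆E i j q) (basis⊆ i j) (K⊆L i j) (pair-⊆ Lsym Lgh i j)
            F₂⊆A : F₂ ⊆ₑ A
            F₂⊆A i j q = tab 4 (λ a b c d → ! ((d ∧ c ∧ b) ∨ ((d ∧ (not c ∨ not b)) ∧ not a)) ⇛ ⊩ ! d) (pair w z i j)
                (U j) (U i) (A i j) (F₂⊆ i j q)
            F₂wz : F₂ w z ≡ false
            F₂wz = tab 5 (λ a b c d e → a ⊃ (e ∧ d ∧ c) ∨ ((e ∧ (not d ∨ not c)) ∧ not b) ⇛ ∼ d ⇛ ! b ⇛ ⊩ ∼ a) (F₂ w z)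
                (pair w z w z) (U z) (U w) (A w z) (F₂⊆ w z) Uw (pair-self w z)
            outside : Decided (U g) → NE (X₂ ∖ U)
            outside (inj₂ Ug) = g , C₂.within g h F₂gh & not-intro Ug
            outside (inj₁ Ug) = h , C₂.within₂ g h F₂gh & (tab 4 (λ a b c d → ! a ⇛ ! ((d ∧ (not a ∨ not c)) ∧ not b) ⇛
                ⊩ ! (not c)) (U g) (pair w z g h) (U h) (A g h) Ug Lgh)
            finish : Edge? (λ x y → F₂ x y ∧ inn A U x y) → Goal
            finish (inj₁ (x , y , q)) = X₂ , F₂ , circ-mono F₂⊆A (circ-in-self c₂) , outside (bool (U g)) , F₂wz , x , y
                ,
              (∧ˡ (F₂ x y) (inn A U x y) q) , (∧ʳ (F₂ x y) (inn A U x y) q)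
            finish (inj₂ none) = ⊥-elim (circ-⊄ c c₂ (λ i j q → all i j (F₂⊆A i j q)
                (tab 4 (λ a b c d → ∼ (d ∧ c ∧ b ∧ a) ⇛ ! d ⇛ ! c ⇛ ⊩ ∼ (b ∧ a)) (U j) (U i) (A i j) (F₂ i j) (none i j)
                q (F₂⊆A i j q)))
              (all w z wz (tab 2 (λ a b → ∼ a ⇛ ⊩ ∼ (a ∧ b)) (U w) (U z) Uw)) F₂wz)

  -- The block on `U` and the circuit share an edge and cover all vertices without using `cd`, so
  -- `join` gives a block after the deletion.
  delete-outside : ∀ {U X F} → Block (inn A U) U → Circ A X F → (∀ i → U i ∨ X i ≡ true) → ∀ {x y} → F x y ≡ true → inn
      A U x y ≡ true →
    ∀ {c d} → A c d ≡ true → U c ∧ U d ≡ false → F c d ≡ false → Outcome A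
  delete-outside {U} {X} {F} blk circ cover {x} {y} Fxy Uxy {c} {d} cd Ucd Fcd = deletable c d cd (block≗ cover
    (join blk circ Uxy Fxy (⊖-simple sA (c , d)) (⊖-keeps (inn-simple sA U) (λ i j p → ∧ˡ (A i j) ((U i) ∧ (U j)) p) {c}
        {d} (tab 3 (λ a b c → ∼ (b ∧ a) ⇛ ⊩ ∼ (c ∧ b ∧ a)) (U d) (U c) (A c d) Ucd))
      (⊖-keeps (Circ.simpleᶜ circ) (Circ.⊆E circ) Fcd) (λ i _ _ → cover i)))

  -- A circuit through an outer edge `wz` either leaves vertices uncovered, and `U` grows, or covers
  -- the rest. Then an outer edge it does not use is deletable; or the outer edges have the right
  -- number; or `second-circuit` avoids `wz`, which makes `U` grow after all or makes `wz`
  -- deletable. `k` bounds the number of vertices outside `U`.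
  enlarge : ∀ k U → ∣ ∁ U ∣ ≤ k → Block (inn A U) U → ∀ {a b} → inn A U a b ≡ true → NE (∁ U) → Outcome A
  enlarge zero U le blk ab (w , Uw) = ⊥-elim (1≰0 (≤-trans (cnt-pos {X = ∁ U} Uw) le))
  enlarge (suc k) U le blk {a} {b} Uab (w , w∉) = first (alive w)
    where
    Uw : U w ≡ false
    Uw = not-elim w∉
    ab : A a b ≡ true
    ab = ∧ˡ (A a b) ((U a) ∧ (U b)) Uab
    advance : ∀ {X F} → Circ A X F → NE (X ∖ U) → ∀ {x y} → F x y ≡ true → inn A U x y ≡ true
        → ((∀ i → U i ∨ X i ≡ true) → Outcome A) → NE (∁ (U ∪ X)) ⊎ (∀ i → ∁ (U ∪ X) i ≡ false) → Outcome A
    advance c (v , p) Fxy Uxy covered (inj₂ none) = covered (λ i → not-elim′ (none i))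
      where
      not-elim′ : ∀ {b} → not b ≡ false → b ≡ true
      not-elim′ {true} _ = refl
    advance {X} {F} c (v , p) {x} {y} Fxy Uxy covered (inj₁ ne) = enlarge k (U ∪ X)
      (≤-pred (≤-trans (subst (_≤ ∣ ∁ U ∣) (cnt-add (∁ (U ∪ X)) {v} (tab 2 (λ a b → ! (b ∧ not a) ⇛ ⊩ ∼ (not (a ∨ b)))
          (U v) (X v) p))
        (cnt≤ {X = ∁ (U ∪ X) ∪ ⟨ v ⟩} {∁ U} (λ i q → tab 3 (λ a b c → ! (not (c ∨ b) ∨ a) ⇛ a ⊃ not c ⇛ ⊩ ! (not c))
            (i == v) (X i) (U i) q (at (∁ U) (∧ʳ (X v) (not (U v)) p) i)))) le))
      (join blk c Uxy Fxy (inn-simple sA (U ∪ X)) (λ i j q → tab 5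
          (λ a b c d e → ! (c ∧ b ∧ a) ⇛ ⊩ ! (c ∧ (b ∨ e) ∧ (a ∨ d))) (U j) (U i) (A i j) (X j) (X i) q)
        (λ i j q → tab 5 (λ a b c d e → ! a ⇛ ! b ⇛ ! c ⇛ ⊩ ! (a ∧ (e ∨ b) ∧ (d ∨ c))) (A i j) (X i) (X j) (U j) (U i)
            (Circ.⊆E c i j q) (Circ.within c i j q) (Circ.within₂ c i j q))
        (λ i j q → ∧ˡ ((U i) ∨ (X i)) ((U j) ∨ (X j)) (∧ʳ (A i j) _ q)))
      {x} {y} (tab 5 (λ a b c d e → ! (c ∧ b ∧ a) ⇛ ⊩ ! (c ∧ (b ∨ e) ∧ (a ∨ d))) (U y) (U x) (A x y) (X y) (X x) Uxy) ne
    first : ∃[ z ] A w z ≡ true → Outcome A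
    first (z , wz) = go (linked wz ab)
      where
      Uwz : U w ∧ U z ≡ false
      Uwz = cong (_∧ U z) Uw
      go : Through A w z a b → Outcome A
      go (X , F , c , Fwz , Fab) = advance c (w , Xw & w∉) Fab Uab covered (empty? (∁ (U ∪ X)))
        where
        Xw : X w ≡ true
        Xw = Circ.within c w z Fwz
        covered : (∀ i → U i ∨ X i ≡ true) → Outcome A
        covered cover = unused (edge? (λ i j → A i j ∧ (not (U i ∧ U j) ∧ not (F i j))))
          where
          unused : Edge? (λ i j → A i j ∧ (not (U i ∧ U j) ∧ not (F i j))) → Outcome A
          unused (inj₁ (i , j , p)) = delete-outside blk c cover Fab Uab {i} {j}
              (∧ˡ (A i j) (not ((U i) ∧ (U j)) ∧ not (F i j)) p)
            (not-elim (∧ˡ (not ((U i) ∧ (U j))) (not (F i j)) (∧ʳ (A i j) _ p)))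
                (not-elim (∧ʳ (not ((U i) ∧ (U j))) (not (F i j)) (∧ʳ (A i j) _ p)))
          unused (inj₂ none) = compare (tch A (∁ U) ≤? 2 * ∣ ∁ U ∣ + 1)
            where
            module C = Covered {U} {X} {F} c cover {a} {b} {w} Fab (∧ˡ (U a) (U b) (∧ʳ (A a b) _ Uab))
                (∧ʳ (U a) (U b) (∧ʳ (A a b) _ Uab)) Xw Uw
              (λ i j p q → tab 4 (λ a b c d → ! a ⇛ ∼ (c ∧ b) ⇛ ∼ (a ∧ not (c ∧ b) ∧ not d) ⇛ ⊩ ! d) (A i j) (U j) (U i)
                  (F i j) p q (none i j))
            compare : Dec (tch A (∁ U) ≤ 2 * ∣ ∁ U ∣ + 1) → Outcome A
            compare (yes small) = package U (C.relative small) C.attached blk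
            compare (no large) = again (C.second-circuit blk (≰⇒> large) wz)
              where
              again : ∃[ X₂ ] ∃[ F₂ ] (Circ A X₂ F₂ × NE (X₂ ∖ U) × F₂ w z ≡ false × ∃[ x ] ∃[ y ]
                  (F₂ x y ≡ true × inn A U x y ≡ true)) → Outcome A
              again (X₂ , F₂ , c₂ , ne , F₂wz , x , y , F₂xy , Uxy) = advance c₂ ne F₂xy Uxy
                  (λ cover₂ → delete-outside blk c₂ cover₂ F₂xy Uxy wz Uwz F₂wz) (empty? (∁ (U ∪ X₂)))

  outcome : ∀ {a b} → A a b ≡ true → Outcome A
  outcome {a} {b} ab = go (linked ab ab)
    where
    go : Through A a b a b → Outcome A
    go (X , F , c , Fab , _) = by (empty? (∁ X))
      where
      open Circ c
      blk : Block F X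
      blk = circ-block c Fab
      by : NE (∁ X) ⊎ (∀ i → ∁ X i ≡ false) → Outcome A
      by (inj₁ ne) = enlarge ∣ ∁ X ∣ X ≤-refl (grow blk (inn-simple sA X) (λ i j p → ⊆E i j p & within i j p & within₂ i
          j p) (λ i j p → ∧ˡ (X i) (X j) (∧ʳ (A i j) _ p)) Fab)
        (ab & within a b Fab & within₂ a b Fab) ne
      by (inj₂ none) = unused (edge? (λ i j → A i j ∧ not (F i j)))
        where
        all : ∀ i → X i ≡ true
        all i = tab 1 (λ a → ∼ (not a) ⇛ ⊩ ! a) (X i) (none i)
        unused : Edge? (λ i j → A i j ∧ not (F i j)) → Outcome A
        unused (inj₁ (i , j , p)) = deletable i j (∧ˡ (A i j) (not (F i j)) p)
            (block≗ all (grow blk (⊖-simple sA (i , j))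
          (⊖-keeps simpleᶜ ⊆E {i} {j} (not-elim (∧ʳ (A i j) (not (F i j)) p))) (λ x _ _ → all x) Fab))
        unused (inj₂ every) = circuit (record { simpleᶜ = sA ; ⊆E = λ _ _ p → p ; within = λ _ _ _ → refl
          ; size = trans (cong (_+ 1) (ec≗ same)) (trans size (cong (2 *_) (cnt≗ all)))
          ; sparse = λ Y _ ne {x} _ Yx → subst (λ k → k + 2 ≤ 2 * ∣ Y ∣)
              (ec≗ (λ i j → cong (_∧ (Y i ∧ Y j)) (sym (same i j)))) (sparse Y (λ i _ → all i) ne (all x) Yx) })
          where
          same : ∀ i j → A i j ≡ F i j
          same i j = tab 2 (λ a b → ∼ (b ∧ not a) ⇛ a ⊃ b ⇛ ⊩ b ⇔ a) (F i j) (A i j) (every i j) (⊆E i j)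

-- From blocks to admissible operations

graph : ∀ {n} → ES n → Graph
graph {n} A = record { n = n ; adj = A }

Reducible : Graph → Set
Reducible G = AdmissibleEdgeReduction G ⊎ AdmissibleK4Reduction G ⊎ AdmissibleEdgeDeletion G

reduce-contract : ∀ {m} {A : ES (suc m)} → Simple A → ∀ {v u y} → A v u ≡ true → A v y ≡ true → u ≢ y →
  (∀ z → A v z ≡ true → z ≢ u → z ≢ y → A u z ≡ false) → Block (contract A v u y) (∁ ⟨ v ⟩) → Reducible (graph A)
reduce-contract sA vu vy u≢y far blk = inj₁ (edge-reduction sA vu vy u≢y far (block-good blk
  (≢⇒not (λ e → adj≢ sA vu (sym e))) (≢⇒not (λ e → adj≢ sA vy (sym e))) u≢y))

reduce-diamond : ∀ {m} {A : ES (suc (suc m))} → Simple A → ∀ {t p q r} → A t p ≡ true → ∣ A t ∣ ≡ 3 → ∣ A p ∣ ≡ 3 → q ≢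
    r → A t q ≡ true → A t r ≡ true → A p q ≡ true → A p r ≡ true → A q r ≡ false →
  Block (replace A t p q r) (∁ ⟨ t ⟩ ∩ ∁ ⟨ p ⟩) → Reducible (graph A)
reduce-diamond {A = A} sA {t} {p} {q} {r} tp dt dp q≢r tq tr pq pr qr blk = inj₂
    (inj₁ (K₄⁻-reduction sA tp dt dp q≢r tq tr pq pr qr
  (block-good blk {q} {r} (off tq & off pq) (off tr & off pr) q≢r)))
  where
  off : ∀ {a b} → A a b ≡ true → not (b == a) ≡ true
  off e = ≢⇒not (λ f → adj≢ sA e (sym f))

reduce-delete : ∀ {n} {A : ES n} {a b} → A a b ≡ true → Good (A ⊖ (a , b)) full → Reducible (graph A)
reduce-delete {a = a} {b} ab good = inj₂ (inj₂ (a , b , ab , good⇒connected good (λ _ → refl)))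

delete-good : ∀ {n} {A : ES n} → Simple A → (∀ v → 3 ≤ ∣ A v ∣) → ∀ {a b} → A a b ≡ true → Linked (A ⊖ (a , b)) → Good
    (A ⊖ (a , b)) full
delete-good {n} {A} sA deg {a} {b} ab link = record { simpleᶢ = ⊖-simple sA (a , b) ; within = λ _ _ _ → refl ; alive
    = λ v _ → first v (pos⇒NE (A v) (≤-trans (s≤s z≤n) (deg v)))
  ; big = lin 4 (λ a b c d → a ≐ 𝕤 b ⇛ c ≑ d ⇛ κ 3 ≼ d ⇛ c ≼ a ⇛ 1 ⊢ κ 2 ≼ b) (ec A) (ec (A ⊖ (a , b))) (tch A ⟨ a ⟩)
      (∣ A a ∣) (ec-rem sA ab) (star A sA a) (deg a) (ec-⊆ {E = inc A ⟨ a ⟩} {A}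
      (λ i j p → ∧ˡ (A i j) ((i == a) ∨ (j == a)) p))
  ; linked = link }
  where
  unique : ∀ {v x y} → pair a b v x ≡ true → pair a b v y ≡ true → x ≡ y
  unique {v} {x} {y} p q = by (pair-elim p) (pair-elim q)
    where
    by : (v ≡ a × x ≡ b) ⊎ (v ≡ b × x ≡ a) → (v ≡ a × y ≡ b) ⊎ (v ≡ b × y ≡ a) → x ≡ y
    by (inj₁ (_ , e)) (inj₁ (_ , f)) = trans e (sym f)
    by (inj₂ (_ , e)) (inj₂ (_ , f)) = trans e (sym f)
    by (inj₁ (e , _)) (inj₂ (f , _)) = ⊥-elim (adj≢ sA ab (trans (sym e) f))
    by (inj₂ (e , _)) (inj₁ (f , _)) = ⊥-elim (adj≢ sA ab (trans (sym f) e))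
  first : ∀ v → NE (A v) → ∃[ w ] (A ⊖ (a , b)) v w ≡ true
  first v (x , vx) = second (pos⇒NE (A v ∖ ⟨ x ⟩) (lin 2 (λ a b → κ 3 ≼ a ⇛ a ≐ 𝕤 b ⇛ 1 ⊢ κ 1 ≼ b) (∣ A v ∣)
      (∣ A v ∖ ⟨ x ⟩ ∣) (deg v) (cnt-rem (A v) vx)))
    where
    second : NE (A v ∖ ⟨ x ⟩) → ∃[ w ] (A ⊖ (a , b)) v w ≡ true
    second (y , p) = by (bool (pair a b v x)) (bool (pair a b v y))
      where
      by : Decided (pair a b v x) → Decided (pair a b v y) → ∃[ w ] (A ⊖ (a , b)) v w ≡ true
      by (inj₂ q) _ = x , vx & not-intro q
      by _ (inj₂ q) = y , (∧ˡ (A v y) (not (y == x)) p) & not-intro q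
      by (inj₁ q) (inj₁ r) = ⊥-elim (==-≢ {i = y} {x} (not-elim (∧ʳ (A v y) (not (y == x)) p))
          (sym (unique {v} {x} {y} q r)))

-- A last ear of cubic vertices only

module CubicComplement {m : ℕ} {A : ES (suc (suc m))} {U : VS (suc (suc m))} (rel : Relative A U) (att : Attached A U)
    (blk : Block (inn A U) U)
    (deg : ∀ v → 3 ≤ ∣ A v ∣) (all-cubic : ∁ U ⊆ cubic A U) where
  open Relative rel
  open RelativeFacts rel
  sA : Simple A
  sA = simpleʳ
  D : VS (suc (suc m))
  D = cubic A U
  Result : Set
  Result = Reducible (graph A)

  D∋ : ∀ {v} → U v ≡ false → D v ≡ true
  D∋ Uv = all-cubic _ (not-intro Uv)

  edge-in-U : ∃[ a ] ∃[ b ] inn A U a b ≡ true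
  edge-in-U = go (ec-edge basis (lin 2 (λ a b → a ⊹ 2 ≑ 2 ⊗ b ⇛ 2 ⊠ κ 2 ≼ b ⇛ 1 ⊢ κ 1 ≼ a) (ec basis) (∣ U ∣)
      (Tight.size tight) (two att)))
    where
    open Block blk
    two : Attached A U → 2 ≤ ∣ U ∣
    two (_ , _ , _ , _ , ne , (Uu , Uv) , _) = cnt-two {X = U} Uu Uv ne
    go : ∃[ a ] ∃[ b ] basis a b ≡ true → ∃[ a ] ∃[ b ] inn A U a b ≡ true
    go (a , b , p) = a , b , basis⊆ a b p

  -- For reductions that remove every vertex outside `U`: the graph inside `U` is a block already,
  -- so additional edges there do no harm and no obstacle has to be examined.
  extend-U : ∀ {E V} → Simple E → inn A U ⊆ₑ E → (∀ i → U i ≡ V i) → (∀ i j → E i j ≡ true → V i ≡ true) → Block E V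
  extend-U sE ⊆E same inside = block≗ same (grow blk sE ⊆E (λ i j p → trans (same i) (inside i j p))
      (proj₂ (proj₂ edge-in-U)))

  -- The last ear is one vertex with three neighbours. Two non-adjacent ones permit a contraction;
  -- otherwise they form a K₄ with `w`, and one of its edges can be rerouted over the claw at `w`.
  module Single {w : Fin (suc (suc m))} (Uw : U w ≡ false) (none : ∀ i → (∁ U ∖ ⟨ w ⟩) i ≡ false) where
    only : ∀ i → U i ≡ not (i == w)
    only i = tab 2 (λ a b → ∼ (not b ∧ not a) ⇛ a ⊃ not b ⇛ ⊩ b ⇔ not a) (i == w) (U i) (none i)
        (at (∁ U) (not-intro Uw) i)

    contract-claw : ∀ {x z y} → Triple (A w) x z y → A x y ≡ false → Result
    contract-claw {x} {z} {y} tri xy = reduce-contract sA vu vy u≢y far (extend-U sA′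
        (λ i j p → tab 6 (λ a b c d e f → ! (c ∧ b ∧ a) ⇛ b ⇔ not d ⇛ a ⇔ not e ⇛ ⊩ ! ((c ∧ not d ∧ not e) ∨ f)) (U j)
            (U i) (A i j) (i == w) (j == w) (spokes A w x z i j) p (only i) (only j)) only
        (λ i j p → tab 7 (λ a b c d e f g → ! ((g ∧ not f ∧ not e) ∨ (d ∧ c) ∨ (b ∧ a)) ⇛ d ⊃ not f ⇛ f ⊃ not a ⇛ ⊩ !
            (not f)) (N i) (j == x) (N j) (i == x) (j == w) (i == w) (A i j) p (at (∁ ⟨ w ⟩) (≢⇒not u≢v) i)
            (at (∁ N) (not-intro Nv) i)))
      where
      open Triple tri
      legal : Legal A U w x z
      legal = Uw , ∈a , ∈b , a≢b , λ v p v≢x v≢z → third (members p) v≢x v≢z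
        where
        third : ∀ {v} → v ≡ x ⊎ v ≡ z ⊎ v ≡ y → v ≢ x → v ≢ z → A x v ≡ false
        third (inj₁ e) f _ = ⊥-elim (f e)
        third (inj₂ (inj₁ e)) _ f = ⊥-elim (f e)
        third (inj₂ (inj₂ refl)) _ _ = xy
      open Contraction rel legal using (vu; vy; u≢y; far; sA′; N; Nv; u≢v)

    result : Result
    result = go (triple (A w) (D-deg (D∋ Uw)))
      where
      go : ∃[ a ] ∃[ b ] ∃[ c ] Triple (A w) a b c → Result
      go (a , b , c , tri) = by (bool (A a b)) (bool (A a c)) (bool (A b c))
        where
        by : Decided (A a b) → Decided (A a c) → Decided (A b c) → Result
        by (inj₂ p) _ _ = contract-claw (triple-swap₂₃ tri) p
        by _ (inj₂ p) _ = contract-claw tri p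
        by _ _ (inj₂ p) = contract-claw (triple-swap₁₂ tri) p
        by (inj₁ ab) (inj₁ ac) (inj₁ _) = reduce-delete ab (delete-good sA deg ab
            (DeleteClaw.linked sA blk only tri ab ac))

  -- Here `w` is a leaf of the forest outside `U`: `k` is its neighbour in the forest, `a` and `b`
  -- are its neighbours in `U`.
  module Leaf {w k a b : Fin (suc (suc m))} (tri : Triple (A w) k a b) (Uw : U w ≡ false) (Uk : U k ≡ false)
      (Ua : U a ≡ true) (Ub : U b ≡ true) where
    open Triple tri
    W′ : VS (suc (suc m))
    W′ = ∁ U ∖ ⟨ w ⟩
    k≢w : k ≢ w
    k≢w e = ≢adj ∈a (sym e)
    W′k : W′ k ≡ true
    W′k = not-intro Uk & ≢⇒not k≢w

    legal : A k b ≡ false → Legal A U w k a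
    legal kb = Uw , ∈a , ∈b , a≢b , λ v p v≢k v≢a → third (members p) v≢k v≢a
      where
      third : ∀ {v} → v ≡ k ⊎ v ≡ a ⊎ v ≡ b → v ≢ k → v ≢ a → A k v ≡ false
      third (inj₁ e) f _ = ⊥-elim (f e)
      third (inj₂ (inj₁ e)) _ f = ⊥-elim (f e)
      third (inj₂ (inj₂ refl)) _ _ = kb

    contract-with : ∀ {y} (legal : Legal A U w k y) (free : ¬ Obstacle A U w k y) → AttachedTo (contract A w k y) U W′
        → Result
    contract-with legal free attached = reduce-contract sA vu vy u≢y far (by-ear attached blk)
      where
      open Contraction rel legal using (vu; vy; u≢y; far; module Unobstructed)
      open Unobstructed free (k , W′k)

    common-one : A k a ≡ true → A k b ≡ false → Result
    common-one ka kb = contract-with (legal kb) free (Contraction.Unobstructed.attached′ rel (legal kb) free (k , W′k)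
        (λ _ → k , Uk , k≢w , flip ka) att)
      where
      free : ¬ Obstacle A U w k a
      free = common-free (D∋ Uw) (D∋ Uk) tri ka

    -- A cotight obstacle would contain `a`, which lies in `U`; a tight one would be a forest with
    -- two or more vertices. Dropping `wa` may cost the attachment at `a`; the moved edge `bk` gives
    -- one at `b`, and `u` must provide another.
    common-none : A k b ≡ false → ∀ {u v} → U u ≡ true → W′ v ≡ true → A u v ≡ true → u ≢ b → Result
    common-none kb {u} {v} Uu W′v uv u≢b = contract-with (legal kb) free
        (b , u , k , v , (≢-sym u≢b) , (Ub , Uu) , (W′k , W′v) , (spoke , Contraction.Unobstructed.keep-edge rel
            (legal kb) free (k , W′k) uv (∈≢∉ {X = U} Uu Uw) (==-≢ (not-elim (∧ʳ (not (U v)) (not (v == w)) W′v)))))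
      where
      free : ¬ Obstacle A U w k a
      free (inj₁ (S , (S⊆ , _) , Sa , _)) = clash Ua (not-elim (S⊆ a Sa))
      free (inj₂ (Y , (Y⊆ , Yt) , Yw , Yk , _)) = lin 2 (λ a b → a ⊹ 1 ≼ b ⇛ a ⊹ 2 ≑ 2 ⊗ b ⇛ κ 2 ≼ b ⇛ ⊢⊥) (ins A Y)
          (∣ Y ∣) (forest Y (λ i p → all-cubic i (Y⊆ i p)) (w , Yw)) Yt (cnt-two {X = Y} Yw Yk (≢-sym k≢w))
      spoke : contract A w k a b k ≡ true
      spoke = tab 6 (λ a b c d e f → ! a ⇛ ! b ⇛ ∼ c ⇛ ∼ d ⇛ ⊩ ! (f ∨ (d ∧ e) ∨ (a ∧ b ∧ not c ∧ not d))) (k == k)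
          (A w b) (b == a) (b == k) (moved A w k a k) (inn A (∁ ⟨ w ⟩) b k) (==-refl k) ∈c (≢⇒== (≢-sym b≢c))
          (≢⇒== (≢-sym a≢c))

    -- Otherwise `wk` is the only edge touching `W′` that is not inside it. Then `tch` is at most
    -- `ins` + 1, incompatible with their sum 3|W′| and `tch` at least 2|W′| + 1.
    no-attachment : (∀ i j → A i j ∧ (U i ∧ W′ j) ≡ false) → ⊥
    no-attachment none = lin 4 (λ a b c d → 2 ⊠ a ⊕ b ≐ 3 ⊗ c ⇛ 3 ⊠ (2 ⊗ c) ⊹ 1 ≼ a ⇛ 2 ⊠ d ≐ κ 1 ⇛ 2 ⊠ a ≼ b ⊕ d ⇛ ⊢⊥)
        (tch A W′) (ins A W′) (∣ W′ ∣) (ec (pair w k)) (degree-sum-const sA W′ 3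
        (λ v p → D-deg (all-cubic v (∧ˡ (not (U v)) (not (v == w)) p))))
        (many W′ (λ i p → ∧ˡ (not (U i)) (not (i == w)) p) (k , W′k)) (ec-pair (≢adj ∈a))
        (ec12≤ (inc A W′) (inn A W′) (pair w k) (λ i j → tab 8 (λ a b c d e f g h → ∼ (d ∧ c ∧ not b ∧ not a) ⇛ ∼
        (f ∧ b ∧ not c ∧ not e) ⇛ d ⇔ f ⇛ d ∧ e ∧ not b ⊃ g ⇛ f ∧ a ∧ not c ⊃ h ⇛ ⊩ 𝟙
        (d ∧ ((not c ∧ not e) ∨ (not b ∧ not a))) ≦ 𝟙 (d ∧ (not c ∧ not e) ∧ not b ∧ not a) + 𝟙 ((e ∧ g) ∨ (h ∧ a)))
        (j == w) (U j) (U i) (A i j) (i == w) (A j i) (j == k) (i == k) (none i j) (none j i) (symm sA i j) (toward i j)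
        (toward j i)))
      where
      toward : ∀ i j → A i j ∧ ((i == w) ∧ not (U j)) ≡ true → (j == k) ≡ true
      toward i j p = by (members (trans (cong (λ z → A z j)
          (sym (==⇒≡ {i = i} (∧ˡ (i == w) (not (U j)) (∧ʳ (A i j) _ p))))) (∧ˡ (A i j) ((i == w) ∧ not (U j)) p)))
        where
        Uj : U j ≡ false
        Uj = not-elim (∧ʳ (i == w) (not (U j)) (∧ʳ (A i j) _ p))
        by : j ≡ k ⊎ j ≡ a ⊎ j ≡ b → (j == k) ≡ true
        by (inj₁ e) = trans (cong (_== k) e) (==-refl k)
        by (inj₂ (inj₁ e)) = ⊥-elim (clash (trans (cong U e) Ua) Uj)
        by (inj₂ (inj₂ e)) = ⊥-elim (clash (trans (cong U e) Ub) Uj)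

    -- The five edges at `w` and `k` use up so much of the total that no other vertex is left
    -- outside `U`. The choice between deletion and K₄⁻-reduction depends on `ab` being an edge.
    module CommonTwo (ka : A k a ≡ true) (kb : A k b ≡ true) where
      trik : Triple (A k) w a b
      trik = triple-of (D-deg (D∋ Uk)) (flip ∈a) ka kb (≢adj ∈b) (≢adj ∈c) b≢c
      rest : VS (suc (suc m))
      rest = W′ ∖ ⟨ k ⟩
      nothing-else : ∀ i → rest i ≡ false
      nothing-else = go (empty? rest)
        where
        go : Empty? rest → ∀ i → rest i ≡ false
        go (inj₂ none) = none
        go (inj₁ ne) = ⊥-elim (lin 8 (λ a b c d e f g h → a ≐ (2 ⊗ b) ⊹ 1 ⇛ a ≑ c ⊕ d ⇛ c ≑ e ⊕ f ⇛ 2 ⊠ b ≐ 𝕤 g ⇛ 2 ⊠ g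
            ≐ 𝕤 h ⇛ (2 ⊗ h) ⊹ 1 ≼ e ⇛ κ 2 ≼ d ⇛ κ 3 ≼ f ⇛ ⊢⊥) (tch A (∁ U)) (∣ ∁ U ∣) (tch A W′) (dg A w (∁ (∁ U)))
            (tch A rest) (dg A k (∁ W′)) (∣ W′ ∣) (∣ rest ∣) total (tch-rem sA (∁ U) (not-intro Uw)) (tch-rem sA W′ W′k)
            (cnt-rem (∁ U) (not-intro Uw)) (cnt-rem W′ W′k) (many rest
            (λ i p → ∧ˡ (not (U i)) (not (i == w)) (∧ˡ _ _ p)) ne)
            (cnt-two {X = A w ∩ ∁ (∁ U)} {a} {b} (∈b & cong (λ z → not (not z)) Ua) (∈c & cong (λ z → not (not z)) Ub)
            b≢c) (cnt-three {X = A k ∩ ∁ W′} {w} {a} {b} (flip ∈a & not-intro (∉∖ (∁ U) w))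
            (ka & (tab 2 (λ a b → ! a ⇛ ⊩ ! (not (not a ∧ not b))) (U a) (a == w) Ua))
            (kb & (tab 2 (λ a b → ! a ⇛ ⊩ ! (not (not a ∧ not b))) (U b) (b == w) Ub)) (≢adj ∈b) (≢adj ∈c) b≢c))
      only : ∀ i → U i ≡ not ((i == w) ∨ (i == k))
      only i = tab 3 (λ a b c → ∼ ((not c ∧ not b) ∧ not a) ⇛ b ⊃ not c ⇛ a ⊃ not c ⇛ ⊩ c ⇔ not (b ∨ a)) (i == k)
          (i == w) (U i) (nothing-else i) (at (∁ U) (not-intro Uw) i) (at (∁ U) (not-intro Uk) i)
      result : Decided (A a b) → Result
      result (inj₁ ab) = reduce-delete ab (delete-good sA deg ab (DeleteDiamond.linked sA blk only tri trik ab))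
      result (inj₂ ab) = reduce-diamond sA ∈a (D-deg (D∋ Uw)) (D-deg (D∋ Uk)) b≢c ∈b ∈c ka kb ab (extend-U
          (∪ₑ-simple (inn-simple (inn-simple sA (∁ ⟨ w ⟩)) (∁ ⟨ k ⟩)) (pair-simple b≢c))
          (λ i j p → tab 8 (λ a b c d e f g h → ! (c ∧ b ∧ a) ⇛ b ⇔ not (e ∨ d) ⇛ a ⇔ not (g ∨ f) ⇛ ⊩ !
              (((c ∧ not e ∧ not g) ∧ not d ∧ not f) ∨ h)) (U j) (U i) (A i j) (i == k) (i == w) (j == k) (j == w)
              (pair a b i j) p (only i) (only j))
          (λ i → tab 3 (λ a b c → a ⇔ not (c ∨ b) ⇛ ⊩ a ⇔ not c ∧ not b) (U i) (i == k) (i == w) (only i))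
          (λ i j p → tab 8 (λ a b c d e f g h → ! (((f ∧ not e ∧ not d) ∧ not c ∧ not b) ∨ a) ⇛ g ⇔ not (e ∨ c) ⇛ a ⊃ g
              ∧ h ⇛ ⊩ ! (not e ∧ not c)) (pair a b i j) (j == k) (i == k) (j == w) (i == w) (A i j) (U i) (U j) p
              (only i) (pair-apart (λ i j → U i ∧ U j) (λ i j → 𝔹.∧-comm (U i) (U j)) (Ua & Ub) i j)))

  leaf : ∀ {w k a b} → Triple (A w) k a b → U w ≡ false → U k ≡ false → U a ≡ true → U b ≡ true → Result
  leaf {w} {k} {a} {b} tri Uw Uk Ua Ub = by (bool (A k a)) (bool (A k b))
    where
    module L = Leaf tri Uw Uk Ua Ub
    module L′ = Leaf (triple-swap₂₃ tri) Uw Uk Ub Ua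
    by : Decided (A k a) → Decided (A k b) → Result
    by (inj₁ ka) (inj₁ kb) = L.CommonTwo.result ka kb (bool (A a b))
    by (inj₁ ka) (inj₂ kb) = L.common-one ka kb
    by (inj₂ ka) (inj₁ kb) = L′.common-one kb ka
    by (inj₂ ka) (inj₂ kb) = some (edge? (λ i j → A i j ∧ (U i ∧ L.W′ j)))
      where
      some : Edge? (λ i j → A i j ∧ (U i ∧ L.W′ j)) → Result
      some (inj₂ none) = ⊥-elim (L.no-attachment none)
      some (inj₁ (i , j , p)) = pick (i ≟ b)
        where
        ij : A i j ≡ true
        ij = ∧ˡ (A i j) ((U i) ∧ (L.W′ j)) p
        Ui : U i ≡ true
        Ui = ∧ˡ (U i) (L.W′ j) (∧ʳ (A i j) _ p)
        W′j : L.W′ j ≡ true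
        W′j = ∧ʳ (U i) (L.W′ j) (∧ʳ (A i j) _ p)
        pick : Dec (i ≡ b) → Result
        pick (no i≢b) = L.common-none kb Ui W′j ij i≢b
        pick (yes i≡b) = L′.common-none ka Ui W′j ij (λ e → Triple.b≢c tri (trans (sym e) i≡b))

  -- Otherwise the cubic vertices outside U would span at least |∁ U| edges.
  two-inside : ∃[ w ] (U w ≡ false × 2 ≤ dg A w U)
  two-inside = go (any? (λ w → (U w 𝔹.≟ false) ×-dec (2 ≤? dg A w U)))
    where
    E : ES (suc (suc m))
    E = inn A (∁ U)
    witness : Attached A U → NE (∁ U)
    witness (_ , _ , w , _ , _ , _ , (Uw , _) , _) = w , not-intro Uw
    go : Dec (∃[ w ] (U w ≡ false × 2 ≤ dg A w U)) → ∃[ w ] (U w ≡ false × 2 ≤ dg A w U)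
    go (yes found) = found
    go (no none) = ⊥-elim (lin 5 (λ a b c d e → 2 ⊠ a ⊹ 1 ≼ b ⇛ c ⊕ d ≑ e ⇛ 2 ⊗ b ≼ e ⇛ c ≼ a ⇛ d ≼ a ⇛ ⊢⊥)
        (ins A (∁ U)) (∣ ∁ U ∣) (tch E (∁ U)) (ins E (∁ U)) total-degree (forest (∁ U) all-cubic (witness att))
        (degree-sum (inn-simple sA (∁ U)) (∁ U)) lower (ec-⊆ {E = inc E (∁ U)} {E}
        (λ i j p → ∧ˡ (E i j) (not (U i) ∨ not (U j)) p)) (ins≤ec E (∁ U)))
      where
      total-degree : ℕ
      total-degree = sumFin (λ v → if ∁ U v then ∣ E v ∣ else 0)
      lower : 2 * ∣ ∁ U ∣ ≤ total-degree
      lower = subst (_≤ total-degree) (sum-const 2 (∁ U)) (sum-mono (λ v → step v (bool (U v))))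
        where
        step : ∀ v → Decided (U v) → (if ∁ U v then 2 else 0) ≤ (if ∁ U v then ∣ E v ∣ else 0)
        step v (inj₁ p) = subst (λ z → (if not z then 2 else 0) ≤ (if not z then ∣ E v ∣ else 0)) (sym p) z≤n
        step v (inj₂ p) = subst (λ z → (if not z then 2 else 0) ≤ (if not z then ∣ E v ∣ else 0)) (sym p)
          (lin 4 (λ a b c d → a ≑ κ 3 ⇛ a ≐ b ⊕ c ⇛ 𝕤 b ≼ κ 2 ⇛ c ≼ d ⇛ 1 ⊢ κ 2 ≼ d) (∣ A v ∣) (dg A v U) (dg A v (∁ U))
              (∣ E v ∣) (D-deg (D∋ p)) (dg-∁ A v U) (≰⇒> (λ h → none (v , p , h)))
              (cnt≤ {X = A v ∩ ∁ U} {E v} (λ i q → tab 3 (λ a b c → ! (b ∧ not a) ⇛ ∼ c ⇛ ⊩ ! (b ∧ not c ∧ not a)) (U i)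
              (A v i) (U v) q p)))

  result : Result
  result = go two-inside
    where
    go : ∃[ w ] (U w ≡ false × 2 ≤ dg A w U) → Result
    go (w , Uw , two) = by (empty? (∁ U ∖ ⟨ w ⟩))
      where
      by : Empty? (∁ U ∖ ⟨ w ⟩) → Result
      by (inj₂ none) = Single.result Uw none
      by (inj₁ ne) = arrange (triple (A w) (D-deg (D∋ Uw)))
        where
        -- With three neighbours in `U`, the remaining outer vertices would be touched by one edge
        -- too few.
        exactly : dg A w U ≤ 2
        exactly = lin 6 (λ a b c d e f → a ≐ (2 ⊗ b) ⊹ 1 ⇛ a ≑ c ⊕ d ⇛ e ≼ d ⇛ 2 ⊠ b ≐ 𝕤 f ⇛ (2 ⊗ f) ⊹ 1 ≼ c ⇛ 1 ⊢ e ≼ κ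
            2) (tch A (∁ U)) (∣ ∁ U ∣) (tch A (∁ U ∖ ⟨ w ⟩)) (dg A w (∁ (∁ U))) (dg A w U) (∣ ∁ U ∖ ⟨ w ⟩ ∣) total
            (tch-rem sA (∁ U) (not-intro Uw)) (cnt≤ {X = A w ∩ U} {A w ∩ ∁ (∁ U)}
            (λ i p → tab 2 (λ a b → ! (b ∧ a) ⇛ ⊩ ! (b ∧ not (not a))) (U i) (A w i) p)) (cnt-rem (∁ U) (not-intro Uw))
            (many (∁ U ∖ ⟨ w ⟩) (λ i p → ∧ˡ (not (U i)) (not (i == w)) p) ne)
        arrange : ∃[ a ] ∃[ b ] ∃[ c ] Triple (A w) a b c → Result
        arrange (a , b , c , tri) = sides (bool (U a)) (bool (U b)) (bool (U c))
          where
          open Triple tri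
          few : 𝟙 (U a) + 𝟙 (U b) + 𝟙 (U c) ≤ 1 → Result
          few h = ⊥-elim (lin 4 (λ a b c d → κ 2 ≼ a ⇛ a ≐ b ⊕ c ⊕ d ⇛ b ⊕ c ⊕ d ≼ κ 1 ⇛ ⊢⊥) (dg A w U) (𝟙 (U a))
              (𝟙 (U b)) (𝟙 (U c)) two (count U) h)
          sides : Decided (U a) → Decided (U b) → Decided (U c) → Result
          sides (inj₂ p) (inj₁ q) (inj₁ r) = leaf tri Uw p q r
          sides (inj₁ p) (inj₂ q) (inj₁ r) = leaf (triple-swap₁₂ tri) Uw q p r
          sides (inj₁ p) (inj₁ q) (inj₂ r) = leaf (triple-swap₁₂ (triple-swap₂₃ tri)) Uw r p q
          sides (inj₁ p) (inj₁ q) (inj₁ r) = ⊥-elim (lin 1 (λ a → a ≼ κ 2 ⇛ κ 3 ≼ a ⇛ ⊢⊥) (dg A w U) exactly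
              (cnt-three {X = A w ∩ U} {a} {b} {c} (∈a & p) (∈b & q) (∈c & r) a≢b a≢c b≢c))
          sides (inj₂ p) (inj₂ q) _ = few (tab 3 (λ a b c → ∼ a ⇛ ∼ b ⇛ ⊩ 𝟙 a + 𝟙 b + 𝟙 c ≦ 1) (U a) (U b) (U c) p q)
          sides (inj₂ p) _ (inj₂ q) = few (tab 3 (λ a b c → ∼ a ⇛ ∼ b ⇛ ⊩ 𝟙 a + 𝟙 c + 𝟙 b ≦ 1) (U a) (U c) (U b) p q)
          sides _ (inj₂ p) (inj₂ q) = few (tab 3 (λ a b c → ∼ a ⇛ ∼ b ⇛ ⊩ 𝟙 c + 𝟙 a + 𝟙 b ≦ 1) (U b) (U c) (U a) p q)

-- Recognising K₅⁻ and B₁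

isomorphic : ∀ {n k} {A : ES n} {H : ES k} (f : Fin k → Fin n) → (∀ i j → f i ≡ f j → i ≡ j) → (∀ v → ∃[ i ] f i ≡ v)
    → (∀ i j → H i j ≡ A (f i) (f j)) → graph A ≅ graph H
isomorphic {A = A} {H} f inj onto same = mk↔ₛ′ g f (λ i → inj _ _ (fg (f i))) fg , λ u v → trans (same (g u) (g v))
    (cong₂ A (fg u) (fg v))
  where
  g : Fin _ → Fin _
  g v = proj₁ (onto v)
  fg : ∀ v → f (g v) ≡ v
  fg v = proj₂ (onto v)

isomorphic-K5⁻ : ∀ {n} {A : ES n} → Simple A → LooksLikeK5⁻ A → graph A ≅ K5⁻
isomorphic-K5⁻ {n} {A} sA shape = isomorphic f (lookup-injective ((t≢s ∷ adj≢ sA tp ∷ adj≢ sA tq ∷ adj≢ sA tr ∷ []) ∷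
    (adj≢ sA sp ∷ adj≢ sA sq ∷ adj≢ sA sr ∷ []) ∷ (adj≢ sA pq ∷ adj≢ sA pr ∷ []) ∷ (adj≢ sA qr ∷ []) ∷ ([]) ∷ [])) onto
    same
  where
  open LooksLikeK5⁻ shape
  flip : ∀ {i j e} → A i j ≡ e → A j i ≡ e
  flip {i} {j} p = trans (symm sA j i) p
  f : Fin 5 → Fin n
  f = lookup (t ∷ s ∷ p ∷ q ∷ r ∷ [])
  onto : ∀ v → ∃[ i ] f i ≡ v
  onto v = go (v ≟ t) (v ≟ s) (v ≟ p) (v ≟ q) (v ≟ r)
    where
    go : Dec (v ≡ t) → Dec (v ≡ s) → Dec (v ≡ p) → Dec (v ≡ q) → Dec (v ≡ r) → ∃[ i ] f i ≡ v
    go (yes e) _ _ _ _ = 0F , sym e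
    go _ (yes e) _ _ _ = 1F , sym e
    go _ _ (yes e) _ _ = 2F , sym e
    go _ _ _ (yes e) _ = 3F , sym e
    go _ _ _ _ (yes e) = 4F , sym e
    go (no e0) (no e1) (no e2) (no e3) (no e4) = ⊥-elim (cover v e0 e1 e2 e3 e4)
  same : ∀ i j → adj K5⁻ i j ≡ A (f i) (f j)
  same 0F 0F = sym (irr sA t)
  same 0F 1F = sym ts
  same 0F 2F = sym tp
  same 0F 3F = sym tq
  same 0F 4F = sym tr
  same 1F 0F = sym (flip ts)
  same 1F 1F = sym (irr sA s)
  same 1F 2F = sym sp
  same 1F 3F = sym sq
  same 1F 4F = sym sr
  same 2F 0F = sym (flip tp)
  same 2F 1F = sym (flip sp)
  same 2F 2F = sym (irr sA p)
  same 2F 3F = sym pq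
  same 2F 4F = sym pr
  same 3F 0F = sym (flip tq)
  same 3F 1F = sym (flip sq)
  same 3F 2F = sym (flip pq)
  same 3F 3F = sym (irr sA q)
  same 3F 4F = sym qr
  same 4F 0F = sym (flip tr)
  same 4F 1F = sym (flip sr)
  same 4F 2F = sym (flip pr)
  same 4F 3F = sym (flip qr)
  same 4F 4F = sym (irr sA r)

isomorphic-B₁ : ∀ {n} {A : ES n} → Simple A → LooksLikeB₁ A → graph A ≅ B₁
isomorphic-B₁ {n} {A} sA shape = isomorphic f (lookup-injective
    ((adj≢ sA xy ∷ adj≢ sA (flip tx) ∷ adj≢ sA (flip dx) ∷ adj≢ sA (flip sx) ∷ adj≢ sA (flip s′x) ∷ []) ∷
    (adj≢ sA (flip ty) ∷ adj≢ sA (flip dy) ∷ adj≢ sA (flip sy) ∷ adj≢ sA (flip s′y) ∷ []) ∷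
    (adj≢ sA td ∷ t≢s ∷ t≢s′ ∷ []) ∷ (d≢s ∷ d≢s′ ∷ []) ∷ (adj≢ sA ss′ ∷ []) ∷ ([]) ∷ [])) onto same
  where
  open LooksLikeB₁ shape
  flip : ∀ {i j e} → A i j ≡ e → A j i ≡ e
  flip {i} {j} p = trans (symm sA j i) p
  f : Fin 6 → Fin n
  f = lookup (x ∷ y ∷ t ∷ d ∷ s ∷ s′ ∷ [])
  onto : ∀ v → ∃[ i ] f i ≡ v
  onto v = go (v ≟ x) (v ≟ y) (v ≟ t) (v ≟ d) (v ≟ s) (v ≟ s′)
    where
    go : Dec (v ≡ x) → Dec (v ≡ y) → Dec (v ≡ t) → Dec (v ≡ d) → Dec (v ≡ s) → Dec (v ≡ s′) → ∃[ i ] f i ≡ v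
    go (yes e) _ _ _ _ _ = 0F , sym e
    go _ (yes e) _ _ _ _ = 1F , sym e
    go _ _ (yes e) _ _ _ = 2F , sym e
    go _ _ _ (yes e) _ _ = 3F , sym e
    go _ _ _ _ (yes e) _ = 4F , sym e
    go _ _ _ _ _ (yes e) = 5F , sym e
    go (no e0) (no e1) (no e2) (no e3) (no e4) (no e5) = ⊥-elim (cover v e0 e1 e2 e3 e4 e5)
  same : ∀ i j → adj B₁ i j ≡ A (f i) (f j)
  same 0F 0F = sym (irr sA x)
  same 0F 1F = sym xy
  same 0F 2F = sym (flip tx)
  same 0F 3F = sym (flip dx)
  same 0F 4F = sym (flip sx)
  same 0F 5F = sym (flip s′x)
  same 1F 0F = sym (flip xy)
  same 1F 1F = sym (irr sA y)
  same 1F 2F = sym (flip ty)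
  same 1F 3F = sym (flip dy)
  same 1F 4F = sym (flip sy)
  same 1F 5F = sym (flip s′y)
  same 2F 0F = sym tx
  same 2F 1F = sym ty
  same 2F 2F = sym (irr sA t)
  same 2F 3F = sym td
  same 2F 4F = sym ts
  same 2F 5F = sym ts′
  same 3F 0F = sym dx
  same 3F 1F = sym dy
  same 3F 2F = sym (flip td)
  same 3F 3F = sym (irr sA d)
  same 3F 4F = sym ds
  same 3F 5F = sym ds′
  same 4F 0F = sym sx
  same 4F 1F = sym sy
  same 4F 2F = sym (flip ts)
  same 4F 3F = sym (flip ds)
  same 4F 4F = sym (irr sA s)
  same 4F 5F = sym ss′
  same 5F 0F = sym s′x
  same 5F 1F = sym s′y
  same 5F 2F = sym (flip ts′)
  same 5F 3F = sym (flip ds′)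
  same 5F 4F = sym (flip ss′)
  same 5F 5F = sym (irr sA s′)

-- Deciding reducibility and assembling the cases

_⊆?_ : ∀ {n} (X Y : VS n) → Dec (X ⊆ Y)
X ⊆? Y = all? (λ i → (X i 𝔹.≟ true) →-dec (Y i 𝔹.≟ true))

⊆-respˡ : ∀ {n} {X Y Z : VS n} → (∀ i → X i ≡ Y i) → X ⊆ Z → Y ⊆ Z
⊆-respˡ e X⊆Z i p = X⊆Z i (trans (e i) p)

-- A finite search over vertex sets. It lets the failure of all reductions yield `Irreducible`
-- constructively, with explicit obstacles.
obstacle? : ∀ {n} (A : ES n) (U : VS n) v u y → Dec (Obstacle A U v u y)
obstacle? {n} A U v u y = search P P-resp P? ⊎-dec search Q Q-resp Q?
  where
  P Q : VS n → Set
  P S = Cotight A U S × S y ≡ true × S u ≡ false × S v ≡ false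
  Q Y = TightSet A U Y × Y v ≡ true × Y u ≡ true × Y y ≡ false
  P-resp : Respects P
  P-resp e ((S⊆ , St) , Sy , Su , Sv) = (⊆-respˡ e S⊆ , trans (sym (tch≗ A e))
      (trans St (cong (λ k → 2 * k + 1) (cnt≗ e)))) ,
    trans (sym (e y)) Sy , trans (sym (e u)) Su , trans (sym (e v)) Sv
  Q-resp : Respects Q
  Q-resp e ((Y⊆ , Yt) , Yv , Yu , Yy) = (⊆-respˡ e Y⊆ , trans (cong (_+ 2) (sym (ins≗ A e)))
      (trans Yt (cong (2 *_) (cnt≗ e)))) ,
    trans (sym (e v)) Yv , trans (sym (e u)) Yu , trans (sym (e y)) Yy
  P? : ∀ S → Dec (P S)
  P? S = ((S ⊆? ∁ U) ×-dec (tch A S ≟ⁿ 2 * ∣ S ∣ + 1)) ×-dec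
      ((S y 𝔹.≟ true) ×-dec ((S u 𝔹.≟ false) ×-dec (S v 𝔹.≟ false)))
  Q? : ∀ Y → Dec (Q Y)
  Q? Y = ((Y ⊆? ∁ U) ×-dec (ins A Y + 2 ≟ⁿ 2 * ∣ Y ∣)) ×-dec
      ((Y v 𝔹.≟ true) ×-dec ((Y u 𝔹.≟ true) ×-dec (Y y 𝔹.≟ false)))

Free : ∀ {n} → ES n → VS n → (v u y : Fin n) → Set
Free A U v u y = Legal A U v u y × StaysAttached A U v y × ¬ Obstacle A U v u y

free? : ∀ {n} (A : ES n) (U : VS n) v u y → Dec (Free A U v u y)
free? A U v u y =
  ((U v 𝔹.≟ false) ×-dec ((A v u 𝔹.≟ true) ×-dec ((A v y 𝔹.≟ true) ×-dec (¬? (u ≟ y) ×-dec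
    all? (λ z → (A v z 𝔹.≟ true) →-dec (¬? (z ≟ u) →-dec (¬? (z ≟ y) →-dec (A u z 𝔹.≟ false)))))))) ×-dec
  (((U y 𝔹.≟ true) →-dec any? (λ w → (U w 𝔹.≟ false) ×-dec (¬? (w ≟ v) ×-dec (A y w 𝔹.≟ true)))) ×-dec ¬?
      (obstacle? A U v u y))

diamond? : ∀ {n} (A : ES n) (U : VS n) t p q r → Dec (Diamond A U t p q r)
diamond? A U t p q r = map′
  (λ (Ut , Up , tp , dt , dp , q≢r , tq , tr , pq , pr , qr , nb) → record { Ut = Ut ; Up = Up ; tp = tp ; deg-t = dt ;
      deg-p = dp ; q≢r = q≢r ; tq = tq ; tr = tr ; pq = pq ; pr = pr ; qr = qr ; not-both = nb })
  (λ d → let open Diamond d in Ut , Up , tp , deg-t , deg-p , q≢r , tq , tr , pq , pr , qr , not-both)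
  ((U t 𝔹.≟ false) ×-dec ((U p 𝔹.≟ false) ×-dec ((A t p 𝔹.≟ true) ×-dec
      ((∣ A t ∣ ≟ⁿ 3) ×-dec ((∣ A p ∣ ≟ⁿ 3) ×-dec (¬? (q ≟ r) ×-dec
    ((A t q 𝔹.≟ true) ×-dec ((A t r 𝔹.≟ true) ×-dec ((A p q 𝔹.≟ true) ×-dec
        ((A p r 𝔹.≟ true) ×-dec ((A q r 𝔹.≟ false) ×-dec (U q ∧ U r 𝔹.≟ false))))))))))))

module NonCubic {m : ℕ} {A : ES (suc (suc m))} {U : VS (suc (suc m))} (rel : Relative A U)
    (base : (Attached A U × Block (inn A U) U) ⊎ Apex A U)
    {b : Fin (suc (suc m))} (Ub : U b ≡ false) (Db : cubic A U b ≡ false) where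
  open Relative rel
  open RelativeFacts rel

  -- If only one vertex were outside `U`, it would be touched by three edges and so be cubic.
  another : ∀ v → NE (∁ U ∖ ⟨ v ⟩)
  another v = go (empty? (∁ U ∖ ⟨ v ⟩))
    where
    go : Empty? (∁ U ∖ ⟨ v ⟩) → NE (∁ U ∖ ⟨ v ⟩)
    go (inj₁ ne) = ne
    go (inj₂ none) = ⊥-elim (clash (deg-D Ub (lin 5 (λ a b c d e → a ≐ (2 ⊗ b) ⊹ 1 ⇛ c ≑ d ⇛ 2 ⊠ e ≐ κ 1 ⇛ a ≑ c ⇛ 2 ⊠ b
        ≐ e ⇛ 1 ⊢ d ≐ κ 3) (tch A (∁ U)) (∣ ∁ U ∣) (tch A ⟨ b ⟩) (∣ A b ∣) (∣ ⟨ b ⟩ ∣) total (star A simpleʳ b)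
        (cnt-single b) (tch≗ A same) (cnt≗ same))) Db)
      where
      b≡v : b ≡ v
      b≡v = ==⇒≡ (tab 2 (λ a b → ∼ (not b ∧ not a) ⇛ ∼ b ⇛ ⊩ ! a) (b == v) (U b) (none b) Ub)
      same : ∀ i → ∁ U i ≡ ⟨ b ⟩ i
      same i = tab 3 (λ a b c → ∼ (not b ∧ not a) ⇛ c ⊃ not b ⇛ c ⇔ a ⇛ ⊩ not b ⇔ c) (i == v) (U i) (i == b) (none i)
          (at (∁ U) (not-intro Ub) i) (cong (i ==_) b≡v)

  attached : Attached A U ⊎ Apex A U
  attached = go base
    where
    go : (Attached A U × Block (inn A U) U) ⊎ Apex A U → Attached A U ⊎ Apex A U
    go (inj₁ (att , _)) = inj₁ att
    go (inj₂ apex) = inj₂ apex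

  contracted : ∀ {v u y} → Free A U v u y → Reducible (graph A)
  contracted {v} {u} {y} (legal , stays , free) = reduce-contract simpleʳ vu vy u≢y far (block base)
    where
    open Contraction rel legal using (vu; vy; u≢y; far; module Unobstructed)
    open Unobstructed free (another v)
    block : (Attached A U × Block (inn A U) U) ⊎ Apex A U → Block (contract A v u y) (∁ ⟨ v ⟩)
    block (inj₁ (att , blk)) = by-ear (attached′ stays att) blk
    block (inj₂ (x , only , _)) = by-apex only

  replaced : ∀ {t p q r} → Diamond A U t p q r → Reducible (graph A)
  replaced {t} {p} {q} {r} dia = reduce-diamond simpleʳ tp deg-t deg-p q≢r tq tr pq pr qr (block base)
    where
    open Diamond dia
    open Replacement rel dia using (by-ear; by-apex)
    block : (Attached A U × Block (inn A U) U) ⊎ Apex A U → Block (replace A t p q r) (∁ ⟨ t ⟩ ∩ ∁ ⟨ p ⟩)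
    block (inj₁ (att , blk)) = by-ear att blk
    block (inj₂ (x , only , _)) = by-apex only

  reducible : ¬ LooksLikeK5⁻ A → ¬ LooksLikeB₁ A → Reducible (graph A)
  reducible noK5⁻ noB₁ = contraction (any? (λ v → any? (λ u → any? (λ y → free? A U v u y))))
    where
    contraction : Dec (∃[ v ] ∃[ u ] ∃[ y ] Free A U v u y) → Reducible (graph A)
    contraction (yes (v , u , y , free)) = contracted free
    contraction (no blocked) = replacement (any? (λ t → any? (λ p → any? (λ q → any? (λ r → diamond? A U t p q r)))))
      where
      replacement : Dec (∃[ t ] ∃[ p ] ∃[ q ] ∃[ r ] Diamond A U t p q r) → Reducible (graph A)
      replacement (yes (t , p , q , r , dia)) = replaced dia
      replacement (no none) = ⊥-elim (irreducible-impossible rel attached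
        (record { blocked = λ v u y legal stays → decidable-stable (obstacle? A U v u y)
            (λ free → blocked (v , u , y , legal , stays , free))
                ; no-diamond = λ t p q r dia → none (t , p , q , r , dia) }) noK5⁻ noB₁ Ub Db)

module WholeCircuit {n : ℕ} {A : ES n} (c : Circ A full A) where
  open Circ c

  relative : ∀ x → Relative A ⟨ x ⟩
  relative x = record
    { simpleʳ = simpleᶜ
    ; many = λ S S⊆ ne → circ-tch c S (λ _ _ → refl) ne {x} refl (avoids S⊆)
    ; sparse = λ Y Y⊆ ne → sparse Y (λ _ _ → refl) ne {x} refl (avoids Y⊆)
    ; total = (lin 4 (λ a b c d → a ⊹ 1 ≐ 2 ⊗ b ⇛ 2 ⊠ b ≐ 𝕤 c ⇛ d ≐ a ⇛ 1 ⊢ d ≐ (2 ⊗ c) ⊹ 1) (ec A) (∣ full {n} ∣)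
        (∣ ∁ ⟨ x ⟩ ∣) (tch A (∁ ⟨ x ⟩)) size (cnt-rem full {x} refl) (ec≗ touches)) }
    where
    avoids : ∀ {S} → S ⊆ ∁ ⟨ x ⟩ → S x ≡ false
    avoids {S} S⊆ = tab 2 (λ a b → a ⊃ not b ⇛ ! b ⇛ ⊩ ∼ a) (S x) (x == x) (S⊆ x) (==-refl x)
    touches : ∀ i j → inc A (∁ ⟨ x ⟩) i j ≡ A i j
    touches i j = tab 3 (λ a b c → b ∧ a ⊃ not c ⇛ ⊩ c ∧ (not b ∨ not a) ⇔ c) (j == x) (i == x) (A i j) loop
      where
      loop : (i == x) ∧ (j == x) ≡ true → not (A i j) ≡ true
      loop p = not-intro (trans (cong₂ A (==⇒≡ {i = i} (∧ˡ (i == x) (j == x) p))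
          (==⇒≡ {i = j} (∧ʳ (i == x) (j == x) p))) (irr simpleᶜ x))

  -- If all vertices but x were cubic, they would span a forest, and x would have too many neighbours.
  non-cubic : ∀ x → NE (∁ ⟨ x ⟩) → ∃[ b ] (⟨ x ⟩ b ≡ false × cubic A ⟨ x ⟩ b ≡ false)
  non-cubic x ne = go (empty? (∁ ⟨ x ⟩ ∖ cubic A ⟨ x ⟩))
    where
    open RelativeFacts (relative x)
    D : VS n
    D = cubic A ⟨ x ⟩
    go : Empty? (∁ ⟨ x ⟩ ∖ D) → ∃[ b ] (⟨ x ⟩ b ≡ false × D b ≡ false)
    go (inj₁ (b , p)) = b , (not-elim (∧ˡ (not (b == x)) (not (D b)) p)) , (not-elim (∧ʳ (not (b == x)) (not (D b)) p))
    go (inj₂ none) = ⊥-elim (lin 6 (λ a b c d e f → a ⊹ 1 ≼ b ⇛ c ⊹ 1 ≑ 2 ⊗ d ⇛ 2 ⊠ d ≑ 𝕤 b ⇛ c ≐ e ⇛ e ≐ a ⊕ f ⇛ f ≼ b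
        ⇛ ⊢⊥) (ins A (∁ ⟨ x ⟩)) (∣ ∁ ⟨ x ⟩ ∣) (ec A) (∣ full {n} ∣) (ins A full) (dg A x full)
        (forest (∁ ⟨ x ⟩) (λ i p → tab 2 (λ a b → ! (not a) ⇛ ∼ (not a ∧ not b) ⇛ ⊩ ! b) (i == x) (D i) p (none i)) ne)
        size (cnt-rem full {x} refl) (ec≗ (λ i j → tab 1 (λ a → ⊩ a ⇔ a ∧ true ∧ true) (A i j)))
        (ins-rem simpleᶜ full {x} refl) (dg≤size simpleᶜ x full))

-- `non-cubic` is used twice: from an arbitrary vertex it finds `x` of degree at least four, which
-- serves as the apex, and from `x` it finds a second non-cubic vertex, where the search for a
-- minimal cotight set starts.
circuit-reducible : ∀ {m} {A : ES (suc (suc m))} → Circ A full A → ¬ LooksLikeK5⁻ A → ¬ LooksLikeB₁ A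
    → ∀ {a b : Fin (suc (suc m))} → a ≢ b → Reducible (graph A)
circuit-reducible {A = A} c noK5⁻ noB₁ {a} {b} a≢b = first (non-cubic a ne)
  where
  open WholeCircuit c
  ne : NE (∁ ⟨ a ⟩)
  ne = b , ≢⇒not (≢-sym a≢b)
  first : ∃[ x ] (⟨ a ⟩ x ≡ false × cubic A ⟨ a ⟩ x ≡ false) → Reducible (graph A)
  first (x , x≢a , Dx) = second (non-cubic x ne′)
    where
    ne′ : NE (∁ ⟨ x ⟩)
    ne′ = a , not-intro (trans (==-sym a x) x≢a)
    second : ∃[ y ] (⟨ x ⟩ y ≡ false × cubic A ⟨ x ⟩ y ≡ false) → Reducible (graph A)
    second (y , Uy , Dy) = NonCubic.reducible (relative x)
        (inj₂ (x , (λ _ → refl) , RelativeFacts.deg≥4 (relative a) x≢a Dx)) Uy Dy noK5⁻ noB₁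

theorem6p9 : (G : Graph) → SimpleGraph G → M22Connected G →
             ¬ (G ≅ K5⁻) → ¬ (G ≅ B₁) →
             AdmissibleEdgeReduction G ⊎ AdmissibleK4Reduction G ⊎ AdmissibleEdgeDeletion G
theorem6p9 record { n = zero } _ (_ , () , _)
theorem6p9 record { n = suc zero } _ (_ , () , _)
theorem6p9 record { n = suc (suc m) ; adj = A } (sym-A , irr-A) conn@(alive , _) noK5⁻ noB₁ = start (alive zero)
  where
  sA : Simple A
  sA = simple sym-A irr-A
  linked : Linked A
  linked = connected⇒linked sA conn
  noK5⁻′ : ¬ LooksLikeK5⁻ A
  noK5⁻′ shape = noK5⁻ (isomorphic-K5⁻ sA shape)
  noB₁′ : ¬ LooksLikeB₁ A
  noB₁′ shape = noB₁ (isomorphic-B₁ sA shape)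
  deg : ∀ v → 3 ≤ ∣ A v ∣
  deg v = go (alive v)
    where
    go : ∃[ w ] A v w ≡ true → 3 ≤ ∣ A v ∣
    go (w , vw) = by (linked vw vw)
      where
      by : Through A v w v w → 3 ≤ ∣ A v ∣
      by (X , F , c , Fvw , _) = ≤-trans (circ-degree c (Circ.within c v w Fvw))
          (cnt≤ {X = F v ∩ X} {A v} (λ i p → Circ.⊆E c v i (∧ˡ (F v i) (X i) p)))
  start : ∃[ w ] A zero w ≡ true → Reducible (graph A)
  start (w , edge) = by (Exhaust.outcome sA linked alive edge)
    where
    by : Outcome A → Reducible (graph A)
    by (deletable a b ab blk) = reduce-delete ab (block-good blk {a} {b} refl refl (adj≢ sA ab))
    by (circuit c) = circuit-reducible c noK5⁻′ noB₁′ (adj≢ sA edge)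
    by (package U rel att blk) = go (empty? (∁ U ∖ cubic A U))
      where
      go : Empty? (∁ U ∖ cubic A U) → Reducible (graph A)
      go (inj₁ (b , p)) = NonCubic.reducible rel (inj₁ (att , blk)) {b}
          (not-elim (∧ˡ (not (U b)) (not (cubic A U b)) p)) (not-elim (∧ʳ (not (U b)) (not (cubic A U b)) p)) noK5⁻′
          noB₁′
      go (inj₂ none) = CubicComplement.result rel att blk deg
          (λ i p → tab 2 (λ a b → ! (not a) ⇛ ∼ (not a ∧ not b) ⇛ ⊩ ! b) (U i) (cubic A U i) p (none i))
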